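{- Let $p$ be a prime, let $\mathbb{F}_p$ be the field with $p$ elements, and let $f(x,y)\in\mathbb{F}_p[x,y]$ be a non-degenerate quadratic polynomial. For every set $A\subset\mathbb{F}_p$ with $|A|\ll p^{1/2}$ we have \[\max\{|A+A|,\ |f(A,A)|\}\gtrsim |A|^{\frac{6}{5}+\frac{4}{305}}.\]
   Context: A polynomial $f(x,y)\in\mathbb{F}_p[x,y]$ is called degenerate if it is of the form $Q(L(x,y))$ where $Q$ is a one-variable polynomial and $L$ is a linear form in $x$ and $y$; otherwise it is non-degenerate. "Quadratic" means of degree $2$. $A+A=\{a+b: a,b\in A\}$ and $f(A,A)=\{f(a,b): a,b\in A\}$. Notation: $X\gg Y$ (equivalently $Y\ll X$) means $X\ge C_1 Y$ for some absolute positive constant $C_1$; $X\gtrsim Y$ means $X\gg (\log Y)^{ -C_2}Y$ for some positive constant $C_2$. -}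

module Defs where

open import Level using (Level; 0ℓ)
open import Algebra.Bundles.Raw using (RawSemiring)
open import Data.Fin using (Fin; toℕ)
open import Data.Fin.Properties using (_≟_; any?)
open import Data.Fin.Subset using (Subset)
open import Data.Fin.Subset.Properties using (_∈?_)
open import Data.List using (List; []; _∷_; map)
open import Data.Nat as ℕ using (ℕ; zero; suc; NonZero; _^_; _≤_; _<_)
open import Data.Nat.DivMod using (_mod_)
open import Data.Nat.Logarithm using (⌊log₂_⌋)
open import Data.Product using (_×_; ∃-syntax)
open import Data.Vec using (tabulate)
open import Function using (id)
open import Relation.Binary.PropositionalEquality using (_≡_)
open import Relation.Nullary using (¬_; does)
open import Relation.Nullary.Decidable using (_×-dec_)

private variable
  c ℓ : Level

𝔽 : (p : ℕ) .{{_ : NonZero p}} → RawSemiring 0ℓ 0ℓ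
𝔽 p = record
  { Carrier = Fin p
  ; _≈_     = _≡_
  ; _+_     = λ a b → (toℕ a ℕ.+ toℕ b) mod p
  ; _*_     = λ a b → (toℕ a ℕ.* toℕ b) mod p
  ; 0#      = 0 mod p
  ; 1#      = 1 mod p
  }

-- Polynomials are coefficient lists, constant term first.  Trailing zeros are
-- allowed, so polynomials are compared by ≈, coefficient by coefficient.
module Poly (R : RawSemiring c ℓ) where
  open RawSemiring R

  coeff : List Carrier → ℕ → Carrier
  coeff []       _       = 0#
  coeff (a ∷ _)  zero    = a
  coeff (_ ∷ as) (suc n) = coeff as n

  add : List Carrier → List Carrier → List Carrier
  add []       bs       = bs
  add (a ∷ as) []       = a ∷ as
  add (a ∷ as) (b ∷ bs) = (a + b) ∷ add as bs

  mul : List Carrier → List Carrier → List Carrier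
  mul []       bs = []
  mul (a ∷ as) bs = add (map (a *_) bs) (0# ∷ mul as bs)

  poly : RawSemiring c ℓ
  poly = record
    { Carrier = List Carrier
    ; _≈_     = λ as bs → ∀ n → coeff as n ≈ coeff bs n
    ; _+_     = add
    ; _*_     = mul
    ; 0#      = []
    ; 1#      = 1# ∷ []
    }

  -- Substitution of s for the variable, coefficients being sent to S by φ.
  eval : (S : RawSemiring c ℓ) →
         (Carrier → RawSemiring.Carrier S) → RawSemiring.Carrier S →
         List Carrier → RawSemiring.Carrier S
  eval S φ s []       = RawSemiring.0# S
  eval S φ s (a ∷ as) = φ a ⊕ (s ⊗ eval S φ s as)
    where open RawSemiring S renaming (_+_ to _⊕_; _*_ to _⊗_) using ()

module _ (p : ℕ) .{{_ : NonZero p}} where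
  open RawSemiring (𝔽 p) using (_+_; _≉_; _≈_; 0#)

  𝔽[y] : RawSemiring 0ℓ 0ℓ
  𝔽[y] = Poly.poly (𝔽 p)

  -- 𝔽ₚ[x,y] as 𝔽ₚ[y][x]: the outer list is indexed by the power of x, the
  -- inner ones by the power of y.
  𝔽[x,y] : RawSemiring 0ℓ 0ℓ
  𝔽[x,y] = Poly.poly 𝔽[y]

  Poly₁ : Set
  Poly₁ = RawSemiring.Carrier 𝔽[y]

  Poly₂ : Set
  Poly₂ = RawSemiring.Carrier 𝔽[x,y]

  coeff₂ : Poly₂ → ℕ → ℕ → Fin p
  coeff₂ f i j = Poly.coeff (𝔽 p) (Poly.coeff 𝔽[y] f i) j

  ⟦_⟧ : Poly₂ → Fin p → Fin p → Fin p
  ⟦ f ⟧ a b = Poly.eval 𝔽[y] (𝔽 p) (Poly.eval (𝔽 p) (𝔽 p) id b) a f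

  HasDegree : ℕ → Poly₂ → Set
  HasDegree d f =
    (∃[ i ] ∃[ j ] (i ℕ.+ j ≡ d × coeff₂ f i j ≉ 0#)) ×
    (∀ i j → d < i ℕ.+ j → coeff₂ f i j ≈ 0#)

  Quadratic : Poly₂ → Set
  Quadratic = HasDegree 2

  -- α x + β y
  linearForm : Fin p → Fin p → Poly₂
  linearForm α β = (0# ∷ β ∷ []) ∷ (α ∷ []) ∷ []

  -- Q(L(x,y)), an element of 𝔽ₚ[x,y]
  compose : Poly₁ → Poly₂ → Poly₂
  compose Q L = Poly.eval (𝔽 p) 𝔽[x,y] (λ a → (a ∷ []) ∷ []) L Q

  Degenerate : Poly₂ → Set
  Degenerate f = ∃[ Q ] ∃[ α ] ∃[ β ]
    RawSemiring._≈_ 𝔽[x,y] f (compose Q (linearForm α β))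

  NonDegenerate : Poly₂ → Set
  NonDegenerate f = ¬ Degenerate f

  -- { g a b : a, b ∈ A }
  image₂ : (Fin p → Fin p → Fin p) → Subset p → Subset p
  image₂ g A = tabulate λ z → does
    (any? λ a → any? λ b → (a ∈? A) ×-dec ((b ∈? A) ×-dec (g a b ≟ z)))

  sumset : Subset p → Subset p
  sumset = image₂ _+_

-- n ≤ K p^{1/2}, squared.  Since every positive real is at most a positive
-- integer, and K is universally quantified where this is used as a hypothesis,
-- integral K cover all implied constants.
_≤_·√_ : ℕ → ℕ → ℕ → Set
n ≤ K ·√ p = n ^ 2 ≤ K ^ 2 ℕ.* p

-- X ≥ C₁⁻¹ (log Y)^{-C₂} Y for Y = n^{r/s}, multiplied out and raised to the
-- power s.  The factor log Y = (r/s) log n is replaced by 1 + ⌊log₂ n⌋.  For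
-- n ≥ 2 and fixed r/s > 0 the two differ by a factor bounded above and below by
-- positive constants, which changes only C₁; for n ≤ 1, where (log Y)^{-C₂} is
-- infinite or undefined, the convention avoids excluding any n.
-- Natural C₁, C₂ suffice when existentially quantified: decreasing the implied
-- constant, or increasing C₂ (as 1 + ⌊log₂ n⌋ ≥ 1), weakens the bound.
Gtrsim : (C₁ C₂ X n r s : ℕ) → Set
Gtrsim C₁ C₂ X n r s = n ^ r ≤ (C₁ ℕ.* suc ⌊log₂ n ⌋ ^ C₂ ℕ.* X) ^ s

-- A coincidence f(x + b, a) = f(x′ + b′, a′) is an incidence between two lines of a
-- three-dimensional family whose directions lie on a conic.  Few incidences are
-- possible: by counting unknowns some nonzero polynomial F of low degree vanishes on
-- all lines of a rich subfamily, and after differentiating F is smooth along one of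
-- them.  Since F vanishes on many lines through a point of a line, second-order contact
-- holds at the crossings, hence identically along rich lines; differentiated once more,
-- it says that the ratio a/b of the two partial derivatives of F transversal to a line
-- satisfies (a/b)″ = 0 along it, so that the lines crossing it satisfy a linear
-- relation, which the family does not allow.
-- By Cauchy–Schwarz the incidence bound yields n J⁴ ≪ M² (|X||B|)³ for the number J of
-- pairs (x , b) ∈ X × B with x + b ∈ A, where n = |A| and M = max(|A+A|, |f(A,A)|).
-- Dyadic pigeonholing of the popular sums and differences of A, with this bound applied
-- to each level set, leads to n⁷⁴ ≪ (log n)³⁸ M⁶¹.
module Submission where

open import Defs
open import Algebra.Bundles using (CommutativeRing; RawRing)
open import Algebra.Bundles.Raw using (RawSemiring)
import Algebra.Solver.Ring
open import Algebra.Solver.Ring.AlmostCommutativeRing using (AlmostCommutativeRing; fromCommutativeRing; _-Raw-AlmostCommutative⟶_)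
open import Algebra.Structures using (IsCommutativeRing)
open import Data.Bool using (true; false)
open import Data.Empty using (⊥-elim; ⊥)
open import Data.Fin as Fin using (Fin; toℕ; fromℕ<; finToFun; funToFin)
open import Data.Fin.Patterns using (0F; 1F; 2F; 3F; 4F; 5F; 6F; 7F; 8F; 9F)
import Data.Fin.Properties as Finₚ
open import Data.Fin.Subset using (Subset; ∣_∣)
open import Data.List using (List; []; _∷_; length; map; allFin; lookup; filter; _++_; concatMap; upTo; take)
import Data.List.Membership.DecPropositional as DecMembership
open import Data.List.Membership.Propositional using (_∈_; find; lose)
import Data.List.Membership.Propositional.Properties as ∈ₚ
open import Data.List.Membership.Propositional.Properties using (∈-map⁺; ∈-allFin)
import Data.List.Properties as Listₚ
open import Data.List.Properties using (length-map; length-tabulate)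
open import Data.List.Relation.Unary.All as All using (All; []; _∷_)
import Data.List.Relation.Unary.All.Properties as Allₚ
open import Data.List.Relation.Unary.AllPairs as AllPairs using (AllPairs; []; _∷_)
import Data.List.Relation.Unary.AllPairs.Properties as AllPairsₚ
open import Data.List.Relation.Unary.Any as Any using (Any; here; there; _─_)
import Data.List.Relation.Unary.Any.Properties as Anyₚ
import Data.List.Relation.Unary.Unique.Propositional.Properties as Uniqueₚ
open import Data.Maybe.Base using (Maybe; just; nothing)
open import Data.Nat as ℕ using (ℕ; zero; suc; _≤_; _<_; z≤n; s≤s; _⊔_; NonZero; _∸_; _%_)
open import Data.Nat.Coprimality using (coprime-Bézout; prime⇒coprime)
open import Data.Nat.DivMod using (_mod_; %-distribˡ-*; %-distribˡ-+; m%n<n; m*n%n≡0; m/n*n≤m; m<n⇒m%n≡m; m≡m%n+[m/n]*n; n%n≡0)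
open import Data.Nat.GCD using (module Bézout)
open import Data.Nat.Logarithm using (⌊log₂_⌋; ⌊log₂⌋-mono-≤; ⌊log₂[2^n]⌋≡n)
open import Data.Nat.Primality using (Prime; prime⇒nonTrivial)
import Data.Nat.Properties as ℕₚ
open import Data.Nat.Tactic.RingSolver using (solve-∀)
open import Data.Product using (_×_; _,_; proj₁; proj₂; ∃-syntax; Σ-syntax)
open import Data.Product.Properties using (≡-dec)
open import Data.Sum using (_⊎_; inj₁; inj₂)
open import Data.Vec as Vec using (Vec; []; _∷_)
import Data.Vec.Properties as Vecₚ
open import Function using (_∘_; id)
open import Function.Bundles using (_↔_; Inverse)
open import Function.Construct.Identity using (↔-id)
open import Level using (0ℓ)
open import Relation.Binary.Definitions using (DecidableEquality)
open import Relation.Binary.PropositionalEquality using (_≡_; _≢_; refl; sym; trans; cong; cong₂; subst; subst₂; isEquivalence; module ≡-Reasoning)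
open import Relation.Nullary using (yes; no; ¬_; Dec; contradiction)
open import Relation.Nullary.Decidable using (¬?; _×-dec_; map′; decidable-stable; dec-true)

-- A coincidence is read with `b` and `b′` exchanged: `(x , a)` is joined to `b′` and `(x′ , a′)` to
-- `b`; only then does the equation say that two lines meet. The obstacle is that many neighbours of
-- a line may cross it in the same point, while a polynomial restricted to that line is controlled
-- only by distinct points. A free parameter `μ` removes it: shearing the two sides by `μ` keeps all
-- incidences but moves the crossings, and two given neighbours share a point for at most one `μ`.
-- So for most `μ` the number of neighbours is comparable to the number of crossings. Non-degeneracy
-- excludes the linear relations: it makes `(x , a)` recoverable, up to two choices, from the two
-- quantities through which it enters a line. Smallness of |A| against p enters since the degree, of
-- order √(|X||A||B|), must stay below p both for counting roots and for differentiating. Level sets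
-- too large for this have such low multiplicity that trivial counting wins, and balancing trivial
-- and incidence bounds produces the exponent 74/61.

-- The pair (a , b) stands for the integer a − b; with it as coefficient the
-- solver recognises cancellation over an abstract ring.
reduce-pair : ℕ × ℕ → ℕ × ℕ
reduce-pair (suc a , suc b) = reduce-pair (a , b)
reduce-pair u = u

DiffRing : RawRing 0ℓ 0ℓ
DiffRing = record
  { Carrier = ℕ × ℕ
  ; _≈_ = _≡_
  ; _+_ = λ (a , b) (c , d) → reduce-pair ((a ℕ.+ c) , (b ℕ.+ d))
  ; _*_ = λ (a , b) (c , d) → reduce-pair ((a ℕ.* c ℕ.+ b ℕ.* d) , (a ℕ.* d ℕ.+ b ℕ.* c))
  ; -_ = λ (a , b) → b , a
  ; 0# = 0 , 0
  ; 1# = 1 , 0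
  }

module RingSolve (R : CommutativeRing 0ℓ 0ℓ) where
  open CommutativeRing R renaming (refl to ≈-refl; sym to ≈-sym; trans to ≈-trans)
  open import Algebra.Properties.Ring ring hiding (⁻¹-anti-homo‿-; xyx⁻¹≈y)
  open import Algebra.Properties.AbelianGroup +-abelianGroup using (⁻¹-anti-homo‿-; xyx⁻¹≈y; ⁻¹-∙-comm; ε⁻¹≈ε)
  open import Algebra.Properties.Semiring.Mult semiring as Mult using (×-homo-+; ×1-homo-*; ×-congˡ)
  open import Algebra.Properties.CommutativeSemigroup +-commutativeSemigroup using (interchange)
  open import Relation.Binary.Reasoning.Setoid setoid

  nat : ℕ → Carrier
  nat n = n Mult.× 1#

  diff : ℕ × ℕ → Carrier
  diff (a , b) = nat a - nat b

  private
    diff-cong : ∀ a b c d → a ℕ.+ d ≡ b ℕ.+ c → diff (a , b) ≈ diff (c , d)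
    diff-cong a b c d e = ≈-sym (begin
      nat c - nat d ≈⟨ +-congʳ (≈-sym (xyx⁻¹≈y (nat b) (nat c))) ⟩
      ((nat b + nat c) - nat b) - nat d
        ≈⟨ +-congʳ (+-congʳ (≈-trans (≈-sym (×-homo-+ 1# b c)) (≈-trans (×-congˡ {1#} (sym e)) (×-homo-+ 1# a d)))) ⟩
      ((nat a + nat d) - nat b) - nat d ≈⟨ +-congʳ (≈-trans (+-congʳ (+-comm _ _)) (+-assoc _ _ _)) ⟩
      (nat d + diff (a , b)) - nat d ≈⟨ xyx⁻¹≈y (nat d) (diff (a , b)) ⟩
      diff (a , b) ∎)

    diff-cancel : ∀ u → diff (reduce-pair u) ≈ diff u
    diff-cancel (zero , _) = ≈-refl
    diff-cancel (suc _ , zero) = ≈-refl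
    diff-cancel (suc a , suc b) =
      ≈-trans (diff-cancel (a , b)) (diff-cong a b (suc a) (suc b) (trans (ℕₚ.+-suc a b) (trans (cong suc (ℕₚ.+-comm a b)) (sym (ℕₚ.+-suc b a)))))

    +-homo : ∀ u v → diff (RawRing._+_ DiffRing u v) ≈ diff u + diff v
    +-homo (a , b) (c , d) = ≈-trans (diff-cancel ((a ℕ.+ c) , (b ℕ.+ d))) (begin
      nat (a ℕ.+ c) - nat (b ℕ.+ d) ≈⟨ +-cong (×-homo-+ 1# a c) (-‿cong (×-homo-+ 1# b d)) ⟩
      (nat a + nat c) - (nat b + nat d) ≈⟨ +-congˡ (≈-sym (⁻¹-∙-comm _ _)) ⟩
      (nat a + nat c) + (- nat b + - nat d) ≈⟨ interchange _ _ _ _ ⟩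
      diff (a , b) + diff (c , d) ∎)

    -‿homo : ∀ u → diff (RawRing.-_ DiffRing u) ≈ - diff u
    -‿homo (a , b) = ≈-sym (⁻¹-anti-homo‿- _ _)

    homo*+ : ∀ a b c d → nat (a ℕ.* c ℕ.+ b ℕ.* d) ≈ nat a * nat c + nat b * nat d
    homo*+ a b c d = ≈-trans (×-homo-+ 1# (a ℕ.* c) (b ℕ.* d)) (+-cong (×1-homo-* a c) (×1-homo-* b d))

    *-homo : ∀ u v → diff (RawRing._*_ DiffRing u v) ≈ diff u * diff v
    *-homo (a , b) (c , d) = ≈-trans (diff-cancel ((a ℕ.* c ℕ.+ b ℕ.* d) , (a ℕ.* d ℕ.+ b ℕ.* c))) (begin
      nat (a ℕ.* c ℕ.+ b ℕ.* d) - nat (a ℕ.* d ℕ.+ b ℕ.* c)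
        ≈⟨ +-cong (homo*+ a b c d) (-‿cong (≈-trans (homo*+ a b d c) (+-comm _ _))) ⟩
      (x * z + y * w) - (y * z + x * w) ≈⟨ +-congˡ (≈-sym (⁻¹-∙-comm _ _)) ⟩
      (x * z + y * w) + (- (y * z) + - (x * w)) ≈⟨ interchange _ _ _ _ ⟩
      (x * z - y * z) + (y * w - x * w) ≈⟨ +-congˡ (≈-sym (⁻¹-anti-homo‿- _ _)) ⟩
      (x * z - y * z) - (x * w - y * w) ≈⟨ +-cong (≈-sym ([y-z]x≈yx-zx z x y)) (-‿cong (≈-sym ([y-z]x≈yx-zx w x y))) ⟩
      (x - y) * z - (x - y) * w ≈⟨ ≈-sym (x[y-z]≈xy-xz (x - y) z w) ⟩
      (x - y) * (z - w) ∎)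
      where x = nat a ; y = nat b ; z = nat c ; w = nat d

    -- Agrees with diff, but sends 0 and 1 to 0# and 1# definitionally.
    ⟦_⟧ᵈ : ℕ × ℕ → Carrier
    ⟦ 0 , 0 ⟧ᵈ = 0#
    ⟦ 1 , 0 ⟧ᵈ = 1#
    ⟦ u ⟧ᵈ = diff u

    ⟦⟧≈diff : ∀ u → ⟦ u ⟧ᵈ ≈ diff u
    ⟦⟧≈diff (0 , 0) = ≈-sym (-‿inverseʳ 0#)
    ⟦⟧≈diff (0 , suc _) = ≈-refl
    ⟦⟧≈diff (1 , 0) = ≈-sym (≈-trans (+-cong (+-identityʳ 1#) ε⁻¹≈ε) (+-identityʳ 1#))
    ⟦⟧≈diff (1 , suc _) = ≈-refl
    ⟦⟧≈diff (suc (suc _) , 0) = ≈-refl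
    ⟦⟧≈diff (suc (suc _) , suc _) = ≈-refl

    morphism : DiffRing -Raw-AlmostCommutative⟶ fromCommutativeRing R
    morphism = record
      { ⟦_⟧ = ⟦_⟧ᵈ
      ; +-homo = λ u v → ≈-trans (⟦⟧≈diff (RawRing._+_ DiffRing u v)) (≈-trans (+-homo u v) (≈-sym (+-cong (⟦⟧≈diff u) (⟦⟧≈diff v))))
      ; *-homo = λ u v → ≈-trans (⟦⟧≈diff (RawRing._*_ DiffRing u v)) (≈-trans (*-homo u v) (≈-sym (*-cong (⟦⟧≈diff u) (⟦⟧≈diff v))))
      ; -‿homo = λ u → ≈-trans (⟦⟧≈diff (RawRing.-_ DiffRing u)) (≈-trans (-‿homo u) (-‿cong (≈-sym (⟦⟧≈diff u))))
      ; 0-homo = ≈-refl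
      ; 1-homo = ≈-refl
      }

    _≟d_ : ∀ u v → Maybe (⟦ u ⟧ᵈ ≈ ⟦ v ⟧ᵈ)
    (a , b) ≟d (c , d) with (a ℕ.+ d) ℕₚ.≟ (b ℕ.+ c)
    ... | yes e = just (≈-trans (⟦⟧≈diff (a , b)) (≈-trans (diff-cong a b c d e) (≈-sym (⟦⟧≈diff (c , d)))))
    ... | no _ = nothing

  open Algebra.Solver.Ring DiffRing (fromCommutativeRing R) morphism _≟d_ public
    using (solve; _:+_; _:*_; _:-_; :-_; _:=_; con; Polynomial)

  :0 :1 : ∀ {n} → Polynomial n
  :0 = con (0 , 0)
  :1 = con (1 , 0)

length-filter-complement : ∀ {A : Set} {P : A → Set} (P? : ∀ x → Dec (P x)) xs →
  length xs ≡ length (filter P? xs) ℕ.+ length (filter (¬? ∘ P?) xs)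
length-filter-complement P? [] = refl
length-filter-complement P? (x ∷ xs) with P? x
... | yes _ = cong suc (length-filter-complement P? xs)
... | no _ = trans (cong suc (length-filter-complement P? xs)) (sym (ℕₚ.+-suc _ _))

-- Finite sums over lists

module Sums where
  open import Data.Nat
  open import Data.Nat.Properties

  private variable
    A C : Set
    P Q : Set

  ∑ : List A → (A → ℕ) → ℕ
  ∑ [] f = 0
  ∑ (x ∷ xs) f = f x + ∑ xs f

  ∑-cong-∈ : ∀ xs {f g : A → ℕ} → (∀ {x} → x ∈ xs → f x ≡ g x) → ∑ xs f ≡ ∑ xs g
  ∑-cong-∈ [] e = refl
  ∑-cong-∈ (x ∷ xs) e = cong₂ _+_ (e (here refl)) (∑-cong-∈ xs (e ∘ there))

  ∑-cong : ∀ xs {f g : A → ℕ} → (∀ x → f x ≡ g x) → ∑ xs f ≡ ∑ xs g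
  ∑-cong xs e = ∑-cong-∈ xs (λ {x} _ → e x)

  ∑-mono-∈ : ∀ xs {f g : A → ℕ} → (∀ {x} → x ∈ xs → f x ≤ g x) → ∑ xs f ≤ ∑ xs g
  ∑-mono-∈ [] e = z≤n
  ∑-mono-∈ (x ∷ xs) e = +-mono-≤ (e (here refl)) (∑-mono-∈ xs (e ∘ there))

  ∑-mono : ∀ xs {f g : A → ℕ} → (∀ x → f x ≤ g x) → ∑ xs f ≤ ∑ xs g
  ∑-mono xs e = ∑-mono-∈ xs (λ {x} _ → e x)

  ∑-+ : ∀ xs (f g : A → ℕ) → ∑ xs (λ x → f x + g x) ≡ ∑ xs f + ∑ xs g
  ∑-+ [] f g = refl
  ∑-+ (x ∷ xs) f g = trans (cong (f x + g x +_) (∑-+ xs f g)) (lem (f x) (g x) (∑ xs f) (∑ xs g))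
    where lem : ∀ a b c d → a + b + (c + d) ≡ a + c + (b + d)
          lem = solve-∀

  ∑-*ˡ : ∀ xs c (f : A → ℕ) → ∑ xs (λ x → c * f x) ≡ c * ∑ xs f
  ∑-*ˡ [] c f = sym (*-zeroʳ c)
  ∑-*ˡ (x ∷ xs) c f = trans (cong (c * f x +_) (∑-*ˡ xs c f)) (sym (*-distribˡ-+ c (f x) (∑ xs f)))

  ∑-*ʳ : ∀ xs c (f : A → ℕ) → ∑ xs (λ x → f x * c) ≡ ∑ xs f * c
  ∑-*ʳ xs c f = trans (∑-cong xs (λ x → *-comm (f x) c)) (trans (∑-*ˡ xs c f) (*-comm c _))

  ∑-zero : ∀ (xs : List A) → ∑ xs (λ _ → 0) ≡ 0
  ∑-zero [] = refl
  ∑-zero (x ∷ xs) = ∑-zero xs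

  ∑-const : ∀ (xs : List A) c → ∑ xs (λ _ → c) ≡ length xs * c
  ∑-const [] c = refl
  ∑-const (x ∷ xs) c = cong (c +_) (∑-const xs c)

  ∑-swap : ∀ (xs : List A) (ys : List C) (f : A → C → ℕ) → ∑ xs (λ x → ∑ ys (f x)) ≡ ∑ ys (λ y → ∑ xs (λ x → f x y))
  ∑-swap [] ys f = sym (∑-zero ys)
  ∑-swap (x ∷ xs) ys f = trans (cong (∑ ys (f x) +_) (∑-swap xs ys f)) (sym (∑-+ ys (f x) (λ y → ∑ xs (λ x → f x y))))

  ∑-map : ∀ (h : A → C) xs f → ∑ (map h xs) f ≡ ∑ xs (f ∘ h)
  ∑-map h [] f = refl
  ∑-map h (x ∷ xs) f = cong (f (h x) +_) (∑-map h xs f)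

  ∑-++ : ∀ xs ys (f : A → ℕ) → ∑ (xs ++ ys) f ≡ ∑ xs f + ∑ ys f
  ∑-++ [] ys f = refl
  ∑-++ (x ∷ xs) ys f = trans (cong (f x +_) (∑-++ xs ys f)) (sym (+-assoc (f x) _ _))

  ∑-∈ : ∀ {xs} {x : A} (f : A → ℕ) → x ∈ xs → f x ≤ ∑ xs f
  ∑-∈ f (here refl) = m≤m+n _ _
  ∑-∈ {xs = x ∷ xs} f (there p) = ≤-trans (∑-∈ f p) (m≤n+m _ (f x))

  ∑-< : ∀ xs {f g : A → ℕ} → ∑ xs f < ∑ xs g → ∃[ x ] (x ∈ xs × f x < g x)
  ∑-< (x ∷ xs) {f} {g} lt with f x <? g x
  ... | yes p = x , here refl , p
  ... | no ¬p with y , y∈ , q ← ∑-< xs {f} {g} (+-cancelˡ-< (g x) _ _ (≤-<-trans (+-monoˡ-≤ (∑ xs f) (≮⇒≥ ¬p)) lt)) = y , there y∈ , q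

  ∑-product : ∀ (xs : List A) (ys : List C) f g → ∑ xs f * ∑ ys g ≡ ∑ xs (λ x → ∑ ys (λ y → f x * g y))
  ∑-product xs ys f g = trans (sym (∑-*ʳ xs (∑ ys g) f)) (∑-cong xs (λ x → sym (∑-*ˡ ys (f x) g)))

  *-self-cancel-≤ : ∀ {m n} → m * m ≤ n * n → m ≤ n
  *-self-cancel-≤ {m} {n} le with m ≤? n
  ... | yes p = p
  ... | no ¬p = contradiction le (<⇒≱ (*-mono-< (≰⇒> ¬p) (≰⇒> ¬p)))

  2ab≤a²+b² : ∀ a b → 2 * (a * b) ≤ a * a + b * b
  2ab≤a²+b² a b with ≤-total a b
  ... | inj₁ le with d , refl ← m≤n⇒∃[o]m+o≡n le = ≤-trans (m≤m+n _ (d * d)) (≤-reflexive (lem a d))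
    where lem : ∀ a d → 2 * (a * (a + d)) + d * d ≡ a * a + (a + d) * (a + d)
          lem = solve-∀
  2ab≤a²+b² a b | inj₂ le with d , refl ← m≤n⇒∃[o]m+o≡n le = ≤-trans (m≤m+n _ (d * d)) (≤-reflexive (lem b d))
    where lem : ∀ b d → 2 * ((b + d) * b) + d * d ≡ (b + d) * (b + d) + b * b
          lem = solve-∀

  -- Both sides are expanded into double sums. Term by term this is `2ab≤a²+b²` for the cross
  -- products `f x * g y` and `g x * f y`, so natural numbers suffice.
  cauchy-schwarz : ∀ xs (f g : A → ℕ) → ∑ xs (λ x → f x * g x) * ∑ xs (λ x → f x * g x) ≤ ∑ xs (λ x → f x * f x) * ∑ xs (λ x → g x * g x)
  cauchy-schwarz xs f g = *-cancelˡ-≤ 2 (begin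
    2 * (∑ xs (λ x → f x * g x) * ∑ xs (λ x → f x * g x)) ≡⟨ cong (2 *_) (∑-product xs xs _ _) ⟩
    2 * ∑ xs (λ x → ∑ xs (λ y → f x * g x * (f y * g y))) ≡⟨ sym (∑-*ˡ xs 2 _) ⟩
    ∑ xs (λ x → 2 * ∑ xs (λ y → f x * g x * (f y * g y))) ≡⟨ ∑-cong xs (λ x → sym (∑-*ˡ xs 2 _)) ⟩
    ∑ xs (λ x → ∑ xs (λ y → 2 * (f x * g x * (f y * g y)))) ≤⟨ ∑-mono xs (λ x → ∑-mono xs (λ y → amgm (f x) (g x) (f y) (g y))) ⟩
    ∑ xs (λ x → ∑ xs (λ y → f x * f x * (g y * g y) + g x * g x * (f y * f y))) ≡⟨ ∑-cong xs (λ x → ∑-+ xs _ _) ⟩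
    ∑ xs (λ x → ∑ xs (λ y → f x * f x * (g y * g y)) + ∑ xs (λ y → g x * g x * (f y * f y))) ≡⟨ ∑-+ xs _ _ ⟩
    ∑ xs (λ x → ∑ xs (λ y → f x * f x * (g y * g y))) + ∑ xs (λ x → ∑ xs (λ y → g x * g x * (f y * f y)))
      ≡⟨ sym (cong₂ _+_ (∑-product xs xs _ _) (∑-product xs xs _ _)) ⟩
    F * G + G * F ≡⟨ lem F G ⟩
    2 * (F * G) ∎)
    where
    open ≤-Reasoning

    F = ∑ xs (λ x → f x * f x)
    G = ∑ xs (λ x → g x * g x)
    lem : ∀ a b → a * b + b * a ≡ 2 * (a * b)
    lem = solve-∀
    amgm : ∀ a b c d → 2 * (a * b * (c * d)) ≤ a * a * (d * d) + b * b * (c * c)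
    amgm a b c d = ≤-trans (≤-reflexive (l₁ a b c d)) (≤-trans (2ab≤a²+b² (a * d) (b * c)) (≤-reflexive (l₂ a b c d)))
      where
      l₁ : ∀ a b c d → 2 * (a * b * (c * d)) ≡ 2 * (a * d * (b * c))
      l₁ = solve-∀
      l₂ : ∀ a b c d → a * d * (a * d) + b * c * (b * c) ≡ a * a * (d * d) + b * b * (c * c)
      l₂ = solve-∀

  [_] : Dec P → ℕ
  [ yes _ ] = 1
  [ no _ ] = 0

  []-mono : (p : Dec P) (q : Dec Q) → (P → Q) → [ p ] ≤ [ q ]
  []-mono (yes p) (yes q) f = ≤-refl
  []-mono (yes p) (no ¬q) f = contradiction (f p) ¬q
  []-mono (no _) q f = z≤n

  []-cong : (p : Dec P) (q : Dec Q) → (P → Q) → (Q → P) → [ p ] ≡ [ q ]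
  []-cong p q f g = ≤-antisym ([]-mono p q f) ([]-mono q p g)

  []-yes : (p : Dec P) → P → [ p ] ≡ 1
  []-yes (yes _) p = refl
  []-yes (no ¬p) p = contradiction p ¬p

  []-no : (p : Dec P) → ¬ P → [ p ] ≡ 0
  []-no (yes p) ¬p = contradiction p ¬p
  []-no (no _) ¬p = refl

  []≤1 : (p : Dec P) → [ p ] ≤ 1
  []≤1 (yes _) = ≤-refl
  []≤1 (no _) = z≤n

  []-idem : (p : Dec P) → [ p ] * [ p ] ≡ [ p ]
  []-idem (yes _) = refl
  []-idem (no _) = refl

  module _ {A : Set} (_≟_ : ∀ (x y : A) → Dec (x ≡ y)) where
    ∑-distinct-≤ : ∀ {xs} → AllPairs _≢_ xs → ∀ y (f : A → ℕ) → ∑ xs (λ x → [ y ≟ x ] * f x) ≤ f y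
    ∑-distinct-≤ [] y f = z≤n
    ∑-distinct-≤ {x ∷ xs} (d ∷ ds) y f with y ≟ x
    ... | no _ = ∑-distinct-≤ ds y f
    ... | yes refl = ≤-reflexive (trans (cong₂ _+_ (*-identityˡ (f y)) (trans (∑-cong-∈ xs (λ {z} z∈ → cong (_* f z) ([]-no (y ≟ z) (All.lookup d z∈)))) (∑-zero xs))) (+-identityʳ _))

    ∑-point : ∀ {xs} → AllPairs _≢_ xs → ∀ {y} → y ∈ xs → (f : A → ℕ) → ∑ xs (λ x → [ y ≟ x ] * f x) ≡ f y
    ∑-point {xs} ds {y} y∈ f = ≤-antisym (∑-distinct-≤ ds y f)
      (≤-trans (≤-reflexive (sym (trans (cong (_* f y) ([]-yes (y ≟ y) refl)) (*-identityˡ _)))) (∑-∈ (λ x → [ y ≟ x ] * f x) y∈))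

open Sums

-- Inclusion with multiplicity, encoded by its effect on sums. It survives the removal of entries,
-- and no injection of positions has to be carried along.
Sub : {A : Set} → List A → List A → Set
Sub xs ys = ∀ f → ∑ xs f ≤ ∑ ys f

∑-remove : ∀ {A : Set} {x : A} {xs} (i : x ∈ xs) f → ∑ xs f ≡ f x ℕ.+ ∑ (xs ─ i) f
∑-remove (here refl) f = refl
∑-remove {x = x} {y ∷ xs} (there i) f = trans (cong (f y ℕ.+_) (∑-remove i f)) (lem (f y) (f x) _)
  where lem : ∀ a b c → a ℕ.+ (b ℕ.+ c) ≡ b ℕ.+ (a ℕ.+ c)
        lem = solve-∀

remove-Sub : ∀ {A : Set} {x : A} {xs ys} (i : x ∈ xs) → Sub xs ys → Sub (xs ─ i) ys
remove-Sub i s f = ℕₚ.≤-trans (ℕₚ.≤-trans (ℕₚ.m≤n+m _ _) (ℕₚ.≤-reflexive (sym (∑-remove i f)))) (s f)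

remove-∈ : ∀ {A : Set} {x y : A} {xs} (i : x ∈ xs) → y ∈ (xs ─ i) → y ∈ xs
remove-∈ (here refl) j = there j
remove-∈ (there i) (here e) = here e
remove-∈ (there i) (there j) = there (remove-∈ i j)

sgn : ℕ → ℕ
sgn zero = 0
sgn (suc _) = 1

sgn-* : ∀ n → sgn n ℕ.* n ≡ n
sgn-* zero = refl
sgn-* (suc n) = ℕₚ.+-identityʳ _

sgn-idem : ∀ n → sgn n ℕ.* sgn n ≡ sgn n
sgn-idem zero = refl
sgn-idem (suc n) = refl

length-filter-sgn : ∀ {A : Set} (f : A → ℕ) xs → length (filter (λ x → 0 ℕ.<? f x) xs) ≡ ∑ xs (sgn ∘ f)
length-filter-sgn f [] = refl
length-filter-sgn f (x ∷ xs) with f x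
... | zero = length-filter-sgn f xs
... | suc _ = cong suc (length-filter-sgn f xs)

∑-unique-≤1 : ∀ {A : Set} {xs : List A} {P : A → Set} (P? : ∀ x → Dec (P x)) → AllPairs _≢_ xs →
              (∀ {x y} → P x → P y → x ≡ y) → ∑ xs (λ x → [ P? x ]) ≤ 1
∑-unique-≤1 P? [] u = z≤n
∑-unique-≤1 {xs = x ∷ xs} P? (d ∷ ds) u with P? x
... | no _ = ∑-unique-≤1 P? ds u
... | yes p = s≤s (ℕₚ.≤-reflexive (trans (∑-cong-∈ xs (λ {y} y∈ → []-no (P? y) (λ q → All.lookup d y∈ (u p q)))) (∑-zero xs)))

∈-inj₁⁻ : ∀ {A B : Set} {p : A} {ps} {qs : List B} → inj₁ p ∈ map inj₁ ps ++ map inj₂ qs → p ∈ ps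
∈-inj₁⁻ {ps = ps} i with ∈ₚ.∈-++⁻ (map inj₁ ps) i
... | inj₁ j with _ , k , refl ← ∈ₚ.∈-map⁻ inj₁ j = k
... | inj₂ j with _ , k , () ← ∈ₚ.∈-map⁻ inj₂ j

∈-inj₂⁻ : ∀ {A B : Set} {q : B} {ps : List A} {qs} → inj₂ q ∈ map inj₁ ps ++ map inj₂ qs → q ∈ qs
∈-inj₂⁻ {ps = ps} i with ∈ₚ.∈-++⁻ (map inj₁ ps) i
... | inj₁ j with _ , k , () ← ∈ₚ.∈-map⁻ inj₁ j
... | inj₂ j with _ , k , refl ← ∈ₚ.∈-map⁻ inj₂ j = k

positive-term : ∀ {A : Set} xs {f : A → ℕ} → 0 < ∑ xs f → ∃[ x ] (x ∈ xs × 0 < f x)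
positive-term xs {f} lt = ∑-< xs {λ _ → 0} {f} (subst (_< ∑ xs f) (sym (∑-zero xs)) lt)

[]-positive : ∀ {P : Set} (p : Dec P) → 0 < [ p ] → P
[]-positive (yes p) _ = p

*-positive : ∀ m n → 0 < m ℕ.* n → 0 < m × 0 < n
*-positive (suc m) (suc n) _ = s≤s z≤n , s≤s z≤n
*-positive (suc m) zero lt = contradiction (subst (0 <_) (ℕₚ.*-zeroʳ m) lt) λ ()

∑-concatMap : ∀ {A C : Set} (h : A → List C) xs f → ∑ (concatMap h xs) f ≡ ∑ xs (λ x → ∑ (h x) f)
∑-concatMap h [] f = refl
∑-concatMap h (x ∷ xs) f = trans (∑-++ (h x) (concatMap h xs) f) (cong (∑ (h x) f ℕ.+_) (∑-concatMap h xs f))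

length-filter-count : ∀ {A : Set} {P : A → Set} (P? : ∀ x → Dec (P x)) xs → ∑ xs (λ x → [ P? x ]) ≡ length (filter P? xs)
length-filter-count P? [] = refl
length-filter-count P? (x ∷ xs) with P? x
... | yes _ = cong suc (length-filter-count P? xs)
... | no _ = length-filter-count P? xs

length-∑ : ∀ {A : Set} (xs : List A) → ∑ xs (λ _ → 1) ≡ length xs
length-∑ xs = trans (∑-const xs 1) (ℕₚ.*-identityʳ _)

-- Integer square roots and small powers

module Powers where
  open import Data.Nat
  open import Data.Nat.Properties

  integer-sqrt : ∀ n → ∃[ d ] (d * d ≤ n × n < suc d * suc d)
  integer-sqrt zero = 0 , z≤n , s≤s z≤n
  integer-sqrt (suc n) with integer-sqrt n
  ... | d , lo , hi with suc d * suc d ≤? suc n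
  ...   | yes p = suc d , p , <-≤-trans (s≤s hi) (≤-trans (m≤m+n (suc (suc d * suc d)) (suc d + suc d)) (≤-reflexive (lem d)))
    where lem : ∀ d → 1 + suc d * suc d + (suc d + suc d) ≡ suc (suc d) * suc (suc d)
          lem = solve-∀
  ...   | no ¬p = d , m≤n⇒m≤1+n lo , ≰⇒> ¬p

  square-of-sum : ∀ a b c d → (a + (b + (c + d))) * (a + (b + (c + d))) ≤ 4 * (a * a + (b * b + (c * c + d * d)))
  square-of-sum a b c d = subst₂ _≤_ (l₁ a b c d) (l₂ a b c d) (cauchy-schwarz (a ∷ b ∷ c ∷ d ∷ []) (λ _ → 1) (λ x → x))
    where
    l₁ : ∀ a b c d → (1 * a + (1 * b + (1 * c + (1 * d + 0)))) * (1 * a + (1 * b + (1 * c + (1 * d + 0)))) ≡ (a + (b + (c + d))) * (a + (b + (c + d)))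
    l₁ = solve-∀
    l₂ : ∀ a b c d → 4 * (a * a + (b * b + (c * c + (d * d + 0)))) ≡ 4 * (a * a + (b * b + (c * c + d * d)))
    l₂ = solve-∀

  fourth : ℕ → ℕ
  fourth x = x * x * (x * x)

  fourth-mono : ∀ {x y} → x ≤ y → fourth x ≤ fourth y
  fourth-mono le = *-mono-≤ (*-mono-≤ le le) (*-mono-≤ le le)

  scaled-root : ∀ c d m s → d * d ≤ m → m * c * c ≤ s * s → c * d ≤ s
  scaled-root c d m s d²≤m fits = *-self-cancel-≤ (≤-trans (≤-reflexive (l c d)) (≤-trans (*-monoˡ-≤ c (*-monoˡ-≤ c d²≤m)) fits))
    where
    l : ∀ c d → c * d * (c * d) ≡ d * d * c * c
    l = solve-∀

  cube : ℕ → ℕ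
  cube x = x * x * x

open Powers

-- Inequalities between monomials

module Exponents where
  open import Data.Fin using (zero; suc)
  open import Data.Nat
  open import Data.Nat.Properties

  infixl 7 _⊙_
  infixr 8 _↑_
  ^-distrib-* : ∀ a b m → (a * b) ^ m ≡ a ^ m * b ^ m
  ^-distrib-* a b zero = refl
  ^-distrib-* a b (suc m) = trans (cong (a * b *_) (^-distrib-* a b m)) (lem a b (a ^ m) (b ^ m))
    where lem : ∀ a b c d → a * b * (c * d) ≡ a * c * (b * d)
          lem = solve-∀

  -- Reified monomials: equality is decided by computing exponent vectors, so identities between
  -- powers as high as the 74th are checked by `refl` without being multiplied out.
  data Monomial (k : ℕ) : Set where
    var : Fin k → Monomial k
    _⊙_ : Monomial k → Monomial k → Monomial k
    _↑_ : Monomial k → ℕ → Monomial k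

  module _ {k : ℕ} where
    ⟪_⟫ : Monomial k → Vec ℕ k → ℕ
    ⟪ var i ⟫ ρ = Vec.lookup ρ i
    ⟪ e ⊙ e′ ⟫ ρ = ⟪ e ⟫ ρ * ⟪ e′ ⟫ ρ
    ⟪ e ↑ m ⟫ ρ = ⟪ e ⟫ ρ ^ m

  basis : ∀ {k} → Fin k → Vec ℕ k
  basis zero = 1 ∷ Vec.replicate _ 0
  basis (suc i) = 0 ∷ basis i

  exponents : ∀ {k} → Monomial k → Vec ℕ k
  exponents (var i) = basis i
  exponents (e ⊙ e′) = Vec.zipWith _+_ (exponents e) (exponents e′)
  exponents (e ↑ m) = Vec.map (_* m) (exponents e)

  power-product : ∀ {k} → Vec ℕ k → Vec ℕ k → ℕ
  power-product [] [] = 1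
  power-product (x ∷ ρ) (m ∷ ms) = x ^ m * power-product ρ ms

  power-product-zero : ∀ {k} (ρ : Vec ℕ k) → power-product ρ (Vec.replicate k 0) ≡ 1
  power-product-zero [] = refl
  power-product-zero (x ∷ ρ) = trans (+-identityʳ _) (power-product-zero ρ)

  power-product-unit : ∀ {k} (ρ : Vec ℕ k) i → power-product ρ (basis i) ≡ Vec.lookup ρ i
  power-product-unit (x ∷ ρ) zero = trans (cong₂ _*_ (^-identityʳ x) (power-product-zero ρ)) (*-identityʳ x)
  power-product-unit (x ∷ ρ) (suc i) = trans (+-identityʳ _) (power-product-unit ρ i)

  power-product-+ : ∀ {k} (ρ ms ns : Vec ℕ k) → power-product ρ (Vec.zipWith _+_ ms ns) ≡ power-product ρ ms * power-product ρ ns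
  power-product-+ [] [] [] = refl
  power-product-+ (x ∷ ρ) (m ∷ ms) (n ∷ ns) = trans (cong₂ _*_ (^-distribˡ-+-* x m n) (power-product-+ ρ ms ns)) (lem (x ^ m) (x ^ n) (power-product ρ ms) (power-product ρ ns))
    where lem : ∀ a b c d → a * b * (c * d) ≡ a * c * (b * d)
          lem = solve-∀

  power-product-^ : ∀ {k} (ρ ms : Vec ℕ k) m → power-product ρ (Vec.map (_* m) ms) ≡ power-product ρ ms ^ m
  power-product-^ [] [] m = sym (^-zeroˡ m)
  power-product-^ (x ∷ ρ) (n ∷ ns) m = trans (cong₂ _*_ (sym (^-*-assoc x n m)) (power-product-^ ρ ns m)) (sym (^-distrib-* (x ^ n) (power-product ρ ns) m))

  exponents-correct : ∀ {k} (e : Monomial k) ρ → ⟪ e ⟫ ρ ≡ power-product ρ (exponents e)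
  exponents-correct (var i) ρ = sym (power-product-unit ρ i)
  exponents-correct (e ⊙ e′) ρ = trans (cong₂ _*_ (exponents-correct e ρ) (exponents-correct e′ ρ)) (sym (power-product-+ ρ (exponents e) (exponents e′)))
  exponents-correct (e ↑ m) ρ = trans (cong (_^ m) (exponents-correct e ρ)) (sym (power-product-^ ρ (exponents e) m))

  same-monomial : ∀ {k} (ρ : Vec ℕ k) e e′ → exponents e ≡ exponents e′ → ⟪ e ⟫ ρ ≡ ⟪ e′ ⟫ ρ
  same-monomial ρ e e′ eq = trans (exponents-correct e ρ) (trans (cong (power-product ρ) eq) (sym (exponents-correct e′ ρ)))

  positive : ∀ {a} → 1 ≤ a → NonZero a
  positive = >-nonZero

  -- (tJ)¹² is balanced between the trivial bound J ≤ Δn and the incidence bounds.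
  level-product : ∀ {n M Δ t J Z C} → 1 ≤ M → 1 ≤ n → 1 ≤ t → 1 ≤ C → J ≤ Δ * n →
    (M ^ 17 < t ^ 12 * n ^ 8 * Δ → n * (t * Z) ^ 4 ≤ C * M ^ 2 * (M * Z) ^ 3) → (M ^ 17 < t ^ 12 * n ^ 8 * Δ → n * J ^ 4 ≤ C * M ^ 2 * (Δ * Z) ^ 3) → (Z ≡ 0 → J ≡ 0) →
    (t * J) ^ 12 ≤ C ^ 12 * (M ^ 17 * n ^ 4 * Δ ^ 11)
  level-product {n} {M} {Δ} {t} {J} {Z} {C} 1≤M 1≤n 1≤t 1≤C J≤ hZ hJ Z0 = cases (t ^ 12 * n ^ 8 * Δ ≤? M ^ 17) (1 ≤? Z)
    where
    open ≤-Reasoning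
    ρ = n ∷ M ∷ Δ ∷ t ∷ J ∷ Z ∷ C ∷ []
    n′ = var {7} 0F
    M′ = var {7} 1F
    Δ′ = var {7} 2F
    t′ = var {7} 3F
    J′ = var {7} 4F
    Z′ = var {7} 5F
    C′ = var {7} 6F
    cases : Dec (t ^ 12 * n ^ 8 * Δ ≤ M ^ 17) → Dec (1 ≤ Z) → (t * J) ^ 12 ≤ C ^ 12 * (M ^ 17 * n ^ 4 * Δ ^ 11)
    cases (yes small) _ = begin
      (t * J) ^ 12 ≤⟨ ^-monoˡ-≤ 12 (*-monoʳ-≤ t J≤) ⟩
      (t * (Δ * n)) ^ 12 ≡⟨ same-monomial ρ ((t′ ⊙ (Δ′ ⊙ n′)) ↑ 12) (t′ ↑ 12 ⊙ n′ ↑ 8 ⊙ Δ′ ⊙ (n′ ↑ 4 ⊙ Δ′ ↑ 11)) refl ⟩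
      t ^ 12 * n ^ 8 * Δ * (n ^ 4 * Δ ^ 11) ≤⟨ *-monoˡ-≤ (n ^ 4 * Δ ^ 11) small ⟩
      M ^ 17 * (n ^ 4 * Δ ^ 11) ≡⟨ same-monomial ρ (M′ ↑ 17 ⊙ (n′ ↑ 4 ⊙ Δ′ ↑ 11)) (M′ ↑ 17 ⊙ n′ ↑ 4 ⊙ Δ′ ↑ 11) refl ⟩
      M ^ 17 * n ^ 4 * Δ ^ 11 ≤⟨ m≤n*m _ (C ^ 12) {{m^n≢0 C 12 {{positive 1≤C}}}} ⟩
      C ^ 12 * (M ^ 17 * n ^ 4 * Δ ^ 11) ∎
    cases (no _) (no ¬Z) = ≤-trans (≤-reflexive (cong (λ j → (t * j) ^ 12) (Z0 (n<1⇒n≡0 (≰⇒> ¬Z))))) (≤-trans (≤-reflexive (cong (_^ 12) (*-zeroʳ t))) z≤n)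
    -- The two incidence bounds enter with exponents 3 (for `J`) and 9 (for `t * Z`), which cancels
    -- the 36th power of `Z`. The square of the case hypothesis then trades the surplus `t ^ 24` for
    -- `M ^ 34`.
    cases (no big) (yes 1≤Z) = *-cancelʳ-≤ _ _ (M ^ 34) {{m^n≢0 M 34 {{positive 1≤M}}}} (begin
      (t * J) ^ 12 * M ^ 34 ≡⟨ cong ((t * J) ^ 12 *_) (same-monomial ρ (M′ ↑ 34) ((M′ ↑ 17) ↑ 2) refl) ⟩
      (t * J) ^ 12 * (M ^ 17) ^ 2 ≤⟨ *-monoʳ-≤ ((t * J) ^ 12) (^-monoˡ-≤ 2 (<⇒≤ (≰⇒> big))) ⟩
      (t * J) ^ 12 * (t ^ 12 * n ^ 8 * Δ) ^ 2 ≡⟨ same-monomial ρ ((t′ ⊙ J′) ↑ 12 ⊙ (t′ ↑ 12 ⊙ n′ ↑ 8 ⊙ Δ′) ↑ 2) (J′ ↑ 12 ⊙ t′ ↑ 36 ⊙ n′ ↑ 12 ⊙ (n′ ↑ 4 ⊙ Δ′ ↑ 2)) refl ⟩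
      J ^ 12 * t ^ 36 * n ^ 12 * (n ^ 4 * Δ ^ 2) ≤⟨ *-monoˡ-≤ (n ^ 4 * Δ ^ 2) cancelled ⟩
      C ^ 12 * (M ^ 51 * Δ ^ 9) * (n ^ 4 * Δ ^ 2) ≡⟨ same-monomial ρ (C′ ↑ 12 ⊙ (M′ ↑ 51 ⊙ Δ′ ↑ 9) ⊙ (n′ ↑ 4 ⊙ Δ′ ↑ 2)) (C′ ↑ 12 ⊙ (M′ ↑ 17 ⊙ n′ ↑ 4 ⊙ Δ′ ↑ 11) ⊙ M′ ↑ 34) refl ⟩
      C ^ 12 * (M ^ 17 * n ^ 4 * Δ ^ 11) * M ^ 34 ∎)
      where
      cancelled : J ^ 12 * t ^ 36 * n ^ 12 ≤ C ^ 12 * (M ^ 51 * Δ ^ 9)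
      cancelled = *-cancelʳ-≤ _ _ (Z ^ 36) {{m^n≢0 Z 36 {{positive 1≤Z}}}} (begin
        J ^ 12 * t ^ 36 * n ^ 12 * Z ^ 36 ≡⟨ same-monomial ρ (J′ ↑ 12 ⊙ t′ ↑ 36 ⊙ n′ ↑ 12 ⊙ Z′ ↑ 36) ((n′ ⊙ J′ ↑ 4) ↑ 3 ⊙ (n′ ⊙ (t′ ⊙ Z′) ↑ 4) ↑ 9) refl ⟩
        (n * J ^ 4) ^ 3 * (n * (t * Z) ^ 4) ^ 9 ≤⟨ *-mono-≤ (^-monoˡ-≤ 3 (hJ (≰⇒> big))) (^-monoˡ-≤ 9 (hZ (≰⇒> big))) ⟩
        (C * M ^ 2 * (Δ * Z) ^ 3) ^ 3 * (C * M ^ 2 * (M * Z) ^ 3) ^ 9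
          ≡⟨ same-monomial ρ ((C′ ⊙ M′ ↑ 2 ⊙ (Δ′ ⊙ Z′) ↑ 3) ↑ 3 ⊙ (C′ ⊙ M′ ↑ 2 ⊙ (M′ ⊙ Z′) ↑ 3) ↑ 9) (C′ ↑ 12 ⊙ (M′ ↑ 51 ⊙ Δ′ ↑ 9) ⊙ Z′ ↑ 36) refl ⟩
        C ^ 12 * (M ^ 51 * Δ ^ 9) * Z ^ 36 ∎)

  -- Here `s` is a dyadic level of a representation function and `X` the size of its level set. Up
  -- to `s = M^(2/3)` the counting bound on `s * X` is the better one, beyond it the incidence
  -- bound; at that threshold both give `M^(4/3) * n ^ 2`.
  level-cube : ∀ {n M s X C} → 1 ≤ M → 1 ≤ n → 1 ≤ C → s * X ≤ n ^ 2 → n * (s * X) ^ 4 ≤ C * M ^ 2 * (n * X) ^ 3 →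
    (s ^ 3 * X) ^ 3 ≤ C ^ 3 * (M ^ 4 * n ^ 6)
  level-cube {n} {M} {s} {X} {C} 1≤M 1≤n 1≤C sX≤ h = cases (s ^ 3 ≤? M ^ 2) (1 ≤? X)
    where
    open ≤-Reasoning
    ρ = n ∷ M ∷ s ∷ X ∷ C ∷ []
    n′ = var {5} 0F
    M′ = var {5} 1F
    s′ = var {5} 2F
    X′ = var {5} 3F
    C′ = var {5} 4F
    cases : Dec (s ^ 3 ≤ M ^ 2) → Dec (1 ≤ X) → (s ^ 3 * X) ^ 3 ≤ C ^ 3 * (M ^ 4 * n ^ 6)
    cases (yes small) _ = begin
      (s ^ 3 * X) ^ 3 ≡⟨ same-monomial ρ ((s′ ↑ 3 ⊙ X′) ↑ 3) ((s′ ↑ 3) ↑ 2 ⊙ (s′ ⊙ X′) ↑ 3) refl ⟩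
      (s ^ 3) ^ 2 * (s * X) ^ 3 ≤⟨ *-mono-≤ (^-monoˡ-≤ 2 small) (^-monoˡ-≤ 3 sX≤) ⟩
      (M ^ 2) ^ 2 * (n ^ 2) ^ 3 ≡⟨ same-monomial ρ ((M′ ↑ 2) ↑ 2 ⊙ (n′ ↑ 2) ↑ 3) (M′ ↑ 4 ⊙ n′ ↑ 6) refl ⟩
      M ^ 4 * n ^ 6 ≤⟨ m≤n*m _ (C ^ 3) {{m^n≢0 C 3 {{positive 1≤C}}}} ⟩
      C ^ 3 * (M ^ 4 * n ^ 6) ∎
    cases (no _) (no ¬X) = ≤-trans (≤-reflexive (cong (λ x → (s ^ 3 * x) ^ 3) (n<1⇒n≡0 (≰⇒> ¬X)))) (≤-trans (≤-reflexive (cong (_^ 3) (*-zeroʳ (s ^ 3)))) z≤n)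
    cases (no big) (yes 1≤X) = *-cancelʳ-≤ _ _ (M ^ 2 * (n ^ 3 * X ^ 9)) {{m*n≢0 (M ^ 2) (n ^ 3 * X ^ 9) {{m^n≢0 M 2 {{positive 1≤M}}}} {{m*n≢0 (n ^ 3) (X ^ 9) {{m^n≢0 n 3 {{positive 1≤n}}}} {{m^n≢0 X 9 {{positive 1≤X}}}}}}}} (begin
      (s ^ 3 * X) ^ 3 * (M ^ 2 * (n ^ 3 * X ^ 9)) ≤⟨ *-monoʳ-≤ ((s ^ 3 * X) ^ 3) (*-monoˡ-≤ (n ^ 3 * X ^ 9) (<⇒≤ (≰⇒> big))) ⟩
      (s ^ 3 * X) ^ 3 * (s ^ 3 * (n ^ 3 * X ^ 9)) ≡⟨ same-monomial ρ ((s′ ↑ 3 ⊙ X′) ↑ 3 ⊙ (s′ ↑ 3 ⊙ (n′ ↑ 3 ⊙ X′ ↑ 9))) ((n′ ⊙ (s′ ⊙ X′) ↑ 4) ↑ 3) refl ⟩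
      (n * (s * X) ^ 4) ^ 3 ≤⟨ ^-monoˡ-≤ 3 h ⟩
      (C * M ^ 2 * (n * X) ^ 3) ^ 3 ≡⟨ same-monomial ρ ((C′ ⊙ M′ ↑ 2 ⊙ (n′ ⊙ X′) ↑ 3) ↑ 3) (C′ ↑ 3 ⊙ (M′ ↑ 4 ⊙ n′ ↑ 6) ⊙ (M′ ↑ 2 ⊙ (n′ ↑ 3 ⊙ X′ ↑ 9))) refl ⟩
      C ^ 3 * (M ^ 4 * n ^ 6) * (M ^ 2 * (n ^ 3 * X ^ 9)) ∎)

  -- With `h₃′` and `h₄` raised to the power 12 in order to reach `h₅`, cancelling `τ` and `Δ`
  -- forces the power 14 of `h₁` and the power 1 of `h₂`. The powers of `M` then add up to 14 + 2 +
  -- 12 + 17 + 16 = 61 and those of `L` to 14 + 12 + 12 = 38.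
  combine : ∀ {n M L Δ τ T Q Q′ G C c₁ c₂ c₃ c₄ c₅ : ℕ} → 1 ≤ n → 1 ≤ Δ →
    n ^ 4 ≤ c₁ * M * L * τ ^ 2 * Δ → n * (τ * Δ) ^ 4 ≤ C * M ^ 2 * (n * Δ) ^ 3 →
    n * (τ * Δ) ≤ c₂ * T → T ^ 2 ≤ Q * G → n ^ 2 * Q ≤ c₃ * M * Q′ →
    Q′ ^ 12 ≤ (c₄ * L) ^ 12 * (C ^ 12 * (M ^ 17 * n ^ 4 * Δ ^ 11)) →
    G ^ 3 ≤ (c₅ * L) ^ 3 * (C ^ 3 * (M ^ 4 * n ^ 6)) →
    n ^ 74 ≤ L ^ 38 * M ^ 61 * (c₁ ^ 14 * (c₂ ^ 2 * c₃ * c₄ * c₅ * C ^ 2) ^ 12 * C)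
  combine {n} {M} {L} {Δ} {τ} {T} {Q} {Q′} {G} {C} {c₁} {c₂} {c₃} {c₄} {c₅} 1≤n 1≤Δ h₁ h₂ h₃ h₃′ h₄ h₅ h₆ = *-cancelʳ-≤ _ _ (n ^ 53 * Δ ^ 14)
      {{m*n≢0 (n ^ 53) (Δ ^ 14) {{m^n≢0 n 53 {{positive 1≤n}}}} {{m^n≢0 Δ 14 {{positive 1≤Δ}}}}}} (begin
    n ^ 74 * (n ^ 53 * Δ ^ 14) ≡⟨ same-monomial ρ (n′ ↑ 74 ⊙ (n′ ↑ 53 ⊙ Δ′ ↑ 14)) ((n′ ↑ 4) ↑ 14 ⊙ (n′ ↑ 71 ⊙ Δ′ ↑ 14)) refl ⟩
    (n ^ 4) ^ 14 * (n ^ 71 * Δ ^ 14) ≤⟨ *-monoˡ-≤ (n ^ 71 * Δ ^ 14) (^-monoˡ-≤ 14 h₁) ⟩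
    (c₁ * M * L * τ ^ 2 * Δ) ^ 14 * (n ^ 71 * Δ ^ 14)
      ≡⟨ same-monomial ρ ((c₁′ ⊙ M′ ⊙ L′ ⊙ τ′ ↑ 2 ⊙ Δ′) ↑ 14 ⊙ (n′ ↑ 71 ⊙ Δ′ ↑ 14)) ((n′ ⊙ (τ′ ⊙ Δ′) ↑ 4) ⊙ ((n′ ⊙ (τ′ ⊙ Δ′)) ↑ 2) ↑ 12 ⊙ (n′ ↑ 2) ↑ 12 ⊙ (c₁′ ↑ 14 ⊙ M′ ↑ 14 ⊙ L′ ↑ 14 ⊙ n′ ↑ 22)) refl ⟩
    n * (τ * Δ) ^ 4 * ((n * (τ * Δ)) ^ 2) ^ 12 * (n ^ 2) ^ 12 * R
      ≤⟨ *-monoˡ-≤ R (*-monoˡ-≤ ((n ^ 2) ^ 12) (*-mono-≤ h₂ (^-monoˡ-≤ 12 square))) ⟩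
    C * M ^ 2 * (n * Δ) ^ 3 * (c₂ ^ 2 * (Q * G)) ^ 12 * (n ^ 2) ^ 12 * R
      ≡⟨ same-monomial ρ (C′ ⊙ M′ ↑ 2 ⊙ (n′ ⊙ Δ′) ↑ 3 ⊙ (c₂′ ↑ 2 ⊙ (q′ ⊙ G′)) ↑ 12 ⊙ (n′ ↑ 2) ↑ 12 ⊙ R′) ((n′ ↑ 2 ⊙ q′) ↑ 12 ⊙ (G′ ↑ 3) ↑ 4 ⊙ (C′ ⊙ M′ ↑ 2 ⊙ (n′ ⊙ Δ′) ↑ 3 ⊙ c₂′ ↑ 24 ⊙ R′)) refl ⟩
    (n ^ 2 * Q) ^ 12 * (G ^ 3) ^ 4 * R₂ ≤⟨ *-monoˡ-≤ R₂ (*-mono-≤ (^-monoˡ-≤ 12 h₄) (^-monoˡ-≤ 4 h₆)) ⟩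
    (c₃ * M * Q′) ^ 12 * ((c₅ * L) ^ 3 * (C ^ 3 * (M ^ 4 * n ^ 6))) ^ 4 * R₂
      ≡⟨ same-monomial ρ ((c₃′ ⊙ M′ ⊙ Q″) ↑ 12 ⊙ ((c₅′ ⊙ L′) ↑ 3 ⊙ (C′ ↑ 3 ⊙ (M′ ↑ 4 ⊙ n′ ↑ 6))) ↑ 4 ⊙ R₂′) (Q″ ↑ 12 ⊙ ((c₃′ ⊙ M′) ↑ 12 ⊙ ((c₅′ ⊙ L′) ↑ 3 ⊙ (C′ ↑ 3 ⊙ (M′ ↑ 4 ⊙ n′ ↑ 6))) ↑ 4 ⊙ R₂′)) refl ⟩
    Q′ ^ 12 * R₃ ≤⟨ *-monoˡ-≤ R₃ h₅ ⟩
    (c₄ * L) ^ 12 * (C ^ 12 * (M ^ 17 * n ^ 4 * Δ ^ 11)) * R₃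
      ≡⟨ same-monomial ρ ((c₄′ ⊙ L′) ↑ 12 ⊙ (C′ ↑ 12 ⊙ (M′ ↑ 17 ⊙ n′ ↑ 4 ⊙ Δ′ ↑ 11)) ⊙ ((c₃′ ⊙ M′) ↑ 12 ⊙ ((c₅′ ⊙ L′) ↑ 3 ⊙ (C′ ↑ 3 ⊙ (M′ ↑ 4 ⊙ n′ ↑ 6))) ↑ 4 ⊙ R₂′))
           (L′ ↑ 38 ⊙ M′ ↑ 61 ⊙ (c₁′ ↑ 14 ⊙ (c₂′ ↑ 2 ⊙ c₃′ ⊙ c₄′ ⊙ c₅′ ⊙ C′ ↑ 2) ↑ 12 ⊙ C′) ⊙ (n′ ↑ 53 ⊙ Δ′ ↑ 14)) refl ⟩
    L ^ 38 * M ^ 61 * (c₁ ^ 14 * (c₂ ^ 2 * c₃ * c₄ * c₅ * C ^ 2) ^ 12 * C) * (n ^ 53 * Δ ^ 14) ∎)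
    where
    open ≤-Reasoning
    ρ = n ∷ M ∷ L ∷ Δ ∷ τ ∷ Q ∷ Q′ ∷ G ∷ C ∷ c₁ ∷ c₂ ∷ c₃ ∷ c₄ ∷ c₅ ∷ T ∷ []
    v : Fin 15 → Monomial 15
    v = var
    n′ = v zero
    M′ = v (suc zero)
    L′ = v (suc (suc zero))
    Δ′ = v 3F
    τ′ = v 4F
    q′ = v 5F
    Q″ = v 6F
    G′ = v 7F
    C′ = v 8F
    c₁′ = v 9F
    c₂′ = v (suc 9F)
    c₃′ = v (suc (suc 9F))
    c₄′ = v (suc (suc (suc 9F)))
    c₅′ = v (suc (suc (suc (suc 9F))))
    T′ = v (suc (suc (suc (suc (suc 9F)))))
    R = c₁ ^ 14 * M ^ 14 * L ^ 14 * n ^ 22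
    R′ = c₁′ ↑ 14 ⊙ M′ ↑ 14 ⊙ L′ ↑ 14 ⊙ n′ ↑ 22
    R₂ = C * M ^ 2 * (n * Δ) ^ 3 * c₂ ^ 24 * R
    R₂′ = C′ ⊙ M′ ↑ 2 ⊙ (n′ ⊙ Δ′) ↑ 3 ⊙ c₂′ ↑ 24 ⊙ R′
    R₃ = (c₃ * M) ^ 12 * ((c₅ * L) ^ 3 * (C ^ 3 * (M ^ 4 * n ^ 6))) ^ 4 * R₂
    square : (n * (τ * Δ)) ^ 2 ≤ c₂ ^ 2 * (Q * G)
    square = begin
      (n * (τ * Δ)) ^ 2 ≤⟨ ^-monoˡ-≤ 2 h₃ ⟩
      (c₂ * T) ^ 2 ≡⟨ same-monomial ρ ((c₂′ ⊙ T′) ↑ 2) (c₂′ ↑ 2 ⊙ T′ ↑ 2) refl ⟩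
      c₂ ^ 2 * T ^ 2 ≤⟨ *-monoʳ-≤ (c₂ ^ 2) h₃′ ⟩
      c₂ ^ 2 * (Q * G) ∎

open Exponents

-- Dyadic level sets

module Dyadic where
  open import Data.Nat
  open import Data.Nat.Properties

  best : ∀ {A : Set} (xs : List A) (x₀ : A) f → ∃[ x ] ∑ xs f ≤ length xs * f x
  best [] x₀ f = x₀ , z≤n
  best (x ∷ xs) x₀ f with best xs x₀ f
  ... | y , le with f x ≤? f y
  ...   | yes p = y , +-mono-≤ p le
  ...   | no ¬p = x , +-monoʳ-≤ (f x) (≤-trans le (*-monoʳ-≤ (length xs) (<⇒≤ (≰⇒> ¬p))))

  module _ {A : Set} where
    ∑-filter : ∀ {P : A → Set} (P? : ∀ x → Dec (P x)) xs f → ∑ (filter P? xs) f ≡ ∑ xs (λ x → [ P? x ] * f x)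
    ∑-filter P? [] f = refl
    ∑-filter P? (x ∷ xs) f with P? x
    ... | yes _ = cong₂ _+_ (sym (*-identityˡ (f x))) (∑-filter P? xs f)
    ... | no _ = ∑-filter P? xs f

    ∑-filter-≤ : ∀ {P : A → Set} (P? : ∀ x → Dec (P x)) xs f → ∑ (filter P? xs) f ≤ ∑ xs f
    ∑-filter-≤ P? xs f = ≤-trans (≤-reflexive (∑-filter P? xs f)) (∑-mono xs (λ x → ≤-trans (*-monoˡ-≤ (f x) ([]≤1 (P? x))) (≤-reflexive (*-identityˡ (f x)))))

    ∑-≥ : ∀ (xs : List A) f c → (∀ {x} → x ∈ xs → c ≤ f x) → c * length xs ≤ ∑ xs f
    ∑-≥ xs f c le = ≤-trans (≤-reflexive (trans (*-comm c _) (sym (∑-const xs c)))) (∑-mono-∈ xs le)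

    ∑-≤ : ∀ (xs : List A) f c → (∀ {x} → x ∈ xs → f x ≤ c) → ∑ xs f ≤ c * length xs
    ∑-≤ xs f c le = ≤-trans (∑-mono-∈ xs le) (≤-reflexive (trans (∑-const xs c) (*-comm _ c)))

    Level : (A → ℕ) → ℕ → A → Set
    Level r j x = 2 ^ j ≤ r x × r x < 2 ^ suc j

    level? : ∀ r j x → Dec (Level r j x)
    level? r j x = (2 ^ j ≤? r x) ×-dec (r x <? 2 ^ suc j)

    find-level : ∀ L {r} → 1 ≤ r → r < 2 ^ L → ∃[ j ] (j < L × 2 ^ j ≤ r × r < 2 ^ suc j)
    find-level zero 1≤r (s≤s r≤0) = contradiction (≤-trans 1≤r r≤0) λ ()
    find-level (suc L) {r} 1≤r lt with r <? 2 ^ L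
    ... | yes p = let j , j<L , lv = find-level L 1≤r p in j , m<n⇒m<1+n j<L , lv
    ... | no ¬p = L , ≤-refl , ≮⇒≥ ¬p , lt

    -- Since `w` vanishes where `r` does, the `L` level sets of `r` carry the whole sum, and the
    -- heaviest of them carries at least an `L`-th part.
    dyadic : ∀ L xs (r w : A → ℕ) → (∀ {x} → x ∈ xs → r x < 2 ^ L) → (∀ x → r x ≡ 0 → w x ≡ 0) →
             ∃[ j ] ∑ xs w ≤ L * ∑ (filter (level? r j) xs) w
    dyadic L xs r w small zero-w = let j , le = best (upTo L) 0 (λ j → ∑ (filter (level? r j) xs) w) in j , (begin
      ∑ xs w ≤⟨ ∑-mono-∈ xs (λ {x} x∈ → cover x x∈ (r x) refl) ⟩
      ∑ xs (λ x → ∑ (upTo L) (λ j → [ level? r j x ] * w x)) ≡⟨ ∑-swap xs (upTo L) _ ⟩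
      ∑ (upTo L) (λ j → ∑ xs (λ x → [ level? r j x ] * w x)) ≡⟨ ∑-cong (upTo L) (λ j → sym (∑-filter (level? r j) xs w)) ⟩
      ∑ (upTo L) (λ j → ∑ (filter (level? r j) xs) w) ≤⟨ le ⟩
      length (upTo L) * ∑ (filter (level? r j) xs) w ≡⟨ cong (_* ∑ (filter (level? r j) xs) w) (Listₚ.length-upTo L) ⟩
      L * ∑ (filter (level? r j) xs) w ∎)
      where
      open ≤-Reasoning
      cover : ∀ x → x ∈ xs → ∀ n → r x ≡ n → w x ≤ ∑ (upTo L) (λ j → [ level? r j x ] * w x)
      cover x x∈ zero e = ≤-trans (≤-reflexive (zero-w x e)) z≤n
      cover x x∈ (suc n) e = let j , j<L , lv = find-level L (subst (1 ≤_) (sym e) (s≤s z≤n)) (small x∈) in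
        ≤-trans (≤-reflexive (sym (trans (cong (_* w x) ([]-yes (level? r j x) lv)) (*-identityˡ (w x))))) (∑-∈ (λ j → [ level? r j x ] * w x) (∈ₚ.∈-upTo⁺ j<L))

  n<2^log : ∀ n → n < 2 ^ suc ⌊log₂ n ⌋
  n<2^log n = ≰⇒> λ le → <⇒≱ (n<1+n ⌊log₂ n ⌋) (≤-trans (≤-reflexive (sym (⌊log₂[2^n]⌋≡n (suc ⌊log₂ n ⌋)))) (⌊log₂⌋-mono-≤ le))

  []-complement : ∀ {P : Set} (p : Dec P) → [ p ] + [ ¬? p ] ≡ 1
  []-complement (yes _) = refl
  []-complement (no _) = refl

open Dyadic

-- Explicit constants and the reduction to small sets

module Rescaling where
  open import Data.Nat
  open import Data.Nat.Properties

  distinct-⊆-length : ∀ {A : Set} (_≟_ : ∀ (x y : A) → Dec (x ≡ y)) {xs ys : List A} → AllPairs _≢_ xs → (∀ {x} → x ∈ xs → x ∈ ys) → length xs ≤ length ys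
  distinct-⊆-length _≟_ {xs} {ys} d sub = begin
    length xs ≡⟨ sym (length-∑ xs) ⟩
    ∑ xs (λ _ → 1) ≤⟨ ∑-mono-∈ xs (λ {x} x∈ → ≤-trans (≤-reflexive (sym ([]-yes (x ≟ x) refl))) (∑-∈ (λ y → [ x ≟ y ]) (sub x∈))) ⟩
    ∑ xs (λ x → ∑ ys (λ y → [ x ≟ y ])) ≡⟨ ∑-swap xs ys _ ⟩
    ∑ ys (λ y → ∑ xs (λ x → [ x ≟ y ])) ≤⟨ ∑-mono ys (λ y → ∑-unique-≤1 (λ x → x ≟ y) d (λ e e′ → trans e (sym e′))) ⟩
    ∑ ys (λ _ → 1) ≡⟨ length-∑ ys ⟩
    length ys ∎
    where open ≤-Reasoning

  abstract
    -- Opaque because `multiplier`, with more than two hundred digits, must not be unfolded. `scale`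
    -- is 5436 · 1024², the requirement `1024 * Δ ≤ size` squared. `multiplier` is the constant of
    -- `combine` for `C = 3142008`, where 3142008 = 2 · 5436 · 17².
    scale multiplier : ℕ
    scale = 5700059136
    multiplier = 128 ^ 14 * (2 ^ 2 * 8 * 2 * 8 * 3142008 ^ 2) ^ 12 * 3142008

    1≤multiplier : 1 ≤ multiplier
    1≤multiplier = s≤s z≤n

    scale-expand : ∀ x → x * 5436 * 1024 * 1024 ≡ x * scale
    scale-expand x = trans (*-assoc (x * 5436) 1024 1024) (*-assoc x 5436 1048576)

    -- The origin of the constant 400: four times `scale` is 22800236544, which is below 160000²,
    -- and 160000 = 400².
    scale-fits : ∀ x → x * x * 4 * scale ≤ x * 160000 * (x * 160000)
    scale-fits x = ≤-trans (≤-reflexive (*-assoc (x * x) 4 5700059136)) (≤-trans (*-monoʳ-≤ (x * x) {22800236544} {25600000000} (≤ᵇ⇒≤ 22800236544 25600000000 _)) (≤-reflexive (l x 160000)))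
      where l : ∀ x c → x * x * (c * c) ≡ x * c * (x * c)
            l = solve-∀

    multiplier-expand : 128 ^ 14 * (2 ^ 2 * 8 * 2 * 8 * 3142008 ^ 2) ^ 12 * 3142008 ≡ multiplier
    multiplier-expand = refl

  abstract
    Bounded : ℕ → ℕ → Set
    Bounded n M = n ^ 74 ≤ suc ⌊log₂ n ⌋ ^ 38 * M ^ 61 * multiplier

    bounded : ∀ {n M} → n ^ 74 ≤ suc ⌊log₂ n ⌋ ^ 38 * M ^ 61 * multiplier → Bounded n M
    bounded h = h

    unbounded : ∀ {n M} → Bounded n M → n ^ 74 ≤ suc ⌊log₂ n ⌋ ^ 38 * M ^ 61 * multiplier
    unbounded h = h

  -- Disposes of the range where `M` is already quadratic in `n`. The opposite inequality
  -- `M ≤ n * n` is what later keeps the level sets small against p.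
  large-M : ∀ n M → 1 ≤ n → n * n ≤ M → n ^ 74 ≤ M ^ 61
  large-M n M 1≤n le = begin
    n ^ 74 ≤⟨ ^-monoʳ-≤ n {{positive 1≤n}} {74} {122} (≤ᵇ⇒≤ 74 122 _) ⟩
    n ^ 122 ≡⟨ sym (^-*-assoc n 2 61) ⟩
    (n ^ 2) ^ 61 ≤⟨ ^-monoˡ-≤ 61 (≤-trans (≤-reflexive (cong (n *_) (*-identityʳ n))) le) ⟩
    M ^ 61 ∎
    where open ≤-Reasoning

  widen : ∀ L y k → 1 ≤ L → 1 ≤ k → y ≤ L ^ 38 * y * k
  widen L y k 1≤L 1≤k = ≤-trans (m≤n*m y (L ^ 38) {{m^n≢0 L 38 {{positive 1≤L}}}}) (m≤m*n (L ^ 38 * y) k {{positive 1≤k}})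

  -- Constants at least 1 may be raised to the 61st power, and so may the logarithm after its
  -- exponent 38 has been raised to 61. This is why a single logarithmic factor inside the power is
  -- enough.
  rescale : ∀ {N n L₁ L M k c} → N ≤ c * n → n ^ 74 ≤ L₁ ^ 38 * M ^ 61 * k → L₁ ≤ L → 1 ≤ c → 1 ≤ k → 1 ≤ L → N ^ 74 ≤ (c ^ 74 * k * L ^ 1 * M) ^ 61
  rescale {N} {n} {L₁} {L} {M} {k} {c} N≤ h L≤ 1≤c 1≤k 1≤L = begin
    N ^ 74 ≤⟨ ^-monoˡ-≤ 74 N≤ ⟩
    (c * n) ^ 74 ≡⟨ ^-distrib-* c n 74 ⟩
    a * n ^ 74 ≤⟨ *-monoʳ-≤ a h ⟩
    a * (L₁ ^ 38 * M ^ 61 * k)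
      ≤⟨ *-mono-≤ (power a (m^n>0 c {{positive 1≤c}} 74)) (*-mono-≤ (*-monoˡ-≤ (M ^ 61) (≤-trans (^-monoˡ-≤ 38 L≤) (^-monoʳ-≤ L {{positive 1≤L}} {38} {61} (≤ᵇ⇒≤ 38 61 _)))) (power k 1≤k)) ⟩
    a ^ 61 * (L ^ 61 * M ^ 61 * k ^ 61) ≡⟨ same-monomial (a ∷ L ∷ M ∷ k ∷ []) (var 0F ↑ 61 ⊙ (var 1F ↑ 61 ⊙ var 2F ↑ 61 ⊙ var 3F ↑ 61)) ((var 0F ⊙ var 3F ⊙ var 1F ↑ 1 ⊙ var 2F) ↑ 61) refl ⟩
    (a * k * L ^ 1 * M) ^ 61 ∎
    where
    open ≤-Reasoning
    a = c ^ 74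
    power : ∀ x → 1 ≤ x → x ≤ x ^ 61
    power x 1≤x = m≤m*n x (x ^ 60) {{m^n≢0 x 60 {{positive 1≤x}}}}

  implied-constant : ℕ → ℕ
  implied-constant q = (q * 2) ^ 74 * multiplier

  implied-constant-positive : ∀ {q} → 1 ≤ q → 1 ≤ implied-constant q
  implied-constant-positive {q} 1≤q = *-mono-≤ (m^n>0 (q * 2) {{m*n≢0 q 2 {{positive 1≤q}}}} 74) 1≤multiplier

  -- The bound is applied to the first ⌊N / q⌋ elements of A, few enough for the smallness condition with constant d² to hold.
  shrink : ∀ (K d : ℕ) {size N X : ℕ} → 1 ≤ K → 1 ≤ d → N ≤ K ·√ size → (1 ≤ N → 1 ≤ X) →
    (∀ n → 2 ≤ n → n ≤ N → n * n * (d * d) ≤ size → Bounded n X) →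
    N ^ 74 ≤ (implied-constant (K * d) * suc ⌊log₂ N ⌋ ^ 1 * X) ^ 61
  shrink K d {size} {N} {X} 1≤K 1≤d N≤√ nonempty bound = cases (1 ≤? N) (2 ≤? n)
    where
    open ≤-Reasoning
    q = K * d
    1≤q : 1 ≤ q
    1≤q = *-mono-≤ 1≤K 1≤d
    instance
      q-nonzero : NonZero q
      q-nonzero = positive 1≤q
    n = N / q
    1≤2q : 1 ≤ q * 2
    1≤2q = ≤-trans 1≤q (m≤m*n q 2)
    N<suc : N < suc n * q
    N<suc = ≤-<-trans (≤-reflexive (m≡m%n+[m/n]*n N q)) (+-monoˡ-< (n * q) (m%n<n N q))
    n≤N : n ≤ N
    n≤N = ≤-trans (m≤m*n n q) (m/n*n≤m N q)
    l₁ : ∀ k n c → k * k * (n * n * (c * c)) ≡ n * (k * c) * (n * (k * c))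
    l₁ = solve-∀
    l₂ : ∀ n q → (n + n) * q ≡ q * 2 * n
    l₂ = solve-∀
    small : n * n * (d * d) ≤ size
    small = *-cancelˡ-≤ (K * K) {{positive (*-mono-≤ 1≤K 1≤K)}} (begin
      K * K * (n * n * (d * d)) ≡⟨ l₁ K n d ⟩
      n * q * (n * q) ≤⟨ *-mono-≤ (m/n*n≤m N q) (m/n*n≤m N q) ⟩
      N * N ≡⟨ cong (N *_) (sym (*-identityʳ N)) ⟩
      N ^ 2 ≤⟨ N≤√ ⟩
      K ^ 2 * size ≡⟨ cong (λ z → K * z * size) (*-identityʳ K) ⟩
      K * K * size ∎)
    Conclusion : Set
    Conclusion = N ^ 74 ≤ (implied-constant q * suc ⌊log₂ N ⌋ ^ 1 * X) ^ 61
    one : ∀ x k → 1 ≤ x → 1 ≤ k → 1 ^ 74 ≤ 1 ^ 38 * x ^ 61 * k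
    one x k 1≤x 1≤k = ≤-trans (m^n>0 x {{positive 1≤x}} 61) (widen 1 (x ^ 61) k (s≤s z≤n) 1≤k)
    large : ∀ m → 2 ≤ m → m ≤ N → m * m * (d * d) ≤ size → N < suc m * q → Conclusion
    large m 2≤m m≤N small N<suc = rescale {N} {m} {suc ⌊log₂ m ⌋} {suc ⌊log₂ N ⌋} {X} {multiplier} {q * 2}
      (≤-trans (<⇒≤ N<suc) (≤-trans (*-monoˡ-≤ q (+-monoˡ-≤ m (≤-trans (s≤s z≤n) 2≤m))) (≤-reflexive (l₂ m q))))
      (unbounded {m} {X} (bound m 2≤m m≤N small)) (s≤s (⌊log₂⌋-mono-≤ m≤N)) 1≤2q 1≤multiplier (s≤s z≤n)
    cases : Dec (1 ≤ N) → Dec (2 ≤ n) → Conclusion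
    cases (no N<1) _ = ≤-trans (≤-reflexive (cong (_^ 74) (n<1⇒n≡0 (≰⇒> N<1)))) z≤n
    -- Here `N` is below `2 * q`, a constant, and the claim reduces to `X` being at least 1.
    cases (yes 1≤N) (no n<2) = rescale {N} {1} {1} {suc ⌊log₂ N ⌋} {X} {multiplier} {q * 2}
      (≤-trans (<⇒≤ N<suc) (≤-trans (*-monoˡ-≤ q (≰⇒> n<2)) (≤-reflexive (trans (*-comm 2 q) (sym (*-identityʳ (q * 2)))))))
      (one X multiplier (nonempty 1≤N) 1≤multiplier) (s≤s z≤n) 1≤2q 1≤multiplier (s≤s z≤n)
    cases (yes _) (yes 2≤n) = large n 2≤n n≤N small N<suc

open Rescaling

-- Polynomials over a prime field

record PrimeField : Set₁ where
  infixl 7 _*_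
  infixl 6 _+_
  infix 8 -_
  infix 4 _≟_
  field
    K : Set
    _+_ _*_ : K → K → K
    -_ inv : K → K
    0# 1# : K
    isCommutativeRing : IsCommutativeRing _≡_ _+_ _*_ -_ 0# 1#
    _≟_ : DecidableEquality K
    inverseʳ : ∀ x → x ≢ 0# → x * inv x ≡ 1#
    1≢0 : 1# ≢ 0#
    size : ℕ
    index : K ↔ Fin size

  commutativeRing : CommutativeRing 0ℓ 0ℓ
  commutativeRing = record { isCommutativeRing = isCommutativeRing }

  open RingSolve commutativeRing public using (nat)

  field
    nat≢0 : ∀ n → suc n < size → nat (suc n) ≢ 0#

module Horner (R : CommutativeRing 0ℓ 0ℓ) where
  open CommutativeRing R renaming (refl to ≈-refl; trans to ≈-trans) hiding (sym; reflexive)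
  open RingSolve R using (solve; _:+_; _:*_; _:=_)

  -- Coefficients are given by a function on all of ℕ and `m` truncates. The same scheme serves over
  -- the field and over the ring of polynomials in the parameter of a line.
  ev : ℕ → (ℕ → Carrier) → Carrier → Carrier
  ev zero f x = f 0
  ev (suc m) f x = f 0 + x * ev m (f ∘ suc) x

  ev-cong : ∀ m {f g} x → (∀ n → f n ≈ g n) → ev m f x ≈ ev m g x
  ev-cong zero x e = e 0
  ev-cong (suc m) x e = +-cong (e 0) (*-congˡ (ev-cong m x (e ∘ suc)))

  ev-zero : ∀ m {f} x → (∀ n → f n ≈ 0#) → ev m f x ≈ 0#
  ev-zero zero x e = e 0
  ev-zero (suc m) x e = ≈-trans (+-cong (e 0) (≈-trans (*-congˡ (ev-zero m x (e ∘ suc))) (zeroʳ x))) (+-identityʳ 0#)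

  ev-+ : ∀ m f g x → ev m (λ n → f n + g n) x ≈ ev m f x + ev m g x
  ev-+ zero f g x = ≈-refl
  ev-+ (suc m) f g x = ≈-trans (+-congˡ (*-congˡ (ev-+ m (f ∘ suc) (g ∘ suc) x)))
    (solve 5 (λ a b x u v → a :+ b :+ x :* (u :+ v) := (a :+ x :* u) :+ (b :+ x :* v)) ≈-refl (f 0) (g 0) x _ _)

  ev-* : ∀ m c f x → ev m (λ n → c * f n) x ≈ c * ev m f x
  ev-* zero c f x = ≈-refl
  ev-* (suc m) c f x = ≈-trans (+-congˡ (*-congˡ (ev-* m c (f ∘ suc) x)))
    (solve 4 (λ c a x u → c :* a :+ x :* (c :* u) := c :* (a :+ x :* u)) ≈-refl c (f 0) x _)

  ev-drop : ∀ m f x → f (suc m) ≈ 0# → ev (suc m) f x ≈ ev m f x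
  ev-drop zero f x e = ≈-trans (+-congˡ (≈-trans (*-congˡ e) (zeroʳ x))) (+-identityʳ _)
  ev-drop (suc m) f x e = +-congˡ (*-congˡ (ev-drop m (f ∘ suc) x e))

  ev-linear : ∀ m u v w f g h x →
    ev m (λ n → u * f n + v * g n + w * h n) x ≈ u * ev m f x + v * ev m g x + w * ev m h x
  ev-linear m u v w f g h x = ≈-trans (ev-+ m _ _ x) (+-cong (≈-trans (ev-+ m _ _ x) (+-cong (ev-* m u f x) (ev-* m v g x))) (ev-* m w h x))

-- Residues modulo a prime form a prime field

module Residues (p : ℕ) .{{nz : NonZero p}} where
  open RawSemiring (𝔽 p) using (_+_; _*_; 0#; 1#)

  π : ℕ → Fin p
  π n = n mod p

  toℕ-π : ∀ n → toℕ (π n) ≡ n % p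
  toℕ-π n = Finₚ.toℕ-fromℕ< (m%n<n n p)

  π-cong : ∀ {m n} → m % p ≡ n % p → π m ≡ π n
  π-cong {m} {n} e = Finₚ.toℕ-injective (trans (toℕ-π m) (trans e (sym (toℕ-π n))))

  π-toℕ : ∀ x → π (toℕ x) ≡ x
  π-toℕ x = Finₚ.toℕ-injective (trans (toℕ-π (toℕ x)) (m<n⇒m%n≡m (Finₚ.toℕ<n x)))

  π-+ : ∀ m n → π m + π n ≡ π (m ℕ.+ n)
  π-+ m n = π-cong (trans (cong₂ (λ x y → (x ℕ.+ y) % p) (toℕ-π m) (toℕ-π n)) (sym (%-distribˡ-+ m n p)))

  π-* : ∀ m n → π m * π n ≡ π (m ℕ.* n)
  π-* m n = π-cong (trans (cong₂ (λ x y → (x ℕ.* y) % p) (toℕ-π m) (toℕ-π n)) (sym (%-distribˡ-* m n p)))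

  π-p : π p ≡ 0#
  π-p = π-cong (trans (n%n≡0 p) (sym (m<n⇒m%n≡m (ℕ.>-nonZero⁻¹ p))))

  neg : Fin p → Fin p
  neg x = π (p ∸ toℕ x)

  private
    -- Every residue is `π` of a natural number and `π` respects sums and products, so the ring laws
    -- are inherited from ℕ.
    lift₁ : ∀ {P : Fin p → Set} → (∀ n → P (π n)) → ∀ x → P x
    lift₁ {P} h x = subst P (π-toℕ x) (h (toℕ x))

    lift₂ : ∀ {P : Fin p → Fin p → Set} → (∀ m n → P (π m) (π n)) → ∀ x y → P x y
    lift₂ {P} h x = lift₁ {P x} (λ n → lift₁ {λ x → P x (π n)} (λ m → h m n) x)

    lift₃ : ∀ {P : Fin p → Fin p → Fin p → Set} → (∀ m n o → P (π m) (π n) (π o)) → ∀ x y z → P x y z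
    lift₃ {P} h x y = lift₁ {P x y} (λ o → lift₂ {λ x y → P x y (π o)} (λ m n → h m n o) x y)

  neg-inverseˡ : ∀ x → neg x + x ≡ 0#
  neg-inverseˡ x = trans (cong (neg x +_) (sym (π-toℕ x))) (trans (π-+ (p ∸ toℕ x) (toℕ x)) (trans (cong π (ℕₚ.m∸n+n≡m (ℕₚ.<⇒≤ (Finₚ.toℕ<n x)))) π-p))

  +-comm : ∀ x y → x + y ≡ y + x
  +-comm x y = cong π (ℕₚ.+-comm (toℕ x) (toℕ y))

  *-comm : ∀ x y → x * y ≡ y * x
  *-comm x y = cong π (ℕₚ.*-comm (toℕ x) (toℕ y))

  +-assoc : ∀ x y z → x + y + z ≡ x + (y + z)
  +-assoc = lift₃ λ m n o → trans (cong (_+ π o) (π-+ m n)) (trans (π-+ (m ℕ.+ n) o) (trans (cong π (ℕₚ.+-assoc m n o)) (sym (trans (cong (π m +_) (π-+ n o)) (π-+ m (n ℕ.+ o))))))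

  *-assoc : ∀ x y z → x * y * z ≡ x * (y * z)
  *-assoc = lift₃ λ m n o → trans (cong (_* π o) (π-* m n)) (trans (π-* (m ℕ.* n) o) (trans (cong π (ℕₚ.*-assoc m n o)) (sym (trans (cong (π m *_) (π-* n o)) (π-* m (n ℕ.* o))))))

  distribˡ : ∀ x y z → x * (y + z) ≡ x * y + x * z
  distribˡ = lift₃ λ m n o → trans (cong (π m *_) (π-+ n o)) (trans (π-* m (n ℕ.+ o)) (trans (cong π (ℕₚ.*-distribˡ-+ m n o)) (sym (trans (cong₂ _+_ (π-* m n) (π-* m o)) (π-+ (m ℕ.* n) (m ℕ.* o))))))

  distribʳ : ∀ x y z → (y + z) * x ≡ y * x + z * x
  distribʳ x y z = trans (*-comm (y + z) x) (trans (distribˡ x y z) (cong₂ _+_ (*-comm x y) (*-comm x z)))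

  +-identityˡ : ∀ x → 0# + x ≡ x
  +-identityˡ = lift₁ λ n → π-+ 0 n

  *-identityˡ : ∀ x → 1# * x ≡ x
  *-identityˡ = lift₁ λ n → trans (π-* 1 n) (cong π (ℕₚ.*-identityˡ n))

  module _ (prime : Prime p) where
    1<p : 1 < p
    1<p = ℕ.nonTrivial⇒n>1 p {{prime⇒nonTrivial prime}}

    bézout : ∀ x → x ≢ 0# → Bézout.Identity 1 p (toℕ x)
    bézout x x≢0 = coprime-Bézout (prime⇒coprime prime {{ℕ.≢-nonZero (λ e → x≢0 (trans (sym (π-toℕ x)) (cong π e)))}} (Finₚ.toℕ<n x))

    coefficient : ∀ {n} → Bézout.Identity 1 p n → Fin p
    -- The identity reads 1 + v x = u p in this case, so the inverse of x is -v; in the other case 1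
    -- + u p = v x.
    coefficient (Bézout.+- u v _) = neg (π v)
    coefficient (Bézout.-+ u v _) = π v

    inverse : Fin p → Fin p
    inverse x with x Finₚ.≟ 0#
    ... | yes _ = x
    ... | no x≢0 = coefficient (bézout x x≢0)

    π-multiple : ∀ u → π (u ℕ.* p) ≡ 0#
    π-multiple u = π-cong (trans (m*n%n≡0 u p) (sym (m<n⇒m%n≡m (ℕ.>-nonZero⁻¹ p))))

    coefficient-inverse : ∀ x (b : Bézout.Identity 1 p (toℕ x)) → x * coefficient b ≡ 1#
    coefficient-inverse x (Bézout.+- u v eq) = begin
      x * neg (π v) ≡⟨ sym (trans (cong (x * neg (π v) +_) vanish) (trans (+-comm _ 0#) (+-identityˡ _))) ⟩
      x * neg (π v) + (x * π v + 1#) ≡⟨ sym (+-assoc _ _ _) ⟩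
      x * neg (π v) + x * π v + 1# ≡⟨ cong (_+ 1#) (trans (sym (distribˡ x (neg (π v)) (π v))) (trans (cong (x *_) (neg-inverseˡ (π v))) (trans (*-comm x 0#) (trans (cong (0# *_) (sym (π-toℕ x))) (π-* 0 (toℕ x)))))) ⟩
      0# + 1# ≡⟨ +-identityˡ 1# ⟩
      1# ∎
      where
      open ≡-Reasoning
      vanish : x * π v + 1# ≡ 0#
      vanish = trans (cong (_+ 1#) (trans (cong (_* π v) (sym (π-toℕ x))) (π-* (toℕ x) v))) (trans (π-+ (toℕ x ℕ.* v) 1)
        (trans (cong π (trans (ℕₚ.+-comm (toℕ x ℕ.* v) 1) (trans (cong suc (ℕₚ.*-comm (toℕ x) v)) eq))) (π-multiple u)))
    coefficient-inverse x (Bézout.-+ u v eq) = begin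
      x * π v ≡⟨ cong (_* π v) (sym (π-toℕ x)) ⟩
      π (toℕ x) * π v ≡⟨ π-* (toℕ x) v ⟩
      π (toℕ x ℕ.* v) ≡⟨ cong π (trans (ℕₚ.*-comm (toℕ x) v) (sym eq)) ⟩
      π (1 ℕ.+ u ℕ.* p) ≡⟨ sym (π-+ 1 (u ℕ.* p)) ⟩
      1# + π (u ℕ.* p) ≡⟨ trans (cong (1# +_) (π-multiple u)) (trans (+-comm 1# 0#) (+-identityˡ 1#)) ⟩
      1# ∎
      where open ≡-Reasoning

    inverseʳ : ∀ x → x ≢ 0# → x * inverse x ≡ 1#
    inverseʳ x x≢0 with x Finₚ.≟ 0#
    ... | yes e = contradiction e x≢0
    ... | no ne = coefficient-inverse x (bézout x ne)

    ring : CommutativeRing _ _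
    ring = record
      { Carrier = Fin p ; _≈_ = _≡_ ; _+_ = _+_ ; _*_ = _*_ ; -_ = neg ; 0# = 0# ; 1# = 1#
      ; isCommutativeRing = record
        { isRing = record
          { +-isAbelianGroup = record
            { isGroup = record
              { isMonoid = record
                { isSemigroup = record { isMagma = record { isEquivalence = isEquivalence ; ∙-cong = cong₂ _+_ } ; assoc = +-assoc }
                ; identity = +-identityˡ , λ x → trans (+-comm x 0#) (+-identityˡ x) }
              ; inverse = neg-inverseˡ , λ x → trans (+-comm x (neg x)) (neg-inverseˡ x)
              ; ⁻¹-cong = cong neg }
            ; comm = +-comm }
          ; *-cong = cong₂ _*_
          ; *-assoc = *-assoc
          ; *-identity = *-identityˡ , λ x → trans (*-comm x 1#) (*-identityˡ x)
          ; distrib = distribˡ , distribʳ }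
        ; *-comm = *-comm } }

    nat-π : ∀ n → RingSolve.nat ring n ≡ π n
    nat-π zero = refl
    nat-π (suc n) = trans (cong (1# +_) (nat-π n)) (π-+ 1 n)

    field′ : PrimeField
    field′ = record
      { K = Fin p ; _+_ = _+_ ; _*_ = _*_ ; -_ = neg ; inv = inverse ; 0# = 0# ; 1# = 1#
      ; isCommutativeRing = CommutativeRing.isCommutativeRing ring
      ; _≟_ = Finₚ._≟_
      ; inverseʳ = inverseʳ
      ; 1≢0 = λ e → contradiction (trans (sym (m<n⇒m%n≡m 1<p)) (trans (sym (toℕ-π 1)) (trans (cong toℕ e) (toℕ-π 0)))) λ e′ → contradiction (trans e′ (m<n⇒m%n≡m (ℕₚ.<-trans (s≤s z≤n) 1<p))) λ ()
      ; size = p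
      ; index = ↔-id (Fin p)
      ; nat≢0 = λ n lt e → contradiction (trans (sym (m<n⇒m%n≡m lt)) (trans (sym (toℕ-π (suc n))) (trans (cong toℕ (trans (sym (nat-π (suc n))) e)) (trans (toℕ-π 0) (m<n⇒m%n≡m (ℕₚ.<-trans (s≤s z≤n) 1<p)))))) λ ()
      }

module _ (𝕂 : PrimeField) where
  module Solver = RingSolve (PrimeField.commutativeRing 𝕂)

  module Univariate where
    open PrimeField 𝕂
    open CommutativeRing commutativeRing public
      using (_-_; +-identityˡ; +-identityʳ; zeroˡ; zeroʳ; *-comm; +-comm; *-identityˡ; *-identityʳ
            ; *-assoc; +-assoc; -‿inverseʳ; -‿inverseˡ; distribˡ; distribʳ)
    open Solver using (solve; _:+_; _:*_; _:-_; :-_; _:=_)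
    open Horner commutativeRing public
    open ≡-Reasoning

    a≡b+[a-b] : ∀ a b → a ≡ b + (a - b)
    a≡b+[a-b] = solve 2 (λ a b → a := b :+ (a :- b)) refl

    *-zero-product : ∀ {x y} → x * y ≡ 0# → x ≢ 0# → y ≡ 0#
    *-zero-product {x} {y} e x≢0 = begin
      y ≡⟨ sym (*-identityˡ y) ⟩
      1# * y ≡⟨ cong (_* y) (sym (inverseʳ x x≢0)) ⟩
      x * inv x * y ≡⟨ solve 3 (λ x i y → x :* i :* y := i :* (x :* y)) refl x (inv x) y ⟩
      inv x * (x * y) ≡⟨ cong (inv x *_) e ⟩
      inv x * 0# ≡⟨ zeroʳ _ ⟩
      0# ∎

    *-nonzero : ∀ {x y} → x ≢ 0# → y ≢ 0# → x * y ≢ 0#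
    *-nonzero x≢0 y≢0 e = y≢0 (*-zero-product e x≢0)

    *-cancelˡ : ∀ {z x y} → z ≢ 0# → z * x ≡ z * y → x ≡ y
    *-cancelˡ {z} {x} {y} z≢0 e = begin
      x ≡⟨ a≡b+[a-b] x y ⟩
      y + (x - y) ≡⟨ cong (y +_) (*-zero-product (trans
            (solve 3 (λ x y z → z :* (x :- y) := z :* x :- z :* y) refl x y z)
            (trans (cong (_- z * y) e) (-‿inverseʳ _))) z≢0) ⟩
      y + 0# ≡⟨ +-identityʳ y ⟩
      y ∎

    x-y≡0⇒x≡y : ∀ {x y} → x - y ≡ 0# → x ≡ y
    x-y≡0⇒x≡y {x} {y} e = trans (a≡b+[a-b] x y) (trans (cong (y +_) e) (+-identityʳ y))

    x≡y⇒x-y≡0 : ∀ {x y} → x ≡ y → x - y ≡ 0#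
    x≡y⇒x-y≡0 {x} refl = -‿inverseʳ x

    Series : Set
    Series = ℕ → K

    VanishAbove : ℕ → Series → Set
    VanishAbove m f = ∀ n → m < n → f n ≡ 0#

    mul : Series → Series → Series
    mul f g zero = f 0 * g 0
    mul f g (suc n) = f 0 * g (suc n) + mul (f ∘ suc) g n

    mul-cong : ∀ {f f′ g g′} → (∀ n → f n ≡ f′ n) → (∀ n → g n ≡ g′ n) → ∀ n → mul f g n ≡ mul f′ g′ n
    mul-cong ef eg zero = cong₂ _*_ (ef 0) (eg 0)
    mul-cong ef eg (suc n) = cong₂ _+_ (cong₂ _*_ (ef 0) (eg (suc n))) (mul-cong (ef ∘ suc) eg n)

    mul-zeroˡ : ∀ {f} g → (∀ n → f n ≡ 0#) → ∀ n → mul f g n ≡ 0#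
    mul-zeroˡ g e zero = trans (cong (_* g 0) (e 0)) (zeroˡ _)
    mul-zeroˡ {f} g e (suc n) = trans (cong₂ _+_ (trans (cong (_* g (suc n)) (e 0)) (zeroˡ _)) (mul-zeroˡ g (e ∘ suc) n)) (+-identityʳ 0#)

    mul-distribʳ : ∀ f g h n → mul (λ i → f i + g i) h n ≡ mul f h n + mul g h n
    mul-distribʳ f g h zero = distribʳ _ _ _
    mul-distribʳ f g h (suc n) = trans (cong ((f 0 + g 0) * h (suc n) +_) (mul-distribʳ (f ∘ suc) (g ∘ suc) h n))
      (solve 5 (λ a b c x y → (a :+ b) :* c :+ (x :+ y) := (a :* c :+ x) :+ (b :* c :+ y)) refl
        (f 0) (g 0) (h (suc n)) (mul (f ∘ suc) h n) (mul (g ∘ suc) h n))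

    mul-scale : ∀ c f g n → mul (λ i → c * f i) g n ≡ c * mul f g n
    mul-scale c f g zero = *-assoc _ _ _
    mul-scale c f g (suc n) = trans (cong (c * f 0 * g (suc n) +_) (mul-scale c (f ∘ suc) g n))
      (solve 4 (λ c a b x → c :* a :* b :+ c :* x := c :* (a :* b :+ x)) refl c (f 0) (g (suc n)) (mul (f ∘ suc) g n))

    -- The defining recursion peels `f`; this one peels `g`, and the two together give commutativity
    -- by induction.
    mul-suc : ∀ f g n → mul f g (suc n) ≡ f (suc n) * g 0 + mul f (g ∘ suc) n
    mul-suc f g zero = +-comm _ _
    mul-suc f g (suc n) = trans (cong (f 0 * g (suc (suc n)) +_) (mul-suc (f ∘ suc) g n))
      (solve 3 (λ a b c → a :+ (b :+ c) := b :+ (a :+ c)) refl (f 0 * g (suc (suc n))) (f (suc (suc n)) * g 0) (mul (f ∘ suc) (g ∘ suc) n))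

    mul-comm : ∀ f g n → mul f g n ≡ mul g f n
    mul-comm f g zero = *-comm _ _
    mul-comm f g (suc n) = trans (cong₂ _+_ (*-comm _ _) (mul-comm (f ∘ suc) g n)) (sym (mul-suc g f n))

    mul-assoc : ∀ f g h n → mul (mul f g) h n ≡ mul f (mul g h) n
    mul-assoc f g h zero = *-assoc _ _ _
    mul-assoc f g h (suc n) = begin
      f 0 * g 0 * h (suc n) + mul (mul f g ∘ suc) h n
        ≡⟨ cong (f 0 * g 0 * h (suc n) +_) (mul-distribʳ (λ i → f 0 * g (suc i)) (mul (f ∘ suc) g) h n) ⟩
      f 0 * g 0 * h (suc n) + (mul (λ i → f 0 * g (suc i)) h n + mul (mul (f ∘ suc) g) h n)
        ≡⟨ cong (f 0 * g 0 * h (suc n) +_) (cong₂ _+_ (mul-scale (f 0) (g ∘ suc) h n) (mul-assoc (f ∘ suc) g h n)) ⟩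
      f 0 * g 0 * h (suc n) + (f 0 * mul (g ∘ suc) h n + mul (f ∘ suc) (mul g h) n)
        ≡⟨ solve 5 (λ a b c d e → a :* b :* c :+ (a :* d :+ e) := a :* (b :* c :+ d) :+ e) refl
             (f 0) (g 0) (h (suc n)) (mul (g ∘ suc) h n) (mul (f ∘ suc) (mul g h) n) ⟩
      f 0 * mul g h (suc n) + mul (f ∘ suc) (mul g h) n ∎

    mul-vanish : ∀ {a b f g} → VanishAbove a f → VanishAbove b g → VanishAbove (a ℕ.+ b) (mul f g)
    mul-vanish {a} {b} {f} {g} vf vg (suc n) (s≤s le) = trans (cong₂ _+_
        (trans (cong (f 0 *_) (vg (suc n) (s≤s (ℕₚ.≤-trans (ℕₚ.m≤n+m b a) le)))) (zeroʳ _)) (rest a vf le))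
        (+-identityʳ 0#)
      where
      rest : ∀ a → VanishAbove a f → a ℕ.+ b ≤ n → mul (f ∘ suc) g n ≡ 0#
      rest zero vf _ = mul-zeroˡ g (λ i → vf (suc i) (s≤s z≤n)) n
      rest (suc a) vf le = mul-vanish {a} {b} (λ i lt → vf (suc i) (s≤s lt)) vg n le

    ev-stable : ∀ {m m′ f} x → VanishAbove m f → m ≤ m′ → ev m′ f x ≡ ev m f x
    ev-stable {zero} {zero} x v z≤n = refl
    ev-stable {zero} {suc m′} {f} x v z≤n = trans (cong (f 0 +_) (trans (cong (x *_) (ev-zero m′ x (λ n → v (suc n) (s≤s z≤n)))) (zeroʳ x))) (+-identityʳ _)
    ev-stable {suc m} {suc m′} {f} x v (s≤s le) = cong (λ y → f 0 + x * y) (ev-stable x (λ n lt → v (suc n) (s≤s lt)) le)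

    ev-neg : ∀ m f x → ev m (λ n → - f n) x ≡ - ev m f x
    ev-neg zero f x = refl
    ev-neg (suc m) f x = trans (cong (λ y → - f 0 + x * y) (ev-neg m (f ∘ suc) x))
      (solve 3 (λ a x u → :- a :+ x :* :- u := :- (a :+ x :* u)) refl (f 0) x _)

    ev-mul : ∀ {a b f g} x → VanishAbove a f → VanishAbove b g → ev (a ℕ.+ b) (mul f g) x ≡ ev a f x * ev b g x
    ev-mul {zero} {b} {f} {g} x vf vg = trans (ev-cong b x lem) (ev-* b (f 0) g x)
      where
      lem : ∀ n → mul f g n ≡ f 0 * g n
      lem zero = refl
      lem (suc n) = trans (cong (f 0 * g (suc n) +_) (mul-zeroˡ g (λ i → vf (suc i) (s≤s z≤n)) n)) (+-identityʳ _)
    ev-mul {suc a} {b} {f} {g} x vf vg = begin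
      f 0 * g 0 + x * ev (a ℕ.+ b) (λ n → f 0 * g (suc n) + mul (f ∘ suc) g n) x
        ≡⟨ cong (λ y → f 0 * g 0 + x * y) (ev-+ (a ℕ.+ b) _ _ x) ⟩
      f 0 * g 0 + x * (ev (a ℕ.+ b) (λ n → f 0 * g (suc n)) x + ev (a ℕ.+ b) (mul (f ∘ suc) g) x)
        ≡⟨ cong₂ (λ y z → f 0 * g 0 + x * (y + z)) (ev-* (a ℕ.+ b) (f 0) (g ∘ suc) x) (ev-mul {a} {b} x (λ i lt → vf (suc i) (s≤s lt)) vg) ⟩
      f 0 * g 0 + x * (f 0 * u + v * ev b g x)
        ≡⟨ solve 6 (λ a b x u v w → a :* b :+ x :* (a :* u :+ v :* w) := a :* (b :+ x :* u) :+ x :* v :* w) refl (f 0) (g 0) x u v (ev b g x) ⟩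
      f 0 * ev (suc (a ℕ.+ b)) g x + x * v * ev b g x
        ≡⟨ cong (λ y → f 0 * y + x * v * ev b g x) (ev-stable x vg (ℕₚ.m≤n⇒m≤1+n (ℕₚ.m≤n+m b a))) ⟩
      f 0 * ev b g x + x * v * ev b g x ≡⟨ sym (distribʳ _ _ _) ⟩
      (f 0 + x * v) * ev b g x ∎
      where u = ev (a ℕ.+ b) (g ∘ suc) x
            v = ev a (f ∘ suc) x

    -- Synthetic division: the coefficients of (f(y) - f(x)) / (y - x) as a polynomial in y.
    quot : ℕ → Series → K → Series
    quot zero f x n = 0#
    quot (suc m) f x zero = ev m (f ∘ suc) x
    quot (suc m) f x (suc n) = quot m (f ∘ suc) x n

    quot-vanish : ∀ m f x → VanishAbove m (quot (suc m) f x)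
    quot-vanish zero f x (suc n) _ = refl
    quot-vanish (suc m) f x (suc n) (s≤s lt) = quot-vanish m (f ∘ suc) x n lt

    ev-quot : ∀ m f x y → ev (suc m) f y ≡ ev (suc m) f x + (y - x) * ev m (quot (suc m) f x) y
    ev-quot zero f x y = solve 4 (λ a b x y → a :+ y :* b := a :+ x :* b :+ (y :- x) :* b) refl (f 0) (f 1) x y
    ev-quot (suc m) f x y = trans (cong (λ z → f 0 + y * z) (ev-quot m (f ∘ suc) x y))
      (solve 5 (λ a x y u v → a :+ y :* (u :+ (y :- x) :* v) := a :+ x :* u :+ (y :- x) :* (u :+ y :* v)) refl
        (f 0) x y (ev (suc m) (f ∘ suc) x) (ev m (quot (suc m) (f ∘ suc) x) y))

    private
      quot-zero : ∀ m f x → VanishAbove (suc m) f → (∀ n → quot (suc m) f x n ≡ 0#) → ∀ n → f (suc n) ≡ 0#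
      quot-zero zero f x v e zero = e 0
      quot-zero zero f x v e (suc n) = v (suc (suc n)) (s≤s (s≤s z≤n))
      quot-zero (suc m) f x v e n = lem n
        where
        tl : ∀ n → f (suc (suc n)) ≡ 0#
        tl = quot-zero m (f ∘ suc) x (λ n lt → v (suc n) (s≤s lt)) (e ∘ suc)
        lem : ∀ n → f (suc n) ≡ 0#
        lem zero = trans (sym (trans (cong (λ z → f 1 + z) (trans (cong (x *_) (ev-zero m x tl)) (zeroʳ x))) (+-identityʳ _))) (e 0)
        lem (suc n) = tl n

    roots⇒zero : ∀ m f (xs : List K) → VanishAbove m f → m < length xs → AllPairs _≢_ xs →
                 All (λ x → ev m f x ≡ 0#) xs → ∀ n → f n ≡ 0#
    roots⇒zero zero f (x ∷ xs) v lt _ (e ∷ _) zero = e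
    roots⇒zero zero f (x ∷ xs) v lt _ (e ∷ _) (suc n) = v (suc n) (s≤s z≤n)
    roots⇒zero (suc m) f (x ∷ xs) v (s≤s lt) (d ∷ ds) (e ∷ es) = res
      where
      step : ∀ {y} → x ≢ y → ev (suc m) f y ≡ 0# → ev m (quot (suc m) f x) y ≡ 0#
      step {y} x≢y ey = *-zero-product (trans (sym (trans (ev-quot m f x y) (trans (cong (_+ (y - x) * ev m (quot (suc m) f x) y) e) (+-identityˡ _)))) ey)
                          (λ z → x≢y (sym (x-y≡0⇒x≡y z)))
      q0 : ∀ n → quot (suc m) f x n ≡ 0#
      q0 = roots⇒zero m _ xs (quot-vanish m f x) lt ds (All.zipWith (λ (p , q) → step p q) (d , es))
      tl : ∀ n → f (suc n) ≡ 0#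
      tl = quot-zero m f x v q0
      res : ∀ n → f n ≡ 0#
      res zero = trans (sym (trans (cong (f 0 +_) (trans (cong (x *_) (ev-zero m x tl)) (zeroʳ x))) (+-identityʳ _))) e
      res (suc n) = tl n

    -- `bd` is an upper bound for the degree rather than the degree, and `_≋_` compares coefficients
    -- alone. The bound is carried because every conclusion comes from counting roots against it.
    record UPoly : Set where
      field
        cf : Series
        bd : ℕ
        vanish : VanishAbove bd cf
    open UPoly public

    infix 4 _≋_
    record _≋_ (f g : UPoly) : Set where
      constructor pw
      field at : ∀ n → cf f n ≡ cf g n
    open _≋_ public

    eval : UPoly → K → K
    eval f x = ev (bd f) (cf f) x

    neg0 : - 0# ≡ 0#
    neg0 = trans (sym (+-identityˡ _)) (-‿inverseʳ 0#)

    line : K → K → UPoly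
    line a b = record { cf = c ; bd = 1 ; vanish = λ { (suc (suc n)) _ → refl ; (suc zero) (s≤s ()) } }
      where
      c : Series
      c zero = a
      c (suc zero) = b
      c (suc (suc n)) = 0#

    cst : K → Series
    cst c zero = c
    cst c (suc n) = 0#

    constant : K → UPoly
    constant c = record { cf = cst c ; bd = 0 ; vanish = λ { (suc n) _ → refl } }

    polyRing : CommutativeRing 0ℓ 0ℓ
    polyRing = record
      { Carrier = UPoly
      ; _≈_ = _≋_
      ; _+_ = λ f g → record { cf = λ n → cf f n + cf g n ; bd = bd f ⊔ bd g
          ; vanish = λ n lt → trans (cong₂ _+_ (vanish f n (ℕₚ.m⊔n≤o⇒m≤o (suc (bd f)) (suc (bd g)) lt))
                                      (vanish g n (ℕₚ.m⊔n≤o⇒n≤o (suc (bd f)) (suc (bd g)) lt))) (+-identityʳ 0#) }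
      ; _*_ = λ f g → record { cf = mul (cf f) (cf g) ; bd = bd f ℕ.+ bd g ; vanish = mul-vanish (vanish f) (vanish g) }
      ; -_ = λ f → record { cf = λ n → - cf f n ; bd = bd f ; vanish = λ n lt → trans (cong -_ (vanish f n lt)) neg0 }
      ; 0# = constant 0#
      ; 1# = constant 1#
      ; isCommutativeRing = record
          { isRing = record
            { +-isAbelianGroup = record
              { isGroup = record
                { isMonoid = record
                  { isSemigroup = record
                    { isMagma = record
                      { isEquivalence = record { refl = pw λ _ → refl ; sym = λ e → pw λ n → sym (at e n) ; trans = λ e e′ → pw λ n → trans (at e n) (at e′ n) }
                      ; ∙-cong = λ e e′ → pw λ n → cong₂ _+_ (at e n) (at e′ n) }
                    ; assoc = λ f g h → pw λ n → +-assoc _ _ _ }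
                  ; identity = (λ f → pw λ n → trans (cong (_+ cf f n) (const0 n)) (+-identityˡ _)) ,
                               (λ f → pw λ n → trans (cong (cf f n +_) (const0 n)) (+-identityʳ _)) }
                ; inverse = (λ f → pw λ n → trans (-‿inverseˡ _) (sym (const0 n))) , (λ f → pw λ n → trans (-‿inverseʳ _) (sym (const0 n)))
                ; ⁻¹-cong = λ e → pw λ n → cong -_ (at e n) }
              ; comm = λ f g → pw λ n → +-comm _ _ }
            ; *-cong = λ e e′ → pw (mul-cong (at e) (at e′))
            ; *-assoc = λ f g h → pw (mul-assoc (cf f) (cf g) (cf h))
            ; *-identity = (λ f → pw λ n → idˡ (cf f) n) , (λ f → pw λ n → trans (mul-comm (cf f) (cst 1#) n) (idˡ (cf f) n))
            ; distrib = (λ f g h → pw λ n → trans (mul-comm (cf f) _ n) (trans (mul-distribʳ (cf g) (cf h) (cf f) n)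
                                     (cong₂ _+_ (mul-comm (cf g) (cf f) n) (mul-comm (cf h) (cf f) n)))) ,
                        (λ f g h → pw (mul-distribʳ (cf g) (cf h) (cf f)))
            }
          ; *-comm = λ f g → pw (mul-comm (cf f) (cf g))
          }
      }
      where
      const0 : ∀ n → cst 0# n ≡ 0#
      const0 zero = refl
      const0 (suc n) = refl
      idˡ : ∀ f n → mul (cst 1#) f n ≡ f n
      idˡ f zero = *-identityˡ _
      idˡ f (suc n) = trans (cong₂ _+_ (*-identityˡ _) (mul-zeroˡ f (λ _ → refl) n)) (+-identityʳ _)

    open CommutativeRing polyRing public
      renaming (_+_ to _⊕_; _*_ to _⊗_; -_ to ⊝_; _-_ to _⊖_; 0# to 𝟘; 1# to 𝟙; refl to ≋-refl; sym to ≋-sym; trans to ≋-trans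
               ; +-cong to ⊕-cong; *-cong to ⊗-cong; -‿cong to ⊝-cong)
      using ()

    eval-cong : ∀ {f g} x → f ≋ g → eval f x ≡ eval g x
    eval-cong {f} {g} x e = begin
      ev (bd f) (cf f) x ≡⟨ sym (ev-stable x (vanish f) (ℕₚ.m≤m⊔n (bd f) (bd g))) ⟩
      ev (bd f ⊔ bd g) (cf f) x ≡⟨ ev-cong (bd f ⊔ bd g) x (at e) ⟩
      ev (bd f ⊔ bd g) (cf g) x ≡⟨ ev-stable x (vanish g) (ℕₚ.m≤n⊔m (bd f) (bd g)) ⟩
      ev (bd g) (cf g) x ∎

    eval-⊕ : ∀ f g x → eval (f ⊕ g) x ≡ eval f x + eval g x
    eval-⊕ f g x = trans (ev-+ (bd f ⊔ bd g) (cf f) (cf g) x)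
      (cong₂ _+_ (ev-stable x (vanish f) (ℕₚ.m≤m⊔n (bd f) (bd g))) (ev-stable x (vanish g) (ℕₚ.m≤n⊔m (bd f) (bd g))))

    eval-⊗ : ∀ f g x → eval (f ⊗ g) x ≡ eval f x * eval g x
    eval-⊗ f g x = ev-mul x (vanish f) (vanish g)

    eval-⊝ : ∀ f x → eval (⊝ f) x ≡ - eval f x
    eval-⊝ f x = ev-neg (bd f) (cf f) x

    eval-⊖ : ∀ f g x → eval (f ⊖ g) x ≡ eval f x - eval g x
    eval-⊖ f g x = trans (eval-⊕ f (⊝ g) x) (cong (eval f x +_) (eval-⊝ g x))

    deriv : Series → Series
    deriv f n = nat (suc n) * f (suc n)

    mul-deriv : ∀ f g n → deriv (mul f g) n ≡ mul (deriv f) g n + mul f (deriv g) n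
    mul-deriv f g zero = solve 5 (λ o a b c d → o :* (a :* d :+ b :* c) := o :* b :* c :+ a :* (o :* d)) refl
      (nat 1) (f 0) (f 1) (g 0) (g 1)
    mul-deriv f g (suc n) = begin
      nat (suc (suc n)) * (f 0 * g (suc (suc n)) + mul f⁺ g (suc n))
        ≡⟨ solve 5 (λ o n a b c → (o :+ n) :* (a :* b :+ c) := a :* ((o :+ n) :* b) :+ (o :* c :+ n :* c)) refl
             1# (nat (suc n)) (f 0) (g (suc (suc n))) (mul f⁺ g (suc n)) ⟩
      f 0 * deriv g (suc n) + (1# * mul f⁺ g (suc n) + deriv (mul f⁺ g) n)
        ≡⟨ cong (f 0 * deriv g (suc n) +_) (cong₂ _+_ (*-identityˡ _) (mul-deriv f⁺ g n)) ⟩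
      f 0 * deriv g (suc n) + (f 1 * g (suc n) + mul (f⁺ ∘ suc) g n + (mul (deriv f⁺) g n + mul f⁺ (deriv g) n))
        ≡⟨ solve 5 (λ a b c d e → a :+ (b :+ c :+ (d :+ e)) := (b :+ (c :+ d)) :+ (a :+ e)) refl
             (f 0 * deriv g (suc n)) (f 1 * g (suc n)) (mul (f⁺ ∘ suc) g n) (mul (deriv f⁺) g n) (mul f⁺ (deriv g) n) ⟩
      f 1 * g (suc n) + (mul (f⁺ ∘ suc) g n + mul (deriv f⁺) g n) + (f 0 * deriv g (suc n) + mul f⁺ (deriv g) n)
        ≡⟨ cong (_+ mul f (deriv g) (suc n)) (cong₂ _+_ (cong (_* g (suc n)) f1) (trans (sym (mul-distribʳ _ _ g n)) (mul-cong lem (λ _ → refl) n))) ⟩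
      mul (deriv f) g (suc n) + mul f (deriv g) (suc n) ∎
      where
      f⁺ : Series
      f⁺ = f ∘ suc
      f1 : f 1 ≡ deriv f 0
      f1 = sym (trans (cong (_* f 1) (+-identityʳ 1#)) (*-identityˡ _))
      lem : ∀ i → f⁺ (suc i) + deriv f⁺ i ≡ deriv f (suc i)
      lem i = trans (cong (_+ deriv f⁺ i) (sym (*-identityˡ _))) (sym (distribʳ _ _ _))

    δ : UPoly → UPoly
    δ f = record { cf = deriv (cf f) ; bd = bd f
                 ; vanish = λ n lt → trans (cong (nat (suc n) *_) (vanish f (suc n) (ℕₚ.m<n⇒m<1+n lt))) (zeroʳ _) }

    δ-cong : ∀ {f g} → f ≋ g → δ f ≋ δ g
    δ-cong e = pw λ n → cong (nat (suc n) *_) (at e (suc n))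

    δ-⊕ : ∀ f g → δ (f ⊕ g) ≋ δ f ⊕ δ g
    δ-⊕ f g = pw λ n → distribˡ _ _ _

    δ-⊝ : ∀ f → δ (⊝ f) ≋ ⊝ δ f
    δ-⊝ f = pw λ n → solve 2 (λ a b → a :* :- b := :- (a :* b)) refl (nat (suc n)) (cf f (suc n))

    δ-⊖ : ∀ f g → δ (f ⊖ g) ≋ δ f ⊖ δ g
    δ-⊖ f g = ≋-trans (δ-⊕ f (⊝ g)) (⊕-cong (≋-refl {δ f}) (δ-⊝ g))

    δ-⊗ : ∀ f g → δ (f ⊗ g) ≋ (δ f ⊗ g) ⊕ (f ⊗ δ g)
    δ-⊗ f g = pw (mul-deriv (cf f) (cf g))

    δ-constant : ∀ c → δ (constant c) ≋ 𝟘
    δ-constant c = pw λ { zero → zeroʳ _ ; (suc n) → zeroʳ _ }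

    δ-𝟘 : δ 𝟘 ≋ 𝟘
    δ-𝟘 = δ-constant 0#

    private
      mul-lowʳ : ∀ f g n → (∀ i → i ≤ n → g i ≡ 0#) → mul f g n ≡ 0#
      mul-lowʳ f g zero e = trans (cong (f 0 *_) (e 0 z≤n)) (zeroʳ _)
      mul-lowʳ f g (suc n) e = trans (cong₂ _+_ (trans (cong (f 0 *_) (e (suc n) ℕₚ.≤-refl)) (zeroʳ _))
        (mul-lowʳ (f ∘ suc) g n (λ i le → e i (ℕₚ.m≤n⇒m≤1+n le)))) (+-identityʳ 0#)

      mul-lowˡ : ∀ f g n → (∀ i → i < n → f i ≡ 0#) → mul f g n ≡ f n * g 0
      mul-lowˡ f g zero e = refl
      mul-lowˡ f g (suc n) e = trans (cong₂ _+_ (trans (cong (_* g (suc n)) (e 0 (s≤s z≤n))) (zeroˡ _))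
        (mul-lowˡ (f ∘ suc) g n (λ i lt → e (suc i) (s≤s lt)))) (+-identityˡ _)

    -- In characteristic 0 the hypothesis says that g / bᵏ is constant.
    log-derivative-unique : ∀ k g b → δ g ⊗ b ≋ constant k ⊗ (δ b ⊗ g) → cf g 0 ≡ 0# → cf b 0 ≢ 0# → bd g < size → g ≋ 𝟘
    log-derivative-unique k g b eq g0 b0 lt = pw λ n → trans (all n n ℕₚ.≤-refl) (sym (const0 n))
      where
      const0 : ∀ n → cf 𝟘 n ≡ 0#
      const0 zero = refl
      const0 (suc n) = refl
      next : ∀ n → (∀ i → i ≤ n → cf g i ≡ 0#) → cf g (suc n) ≡ 0#
      next n low with suc n ℕₚ.<? size
      ... | no ¬lt = vanish g (suc n) (ℕₚ.<-≤-trans lt (ℕₚ.≮⇒≥ ¬lt))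
      -- In order `n` of the equation every coefficient of `g` up to `n` is known to vanish. The
      -- right side is then zero, and on the left only (n+1) · g_(n+1) · b₀ survives.
      ... | yes lt′ = *-zero-product (*-zero-product (begin
          cf b 0 * (nat (suc n) * cf g (suc n)) ≡⟨ *-comm _ _ ⟩
          deriv (cf g) n * cf b 0 ≡⟨ sym (mul-lowˡ _ (cf b) n (λ i i<n → trans (cong (nat (suc i) *_) (low (suc i) i<n)) (zeroʳ _))) ⟩
          mul (deriv (cf g)) (cf b) n ≡⟨ at eq n ⟩
          mul (cst k) (mul (deriv (cf b)) (cf g)) n ≡⟨ mul-lowʳ (cst k) _ n (λ i i≤n → mul-lowʳ _ (cf g) i (λ j j≤i → low j (ℕₚ.≤-trans j≤i i≤n))) ⟩
          0# ∎) b0) (nat≢0 n lt′)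
      all : ∀ n i → i ≤ n → cf g i ≡ 0#
      all zero zero z≤n = g0
      all (suc n) i le with ℕₚ.m≤n⇒m<n∨m≡n le
      ... | inj₁ (s≤s le′) = all n i le′
      ... | inj₂ refl = next n (all n)

  -- Polynomials in three variables and their restriction to curves

  module Trivariate where
    open PrimeField 𝕂
    open Univariate
    open Solver using (solve; _:+_; _:*_; _:-_; :-_; _:=_)
    module PR = CommutativeRing polyRing
    module PS = RingSolve polyRing
    module PH = Horner polyRing

    elements : List K
    elements = map (Inverse.from index) (allFin size)

    elements-length : length elements ≡ size
    elements-length = trans (length-map _ (allFin size)) (length-tabulate _)

    elements-distinct : AllPairs _≢_ elements
    elements-distinct = Uniqueₚ.map⁺ injective (Uniqueₚ.allFin⁺ size)
      where
      injective : ∀ {x y} → Inverse.from index x ≡ Inverse.from index y → x ≡ y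
      injective {x} {y} e = trans (sym (Inverse.strictlyInverseˡ index x)) (trans (cong (Inverse.to index) e) (Inverse.strictlyInverseˡ index y))

    identically-zero : ∀ f → bd f < size → (∀ x → eval f x ≡ 0#) → f ≋ 𝟘
    identically-zero f lt e = pw λ n → trans (roots⇒zero (bd f) (cf f) elements (vanish f)
      (subst (bd f <_) (sym elements-length) lt) elements-distinct (All.tabulate (λ {x} _ → e x)) n) (lem n)
      where
      lem : ∀ n → 0# ≡ cf 𝟘 n
      lem zero = refl
      lem (suc n) = refl

    δ-line : ∀ a b → δ (line a b) ≋ constant b
    δ-line a b = pw λ { zero → trans (cong (_* b) (+-identityʳ 1#)) (*-identityˡ b) ; (suc n) → zeroʳ _ }

    constant-cong : ∀ {a b} → a ≡ b → constant a ≋ constant b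
    constant-cong refl = ≋-refl

    constant-* : ∀ a b → constant (a * b) ≋ constant a ⊗ constant b
    constant-* a b = pw λ { zero → refl ; (suc n) → sym (trans (cong₂ _+_ (zeroʳ a) (mul-zeroˡ (cst b) (λ _ → refl) n)) (+-identityʳ 0#)) }

    constant-+ : ∀ a b → constant (a + b) ≋ constant a ⊕ constant b
    constant-+ a b = pw λ { zero → refl ; (suc n) → sym (+-identityʳ 0#) }

    eval-horner : ∀ m G x t → eval (PH.ev m G x) t ≡ ev m (λ i → eval (G i) t) (eval x t)
    eval-horner zero G x t = refl
    eval-horner (suc m) G x t = trans (eval-⊕ (G 0) (x ⊗ PH.ev m (G ∘ suc) x) t)
      (cong (eval (G 0) t +_) (trans (eval-⊗ x (PH.ev m (G ∘ suc) x) t) (cong (eval x t *_) (eval-horner m (G ∘ suc) x t))))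

    bd-horner : ∀ m G x b → (∀ i → bd (G i) ≤ b) → bd x ≤ 1 → bd (PH.ev m G x) ≤ m ℕ.+ b
    bd-horner zero G x b bG bx = bG 0
    bd-horner (suc m) G x b bG bx =
      ℕₚ.⊔-lub (ℕₚ.≤-trans (bG 0) (ℕₚ.m≤n+m b (suc m))) (ℕₚ.+-mono-≤ bx (bd-horner m (G ∘ suc) x b (bG ∘ suc) bx))

    weight : ℕ → UPoly
    weight i = constant (nat (suc i))

    -- Product and chain rule for a Horner sum whose coefficients are themselves polynomials in the
    -- parameter. The shifted sum still reads `G (suc m)`, hence the hypothesis that `G` vanishes
    -- above `m`.
    δ-horner : ∀ m G x → (∀ i → m < i → G i ≋ 𝟘) →
               δ (PH.ev m G x) ≋ PH.ev m (δ ∘ G) x ⊕ (δ x ⊗ PH.ev m (λ i → weight i ⊗ G (suc i)) x)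
    δ-horner zero G x v = PR.sym (begin
      δ (G 0) ⊕ (δ x ⊗ (weight 0 ⊗ G 1)) ≈⟨ PR.+-congˡ {δ (G 0)} (PR.*-congˡ {δ x} (PR.*-congˡ {weight 0} (v 1 (s≤s z≤n)))) ⟩
      δ (G 0) ⊕ (δ x ⊗ (weight 0 ⊗ 𝟘)) ≈⟨ PR.+-congˡ {δ (G 0)} (PR.trans (PR.*-congˡ {δ x} (PR.zeroʳ (weight 0))) (PR.zeroʳ (δ x))) ⟩
      δ (G 0) ⊕ 𝟘 ≈⟨ PR.+-identityʳ (δ (G 0)) ⟩
      δ (G 0) ∎)
      where open import Relation.Binary.Reasoning.Setoid PR.setoid
    δ-horner (suc m) G x v = begin
      δ (G 0 ⊕ (x ⊗ H)) ≈⟨ δ-⊕ (G 0) (x ⊗ H) ⟩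
      δ (G 0) ⊕ δ (x ⊗ H) ≈⟨ PR.+-congˡ {δ (G 0)} (δ-⊗ x H) ⟩
      δ (G 0) ⊕ ((δ x ⊗ H) ⊕ (x ⊗ δ H)) ≈⟨ PR.+-congˡ {δ (G 0)} (PR.+-congˡ {δ x ⊗ H} (PR.*-congˡ {x} (δ-horner m (G ∘ suc) x (λ i lt → v (suc i) (s≤s lt))))) ⟩
      δ (G 0) ⊕ ((δ x ⊗ H) ⊕ (x ⊗ (H′ ⊕ (δ x ⊗ H″))))
        ≈⟨ PS.solve 6 (λ g d h x h′ h″ → g PS.:+ (d PS.:* h PS.:+ x PS.:* (h′ PS.:+ d PS.:* h″)) PS.:= (g PS.:+ x PS.:* h′) PS.:+ d PS.:* (h PS.:+ x PS.:* h″))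
            PR.refl (δ (G 0)) (δ x) H x H′ H″ ⟩
      PH.ev (suc m) (δ ∘ G) x ⊕ (δ x ⊗ (H ⊕ (x ⊗ H″))) ≈⟨ PR.+-congˡ {PH.ev (suc m) (δ ∘ G) x} (PR.*-congˡ {δ x} shift) ⟩
      PH.ev (suc m) (δ ∘ G) x ⊕ (δ x ⊗ PH.ev (suc m) (λ i → weight i ⊗ G (suc i)) x) ∎
      where
      open import Relation.Binary.Reasoning.Setoid PR.setoid
      H = PH.ev m (G ∘ suc) x
      H′ = PH.ev m (δ ∘ G ∘ suc) x
      H″ = PH.ev m (λ i → weight i ⊗ G (suc (suc i))) x
      I = PH.ev m (G ∘ suc ∘ suc) x
      weight0 : 𝟙 ≋ weight 0
      weight0 = constant-cong (sym (+-identityʳ 1#))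
      shift : H ⊕ (x ⊗ H″) ≋ PH.ev (suc m) (λ i → weight i ⊗ G (suc i)) x
      shift = begin
        H ⊕ (x ⊗ H″) ≈⟨ PR.+-congʳ {x ⊗ H″} (PR.sym (PH.ev-drop m (G ∘ suc) x (v (suc (suc m)) ℕₚ.≤-refl))) ⟩
        (G 1 ⊕ (x ⊗ I)) ⊕ (x ⊗ H″) ≈⟨ PS.solve 4 (λ g x i h → (g PS.:+ x PS.:* i) PS.:+ x PS.:* h PS.:= g PS.:+ x PS.:* (i PS.:+ h)) PR.refl (G 1) x I H″ ⟩
        G 1 ⊕ (x ⊗ (I ⊕ H″)) ≈⟨ PR.+-cong (PR.trans (PR.sym (PR.*-identityˡ (G 1))) (PR.*-congʳ {G 1} weight0)) (PR.*-congˡ {x} (PR.sym (PH.ev-+ m _ _ x))) ⟩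
        (weight 0 ⊗ G 1) ⊕ (x ⊗ PH.ev m (λ i → G (suc (suc i)) ⊕ (weight i ⊗ G (suc (suc i)))) x)
          ≈⟨ PR.+-congˡ {weight 0 ⊗ G 1} (PR.*-congˡ {x} (PH.ev-cong m x (λ i → PR.trans
               (PS.solve 3 (λ o w g → o PS.:* g PS.:+ w PS.:* g PS.:= (o PS.:+ w) PS.:* g) PR.refl 𝟙 (weight i) (G (suc (suc i))) ⟵ PR.+-congʳ {weight i ⊗ G (suc (suc i))} (PR.sym (PR.*-identityˡ (G (suc (suc i))))))
               (PR.*-congʳ {G (suc (suc i))} (PR.sym (constant-+ 1# (nat (suc i)))))))) ⟩
        (weight 0 ⊗ G 1) ⊕ (x ⊗ PH.ev m (λ i → weight (suc i) ⊗ G (suc (suc i))) x) ∎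
        where
        _⟵_ : ∀ {a b c} → b ≋ c → a ≋ b → a ≋ c
        p ⟵ q = PR.trans q p

    Coef : Set
    Coef = ℕ → ℕ → ℕ → K

    -- Degree at most `D` in each variable separately: this leaves (D+1)³ free coefficients, while
    -- the restriction to a line has degree at most 3D.
    record Box (D : ℕ) (c : Coef) : Set where
      field
        inX : ∀ i j k → D < i → c i j k ≡ 0#
        inY : ∀ i j k → D < j → c i j k ≡ 0#
        inZ : ∀ i j k → D < k → c i j k ≡ 0#

    ∂X ∂Y ∂Z : Coef → Coef
    ∂X c i j k = nat (suc i) * c (suc i) j k
    ∂Y c i j k = nat (suc j) * c i (suc j) k
    ∂Z c i j k = nat (suc k) * c i j (suc k)

    ∂[_,_,_] : K → K → K → Coef → Coef
    ∂[ u , v , w ] c i j k = u * ∂X c i j k + v * ∂Y c i j k + w * ∂Z c i j k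

    private
      vanish₃ : ∀ u v w n n′ n″ {a b c} → a ≡ 0# → b ≡ 0# → c ≡ 0# → u * (n * a) + v * (n′ * b) + w * (n″ * c) ≡ 0#
      vanish₃ u v w n n′ n″ refl refl refl = trans
        (cong₂ _+_ (cong₂ _+_ (kill u n) (kill v n′)) (kill w n″)) (trans (+-identityʳ _) (+-identityʳ 0#))
        where
        kill : ∀ u n → u * (n * 0#) ≡ 0#
        kill u n = trans (cong (u *_) (zeroʳ n)) (zeroʳ u)

    ∂-Box : ∀ {D c} u v w → Box D c → Box D (∂[ u , v , w ] c)
    ∂-Box u v w B = record
      { inX = λ i j k lt → vanish₃ u v w _ _ _ (inX _ _ _ (ℕₚ.m<n⇒m<1+n lt)) (inX _ _ _ lt) (inX _ _ _ lt)
      ; inY = λ i j k lt → vanish₃ u v w _ _ _ (inY _ _ _ lt) (inY _ _ _ (ℕₚ.m<n⇒m<1+n lt)) (inY _ _ _ lt)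
      ; inZ = λ i j k lt → vanish₃ u v w _ _ _ (inZ _ _ _ lt) (inZ _ _ _ lt) (inZ _ _ _ (ℕₚ.m<n⇒m<1+n lt))
      }
      where open Box B

    ∂-comm : ∀ u v w u′ v′ w′ c i j k → ∂[ u , v , w ] (∂[ u′ , v′ , w′ ] c) i j k ≡ ∂[ u′ , v′ , w′ ] (∂[ u , v , w ] c) i j k
    ∂-comm u v w u′ v′ w′ c i j k =
      solve 18 (λ u v w u′ v′ w′ i i⁺ j j⁺ k k⁺ xx xy xz yy yz zz →
        u :* (i :* (u′ :* (i⁺ :* xx) :+ v′ :* (j :* xy) :+ w′ :* (k :* xz)))
        :+ v :* (j :* (u′ :* (i :* xy) :+ v′ :* (j⁺ :* yy) :+ w′ :* (k :* yz)))
        :+ w :* (k :* (u′ :* (i :* xz) :+ v′ :* (j :* yz) :+ w′ :* (k⁺ :* zz)))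
        := u′ :* (i :* (u :* (i⁺ :* xx) :+ v :* (j :* xy) :+ w :* (k :* xz)))
        :+ v′ :* (j :* (u :* (i :* xy) :+ v :* (j⁺ :* yy) :+ w :* (k :* yz)))
        :+ w′ :* (k :* (u :* (i :* xz) :+ v :* (j :* yz) :+ w :* (k⁺ :* zz)))) refl
        u v w u′ v′ w′ (nat (suc i)) (nat (suc (suc i))) (nat (suc j)) (nat (suc (suc j))) (nat (suc k)) (nat (suc (suc k)))
        (c (suc (suc i)) j k) (c (suc i) (suc j) k) (c (suc i) j (suc k)) (c i (suc (suc j)) k) (c i (suc j) (suc k)) (c i j (suc (suc k)))

    ∂-cong : ∀ u v w {c c′} → (∀ i j k → c i j k ≡ c′ i j k) → ∀ i j k → ∂[ u , v , w ] c i j k ≡ ∂[ u , v , w ] c′ i j k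
    ∂-cong u v w e i j k = cong₂ _+_ (cong₂ _+_ (cong (λ z → u * (nat (suc i) * z)) (e _ _ _)) (cong (λ z → v * (nat (suc j) * z)) (e _ _ _)))
      (cong (λ z → w * (nat (suc k) * z)) (e _ _ _))

    module Values (D : ℕ) where
      val : Coef → K → K → K → K
      val c x y z = ev D (λ i → ev D (λ j → ev D (c i j) z) y) x

      val-cong : ∀ {c c′} x y z → (∀ i j k → c i j k ≡ c′ i j k) → val c x y z ≡ val c′ x y z
      val-cong x y z e = ev-cong D x λ i → ev-cong D y λ j → ev-cong D z (e i j)

      val-linear : ∀ u v w c c′ c″ x y z →
        val (λ i j k → u * c i j k + v * c′ i j k + w * c″ i j k) x y z ≡ u * val c x y z + v * val c′ x y z + w * val c″ x y z
      val-linear u v w c c′ c″ x y z = trans (ev-cong D x λ i → trans (ev-cong D y λ j → ev-linear D u v w _ _ _ z) (ev-linear D u v w _ _ _ y)) (ev-linear D u v w _ _ _ x)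

      module Restrict (X Y Z : UPoly) where
        resZ : Coef → ℕ → ℕ → UPoly
        resZ c i j = PH.ev D (λ k → constant (c i j k)) Z
        resY : Coef → ℕ → UPoly
        resY c i = PH.ev D (resZ c i) Y
        res : Coef → UPoly
        res c = PH.ev D (resY c) X

        eval-res : ∀ c t → eval (res c) t ≡ val c (eval X t) (eval Y t) (eval Z t)
        eval-res c t = trans (eval-horner D _ X t) (ev-cong D _ λ i → trans (eval-horner D _ Y t) (ev-cong D _ λ j → eval-horner D _ Z t))

        bd-res : bd X ≤ 1 → bd Y ≤ 1 → bd Z ≤ 1 → ∀ c → bd (res c) ≤ D ℕ.+ (D ℕ.+ (D ℕ.+ 0))
        bd-res bX bY bZ c = bd-horner D _ X _ (λ i → bd-horner D _ Y _ (λ j → bd-horner D _ Z 0 (λ k → z≤n) bZ) bY) bX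

        res-linear : ∀ u v w c c′ c″ → res (λ i j k → u * c i j k + v * c′ i j k + w * c″ i j k)
                       ≋ ((constant u ⊗ res c) ⊕ (constant v ⊗ res c′)) ⊕ (constant w ⊗ res c″)
        res-linear u v w c c′ c″ = PR.trans (PH.ev-cong D X λ i → PR.trans (PH.ev-cong D Y λ j → PR.trans (PH.ev-cong D Z λ k →
            PR.trans (constant-+ (u * c i j k + v * c′ i j k) (w * c″ i j k)) (PR.+-cong (PR.trans (constant-+ (u * c i j k) (v * c′ i j k)) (PR.+-cong (constant-* u (c i j k)) (constant-* v (c′ i j k)))) (constant-* w (c″ i j k))))
            (PH.ev-linear D U V W _ _ _ Z)) (PH.ev-linear D U V W _ _ _ Y)) (PH.ev-linear D U V W _ _ _ X)
          where U = constant u ; V = constant v ; W = constant w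

        module _ (c : Coef) (B : Box D c) where
          open Box B

          resZ-scale : ∀ a d i j i′ j′ → (∀ k → d i j k ≡ a * c i′ j′ k) → constant a ⊗ resZ c i′ j′ ≋ resZ d i j
          resZ-scale a d i j i′ j′ e = PR.trans (PR.sym (PH.ev-* D (constant a) _ Z))
            (PH.ev-cong D Z λ k → PR.trans (PR.sym (constant-* a (c i′ j′ k))) (constant-cong (sym (e k))))

          δ-resZ : ∀ i j → δ (resZ c i j) ≋ δ Z ⊗ resZ (∂Z c) i j
          δ-resZ i j = PR.trans (δ-horner D _ Z (λ k lt → constant-cong (inZ i j k lt)))
            (PR.trans (PR.+-cong (PH.ev-zero D Z (λ k → δ-constant (c i j k))) (PR.*-congˡ {δ Z} (PH.ev-cong D Z λ k → PR.sym (constant-* (nat (suc k)) (c i j (suc k)))))) (PR.+-identityˡ (δ Z ⊗ resZ (∂Z c) i j)))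

          δ-resY : ∀ i → δ (resY c i) ≋ (δ Y ⊗ resY (∂Y c) i) ⊕ (δ Z ⊗ resY (∂Z c) i)
          δ-resY i = PR.trans (δ-horner D _ Y (λ j lt → PH.ev-zero D Z λ k → constant-cong (inY i j k lt)))
            (PR.trans (PR.+-cong (PR.trans (PH.ev-cong D Y (δ-resZ i)) (PH.ev-* D (δ Z) _ Y))
              (PR.*-congˡ {δ Y} (PH.ev-cong D Y λ j → resZ-scale (nat (suc j)) (∂Y c) i j i (suc j) (λ _ → refl)))) (PR.+-comm (δ Z ⊗ resY (∂Z c) i) (δ Y ⊗ resY (∂Y c) i)))

          δ-res : δ (res c) ≋ ((δ X ⊗ res (∂X c)) ⊕ (δ Y ⊗ res (∂Y c))) ⊕ (δ Z ⊗ res (∂Z c))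
          δ-res = PR.trans (δ-horner D _ X (λ i lt → PH.ev-zero D Y λ j → PH.ev-zero D Z λ k → constant-cong (inX i j k lt)))
            (PR.trans (PR.+-cong
                (PR.trans (PH.ev-cong D X δ-resY) (PR.trans (PH.ev-+ D _ _ X) (PR.+-cong (PH.ev-* D (δ Y) _ X) (PH.ev-* D (δ Z) _ X))))
                (PR.*-congˡ {δ X} (PH.ev-cong D X λ i → PR.trans (PR.sym (PH.ev-* D (weight i) _ Y))
                  (PH.ev-cong D Y λ j → resZ-scale (nat (suc i)) (∂X c) i j (suc i) j (λ _ → refl)))))
              (PS.solve 3 (λ a b c → (a PS.:+ b) PS.:+ c PS.:= (c PS.:+ a) PS.:+ b) PR.refl (δ Y ⊗ res (∂Y c)) (δ Z ⊗ res (∂Z c)) (δ X ⊗ res (∂X c))))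

  -- Contact of a polynomial with a family of lines

  module Contact₁ where
    open PrimeField 𝕂
    open Univariate
    open Trivariate
    open Solver using (solve; _:+_; _:*_; _:-_; :-_; _:=_; :0; :1)
    open ≡-Reasoning

    -- The line through (x₀ , y₀ , z₀) with direction (σ² , - σ , 1).
    record Line : Set where
      constructor mkLine
      field x₀ y₀ z₀ slope : K
    open Line public

    px py pz : Line → K → K
    px ℓ t = x₀ ℓ + t * (slope ℓ * slope ℓ)
    py ℓ t = y₀ ℓ + t * - slope ℓ
    pz ℓ t = z₀ ℓ + t * 1#

    -- A frame adapted to the conic of directions d(σ) = (σ², -σ, 1): `∂s` differentiates along
    -- d(σ), `∂b` along -d′(σ), and `∂a` along d″(σ)/2.
    ∂a : Coef → Coef
    ∂a = ∂[ 1# , 0# , 0# ]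
    ∂b ∂s : K → Coef → Coef
    ∂b σ = ∂[ - (σ + σ) , 1# , 0# ]
    ∂s σ = ∂[ σ * σ , - σ , 1# ]

    -- The two lines carry separate parameters for their common point, because one of them is later
    -- given a new base point.
    record Hit (ℓ m : Line) (t : K) : Set where
      field
        t′ : K
        eqx : px ℓ t ≡ px m t′
        eqy : py ℓ t ≡ py m t′
        eqz : pz ℓ t ≡ pz m t′
        transversal : slope m ≢ slope ℓ

    module AtDegree (D : ℕ) where
      open Values D public

      B : ℕ
      B = D ℕ.+ (D ℕ.+ (D ℕ.+ 0))

      At : Coef → Line → K → K
      At c ℓ t = val c (px ℓ t) (py ℓ t) (pz ℓ t)

      Van : Coef → Line → Set
      Van c ℓ = ∀ t → At c ℓ t ≡ 0#

      module OnLine (ℓ : Line) where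
        open Restrict (line (x₀ ℓ) (slope ℓ * slope ℓ)) (line (y₀ ℓ) (- slope ℓ)) (line (z₀ ℓ) 1#) public

        δ-restrict : ∀ {c} → Box D c → δ (res c) ≋ res (∂s (slope ℓ) c)
        δ-restrict {c} bx = PR.trans (δ-res c bx) (PR.trans
          (PR.+-cong (PR.+-cong (PR.*-congʳ {res (∂X c)} (δ-line (x₀ ℓ) _)) (PR.*-congʳ {res (∂Y c)} (δ-line (y₀ ℓ) _))) (PR.*-congʳ {res (∂Z c)} (δ-line (z₀ ℓ) 1#)))
          (PR.sym (res-linear (slope ℓ * slope ℓ) (- slope ℓ) 1# (∂X c) (∂Y c) (∂Z c))))

        bd-restrict : ∀ c → bd (res c) ≤ B
        bd-restrict = bd-res ℕₚ.≤-refl ℕₚ.≤-refl ℕₚ.≤-refl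

      restrict : Coef → Line → UPoly
      restrict c ℓ = OnLine.res ℓ c

      eval-restrict : ∀ c ℓ t → eval (restrict c ℓ) t ≡ At c ℓ t
      eval-restrict c ℓ t = OnLine.eval-res ℓ c t

      module Small (B<size : B < size) where
        restrict≋𝟘 : ∀ c ℓ → Van c ℓ → restrict c ℓ ≋ 𝟘
        restrict≋𝟘 c ℓ v = identically-zero _ (ℕₚ.≤-<-trans (OnLine.bd-restrict ℓ c) B<size) (λ t → trans (eval-restrict c ℓ t) (v t))

        Van-∂ : ∀ {c} → Box D c → ∀ ℓ → Van c ℓ → Van (∂s (slope ℓ) c) ℓ
        Van-∂ {c} bx ℓ v t = begin
          At (∂s (slope ℓ) c) ℓ t ≡⟨ sym (eval-restrict _ ℓ t) ⟩
          eval (restrict (∂s (slope ℓ) c) ℓ) t ≡⟨ eval-cong t (PR.sym (OnLine.δ-restrict ℓ bx)) ⟩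
          eval (δ (restrict c ℓ)) t ≡⟨ eval-cong t (PR.trans (δ-cong (restrict≋𝟘 c ℓ v)) δ-𝟘) ⟩
          0# ∎

      At-cong : ∀ {c c′} → (∀ i j k → c i j k ≡ c′ i j k) → ∀ ℓ t → At c ℓ t ≡ At c′ ℓ t
      At-cong e ℓ t = val-cong _ _ _ e

      At-hit : ∀ c {ℓ m t} (h : Hit ℓ m t) → At c ℓ t ≡ At c m (Hit.t′ h)
      At-hit c {ℓ} {m} {t} h = trans (cong (λ x → val c x (py ℓ t) (pz ℓ t)) eqx) (cong₂ (λ y z → val c (px m t′) y z) eqy eqz)
        where open Hit h

      -- The direction of slope σ + s in terms of the frame ∂a, ∂b, ∂s at slope σ.
      At-turn : ∀ σ s c ℓ t → At (∂s (σ + s) c) ℓ t ≡ s * s * At (∂a c) ℓ t - s * At (∂b σ c) ℓ t + At (∂s σ c) ℓ t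
      At-turn σ s c ℓ t = trans (At-cong (λ i j k →
          solve 5 (λ σ s x y z → ((σ :+ s) :* (σ :+ s)) :* x :+ (:- (σ :+ s)) :* y :+ :1 :* z
            := (s :* s) :* (:1 :* x :+ :0 :* y :+ :0 :* z) :+ (:- s) :* ((:- (σ :+ σ)) :* x :+ :1 :* y :+ :0 :* z) :+ :1 :* (σ :* σ :* x :+ :- σ :* y :+ :1 :* z))
            refl σ s (∂X c i j k) (∂Y c i j k) (∂Z c i j k)) ℓ t)
        (trans (val-linear (s * s) (- s) 1# (∂a c) (∂b σ c) (∂s σ c) (px ℓ t) (py ℓ t) (pz ℓ t))
          (solve 4 (λ s a b z → s :* s :* a :+ :- s :* b :+ :1 :* z := s :* s :* a :- s :* b :+ z) refl s (At (∂a c) ℓ t) (At (∂b σ c) ℓ t) (At (∂s σ c) ℓ t)))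

      At-comm : ∀ u v w u′ v′ w′ c ℓ t → At (∂[ u , v , w ] (∂[ u′ , v′ , w′ ] c)) ℓ t ≡ At (∂[ u′ , v′ , w′ ] (∂[ u , v , w ] c)) ℓ t
      At-comm u v w u′ v′ w′ c ℓ t = At-cong (∂-comm u v w u′ v′ w′ c) ℓ t

      -- `At-turn` applied twice. The second derivative in a turned direction becomes a quartic in
      -- `s` with the second derivatives in the fixed frame as coefficients.
      At-turn₂ : ∀ σ s c ℓ t → At (∂s (σ + s) (∂s (σ + s) c)) ℓ t
        ≡ s * s * (s * s * At (∂a (∂a c)) ℓ t - s * (At (∂a (∂b σ c)) ℓ t + At (∂a (∂b σ c)) ℓ t) + (At (∂b σ (∂b σ c)) ℓ t + (At (∂s σ (∂a c)) ℓ t + At (∂s σ (∂a c)) ℓ t)))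
          - s * (At (∂s σ (∂b σ c)) ℓ t + At (∂s σ (∂b σ c)) ℓ t) + At (∂s σ (∂s σ c)) ℓ t
      At-turn₂ σ s c ℓ t = begin
        At (∂s τ (∂s τ c)) ℓ t ≡⟨ At-turn σ s (∂s τ c) ℓ t ⟩
        s * s * At (∂a (∂s τ c)) ℓ t - s * At (∂b σ (∂s τ c)) ℓ t + At (∂s σ (∂s τ c)) ℓ t
          ≡⟨ cong₂ _+_ (cong₂ (λ x y → s * s * x - s * y) ea eb) es ⟩
        s * s * (s * s * aa - s * ab + sa) - s * (s * s * ab - s * bb + sb) + (s * s * sa - s * sb + ss)
          ≡⟨ solve 7 (λ s aa ab bb sa sb ss →
               s :* s :* (s :* s :* aa :- s :* ab :+ sa) :- s :* (s :* s :* ab :- s :* bb :+ sb) :+ (s :* s :* sa :- s :* sb :+ ss)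
               := s :* s :* (s :* s :* aa :- s :* (ab :+ ab) :+ (bb :+ (sa :+ sa))) :- s :* (sb :+ sb) :+ ss) refl s aa ab bb sa sb ss ⟩
        s * s * (s * s * aa - s * (ab + ab) + (bb + (sa + sa))) - s * (sb + sb) + ss ∎
        where
        τ = σ + s
        aa = At (∂a (∂a c)) ℓ t
        ab = At (∂a (∂b σ c)) ℓ t
        bb = At (∂b σ (∂b σ c)) ℓ t
        sa = At (∂s σ (∂a c)) ℓ t
        sb = At (∂s σ (∂b σ c)) ℓ t
        ss = At (∂s σ (∂s σ c)) ℓ t
        ea : At (∂a (∂s τ c)) ℓ t ≡ s * s * aa - s * ab + sa
        ea = trans (At-comm _ _ _ _ _ _ c ℓ t) (trans (At-turn σ s (∂a c) ℓ t) (cong (λ z → s * s * aa - s * z + sa) (At-comm _ _ _ _ _ _ c ℓ t)))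
        eb : At (∂b σ (∂s τ c)) ℓ t ≡ s * s * ab - s * bb + sb
        eb = trans (At-comm _ _ _ _ _ _ c ℓ t) (At-turn σ s (∂b σ c) ℓ t)
        es : At (∂s σ (∂s τ c)) ℓ t ≡ s * s * sa - s * sb + ss
        es = trans (At-comm _ _ _ _ _ _ c ℓ t) (trans (At-turn σ s (∂s σ c) ℓ t) (cong₂ (λ x y → s * s * x - s * y + ss) (At-comm _ _ _ _ _ _ c ℓ t) (At-comm _ _ _ _ _ _ c ℓ t)))

      -- The family directions tangent to the surface at a point are the roots of this quadratic.
      -- Two known roots give b/a as their sum, stated without division because `a` may vanish.
      sum-of-roots : ∀ {s s′ a b z} → s ≢ s′ → s * s * a - s * b + z ≡ 0# → s′ * s′ * a - s′ * b + z ≡ 0# → b ≡ (s + s′) * a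
      sum-of-roots {s} {s′} {a} {b} {z} ne e e′ = *-cancelˡ {s - s′} (λ z → ne (x-y≡0⇒x≡y z)) (sym (x-y≡0⇒x≡y (begin
        (s - s′) * ((s + s′) * a) - (s - s′) * b
          ≡⟨ solve 5 (λ s s′ a b z → (s :- s′) :* ((s :+ s′) :* a) :- (s :- s′) :* b := (s :* s :* a :- s :* b :+ z) :- (s′ :* s′ :* a :- s′ :* b :+ z)) refl s s′ a b z ⟩
        (s * s * a - s * b + z) - (s′ * s′ * a - s′ * b + z) ≡⟨ cong₂ _-_ e e′ ⟩
        0# - 0# ≡⟨ -‿inverseʳ 0# ⟩
        0# ∎)))

      turn : ∀ σ τ → σ + (τ - σ) ≡ τ
      turn = solve 2 (λ σ τ → σ :+ (τ :- σ) := τ) refl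

      deg-⊕ : ∀ f g {k l} → bd f ≤ k ℕ.* B → bd g ≤ l ℕ.* B → bd (f ⊕ g) ≤ (k ⊔ l) ℕ.* B
      deg-⊕ f g {k} {l} p q = ℕₚ.⊔-lub (ℕₚ.≤-trans p (ℕₚ.*-monoˡ-≤ B (ℕₚ.m≤m⊔n k l))) (ℕₚ.≤-trans q (ℕₚ.*-monoˡ-≤ B (ℕₚ.m≤n⊔m k l)))

      deg-⊗ : ∀ f g {k l} → bd f ≤ k ℕ.* B → bd g ≤ l ℕ.* B → bd (f ⊗ g) ≤ (k ℕ.+ l) ℕ.* B
      deg-⊗ f g {k} {l} p q = ℕₚ.≤-trans (ℕₚ.+-mono-≤ p q) (ℕₚ.≤-reflexive (sym (ℕₚ.*-distribʳ-+ B k l)))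

      deg-restrict : ∀ c ℓ → bd (restrict c ℓ) ≤ 1 ℕ.* B
      deg-restrict c ℓ = ℕₚ.≤-trans (OnLine.bd-restrict ℓ c) (ℕₚ.≤-reflexive (sym (ℕₚ.*-identityˡ B)))

      eval≡⊕ : ∀ f g {t x y} → eval f t ≡ x → eval g t ≡ y → eval (f ⊕ g) t ≡ x + y
      eval≡⊕ f g e e′ = trans (eval-⊕ f g _) (cong₂ _+_ e e′)

      eval≡⊖ : ∀ f g {t x y} → eval f t ≡ x → eval g t ≡ y → eval (f ⊖ g) t ≡ x - y
      eval≡⊖ f g e e′ = trans (eval-⊖ f g _) (cong₂ _-_ e e′)

      eval≡⊗ : ∀ f g {t x y} → eval f t ≡ x → eval g t ≡ y → eval (f ⊗ g) t ≡ x * y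
      eval≡⊗ f g e e′ = trans (eval-⊗ f g _) (cong₂ _*_ e e′)

      module Vanishing (B<size : B < size) (c : Coef) (box : Box D c) where
        open Small B<size public

        contact₁ : ∀ {ℓ m t} → Van c m → Hit ℓ m t → At (∂s (slope m) c) ℓ t ≡ 0#
        contact₁ {m = m} v h = trans (At-hit _ h) (Van-∂ box m v _)

        contact₂ : ∀ {ℓ m t} → Van c m → Hit ℓ m t → At (∂s (slope m) (∂s (slope m) c)) ℓ t ≡ 0#
        contact₂ {m = m} v h = trans (At-hit _ h) (Van-∂ (∂-Box _ _ _ box) m (Van-∂ box m v) _)

        -- More than `k ℕ.* B` crossings: enough to annihilate any polynomial along `q` that is a
        -- product of `k` restrictions and vanishes at each crossing.
        record Rich (k : ℕ) (q : Line) : Set where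
          field
            van : Van c q
            ts : List K
            distinct : AllPairs _≢_ ts
            many : k ℕ.* B < length ts
            hits : All (λ t → ∃[ r ] (Van c r × Hit q r t)) ts

        -- If q carries many crossings, then at every point of q the second
        -- tangent direction of slope in the family also has second order contact;
        -- multiplied out, this is the vanishing of R.
        module SecondDirection (q : Line) (σ : K) where
          s = slope q - σ
          Fa Fb Faa Fab Fbb Fsa Fsb Fss e U V P R : UPoly
          Fa = restrict (∂a c) q
          Fb = restrict (∂b σ c) q
          Faa = restrict (∂a (∂a c)) q
          Fab = restrict (∂a (∂b σ c)) q
          Fbb = restrict (∂b σ (∂b σ c)) q
          Fsa = restrict (∂s σ (∂a c)) q
          Fsb = restrict (∂s σ (∂b σ c)) q
          Fss = restrict (∂s σ (∂s σ c)) q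
          -- By `sum-of-roots` the value of `e` at a crossing with a line of slope σ + s′ is s′
          -- times that of `Fa`. Thus e/Fa is the second tangent direction, and `R` is the quartic
          -- of `At-turn₂` at this ratio, multiplied by the fourth power of `Fa`.
          e = Fb ⊖ (constant s ⊗ Fa)
          U = (e ⊗ (e ⊗ Faa) ⊖ e ⊗ (Fa ⊗ (Fab ⊕ Fab))) ⊕ Fa ⊗ (Fa ⊗ (Fbb ⊕ (Fsa ⊕ Fsa)))
          V = e ⊗ U ⊖ Fa ⊗ (Fa ⊗ (Fa ⊗ (Fsb ⊕ Fsb)))
          P = Fa ⊗ (Fa ⊗ (Fa ⊗ Fa))
          R = e ⊗ V ⊕ P ⊗ Fss

          deg-e : bd e ≤ 1 ℕ.* B
          deg-e = deg-⊕ Fb (⊝ (constant s ⊗ Fa)) {1} {1} (deg-restrict _ q) (deg-⊗ (constant s) Fa {0} {1} z≤n (deg-restrict _ q))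

          -- Four factors of degree at most `B` come from clearing the denominators of the quartic,
          -- the fifth from the second derivatives. This is where the richness 5 originates.
          deg-R : bd R ≤ 5 ℕ.* B
          deg-R = deg-⊕ (e ⊗ V) (P ⊗ Fss) {5} {5}
            (deg-⊗ e V {1} {4} deg-e (deg-⊕ (e ⊗ U) (⊝ (Fa ⊗ (Fa ⊗ (Fa ⊗ (Fsb ⊕ Fsb))))) {4} {4}
              (deg-⊗ e U {1} {3} deg-e (deg-⊕ (e ⊗ (e ⊗ Faa) ⊖ e ⊗ (Fa ⊗ (Fab ⊕ Fab))) (Fa ⊗ (Fa ⊗ (Fbb ⊕ (Fsa ⊕ Fsa)))) {3} {3}
                (deg-⊕ (e ⊗ (e ⊗ Faa)) (⊝ (e ⊗ (Fa ⊗ (Fab ⊕ Fab)))) {3} {3} (deg-⊗ e (e ⊗ Faa) {1} {2} deg-e (deg-⊗ e Faa {1} {1} deg-e (d _)))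
                  (deg-⊗ e (Fa ⊗ (Fab ⊕ Fab)) {1} {2} deg-e (deg-⊗ Fa (Fab ⊕ Fab) {1} {1} (d _) (deg-⊕ Fab Fab {1} {1} (d _) (d _)))))
                (deg-⊗ Fa (Fa ⊗ (Fbb ⊕ (Fsa ⊕ Fsa))) {1} {2} (d _) (deg-⊗ Fa (Fbb ⊕ (Fsa ⊕ Fsa)) {1} {1} (d _)
                   (deg-⊕ Fbb (Fsa ⊕ Fsa) {1} {1} (d _) (deg-⊕ Fsa Fsa {1} {1} (d _) (d _)))))))
              (deg-⊗ Fa (Fa ⊗ (Fa ⊗ (Fsb ⊕ Fsb))) {1} {3} (d _) (deg-⊗ Fa (Fa ⊗ (Fsb ⊕ Fsb)) {1} {2} (d _) (deg-⊗ Fa (Fsb ⊕ Fsb) {1} {1} (d _) (deg-⊕ Fsb Fsb {1} {1} (d _) (d _)))))))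
            (deg-⊗ P Fss {4} {1} (deg-⊗ Fa (Fa ⊗ (Fa ⊗ Fa)) {1} {3} (d _) (deg-⊗ Fa (Fa ⊗ Fa) {1} {2} (d _) (deg-⊗ Fa Fa {1} {1} (d _) (d _)))) (d _))
            where
            d : ∀ c → bd (restrict c q) ≤ 1 ℕ.* B
            d c = deg-restrict c q

          R-value : K → K → K → K → K → K → K → K → K
          R-value ε a aa ab bb sa sb ss =
            ε * (ε * ((ε * (ε * aa) - ε * (a * (ab + ab))) + a * (a * (bb + (sa + sa)))) - a * (a * (a * (sb + sb)))) + a * (a * (a * a)) * ss

          eval-e : ∀ t → eval e t ≡ At (∂b σ c) q t - s * At (∂a c) q t
          eval-e t = eval≡⊖ Fb (constant s ⊗ Fa) (eval-restrict _ q t) (eval≡⊗ (constant s) Fa refl (eval-restrict _ q t))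

          eval-V : ∀ t {ε} → eval e t ≡ ε → eval V t ≡
            ε * ((ε * (ε * At (∂a (∂a c)) q t) - ε * (At (∂a c) q t * (At (∂a (∂b σ c)) q t + At (∂a (∂b σ c)) q t)))
              + At (∂a c) q t * (At (∂a c) q t * (At (∂b σ (∂b σ c)) q t + (At (∂s σ (∂a c)) q t + At (∂s σ (∂a c)) q t))))
            - At (∂a c) q t * (At (∂a c) q t * (At (∂a c) q t * (At (∂s σ (∂b σ c)) q t + At (∂s σ (∂b σ c)) q t)))
          eval-V t eε = eval≡⊖ (e ⊗ U) (Fa ⊗ (Fa ⊗ (Fa ⊗ (Fsb ⊕ Fsb))))
            (eval≡⊗ e U eε (eval≡⊕ (e ⊗ (e ⊗ Faa) ⊖ e ⊗ (Fa ⊗ (Fab ⊕ Fab))) (Fa ⊗ (Fa ⊗ (Fbb ⊕ (Fsa ⊕ Fsa))))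
              (eval≡⊖ (e ⊗ (e ⊗ Faa)) (e ⊗ (Fa ⊗ (Fab ⊕ Fab))) (eval≡⊗ e (e ⊗ Faa) eε (eval≡⊗ e Faa eε (r _)))
                 (eval≡⊗ e (Fa ⊗ (Fab ⊕ Fab)) eε (eval≡⊗ Fa (Fab ⊕ Fab) (r _) (eval≡⊕ Fab Fab (r _) (r _)))))
              (eval≡⊗ Fa (Fa ⊗ (Fbb ⊕ (Fsa ⊕ Fsa))) (r _) (eval≡⊗ Fa (Fbb ⊕ (Fsa ⊕ Fsa)) (r _) (eval≡⊕ Fbb (Fsa ⊕ Fsa) (r _) (eval≡⊕ Fsa Fsa (r _) (r _)))))))
            (eval≡⊗ Fa (Fa ⊗ (Fa ⊗ (Fsb ⊕ Fsb))) (r _) (eval≡⊗ Fa (Fa ⊗ (Fsb ⊕ Fsb)) (r _) (eval≡⊗ Fa (Fsb ⊕ Fsb) (r _) (eval≡⊕ Fsb Fsb (r _) (r _)))))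
            where
            r : ∀ d → eval (restrict d q) t ≡ At d q t
            r d = eval-restrict d q t

          eval-P : ∀ t → eval P t ≡ At (∂a c) q t * (At (∂a c) q t * (At (∂a c) q t * At (∂a c) q t))
          eval-P t = eval≡⊗ Fa (Fa ⊗ (Fa ⊗ Fa)) r (eval≡⊗ Fa (Fa ⊗ Fa) r (eval≡⊗ Fa Fa r r))
            where r = eval-restrict (∂a c) q t

          eval-R : ∀ t {ε} → eval e t ≡ ε → eval R t ≡ R-value ε (At (∂a c) q t) (At (∂a (∂a c)) q t)
            (At (∂a (∂b σ c)) q t) (At (∂b σ (∂b σ c)) q t) (At (∂s σ (∂a c)) q t) (At (∂s σ (∂b σ c)) q t) (At (∂s σ (∂s σ c)) q t)
          eval-R t eε = eval≡⊕ (e ⊗ V) (P ⊗ Fss) (eval≡⊗ e V eε (eval-V t eε)) (eval≡⊗ P Fss (eval-P t) (eval-restrict _ q t))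

          R-root : Van c q → ∀ t → (∃[ r ] (Van c r × Hit q r t)) → eval R t ≡ 0#
          R-root vq t (r , vr , h) = begin
            eval R t ≡⟨ eval-R t eε ⟩
            R-value (s′ * a) a aa ab bb sa sb ss
              ≡⟨ solve 8 (λ s′ a aa ab bb sa sb ss →
                   s′ :* a :* (s′ :* a :* ((s′ :* a :* (s′ :* a :* aa) :- s′ :* a :* (a :* (ab :+ ab))) :+ a :* (a :* (bb :+ (sa :+ sa)))) :- a :* (a :* (a :* (sb :+ sb)))) :+ a :* (a :* (a :* a)) :* ss
                   := a :* (a :* (a :* a)) :* (s′ :* s′ :* (s′ :* s′ :* aa :- s′ :* (ab :+ ab) :+ (bb :+ (sa :+ sa))) :- s′ :* (sb :+ sb) :+ ss))
                   refl s′ a aa ab bb sa sb ss ⟩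
            a * (a * (a * a)) * (s′ * s′ * (s′ * s′ * aa - s′ * (ab + ab) + (bb + (sa + sa))) - s′ * (sb + sb) + ss)
              ≡⟨ cong (a * (a * (a * a)) *_) (trans (sym (At-turn₂ σ s′ c q t)) (trans (cong (λ τ → At (∂s τ (∂s τ c)) q t) (turn σ (slope r))) (contact₂ vr h))) ⟩
            a * (a * (a * a)) * 0# ≡⟨ zeroʳ _ ⟩
            0# ∎
            where
            s′ = slope r - σ
            a = At (∂a c) q t
            b = At (∂b σ c) q t
            aa = At (∂a (∂a c)) q t
            ab = At (∂a (∂b σ c)) q t
            bb = At (∂b σ (∂b σ c)) q t
            sa = At (∂s σ (∂a c)) q t
            sb = At (∂s σ (∂b σ c)) q t
            ss = At (∂s σ (∂s σ c)) q t
            s′≢s : s′ ≢ s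
            s′≢s eq = Hit.transversal h (trans (sym (turn σ (slope r))) (trans (cong (σ +_) eq) (turn σ (slope q))))
            first : ∀ τ → At (∂s τ c) q t ≡ 0# → (τ - σ) * (τ - σ) * a - (τ - σ) * b + At (∂s σ c) q t ≡ 0#
            first τ eq = trans (sym (At-turn σ (τ - σ) c q t)) (trans (cong (λ τ → At (∂s τ c) q t) (turn σ τ)) eq)
            eε : eval e t ≡ s′ * a
            eε = trans (eval-e t) (trans (cong (_- s * a) (sum-of-roots s′≢s (first (slope r) (contact₁ vr h)) (first (slope q) (Van-∂ box q vq t))))
              (solve 3 (λ s′ s a → (s′ :+ s) :* a :- s :* a := s′ :* a) refl s′ s a))

          R≋𝟘 : Rich 5 q → R ≋ 𝟘
          R≋𝟘 rich = pw λ n → trans (roots⇒zero (bd R) (cf R) ts (vanish R) (ℕₚ.≤-<-trans deg-R many) distinct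
              (All.map (λ {t} → R-root van t) hits) n) (lem n)
            where
            open Rich rich
            lem : ∀ n → 0# ≡ cf 𝟘 n
            lem zero = refl
            lem (suc n) = refl

          δ-R : δ R ≋ (δ e ⊗ V ⊕ e ⊗ δ V) ⊕ (δ P ⊗ Fss ⊕ P ⊗ δ Fss)
          δ-R = PR.trans (δ-⊕ (e ⊗ V) (P ⊗ Fss)) (⊕-cong (δ-⊗ e V) (δ-⊗ P Fss))

          eval-δe : ∀ t → eval (δ e) t ≡ At (∂s (slope q) (∂b σ c)) q t - s * At (∂s (slope q) (∂a c)) q t
          eval-δe t = trans (eval-cong t (PR.trans (δ-⊖ Fb (constant s ⊗ Fa)) (⊕-cong (PR.refl {δ Fb}) (⊝-cong (PR.trans (δ-⊗ (constant s) Fa)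
              (PR.trans (PR.+-congʳ {constant s ⊗ δ Fa} (PR.trans (PR.*-congʳ {Fa} (δ-constant s)) (PR.zeroˡ Fa))) (PR.+-identityˡ (constant s ⊗ δ Fa))))))))
            (eval≡⊖ (δ Fb) (constant s ⊗ δ Fa) (δr (∂-Box _ _ _ box)) (eval≡⊗ (constant s) (δ Fa) refl (δr (∂-Box _ _ _ box))))
            where
            δr : ∀ {d} → Box D d → eval (δ (restrict d q)) t ≡ At (∂s (slope q) d) q t
            δr {d} bx = trans (eval-cong t (OnLine.δ-restrict q bx)) (eval-restrict _ q t)

          -- δ R = 0 at a crossing with a line of slope σ, where e and Fss vanish.
          derivative : Rich 5 q → ∀ t → eval e t ≡ 0# → At (∂s σ (∂s σ c)) q t ≡ 0# → At (∂a c) q t ≢ 0# →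
            At (∂a c) q t * At (∂s (slope q) (∂s σ (∂s σ c))) q t
              ≡ (At (∂s σ (∂b σ c)) q t + At (∂s σ (∂b σ c)) q t) * (At (∂s (slope q) (∂b σ c)) q t - s * At (∂s (slope q) (∂a c)) q t)
          derivative rich t e0 ss0 a≢0 = x-y≡0⇒x≡y (*-zero-product (trans (solve 4 (λ a d b e →
                a :* (a :* a) :* (a :* d :- (b :+ b) :* e) := e :* (:- (a :* (a :* (a :* (b :+ b))))) :+ a :* (a :* (a :* a)) :* d) refl a d b e′) total)
                (*-nonzero a≢0 (*-nonzero a≢0 a≢0)))
            where
            a = At (∂a c) q t
            b = At (∂s σ (∂b σ c)) q t
            d = At (∂s (slope q) (∂s σ (∂s σ c))) q t
            e′ = At (∂s (slope q) (∂b σ c)) q t - s * At (∂s (slope q) (∂a c)) q t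
            eV : eval V t ≡ - (a * (a * (a * (b + b))))
            eV = trans (eval-V t e0) (trans (cong (_- a * (a * (a * (b + b)))) (zeroˡ _)) (+-identityˡ _))
            eFss : eval (δ Fss) t ≡ d
            eFss = trans (eval-cong t (OnLine.δ-restrict q (∂-Box _ _ _ (∂-Box _ _ _ box)))) (eval-restrict _ q t)
            total : e′ * (- (a * (a * (a * (b + b))))) + a * (a * (a * a)) * d ≡ 0#
            total = begin
              e′ * (- (a * (a * (a * (b + b))))) + a * (a * (a * a)) * d
                ≡⟨ solve 4 (λ x y u v → x :+ y := (x :+ :0 :* u) :+ (v :* :0 :+ y)) refl _ _ (eval (δ V) t) (eval (δ P) t) ⟩
              (e′ * (- (a * (a * (a * (b + b))))) + 0# * eval (δ V) t) + (eval (δ P) t * 0# + a * (a * (a * a)) * d)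
                ≡⟨ sym (eval≡⊕ (δ e ⊗ V ⊕ e ⊗ δ V) (δ P ⊗ Fss ⊕ P ⊗ δ Fss)
                     (eval≡⊕ (δ e ⊗ V) (e ⊗ δ V) (eval≡⊗ (δ e) V (eval-δe t) eV) (eval≡⊗ e (δ V) e0 refl))
                     (eval≡⊕ (δ P ⊗ Fss) (P ⊗ δ Fss) (eval≡⊗ (δ P) Fss refl (trans (eval-restrict _ q t) ss0)) (eval≡⊗ P (δ Fss) (eval-P t) eFss))) ⟩
              eval ((δ e ⊗ V ⊕ e ⊗ δ V) ⊕ (δ P ⊗ Fss ⊕ P ⊗ δ Fss)) t ≡⟨ eval-cong t (PR.sym δ-R) ⟩
              eval (δ R) t ≡⟨ eval-cong t (PR.trans (δ-cong (R≋𝟘 rich)) δ-𝟘) ⟩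
              0# ∎

        module AtLine (p : Line) (vp : Van c p) where
          σ = slope p
          a b W : UPoly
          a = restrict (∂a c) p
          b = restrict (∂b σ c) p
          -- This is b³ (a/b)″ with the quotient rule multiplied out.
          W = b ⊗ (b ⊗ δ (δ a) ⊖ a ⊗ δ (δ b)) ⊖ (δ b ⊕ δ b) ⊗ (b ⊗ δ a ⊖ a ⊗ δ b)

          deg-W : bd W ≤ 3 ℕ.* B
          deg-W = deg-⊕ (b ⊗ (b ⊗ δ (δ a) ⊖ a ⊗ δ (δ b))) (⊝ ((δ b ⊕ δ b) ⊗ (b ⊗ δ a ⊖ a ⊗ δ b))) {3} {3}
            (deg-⊗ b (b ⊗ δ (δ a) ⊖ a ⊗ δ (δ b)) {1} {2} db (deg-⊕ (b ⊗ δ (δ a)) (⊝ (a ⊗ δ (δ b))) {2} {2} (deg-⊗ b (δ (δ a)) {1} {1} db da) (deg-⊗ a (δ (δ b)) {1} {1} da db)))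
            (deg-⊗ (δ b ⊕ δ b) (b ⊗ δ a ⊖ a ⊗ δ b) {1} {2} (deg-⊕ (δ b) (δ b) {1} {1} db db) (deg-⊕ (b ⊗ δ a) (⊝ (a ⊗ δ b)) {2} {2} (deg-⊗ b (δ a) {1} {1} db da) (deg-⊗ a (δ b) {1} {1} da db)))
            where
            da : bd a ≤ 1 ℕ.* B
            da = deg-restrict _ p
            db : bd b ≤ 1 ℕ.* B
            db = deg-restrict _ p

          ∂s-van : ∀ t → At (∂s σ c) p t ≡ 0#
          ∂s-van = Van-∂ box p vp

          -- As `c` vanishes on both lines, 0 and `slope q - σ` are roots of the tangent quadratic
          -- at their common point, and its coefficient of order zero vanishes.
          tangent : ∀ {q t} → Van c q → (h : Hit p q t) → At (∂b σ c) p t ≡ (slope q - σ) * At (∂a c) p t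
          tangent {q} {t} vq h = trans (sum-of-roots {slope q - σ} {0#} {z = 0#} (λ e → Hit.transversal h (x-y≡0⇒x≡y e))
              (trans (cong ((slope q - σ) * (slope q - σ) * At (∂a c) p t - (slope q - σ) * At (∂b σ c) p t +_) (sym (∂s-van t)))
                (trans (sym (At-turn σ (slope q - σ) c p t)) (trans (cong (λ τ → At (∂s τ c) p t) (turn σ (slope q))) (contact₁ vq h))))
              (solve 2 (λ a b → :0 :* :0 :* a :- :0 :* b :+ :0 := :0) refl _ _))
            (cong (_* At (∂a c) p t) (+-identityʳ _))

          RichHit : K → Set
          RichHit t = ∃[ q ] (Rich 5 q × Hit p q t)

          δδ-eval : ∀ {d} → Box D d → ∀ t → eval (δ (δ (restrict d p))) t ≡ At (∂s σ (∂s σ d)) p t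
          δδ-eval bx t = trans (eval-cong t (PR.trans (δ-cong (OnLine.δ-restrict p bx)) (OnLine.δ-restrict p (∂-Box _ _ _ bx)))) (eval-restrict _ p t)

          δ-eval : ∀ {d} → Box D d → ∀ t → eval (δ (restrict d p)) t ≡ At (∂s σ d) p t
          δ-eval bx t = trans (eval-cong t (OnLine.δ-restrict p bx)) (eval-restrict _ p t)

          eval-W : ∀ t {b₀ a₀} → At (∂a c) p t ≡ a₀ → At (∂b σ c) p t ≡ b₀ → eval W t ≡
            b₀ * (b₀ * At (∂s σ (∂s σ (∂a c))) p t - a₀ * At (∂s σ (∂s σ (∂b σ c))) p t)
              - (At (∂s σ (∂b σ c)) p t + At (∂s σ (∂b σ c)) p t) * (b₀ * At (∂s σ (∂a c)) p t - a₀ * At (∂s σ (∂b σ c)) p t)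
          eval-W t ea eb = eval≡⊖ (b ⊗ (b ⊗ δ (δ a) ⊖ a ⊗ δ (δ b))) ((δ b ⊕ δ b) ⊗ (b ⊗ δ a ⊖ a ⊗ δ b))
            (eval≡⊗ b (b ⊗ δ (δ a) ⊖ a ⊗ δ (δ b)) eb′ (eval≡⊖ (b ⊗ δ (δ a)) (a ⊗ δ (δ b)) (eval≡⊗ b (δ (δ a)) eb′ (δδ-eval bxa t)) (eval≡⊗ a (δ (δ b)) ea′ (δδ-eval bxb t))))
            (eval≡⊗ (δ b ⊕ δ b) (b ⊗ δ a ⊖ a ⊗ δ b) (eval≡⊕ (δ b) (δ b) (δ-eval bxb t) (δ-eval bxb t))
              (eval≡⊖ (b ⊗ δ a) (a ⊗ δ b) (eval≡⊗ b (δ a) eb′ (δ-eval bxa t)) (eval≡⊗ a (δ b) ea′ (δ-eval bxb t))))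
            where
            ea′ = trans (eval-restrict (∂a c) p t) ea
            eb′ = trans (eval-restrict (∂b σ c) p t) eb
            bxa : Box D (∂a c)
            bxa = ∂-Box _ _ _ box
            bxb : Box D (∂b σ c)
            bxb = ∂-Box _ _ _ box

          -- Two facts about the crossing line `q` are combined: its second-order contact, which
          -- after division by `s` is `first`, and the derivative along `q` of the identity `R` = 0,
          -- which is `second`. `W` is a linear combination of the two.
          W-root : ∀ t → RichHit t → eval W t ≡ 0#
          W-root t (q , rich , h) with At (∂a c) p t ≟ 0#
          -- Then `b`, being s times `a`, vanishes there too, and every term of `W` has `a` or `b`
          -- as a factor.
          ... | yes a0 = trans (eval-W t a0 (trans (tangent (Rich.van rich) h) (trans (cong ((slope q - σ) *_) a0) (zeroʳ _))))
              (solve 4 (λ x y u v → :0 :* (:0 :* x :- :0 :* y) :- (v :+ v) :* (:0 :* u :- :0 :* v) := :0) refl _ _ _ _)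
          ... | no a≢0 = begin
            eval W t ≡⟨ eval-W t refl (tangent (Rich.van rich) h) ⟩
            s * a₀ * (s * a₀ * a₂ - a₀ * b₂) - (b₁ + b₁) * (s * a₀ * a₁ - a₀ * b₁)
              ≡⟨ solve 9 (λ s a a₁ b₁ a₂ b₂ aa ab bb →
                   s :* a :* (s :* a :* a₂ :- a :* b₂) :- (b₁ :+ b₁) :* (s :* a :* a₁ :- a :* b₁)
                   := a :* (a :* (s :* s :* a₂ :- s :* b₂) :- (b₁ :+ b₁) :* ((s :* s :* ab :- s :* bb :+ b₁) :- s :* (s :* s :* aa :- s :* ab :+ a₁)))
                      :- a :* (b₁ :+ b₁) :* (s :* (s :* s :* aa :- s :* (ab :+ ab) :+ (bb :+ (a₁ :+ a₁))) :- (b₁ :+ b₁))) refl s a₀ a₁ b₁ a₂ b₂ aa ab bb ⟩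
            a₀ * (a₀ * (s * s * a₂ - s * b₂) - (b₁ + b₁) * ((s * s * ab - s * bb + b₁) - s * (s * s * aa - s * ab + a₁)))
              - a₀ * (b₁ + b₁) * (s * (s * s * aa - s * (ab + ab) + (bb + (a₁ + a₁))) - (b₁ + b₁))
              ≡⟨ cong₂ (λ x y → a₀ * x - a₀ * (b₁ + b₁) * y) (x≡y⇒x-y≡0 second) first ⟩
            a₀ * 0# - a₀ * (b₁ + b₁) * 0# ≡⟨ solve 2 (λ x y → x :* :0 :- y :* :0 := :0) refl _ _ ⟩
            0# ∎
            where
            open SecondDirection q σ using (s; e; derivative; eval-e)
            t′ = Hit.t′ h
            τ = slope q
            a₀ = At (∂a c) p t
            a₁ = At (∂s σ (∂a c)) p t
            b₁ = At (∂s σ (∂b σ c)) p t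
            a₂ = At (∂s σ (∂s σ (∂a c))) p t
            b₂ = At (∂s σ (∂s σ (∂b σ c))) p t
            aa = At (∂a (∂a c)) p t
            ab = At (∂a (∂b σ c)) p t
            bb = At (∂b σ (∂b σ c)) p t
            s≢0 : s ≢ 0#
            s≢0 e = Hit.transversal h (x-y≡0⇒x≡y e)
            move : ∀ d → At d q t′ ≡ At d p t
            move d = sym (At-hit d h)
            ss0 : At (∂s σ (∂s σ c)) p t ≡ 0#
            ss0 = Van-∂ (∂-Box _ _ _ box) p ∂s-van t
            sss0 : At (∂s σ (∂s σ (∂s σ c))) p t ≡ 0#
            sss0 = Van-∂ (∂-Box _ _ _ (∂-Box _ _ _ box)) p (Van-∂ (∂-Box _ _ _ box) p ∂s-van) t
            first : s * (s * s * aa - s * (ab + ab) + (bb + (a₁ + a₁))) - (b₁ + b₁) ≡ 0#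
            first = *-zero-product (begin
              s * (s * (s * s * aa - s * (ab + ab) + (bb + (a₁ + a₁))) - (b₁ + b₁))
                ≡⟨ solve 3 (λ s x y → s :* (s :* x :- y) := s :* s :* x :- s :* y :+ :0) refl s _ _ ⟩
              s * s * (s * s * aa - s * (ab + ab) + (bb + (a₁ + a₁))) - s * (b₁ + b₁) + 0#
                ≡⟨ cong (s * s * (s * s * aa - s * (ab + ab) + (bb + (a₁ + a₁))) - s * (b₁ + b₁) +_) (sym ss0) ⟩
              s * s * (s * s * aa - s * (ab + ab) + (bb + (a₁ + a₁))) - s * (b₁ + b₁) + At (∂s σ (∂s σ c)) p t
                ≡⟨ sym (At-turn₂ σ s c p t) ⟩
              At (∂s (σ + s) (∂s (σ + s) c)) p t ≡⟨ cong (λ τ → At (∂s τ (∂s τ c)) p t) (turn σ τ) ⟩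
              At (∂s τ (∂s τ c)) p t ≡⟨ contact₂ (Rich.van rich) h ⟩
              0# ∎) s≢0
            turn-at : ∀ d → At (∂s τ d) q t′ ≡ s * s * At (∂a d) p t - s * At (∂b σ d) p t + At (∂s σ d) p t
            turn-at d = trans (move (∂s τ d)) (trans (cong (λ τ → At (∂s τ d) p t) (sym (turn σ τ))) (At-turn σ s d p t))
            commute₂ : ∀ u v w → At (∂[ u , v , w ] (∂s σ (∂s σ c))) p t ≡ At (∂s σ (∂s σ (∂[ u , v , w ] c))) p t
            commute₂ u v w = trans (At-comm u v w _ _ _ (∂s σ c) p t) (At-cong (∂-cong _ _ _ (∂-comm u v w _ _ _ c)) p t)
            -- The identity `derivative` on `q`, carried to the common point and expanded in the
            -- frame of `p`. The third derivative along `p` drops out because `c` vanishes on `p`.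
            second : a₀ * (s * s * a₂ - s * b₂) ≡ (b₁ + b₁) * ((s * s * ab - s * bb + b₁) - s * (s * s * aa - s * ab + a₁))
            second = begin
              a₀ * (s * s * a₂ - s * b₂) ≡⟨ cong (a₀ *_) (sym (+-identityʳ _)) ⟩
              a₀ * (s * s * a₂ - s * b₂ + 0#)
                ≡⟨ cong (a₀ *_) (sym (trans (turn-at (∂s σ (∂s σ c))) (cong₂ _+_ (cong₂ (λ x y → s * s * x - s * y) (commute₂ _ _ _) (commute₂ _ _ _)) sss0))) ⟩
              a₀ * At (∂s τ (∂s σ (∂s σ c))) q t′ ≡⟨ cong (_* At (∂s τ (∂s σ (∂s σ c))) q t′) (sym (move (∂a c))) ⟩
              At (∂a c) q t′ * At (∂s τ (∂s σ (∂s σ c))) q t′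
                ≡⟨ derivative rich t′ (trans (eval-e t′) (trans (cong₂ (λ x y → x - s * y) (move (∂b σ c)) (move (∂a c))) (x≡y⇒x-y≡0 (tangent (Rich.van rich) h))))
                     (trans (move (∂s σ (∂s σ c))) ss0) (λ e → a≢0 (trans (sym (move (∂a c))) e)) ⟩
              (At (∂s σ (∂b σ c)) q t′ + At (∂s σ (∂b σ c)) q t′) * (At (∂s τ (∂b σ c)) q t′ - s * At (∂s τ (∂a c)) q t′)
                ≡⟨ cong₂ _*_ (cong₂ _+_ (move _) (move _)) (cong₂ (λ x y → x - s * y) (turn-at (∂b σ c))
                     (trans (turn-at (∂a c)) (cong (λ z → s * s * aa - s * z + a₁) (At-comm _ _ _ _ _ _ c p t)))) ⟩
              (b₁ + b₁) * ((s * s * ab - s * bb + b₁) - s * (s * s * aa - s * ab + a₁)) ∎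

          module Conclude (ts : List K) (distinct : AllPairs _≢_ ts) (many : 3 ℕ.* B < length ts) (hits : All RichHit ts)
                          (room : suc (2 ℕ.* B) < size) (here : RichHit 0#) (a≢0 : At (∂a c) p 0# ≢ 0#) where
            W≋𝟘 : W ≋ 𝟘
            W≋𝟘 = pw λ n → trans (roots⇒zero (bd W) (cf W) ts (vanish W) (ℕₚ.≤-<-trans deg-W many) distinct (All.map (λ {t} → W-root t) hits) n) (lem n)
              where
              lem : ∀ n → 0# ≡ cf 𝟘 n
              lem zero = refl
              lem (suc n) = refl

            eval-at-0 : ∀ f → eval f 0# ≡ cf f 0
            eval-at-0 f = lem (bd f) (cf f)
              where
              lem : ∀ m f → ev m f 0# ≡ f 0
              lem zero f = refl
              lem (suc m) f = trans (cong (f 0 +_) (zeroˡ _)) (+-identityʳ _)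

            a0 : cf a 0 ≡ At (∂a c) p 0#
            a0 = trans (sym (eval-at-0 a)) (eval-restrict _ p 0#)

            -- The base point is a crossing where `a` is nonzero, and there `b` is `a` times the
            -- nonzero difference of slopes. This provides the initial condition for dividing by
            -- `b`.
            b0≢0 : cf b 0 ≢ 0#
            b0≢0 e = let q , rich , h = here in *-nonzero (λ z → Hit.transversal h (x-y≡0⇒x≡y z)) a≢0
              (trans (sym (tangent (Rich.van rich) h)) (trans (sym (eval-restrict _ p 0#)) (trans (eval-at-0 b) e)))

            -- w = b² (a/b)′ and W = 0 says that (a/b)″ = 0.
            w g₁ g₂ : UPoly
            ν μ : K
            w = δ a ⊗ b ⊖ a ⊗ δ b
            ν = cf w 0 * (inv (cf b 0) * inv (cf b 0))
            μ = cf a 0 * inv (cf b 0)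
            g₁ = w ⊖ constant ν ⊗ (b ⊗ b)
            g₂ = a ⊖ b ⊗ line μ ν

            b/b : cf b 0 * inv (cf b 0) ≡ 1#
            b/b = inverseʳ _ b0≢0

            -- First integration: `W` = 0 turns into g₁′ b = 2 b′ g₁, and `ν` is chosen to make g₁
            -- vanish at 0. Hence b² (a/b)′ = ν b².
            g₁≋𝟘 : g₁ ≋ 𝟘
            g₁≋𝟘 = log-derivative-unique (1# + 1#) g₁ b eq at0 b0≢0 (ℕₚ.≤-<-trans dg (ℕₚ.<-trans (ℕₚ.n<1+n _) room))
              where
              open import Relation.Binary.Reasoning.Setoid PR.setoid renaming (begin_ to begin′_; _∎ to _∎′)
              dg : bd g₁ ≤ 2 ℕ.* B
              dg = deg-⊕ w (⊝ (constant ν ⊗ (b ⊗ b))) {2} {2}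
                (deg-⊕ (δ a ⊗ b) (⊝ (a ⊗ δ b)) {2} {2} (deg-⊗ (δ a) b {1} {1} (deg-restrict _ p) (deg-restrict _ p)) (deg-⊗ a (δ b) {1} {1} (deg-restrict _ p) (deg-restrict _ p)))
                (deg-⊗ (constant ν) (b ⊗ b) {0} {2} z≤n (deg-⊗ b b {1} {1} (deg-restrict _ p) (deg-restrict _ p)))
              at0 : cf g₁ 0 ≡ 0#
              at0 = trans (cong (λ z → cf w 0 - z) (trans (solve 3 (λ w b i → w :* (i :* i) :* (b :* b) := w :* ((b :* i) :* (b :* i))) refl (cf w 0) (cf b 0) (inv (cf b 0)))
                (trans (cong (λ z → cf w 0 * (z * z)) b/b) (trans (cong (cf w 0 *_) (*-identityˡ 1#)) (*-identityʳ _))))) (-‿inverseʳ _)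
              δw : δ w ≋ δ (δ a) ⊗ b ⊖ a ⊗ δ (δ b)
              δw = PR.trans (δ-⊖ (δ a ⊗ b) (a ⊗ δ b)) (PR.trans (⊕-cong (δ-⊗ (δ a) b) (⊝-cong (δ-⊗ a (δ b))))
                (PS.solve 6 (λ a b a₁ b₁ a₂ b₂ → (a₂ PS.:* b PS.:+ a₁ PS.:* b₁) PS.:- (a₁ PS.:* b₁ PS.:+ a PS.:* b₂) PS.:= a₂ PS.:* b PS.:- a PS.:* b₂) PR.refl
                  a b (δ a) (δ b) (δ (δ a)) (δ (δ b))))
              δg₁ : δ g₁ ≋ (δ (δ a) ⊗ b ⊖ a ⊗ δ (δ b)) ⊖ constant ν ⊗ (δ b ⊗ b ⊕ b ⊗ δ b)
              δg₁ = PR.trans (δ-⊖ w (constant ν ⊗ (b ⊗ b))) (⊕-cong δw (⊝-cong (PR.trans (δ-⊗ (constant ν) (b ⊗ b))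
                (PR.trans (⊕-cong (PR.trans (PR.*-congʳ {b ⊗ b} (δ-constant ν)) (PR.zeroˡ (b ⊗ b))) (PR.*-congˡ {constant ν} (δ-⊗ b b))) (PR.+-identityˡ (constant ν ⊗ (δ b ⊗ b ⊕ b ⊗ δ b)))))))
              eq : δ g₁ ⊗ b ≋ constant (1# + 1#) ⊗ (δ b ⊗ g₁)
              eq = begin′
                δ g₁ ⊗ b ≈⟨ PR.*-congʳ {b} δg₁ ⟩
                ((δ (δ a) ⊗ b ⊖ a ⊗ δ (δ b)) ⊖ constant ν ⊗ (δ b ⊗ b ⊕ b ⊗ δ b)) ⊗ b
                  ≈⟨ PS.solve 7 (λ a b a₁ b₁ a₂ b₂ n →
                       ((a₂ PS.:* b PS.:- a PS.:* b₂) PS.:- n PS.:* (b₁ PS.:* b PS.:+ b PS.:* b₁)) PS.:* b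
                       PS.:= (b PS.:* (b PS.:* a₂ PS.:- a PS.:* b₂) PS.:- (b₁ PS.:+ b₁) PS.:* (b PS.:* a₁ PS.:- a PS.:* b₁))
                         PS.:+ (PS.:1 PS.:+ PS.:1) PS.:* (b₁ PS.:* ((a₁ PS.:* b PS.:- a PS.:* b₁) PS.:- n PS.:* (b PS.:* b)))) PR.refl
                       a b (δ a) (δ b) (δ (δ a)) (δ (δ b)) (constant ν) ⟩
                W ⊕ (𝟙 ⊕ 𝟙) ⊗ (δ b ⊗ g₁) ≈⟨ ⊕-cong W≋𝟘 (PR.*-congʳ {δ b ⊗ g₁} (PR.sym (constant-+ 1# 1#))) ⟩
                𝟘 ⊕ constant (1# + 1#) ⊗ (δ b ⊗ g₁) ≈⟨ PR.+-identityˡ (constant (1# + 1#) ⊗ (δ b ⊗ g₁)) ⟩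
                constant (1# + 1#) ⊗ (δ b ⊗ g₁) ∎′

            -- Second integration: with g₁ = 0 the equation is g₂′ b = b′ g₂, so a = b (μ + ν t).
            -- The linear factor raises the degree by one, hence the `suc` in `room`.
            g₂≋𝟘 : g₂ ≋ 𝟘
            g₂≋𝟘 = log-derivative-unique 1# g₂ b eq at0 b0≢0 (ℕₚ.≤-<-trans dg room)
              where
              open import Relation.Binary.Reasoning.Setoid PR.setoid renaming (begin_ to begin′_; _∎ to _∎′)
              L = line μ ν
              dg : bd g₂ ≤ suc (2 ℕ.* B)
              dg = ℕₚ.⊔-lub (ℕₚ.≤-trans (deg-restrict _ p) (ℕₚ.m≤n⇒m≤1+n (ℕₚ.*-monoˡ-≤ B {1} {2} (s≤s z≤n))))
                (ℕₚ.≤-trans (ℕₚ.≤-reflexive (ℕₚ.+-comm (bd b) 1)) (s≤s (ℕₚ.≤-trans (deg-restrict _ p) (ℕₚ.*-monoˡ-≤ B {1} {2} (s≤s z≤n)))))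
              at0 : cf g₂ 0 ≡ 0#
              at0 = trans (cong (λ z → cf a 0 - z) (trans (solve 3 (λ a b i → b :* (a :* i) := a :* (b :* i)) refl (cf a 0) (cf b 0) (inv (cf b 0)))
                (trans (cong (cf a 0 *_) b/b) (*-identityʳ _)))) (-‿inverseʳ _)
              δg₂ : δ g₂ ≋ δ a ⊖ (δ b ⊗ L ⊕ b ⊗ constant ν)
              δg₂ = PR.trans (δ-⊖ a (b ⊗ L)) (PR.+-congˡ {δ a} (⊝-cong (PR.trans (δ-⊗ b L) (PR.+-congˡ {δ b ⊗ L} (PR.*-congˡ {b} (δ-line μ ν))))))
              eq : δ g₂ ⊗ b ≋ constant 1# ⊗ (δ b ⊗ g₂)
              eq = begin′
                δ g₂ ⊗ b ≈⟨ PR.*-congʳ {b} δg₂ ⟩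
                (δ a ⊖ (δ b ⊗ L ⊕ b ⊗ constant ν)) ⊗ b
                  ≈⟨ PS.solve 6 (λ a b a₁ b₁ l n → (a₁ PS.:- (b₁ PS.:* l PS.:+ b PS.:* n)) PS.:* b
                       PS.:= ((a₁ PS.:* b PS.:- a PS.:* b₁) PS.:- n PS.:* (b PS.:* b)) PS.:+ b₁ PS.:* (a PS.:- b PS.:* l)) PR.refl a b (δ a) (δ b) L (constant ν) ⟩
                g₁ ⊕ δ b ⊗ g₂ ≈⟨ ⊕-cong g₁≋𝟘 (PR.sym (PR.*-identityˡ (δ b ⊗ g₂))) ⟩
                𝟘 ⊕ 𝟙 ⊗ (δ b ⊗ g₂) ≈⟨ PR.+-identityˡ (𝟙 ⊗ (δ b ⊗ g₂)) ⟩
                constant 1# ⊗ (δ b ⊗ g₂) ∎′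

            -- Substituting `tangent`, that is b = s a, into a = b (μ + ν t) and cancelling a.
            collinear : ∀ t q → Van c q → Hit p q t → At (∂a c) p t ≢ 0# → (slope q - σ) * (μ + t * ν) ≡ 1#
            collinear t q vq h ne = *-cancelˡ ne (begin
              At (∂a c) p t * ((slope q - σ) * (μ + t * ν))
                ≡⟨ solve 3 (λ a s l → a :* (s :* l) := s :* a :* l) refl _ _ _ ⟩
              (slope q - σ) * At (∂a c) p t * (μ + t * ν) ≡⟨ cong (_* (μ + t * ν)) (sym (tangent vq h)) ⟩
              At (∂b σ c) p t * (μ + t * ν) ≡⟨ sym (eval≡⊗ b (line μ ν) (eval-restrict _ p t) refl) ⟩
              eval (b ⊗ line μ ν) t ≡⟨ sym (x-y≡0⇒x≡y (trans (sym (eval-⊖ a (b ⊗ line μ ν) t)) (eval-cong t g₂≋𝟘))) ⟩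
              eval a t ≡⟨ eval-restrict _ p t ⟩
              At (∂a c) p t ≡⟨ sym (*-identityʳ _) ⟩
              At (∂a c) p t * 1# ∎)

  -- A polynomial vanishing on given lines and smooth along one of them

  module Existence where
    open PrimeField 𝕂
    open Univariate
    open Trivariate
    open Contact₁
    open Solver using (solve; _:+_; _:*_; _:-_; :-_; _:=_; :0; :1)
    open ≡-Reasoning

    elements-complete : ∀ x → x ∈ elements
    elements-complete x = subst (_∈ elements) (Inverse.strictlyInverseʳ index x) (∈-map⁺ (Inverse.from index) (∈-allFin (Inverse.to index x)))

    all-elements? : ∀ {P : K → Set} → (∀ x → Dec (P x)) → Dec (∀ x → P x)
    all-elements? P? = map′ (λ ps x → All.lookup ps (elements-complete x)) (λ f → All.tabulate (λ {x} _ → f x)) (All.all? P? elements)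

    -- Pigeonhole over a finite field in place of linear algebra: size^u vectors have at most size^e
    -- images. For a linear `φ` the difference of the two vectors is a nonzero solution of the
    -- homogeneous system.
    homogeneous-solution : ∀ {u e} → 1 < size → e < u → (φ : (Fin u → K) → Fin e → K) →
      ∃[ v ] ∃[ v′ ] ((∃[ i ] v i ≢ v′ i) × (∀ j → φ v j ≡ φ v′ j))
    homogeneous-solution {u} {e} 1<size e<u φ
      with i , j , i<j , eq ← Finₚ.pigeonhole (ℕₚ.^-monoʳ-< size 1<size e<u)
             (λ n → funToFin (λ k → Inverse.to index (φ (λ l → Inverse.from index (finToFun n l)) k)))
      = vec i , vec j , differ , agree
      where
      vec : Fin (size ℕ.^ u) → Fin u → K
      vec n l = Inverse.from index (finToFun n l)
      agree : ∀ k → φ (vec i) k ≡ φ (vec j) k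
      agree k = begin
        φ (vec i) k ≡⟨ sym (Inverse.strictlyInverseʳ index _) ⟩
        Inverse.from index (Inverse.to index (φ (vec i) k))
          ≡⟨ cong (Inverse.from index) (trans (sym (Finₚ.finToFun-funToFin (λ k → Inverse.to index (φ (vec i) k)) k)) (trans (cong (λ n → finToFun n k) eq) (Finₚ.finToFun-funToFin (λ k → Inverse.to index (φ (vec j) k)) k))) ⟩
        Inverse.from index (Inverse.to index (φ (vec j) k)) ≡⟨ Inverse.strictlyInverseʳ index _ ⟩
        φ (vec j) k ∎
      differ : ∃[ l ] vec i l ≢ vec j l
      differ with Finₚ.any? (λ l → ¬? (vec i l ≟ vec j l))
      ... | yes p = p
      ... | no all = contradiction (trans (sym (Finₚ.funToFin-finToFin {u} i)) (trans (funToFin-cong same) (Finₚ.funToFin-finToFin {u} j))) (Finₚ.<⇒≢ i<j)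
        where
        funToFin-cong : ∀ {m n} {f g : Fin m → Fin n} → (∀ i → f i ≡ g i) → funToFin f ≡ funToFin g
        funToFin-cong {zero} e = refl
        funToFin-cong {suc m} e = cong₂ Fin.combine (e Fin.zero) (funToFin-cong (e ∘ Fin.suc))
        same : ∀ l → finToFun i l ≡ finToFun j l
        same l with vec i l ≟ vec j l
        ... | no ne = contradiction (l , ne) all
        ... | yes e = trans (sym (Inverse.strictlyInverseˡ index _)) (trans (cong (Inverse.to index) e) (Inverse.strictlyInverseˡ index _))

    module Polynomials (D : ℕ) where
      open AtDegree D

      N = suc D

      extend : (Fin (N ℕ.* (N ℕ.* N)) → K) → Coef
      extend v i j k with i ℕ.<? N | j ℕ.<? N | k ℕ.<? N
      ... | yes p | yes q | yes r = v (Fin.combine (fromℕ< p) (Fin.combine (fromℕ< q) (fromℕ< r)))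
      ... | _ | _ | _ = 0#

      extend-Box : ∀ v → Box D (extend v)
      extend-Box v = record { inX = inX ; inY = inY ; inZ = inZ }
        where
        inX : ∀ i j k → D < i → extend v i j k ≡ 0#
        inX i j k lt with i ℕ.<? N | j ℕ.<? N | k ℕ.<? N
        ... | yes (s≤s p) | _ | _ = contradiction lt (ℕₚ.≤⇒≯ p)
        ... | no _ | _ | _ = refl
        inY : ∀ i j k → D < j → extend v i j k ≡ 0#
        inY i j k lt with i ℕ.<? N | j ℕ.<? N | k ℕ.<? N
        ... | _ | yes (s≤s p) | _ = contradiction lt (ℕₚ.≤⇒≯ p)
        ... | yes _ | no _ | _ = refl
        ... | no _ | no _ | _ = refl
        inZ : ∀ i j k → D < k → extend v i j k ≡ 0#
        inZ i j k lt with i ℕ.<? N | j ℕ.<? N | k ℕ.<? N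
        ... | _ | _ | yes (s≤s p) = contradiction lt (ℕₚ.≤⇒≯ p)
        ... | yes _ | yes _ | no _ = refl
        ... | yes _ | no _ | no _ = refl
        ... | no _ | _ | no _ = refl

      extend-value : ∀ v i j k → extend v (toℕ i) (toℕ j) (toℕ k) ≡ v (Fin.combine i (Fin.combine j k))
      extend-value v i j k with toℕ i ℕ.<? N | toℕ j ℕ.<? N | toℕ k ℕ.<? N
      ... | yes p | yes q | yes r = cong v (cong₂ Fin.combine (Finₚ.fromℕ<-toℕ i p) (cong₂ Fin.combine (Finₚ.fromℕ<-toℕ j q) (Finₚ.fromℕ<-toℕ k r)))
      ... | no p | _ | _ = contradiction (Finₚ.toℕ<n i) p
      ... | yes _ | no p | _ = contradiction (Finₚ.toℕ<n j) p
      ... | yes _ | yes _ | no p = contradiction (Finₚ.toℕ<n k) p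

      Nonzero : Coef → Set
      Nonzero c = ∃[ i ] ∃[ j ] ∃[ k ] c i j k ≢ 0#

      coefficients : (T : List Line) → (Fin (N ℕ.* (N ℕ.* N)) → K) → Fin (length T ℕ.* suc B) → K
      coefficients T v n = let ℓ , d = Fin.remQuot {length T} (suc B) n in cf (restrict (extend v) (lookup T ℓ)) (toℕ d)

      interpolation : 1 < size → (T : List Line) → length T ℕ.* suc B < N ℕ.* (N ℕ.* N) →
        ∃[ c ] (Box D c × Nonzero c × All (Van c) T)
      interpolation 1<size T lt
        with v , v′ , (l , ne) , agree ← homogeneous-solution 1<size lt (coefficients T)
           with i , jk , eq₁ ← Finₚ.combine-surjective {N} {N ℕ.* N} l
           with j , k , eq₂ ← Finₚ.combine-surjective {N} {N} jk
        = c , box , (toℕ i , toℕ j , toℕ k , nonzero) , van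
        where
        c : Coef
        -- The difference of the two solutions, written with three terms so that `val-linear`
        -- applies to it.
        c i j k = 1# * extend v i j k + - 1# * extend v′ i j k + 0# * extend v i j k
        diff : ∀ x y z → 1# * x + - 1# * y + 0# * z ≡ x - y
        diff = solve 3 (λ x y z → :1 :* x :+ :- :1 :* y :+ :0 :* z := x :- y) refl
        box : Box D c
        box = record
          { inX = λ i j k lt → zz (Box.inX bv i j k lt) (Box.inX bv′ i j k lt)
          ; inY = λ i j k lt → zz (Box.inY bv i j k lt) (Box.inY bv′ i j k lt)
          ; inZ = λ i j k lt → zz (Box.inZ bv i j k lt) (Box.inZ bv′ i j k lt) }
          where
          bv = extend-Box v
          bv′ = extend-Box v′
          zz : ∀ {x y z} → x ≡ 0# → y ≡ 0# → 1# * x + - 1# * y + 0# * z ≡ 0#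
          zz {z = z} refl refl = trans (diff 0# 0# z) (-‿inverseʳ 0#)
        nonzero : c (toℕ i) (toℕ j) (toℕ k) ≢ 0#
        nonzero e = ne (trans (sym (ex v)) (trans (x-y≡0⇒x≡y (trans (sym (diff _ _ _)) e)) (ex v′)))
          where
          ex : ∀ v → extend v (toℕ i) (toℕ j) (toℕ k) ≡ v l
          ex v = trans (extend-value v i j k) (cong v (trans (cong (Fin.combine i) eq₂) eq₁))
        same : ∀ ℓ n → cf (restrict (extend v) (lookup T ℓ)) n ≡ cf (restrict (extend v′) (lookup T ℓ)) n
        same ℓ n with n ℕ.<? suc B
        ... | no ¬lt = trans (vanish (restrict (extend v) (lookup T ℓ)) n (ℕₚ.≤-<-trans (OnLine.bd-restrict (lookup T ℓ) _) (ℕₚ.≰⇒> (¬lt ∘ s≤s))))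
                         (sym (vanish (restrict (extend v′) (lookup T ℓ)) n (ℕₚ.≤-<-trans (OnLine.bd-restrict (lookup T ℓ) _) (ℕₚ.≰⇒> (¬lt ∘ s≤s)))))
        ... | yes p = trans (sym (φv v)) (trans (agree (Fin.combine ℓ (fromℕ< p))) (φv v′))
          where
          φv : ∀ v → coefficients T v (Fin.combine ℓ (fromℕ< p)) ≡ cf (restrict (extend v) (lookup T ℓ)) n
          φv v = trans (cong (λ (ℓ , d) → cf (restrict (extend v) (lookup T ℓ)) (toℕ d)) (Finₚ.remQuot-combine {length T} {suc B} ℓ (fromℕ< p)))
            (cong (cf (restrict (extend v) (lookup T ℓ))) (Finₚ.toℕ-fromℕ< p))
        van′ : ∀ ℓ → Van c (lookup T ℓ)
        van′ ℓ t = begin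
          At c (lookup T ℓ) t ≡⟨ val-linear 1# (- 1#) 0# (extend v) (extend v′) (extend v) (px (lookup T ℓ) t) (py (lookup T ℓ) t) (pz (lookup T ℓ) t) ⟩
          1# * At (extend v) (lookup T ℓ) t + - 1# * At (extend v′) (lookup T ℓ) t + 0# * At (extend v) (lookup T ℓ) t ≡⟨ diff _ _ _ ⟩
          At (extend v) (lookup T ℓ) t - At (extend v′) (lookup T ℓ) t
            ≡⟨ x≡y⇒x-y≡0 (trans (sym (eval-restrict (extend v) (lookup T ℓ) t)) (trans (eval-cong {restrict (extend v) (lookup T ℓ)} {restrict (extend v′) (lookup T ℓ)} t (pw (same ℓ))) (eval-restrict (extend v′) (lookup T ℓ) t))) ⟩
          0# ∎
        van : All (Van c) T
        van = All.tabulate λ {ℓ} ℓ∈T → subst (Van c) (sym (Anyₚ.lookup-index ℓ∈T)) (van′ (Any.index ℓ∈T))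

      ∂y : Coef → Coef
      ∂y = ∂[ 0# , 1# , 0# ]

      -- Two partial derivatives decide whether the gradient vanishes: along a line on which `c` is
      -- zero so is the derivative in direction (σ², -σ, 1), which expresses the third through these
      -- two.
      Smooth : Coef → Line → Set
      Smooth c ℓ = ¬ (Van (∂a c) ℓ × Van (∂y c) ℓ)

      Flat? : ∀ c ℓ → Dec (Van (∂a c) ℓ × Van (∂y c) ℓ)
      Flat? c ℓ = all-elements? (λ t → At (∂a c) ℓ t ≟ 0#) ×-dec all-elements? (λ t → At (∂y c) ℓ t ≟ 0#)

      find-nonzero : ∀ {c} → Box D c → Nonzero c ⊎ (∀ i j k → c i j k ≡ 0#)
      find-nonzero {c} box with Finₚ.any? {N} (λ i → Finₚ.any? {N} λ j → Finₚ.any? {N} λ k → ¬? (c (toℕ i) (toℕ j) (toℕ k) ≟ 0#))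
      ... | yes (i , j , k , ne) = inj₁ (toℕ i , toℕ j , toℕ k , ne)
      ... | no none = inj₂ zeros
        where
        open Box box
        zeros : ∀ i j k → c i j k ≡ 0#
        zeros i j k with i ℕ.<? N | j ℕ.<? N | k ℕ.<? N
        ... | no p | _ | _ = inX i j k (ℕₚ.≰⇒> (p ∘ s≤s))
        ... | yes _ | no p | _ = inY i j k (ℕₚ.≰⇒> (p ∘ s≤s))
        ... | yes _ | yes _ | no p = inZ i j k (ℕₚ.≰⇒> (p ∘ s≤s))
        ... | yes p | yes q | yes r with c i j k ≟ 0#
        ...   | yes e = e
        ...   | no ne = contradiction (fromℕ< p , fromℕ< q , fromℕ< r ,
                  subst (λ a → c a (toℕ (fromℕ< q)) (toℕ (fromℕ< r)) ≢ 0#) (sym (Finₚ.toℕ-fromℕ< p))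
                    (subst (λ a → c i a (toℕ (fromℕ< r)) ≢ 0#) (sym (Finₚ.toℕ-fromℕ< q)) (subst (λ a → c i j a ≢ 0#) (sym (Finₚ.toℕ-fromℕ< r)) ne))) none

      -- A polynomial in z alone that vanishes on one line vanishes for every z, since z runs
      -- through the whole field along the line; with degree below `size` it is zero.
      depends-on-XY : D < size → ∀ {c ℓ} → Box D c → Nonzero c → Van c ℓ →
        (∀ i j k → c (suc i) j k ≡ 0#) → (∀ i j k → c i (suc j) k ≡ 0#) → ⊥
      depends-on-XY D<size {c} {ℓ} box (i , j , k , ne) van noX noY = ne (zeros i j k)
        where
        first-term : ∀ m {f} x → (∀ i → f (suc i) ≡ 0#) → ev m f x ≡ f 0
        first-term zero x e = refl
        first-term (suc m) {f} x e = trans (cong (f 0 +_) (trans (cong (x *_) (ev-zero m x e)) (zeroʳ x))) (+-identityʳ _)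
        value : ∀ z → ev D (c 0 0) z ≡ 0#
        value z = begin
          ev D (c 0 0) z ≡⟨ cong (ev D (c 0 0)) (solve 2 (λ z z₀ → z := z₀ :+ (z :- z₀) :* :1) refl z (z₀ ℓ)) ⟩
          ev D (c 0 0) (pz ℓ t) ≡⟨ sym (first-term D (py ℓ t) (λ j → ev-zero D (pz ℓ t) (λ k → noY 0 j k))) ⟩
          ev D (λ j → ev D (c 0 j) (pz ℓ t)) (py ℓ t) ≡⟨ sym (first-term D (px ℓ t) (λ i → ev-zero D (py ℓ t) (λ j → ev-zero D (pz ℓ t) (λ k → noX i j k)))) ⟩
          At c ℓ t ≡⟨ van t ⟩
          0# ∎
          where t = z - z₀ ℓ
        zeros : ∀ i j k → c i j k ≡ 0#
        zeros zero zero k = roots⇒zero D (c 0 0) elements (λ n lt → Box.inZ box 0 0 n lt) (subst (D <_) (sym elements-length) D<size) elements-distinct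
          (All.tabulate (λ {z} _ → value z)) k
        zeros (suc i) j k = noX i j k
        zeros zero (suc j) k = noY 0 j k

      -- As long as the gradient vanishes along all lines, a nonzero partial derivative inherits the
      -- vanishing and replaces `c`. The joint degree in X and Y, bounded by `m`, drops each time.
      -- `D < size` ensures that differentiation kills no monomial that contains the variable.
      descent : D < size → ∀ m c {ℓ₀ T} → (∀ i j k → m < i ℕ.+ j → c i j k ≡ 0#) → Box D c → Nonzero c → All (Van c) (ℓ₀ ∷ T) →
        ∃[ c′ ] (Box D c′ × All (Van c′) (ℓ₀ ∷ T) × Any (Smooth c′) (ℓ₀ ∷ T))
      descent D<size m c {ℓ₀} {T} small box nz van with All.all? (Flat? c) (ℓ₀ ∷ T)
      ... | no ¬flat = c , box , van , Allₚ.¬All⇒Any¬ (Flat? c) (ℓ₀ ∷ T) ¬flat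
      ... | yes flat with find-nonzero (∂-Box 1# 0# 0# box) | find-nonzero (∂-Box 0# 1# 0# box)
      ...   | inj₂ zx | inj₂ zy = ⊥-elim (depends-on-XY D<size box nz (All.head van) noX noY)
        where
        open Box box
        noX : ∀ i j k → c (suc i) j k ≡ 0#
        noX i j k with suc i ℕ.≤? D
        ... | no p = inX (suc i) j k (ℕₚ.≰⇒> p)
        ... | yes p = *-zero-product (trans (solve 3 (λ x y z → x := :1 :* x :+ :0 :* y :+ :0 :* z) refl _ _ _) (zx i j k)) (nat≢0 i (ℕₚ.≤-<-trans p D<size))
        noY : ∀ i j k → c i (suc j) k ≡ 0#
        noY i j k with suc j ℕ.≤? D
        ... | no p = inY i (suc j) k (ℕₚ.≰⇒> p)
        ... | yes p = *-zero-product (trans (solve 3 (λ x y z → x := :0 :* y :+ :1 :* x :+ :0 :* z) refl _ _ _) (zy i j k)) (nat≢0 j (ℕₚ.≤-<-trans p D<size))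
      descent D<size zero c small box nz van | yes flat | inj₁ (i , j , k , ne) | _ = ⊥-elim (ne (trans
        (cong₂ _+_ (cong₂ _+_ (cong (λ x → 1# * (nat (suc i) * x)) (small (suc i) j k (s≤s z≤n))) (zeroˡ _)) (zeroˡ _))
        (solve 1 (λ n → :1 :* (n :* :0) :+ :0 :+ :0 := :0) refl (nat (suc i)))))
      descent D<size (suc m) c small box nz van | yes flat | inj₁ nz′ | _ =
        descent D<size m (∂a c) (λ i j k lt → trans
          (cong₂ _+_ (cong₂ _+_ (cong (λ x → 1# * (nat (suc i) * x)) (small (suc i) j k (s≤s lt))) (zeroˡ _)) (zeroˡ _))
          (solve 1 (λ n → :1 :* (n :* :0) :+ :0 :+ :0 := :0) refl (nat (suc i)))) (∂-Box 1# 0# 0# box) nz′ (All.map proj₁ flat)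
      descent D<size zero c small box nz van | yes flat | inj₂ _ | inj₁ (i , j , k , ne) = ⊥-elim (ne (trans
        (cong₂ _+_ (cong₂ _+_ (zeroˡ _) (cong (λ x → 1# * (nat (suc j) * x)) (small i (suc j) k (subst (0 <_) (sym (ℕₚ.+-suc i j)) (s≤s z≤n))))) (zeroˡ _))
        (solve 1 (λ n → :0 :+ :1 :* (n :* :0) :+ :0 := :0) refl (nat (suc j)))))
      descent D<size (suc m) c small box nz van | yes flat | inj₂ _ | inj₁ nz′ =
        descent D<size m (∂y c) (λ i j k lt → trans
          (cong₂ _+_ (cong₂ _+_ (zeroˡ _) (cong (λ x → 1# * (nat (suc j) * x)) (small i (suc j) k (subst (suc m <_) (sym (ℕₚ.+-suc i j)) (s≤s lt))))) (zeroˡ _))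
          (solve 1 (λ n → :0 :+ :1 :* (n :* :0) :+ :0 := :0) refl (nat (suc j)))) (∂-Box 0# 1# 0# box) nz′ (All.map proj₂ flat)

  -- A linear relation between the lines crossing a smooth line

  module Cores where
    open PrimeField 𝕂
    open Univariate
    open Trivariate
    open Contact₁
    open Existence
    open Solver using (solve; _:+_; _:*_; _:-_; :-_; _:=_; :0; :1)
    open ≡-Reasoning

    Triple : Set
    Triple = K × K × K

    σ-of β-of γ-of : Triple → K
    σ-of (σ , β , γ) = σ
    β-of (σ , β , γ) = β
    γ-of (σ , β , γ) = γ

    -- The coordinate z is the parameter, so two such lines can meet only at equal parameters.
    -- Eliminating t from the other two coordinates leaves γ′ + σ β′ = γ + σ′ β, the relation `Adj`
    -- below.
    toLine : Triple → Line
    toLine (σ , β , γ) = mkLine (γ - σ * β) β 0# σ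

    record Meets (p q : Triple) (t : K) : Set where
      field
        transversal : σ-of q ≢ σ-of p
        eqx : px (toLine p) t ≡ px (toLine q) t
        eqy : py (toLine p) t ≡ py (toLine q) t

    meets⇒hit : ∀ {p q t} → Meets p q t → Hit (toLine p) (toLine q) t
    meets⇒hit {t = t} m = record { t′ = t ; eqx = eqx ; eqy = eqy ; eqz = refl ; transversal = transversal }
      where open Meets m

    -- Vertices are kept apart from their position in space, because the two sides of the incidence
    -- graph are sheared differently. `Nb` travels with each crossing so that its combinatorial
    -- adjacency is still known when the linear relation has been found.
    module CoreContradiction (V : Set) (triple : V → Triple) (D h : ℕ) (p₀ : V) (T₀ : List V) (Nb : V → V → Set) where
      open AtDegree D
      open Polynomials D using (interpolation; descent; ∂y; Smooth)
      T = p₀ ∷ T₀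

      private
        sl be : V → K
        sl = σ-of ∘ triple
        be = β-of ∘ triple
        lineOf : V → Line
        lineOf = toLine ∘ triple

      HitList : V → Set
      HitList p = ∃[ ts ] (AllPairs _≢_ ts × h < length ts × All (λ t → ∃[ q ] (q ∈ T × Nb p q × Meets (triple p) (triple q) t)) ts)

      module _ (1<size : 1 < size) (room : suc (2 ℕ.* B) < size) (unknowns : length T ℕ.* suc B < suc D ℕ.* (suc D ℕ.* suc D))
               (5B≤h : 5 ℕ.* B ≤ h) (rich : All HitList T) where

        B<size : B < size
        B<size = ℕₚ.≤-<-trans (ℕₚ.m≤m+n B _) (ℕₚ.<-trans (ℕₚ.n<1+n _) room)

        D<size : D < size
        D<size = ℕₚ.≤-<-trans (ℕₚ.m≤m+n D _) B<size

        polynomial : ∃[ c ] (Box D c × All (Van c) (map lineOf T) × Any (Smooth c) (map lineOf T))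
        polynomial = let c , box , nz , van = interpolation 1<size (map lineOf T) unknowns′
                     in descent D<size (D ℕ.+ D) c (small c box) box nz van
          where
          unknowns′ : length (map lineOf T) ℕ.* suc B < suc D ℕ.* (suc D ℕ.* suc D)
          unknowns′ = ℕₚ.≤-<-trans (ℕₚ.≤-reflexive (cong (ℕ._* suc B) (Listₚ.length-map lineOf T))) unknowns
          small : ∀ c → Box D c → ∀ i j k → D ℕ.+ D < i ℕ.+ j → c i j k ≡ 0#
          small c box i j k lt with i ℕ.≤? D
          ... | no i>D = Box.inX box i j k (ℕₚ.≰⇒> i>D)
          ... | yes i≤D = Box.inY box i j k (ℕₚ.≰⇒> (λ j≤D → ℕₚ.<⇒≱ lt (ℕₚ.+-mono-≤ i≤D j≤D)))

        record Collinear (p : V) : Set where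
          field
            μ ν κ : K
            nontrivial : ¬ (μ ≡ 0# × ν ≡ 0#)
            many : List K
            distinct : AllPairs _≢_ many
            -- Up to `B` crossings are given up, those where the derivative `∂a c` vanishes on the
            -- line.
            covers : h < length many ℕ.+ B
            on : All (λ t → ∃[ q ] (q ∈ T × Nb p q × Meets (triple p) (triple q) t × μ * sl q + ν * be q ≡ κ)) many

        private
          module Fix (c : Coef) (box : Box D c) (vans : All (Van c) (map lineOf T)) where
            open Vanishing B<size c box

            van : ∀ {q} → q ∈ T → Van c (lineOf q)
            van q∈T = All.lookup (Allₚ.map⁻ vans) q∈T

            richLine : ∀ {q} → q ∈ T → Rich 5 (lineOf q)
            richLine {q} q∈T = let ts , distinct , many , hits = All.lookup rich q∈T in record
              { van = van q∈T ; ts = ts ; distinct = distinct ; many = ℕₚ.≤-<-trans 5B≤h many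
              ; hits = All.map (λ (r , r∈T , _ , m) → lineOf r , van r∈T , meets⇒hit m) hits }

            module At-p (p : V) (p∈T : p ∈ T) (smooth : Smooth c (lineOf p)) (ts : List K) (distinct : AllPairs _≢_ ts)
                        (many : h < length ts) (hits : All (λ t → ∃[ q ] (q ∈ T × Nb p q × Meets (triple p) (triple q) t)) ts) where
              ℓ = lineOf p
              open AtLine ℓ (van p∈T) using (tangent)

              vanishes : ∀ {d} ts → AllPairs _≢_ ts → B < length ts → All (λ t → At d ℓ t ≡ 0#) ts → Van d ℓ
              vanishes {d} ts distinct many zeros t = trans (sym (eval-restrict d ℓ t)) (trans (ev-zero (bd f) t
                  (roots⇒zero (bd f) (cf f) ts (vanish f) (ℕₚ.≤-<-trans (OnLine.bd-restrict ℓ d) many) distinct (All.map (λ {u} e → trans (eval-restrict d ℓ u) e) zeros))) refl)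
                where f = restrict d ℓ

              -- If a vanished at all crossings, so would b = s a. Having more than `B` zeros both
              -- would vanish along the whole line, and so would `∂y c`, against smoothness.
              no-singular : ¬ Any (λ t → At (∂a c) ℓ t ≢ 0#) ts → ⊥
              no-singular none = smooth (vanishes ts distinct B<ts a-zero , λ t → begin
                  At (∂y c) ℓ t ≡⟨ val-cong _ _ _ (λ i j k → solve 4 (λ σ x y z → :0 :* x :+ :1 :* y :+ :0 :* z
                      := :1 :* ((:- (σ :+ σ)) :* x :+ :1 :* y :+ :0 :* z) :+ (σ :+ σ) :* (:1 :* x :+ :0 :* y :+ :0 :* z) :+ :0 :* x) refl (sl p) (∂X c i j k) (∂Y c i j k) (∂Z c i j k)) ⟩
                  At (λ i j k → 1# * ∂b (sl p) c i j k + (sl p + sl p) * ∂a c i j k + 0# * ∂X c i j k) ℓ t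
                    ≡⟨ val-linear 1# (sl p + sl p) 0# (∂b (sl p) c) (∂a c) (∂X c) _ _ _ ⟩
                  1# * At (∂b (sl p) c) ℓ t + (sl p + sl p) * At (∂a c) ℓ t + 0# * At (∂X c) ℓ t
                    ≡⟨ cong₂ (λ x y → 1# * x + (sl p + sl p) * y + 0# * At (∂X c) ℓ t) (vanishes ts distinct B<ts b-zero t) (vanishes ts distinct B<ts a-zero t) ⟩
                  1# * 0# + (sl p + sl p) * 0# + 0# * At (∂X c) ℓ t ≡⟨ solve 2 (λ x y → :1 :* :0 :+ x :* :0 :+ :0 :* y := :0) refl (sl p + sl p) (At (∂X c) ℓ t) ⟩
                  0# ∎)
                where
                B<ts : B < length ts
                B<ts = ℕₚ.≤-<-trans (ℕₚ.≤-trans (ℕₚ.m≤m+n B _) 5B≤h) many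
                a-zero : All (λ t → At (∂a c) ℓ t ≡ 0#) ts
                a-zero = All.tabulate λ {t} t∈ts → decidable-stable (At (∂a c) ℓ t ≟ 0#) (λ ne → none (lose t∈ts ne))
                b-zero : All (λ t → At (∂b (sl p) c) ℓ t ≡ 0#) ts
                b-zero = All.zipWith (λ { {t} (a0 , q , q∈T , _ , m) → trans (tangent (van q∈T) (meets⇒hit m)) (trans (cong ((sl q - sl p) *_) a0) (zeroʳ _)) }) (a-zero , hits)
              smooth-at : ∀ t₁ → t₁ ∈ ts → At (∂a c) ℓ t₁ ≢ 0# → Collinear p
              smooth-at t₁ t₁∈ts a≢0 = record
                  { μ = μ - t₁ * ν ; ν = ν ; κ = 1# + ((μ - t₁ * ν) * sl p + ν * be p)
                  ; nontrivial = nontrivial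
                  ; many = filter nonzero? ts
                  ; distinct = AllPairsₚ.filter⁺ nonzero? distinct
                  ; covers = ℕₚ.<-≤-trans many (ℕₚ.≤-trans (ℕₚ.≤-reflexive (trans (length-filter-complement zero? ts) (ℕₚ.+-comm (length (filter zero? ts)) _)))
                      (ℕₚ.+-monoʳ-≤ (length (filter nonzero? ts)) few-zeros))
                  ; on = All.zipWith (λ { {t} (ne , q , q∈T , nb , m) → q , q∈T , nb , m , relation t q q∈T m ne }) (Allₚ.all-filter nonzero? ts , Allₚ.filter⁺ nonzero? hits)
                  }
                where
                zero? : ∀ t → Dec (At (∂a c) ℓ t ≡ 0#)
                zero? t = At (∂a c) ℓ t ≟ 0#
                nonzero? : ∀ t → Dec (At (∂a c) ℓ t ≢ 0#)
                nonzero? t = ¬? (zero? t)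
                few-zeros : length (filter zero? ts) ≤ B
                few-zeros = ℕₚ.≮⇒≥ λ lt → a≢0 (vanishes (filter zero? ts) (AllPairsₚ.filter⁺ zero? distinct) lt (Allₚ.all-filter zero? ts) t₁)
                -- The same line based at a crossing where a is nonzero, because `Conclude` wants
                -- such a point at parameter 0.
                ℓ₁ : Line
                ℓ₁ = mkLine (px ℓ t₁) (py ℓ t₁) (pz ℓ t₁) (sl p)
                reb : ∀ x d t → x + t₁ * d + (t - t₁) * d ≡ x + t * d
                reb x d t = solve 4 (λ x d t t₁ → x :+ t₁ :* d :+ (t :- t₁) :* d := x :+ t :* d) refl x d t t₁
                rebase : ∀ d t → At d ℓ₁ (t - t₁) ≡ At d ℓ t
                rebase d t = trans (cong (λ x → val d x (py ℓ₁ (t - t₁)) (pz ℓ₁ (t - t₁))) (reb _ _ t)) (cong₂ (val d _) (reb _ _ t) (reb _ _ t))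
                hit₁ : ∀ {q t} → Meets (triple p) (triple q) t → Hit ℓ₁ (lineOf q) (t - t₁)
                hit₁ {q} {t} m = record { t′ = t ; eqx = trans (reb _ _ t) (Meets.eqx m) ; eqy = trans (reb _ _ t) (Meets.eqy m) ; eqz = reb _ _ t ; transversal = Meets.transversal m }
                van₁ : Van c ℓ₁
                van₁ u = trans (cong (At c ℓ₁) (solve 2 (λ u t → u := u :+ t :- t) refl u t₁)) (trans (rebase c (u + t₁)) (van p∈T (u + t₁)))
                open AtLine ℓ₁ van₁ using (RichHit; module Conclude)
                hits₁ : All RichHit (map (_- t₁) ts)
                hits₁ = Allₚ.map⁺ (All.map (λ (q , q∈T , _ , m) → lineOf q , richLine q∈T , hit₁ m) hits)
                distinct₁ : AllPairs _≢_ (map (_- t₁) ts)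
                distinct₁ = AllPairsₚ.map⁺ (AllPairs.map (λ {x} {y} ne e → ne (trans (solve 2 (λ x t → x := x :- t :+ t) refl x t₁) (trans (cong (_+ t₁) e) (solve 2 (λ x t → x :- t :+ t := x) refl y t₁)))) distinct)
                here₁ : RichHit 0#
                here₁ = subst RichHit (-‿inverseʳ t₁) (let q , q∈T , _ , m = All.lookup hits t₁∈ts in lineOf q , richLine q∈T , hit₁ m)
                a≢0₁ : At (∂a c) ℓ₁ 0# ≢ 0#
                a≢0₁ e = a≢0 (trans (sym (trans (cong (At (∂a c) ℓ₁) (sym (-‿inverseʳ t₁))) (rebase (∂a c) t₁))) e)
                many₁ : 3 ℕ.* B < length (map (_- t₁) ts)
                many₁ = subst (3 ℕ.* B <_) (sym (Listₚ.length-map (_- t₁) ts)) (ℕₚ.≤-<-trans (ℕₚ.*-monoˡ-≤ B {3} {5} (s≤s (s≤s (s≤s z≤n)))) (ℕₚ.≤-<-trans 5B≤h many))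
                open Conclude (map (_- t₁) ts) distinct₁ many₁ hits₁ room here₁ a≢0₁ using (μ; ν; collinear)
                unit : ∀ t q → q ∈ T → Meets (triple p) (triple q) t → At (∂a c) ℓ t ≢ 0# → (sl q - sl p) * (μ + (t - t₁) * ν) ≡ 1#
                unit t q q∈T m ne = collinear (t - t₁) (lineOf q) (van q∈T) (hit₁ m) (λ e → ne (trans (sym (rebase (∂a c) t)) e))
                nontrivial : ¬ (μ - t₁ * ν ≡ 0# × ν ≡ 0#)
                nontrivial (e₁ , e₂) = let q , q∈T , _ , m = All.lookup hits t₁∈ts in 1≢0 (trans (sym (unit t₁ q q∈T m a≢0)) (begin
                  (sl q - sl p) * (μ + (t₁ - t₁) * ν) ≡⟨ solve 4 (λ s m n t → s :* (m :+ (t :- t) :* n) := s :* ((m :- t :* n) :+ t :* n)) refl (sl q - sl p) μ ν t₁ ⟩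
                  (sl q - sl p) * ((μ - t₁ * ν) + t₁ * ν) ≡⟨ cong₂ (λ x y → (sl q - sl p) * (x + t₁ * y)) e₁ e₂ ⟩
                  (sl q - sl p) * (0# + t₁ * 0#) ≡⟨ solve 2 (λ s t → s :* (:0 :+ t :* :0) := :0) refl (sl q - sl p) t₁ ⟩
                  0# ∎))
                -- At the crossing t (σ′ - σ) = β′ - β. This turns the product of t with the slope
                -- difference in `unit` into a difference of offsets and leaves a relation linear in
                -- (σ′, β′).
                relation : ∀ t q → q ∈ T → Meets (triple p) (triple q) t → At (∂a c) ℓ t ≢ 0# → (μ - t₁ * ν) * sl q + ν * be q ≡ 1# + ((μ - t₁ * ν) * sl p + ν * be p)
                relation t q q∈T m ne = begin
                  (μ - t₁ * ν) * sl q + ν * be q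
                    ≡⟨ solve 8 (λ μ ν t₁ t σ σ′ β β′ → (μ :- t₁ :* ν) :* σ′ :+ ν :* β′
                         := (σ′ :- σ) :* (μ :+ (t :- t₁) :* ν) :+ ((μ :- t₁ :* ν) :* σ :+ ν :* β) :+ ν :* ((β′ :+ t :* :- σ′) :- (β :+ t :* :- σ))) refl
                         μ ν t₁ t (sl p) (sl q) (be p) (be q) ⟩
                  (sl q - sl p) * (μ + (t - t₁) * ν) + ((μ - t₁ * ν) * sl p + ν * be p) + ν * (py (lineOf q) t - py (lineOf p) t)
                    ≡⟨ cong₂ (λ x y → x + ((μ - t₁ * ν) * sl p + ν * be p) + ν * y) (unit t q q∈T m ne) (x≡y⇒x-y≡0 (sym (Meets.eqy m))) ⟩
                  1# + ((μ - t₁ * ν) * sl p + ν * be p) + ν * 0# ≡⟨ trans (cong (1# + ((μ - t₁ * ν) * sl p + ν * be p) +_) (zeroʳ ν)) (+-identityʳ _) ⟩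
                  1# + ((μ - t₁ * ν) * sl p + ν * be p) ∎

              result : Collinear p
              result = choose (Any.any? (λ t → ¬? (At (∂a c) ℓ t ≟ 0#)) ts)
                where
                choose : Dec (Any (λ t → At (∂a c) ℓ t ≢ 0#) ts) → Collinear p
                choose (no none) = ⊥-elim (no-singular none)
                choose (yes some) = let t₁ , t₁∈ts , a≢0 = find some in smooth-at t₁ t₁∈ts a≢0

        core : ∃[ p ] (p ∈ T × Collinear p)
        core = let c , box , vans , smooth = polynomial
                   p , p∈T , sm = find (Anyₚ.map⁻ smooth)
                   ts , distinct , many , hits = All.lookup rich p∈T
               in p , p∈T , Fix.At-p.result c box vans p p∈T sm ts distinct many hits

  -- Incidences

  module Incidence where
    open PrimeField 𝕂
    open Univariate
    open Trivariate
    open Existence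
    open Cores
    open Solver using (solve; _:+_; _:*_; _:-_; :-_; _:=_; :0; :1)

    _≟ₜ_ : (p q : Triple) → Dec (p ≡ q)
    _≟ₜ_ = ≡-dec _≟_ (≡-dec _≟_ _≟_)

    Adj : Triple → Triple → Set
    Adj p q = σ-of p ≢ σ-of q × γ-of q + σ-of p * β-of q ≡ γ-of p + σ-of q * β-of p

    adj? : ∀ p q → Dec (Adj p q)
    adj? p q = ¬? (σ-of p ≟ σ-of q) ×-dec (γ-of q + σ-of p * β-of q ≟ γ-of p + σ-of q * β-of p)

    adj-sym : ∀ {p q} → Adj p q → Adj q p
    adj-sym (ne , e) = ne ∘ sym , sym e

    module Star {V : Set} (a : V → ℕ) (pos : V → K) where
      occ : List V → K → ℕ
      occ vs t = ∑ vs (λ v → a v ℕ.* [ pos v ≟ t ])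

      positions : List V → ℕ
      positions vs = ∑ elements (sgn ∘ occ vs)

      collisions : List V → ℕ
      collisions vs = ∑ vs (λ v → ∑ vs (λ w → a v ℕ.* (a w ℕ.* [ pos w ≟ pos v ])))

      degree-occ : ∀ vs → ∑ elements (occ vs) ≡ ∑ vs a
      degree-occ vs = trans (∑-swap elements vs _) (∑-cong vs (λ v →
        trans (∑-cong elements (λ t → ℕₚ.*-comm (a v) _)) (∑-point _≟_ elements-distinct (elements-complete (pos v)) (λ _ → a v))))

      occ-square : ∀ vs → ∑ elements (λ t → occ vs t ℕ.* occ vs t) ≡ collisions vs
      occ-square vs = trans (∑-cong elements (λ t → ∑-product vs vs _ _)) (trans (∑-swap elements vs _) (∑-cong vs (λ v →
        trans (∑-swap elements vs _) (∑-cong vs (λ w → trans (∑-cong elements (λ t → lem (a v) [ pos v ≟ t ] (a w ℕ.* [ pos w ≟ t ])))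
          (∑-point _≟_ elements-distinct (elements-complete (pos v)) (λ t → a v ℕ.* (a w ℕ.* [ pos w ≟ t ]))))))))
        where
        lem : ∀ x y z → x ℕ.* y ℕ.* z ≡ y ℕ.* (x ℕ.* z)
        lem = solve-∀

      -- Cauchy-Schwarz over the crossing points: a large degree at few positions forces many
      -- colliding pairs of neighbours.
      degree² : ∀ vs → ∑ vs a ℕ.* ∑ vs a ≤ positions vs ℕ.* collisions vs
      degree² vs = subst₂ _≤_ (cong₂ ℕ._*_ e₁ e₁) (cong₂ ℕ._*_ (∑-cong elements (λ t → sgn-idem (occ vs t))) (occ-square vs))
        (cauchy-schwarz elements (sgn ∘ occ vs) (occ vs))
        where
        e₁ : ∑ elements (λ t → sgn (occ vs t) ℕ.* occ vs t) ≡ ∑ vs a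
        e₁ = trans (∑-cong elements (λ t → sgn-* (occ vs t))) (degree-occ vs)

    -- At the centre c, the neighbour v is met at the root t of
    -- t (σ c - σ v) = β c - β v - s μ; the shift μ is used to make these
    -- positions distinct.
    module Centre (s : K → K) (s-injective : ∀ {x y} → s x ≡ s y → x ≡ y) (c : Triple) (vs : List Triple) (Δ : ℕ)
                  (multiplicity : ∀ v → ∑ vs (λ w → [ v ≟ₜ w ]) ≤ 2) where
      a : Triple → ℕ
      a v = [ adj? c v ]

      pos : K → Triple → K
      pos μ v = (β-of c - β-of v - s μ) * inv (σ-of c - σ-of v)

      pos-eq : ∀ μ {v} → Adj c v → pos μ v * (σ-of c - σ-of v) ≡ β-of c - β-of v - s μ
      pos-eq μ {v} (ne , _) = trans (solve 3 (λ x i y → x :* i :* y := x :* (y :* i)) refl (β-of c - β-of v - s μ) (inv (σ-of c - σ-of v)) (σ-of c - σ-of v))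
        (trans (cong ((β-of c - β-of v - s μ) *_) (inverseʳ _ (λ e → ne (x-y≡0⇒x≡y e)))) (*-identityʳ _))

      pos-unique : ∀ μ {v t} → Adj c v → t * (σ-of c - σ-of v) ≡ β-of c - β-of v - s μ → pos μ v ≡ t
      pos-unique μ {v} {t} adj e = *-cancelˡ (λ z → proj₁ adj (x-y≡0⇒x≡y z)) (trans (*-comm _ _) (trans (pos-eq μ adj) (trans (sym e) (*-comm _ _))))

      Collide : K → Triple → Triple → Set
      Collide μ v w = ¬ (v ≡ w) × pos μ w ≡ pos μ v

      collide? : ∀ μ v w → Dec (Collide μ v w)
      collide? μ v w = ¬? (v ≟ₜ w) ×-dec (pos μ w ≟ pos μ v)

      -- Equality of the two positions is an affine equation for `s μ` with coefficient σ-of v -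
      -- σ-of w. If that coefficient is zero, the positions can agree only when the β agree, and
      -- then adjacency to `c` makes the γ agree as well.
      collide-unique : ∀ {v w μ ν} → Adj c v → Adj c w → Collide μ v w → Collide ν v w → μ ≡ ν
      collide-unique {v} {w} {μ} {ν} av aw (ne , e) (_ , e′) = s-injective (byσ (σ-of v ≟ σ-of w))
        where
        open ≡-Reasoning
        cross : ∀ μ → pos μ w ≡ pos μ v → (β-of c - β-of v - s μ) * (σ-of c - σ-of w) ≡ (β-of c - β-of w - s μ) * (σ-of c - σ-of v)
        cross μ e = begin
          (β-of c - β-of v - s μ) * (σ-of c - σ-of w) ≡⟨ cong (_* (σ-of c - σ-of w)) (sym (pos-eq μ av)) ⟩
          pos μ v * (σ-of c - σ-of v) * (σ-of c - σ-of w) ≡⟨ solve 3 (λ x y z → x :* y :* z := x :* z :* y) refl (pos μ v) _ _ ⟩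
          pos μ v * (σ-of c - σ-of w) * (σ-of c - σ-of v) ≡⟨ cong (λ z → z * (σ-of c - σ-of w) * (σ-of c - σ-of v)) (sym e) ⟩
          pos μ w * (σ-of c - σ-of w) * (σ-of c - σ-of v) ≡⟨ cong (_* (σ-of c - σ-of v)) (pos-eq μ aw) ⟩
          (β-of c - β-of w - s μ) * (σ-of c - σ-of v) ∎
        byσ : Dec (σ-of v ≡ σ-of w) → s μ ≡ s ν
        byσ (no σ≢) = *-cancelˡ {σ-of v - σ-of w} (λ z → σ≢ (x-y≡0⇒x≡y z)) (x-y≡0⇒x≡y (begin
          (σ-of v - σ-of w) * s μ - (σ-of v - σ-of w) * s ν
            ≡⟨ solve 8 (λ b v w c x y m n → (x :- y) :* m :- (x :- y) :* n
                 := (((b :- v :- n) :* (c :- y) :- (b :- w :- n) :* (c :- x)) :- ((b :- v :- m) :* (c :- y) :- (b :- w :- m) :* (c :- x)))) refl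
                 (β-of c) (β-of v) (β-of w) (σ-of c) (σ-of v) (σ-of w) (s μ) (s ν) ⟩
          ((β-of c - β-of v - s ν) * (σ-of c - σ-of w) - (β-of c - β-of w - s ν) * (σ-of c - σ-of v))
            - ((β-of c - β-of v - s μ) * (σ-of c - σ-of w) - (β-of c - β-of w - s μ) * (σ-of c - σ-of v))
            ≡⟨ cong₂ _-_ (x≡y⇒x-y≡0 (cross ν e′)) (x≡y⇒x-y≡0 (cross μ e)) ⟩
          0# - 0# ≡⟨ -‿inverseʳ 0# ⟩
          0# ∎))
        byσ (yes σ≡) = ⊥-elim (ne (cong₂ _,_ σ≡ (cong₂ _,_ β≡ γ≡)))
          where
          β≡ : β-of v ≡ β-of w
          β≡ = *-cancelˡ {σ-of c - σ-of v} (λ z → proj₁ av (x-y≡0⇒x≡y z)) (x-y≡0⇒x≡y (begin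
            (σ-of c - σ-of v) * β-of v - (σ-of c - σ-of v) * β-of w
              ≡⟨ solve 6 (λ b v w c x m → (c :- x) :* v :- (c :- x) :* w := (b :- w :- m) :* (c :- x) :- (b :- v :- m) :* (c :- x)) refl
                   (β-of c) (β-of v) (β-of w) (σ-of c) (σ-of v) (s μ) ⟩
            (β-of c - β-of w - s μ) * (σ-of c - σ-of v) - (β-of c - β-of v - s μ) * (σ-of c - σ-of v)
              ≡⟨ x≡y⇒x-y≡0 (trans (sym (cross μ e)) (cong (λ z → (β-of c - β-of v - s μ) * (σ-of c - z)) (sym σ≡))) ⟩
            0# ∎))
          γ≡ : γ-of v ≡ γ-of w
          γ≡ = begin
            γ-of v ≡⟨ solve 2 (λ g x → g := g :+ x :- x) refl (γ-of v) (σ-of c * β-of v) ⟩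
            γ-of v + σ-of c * β-of v - σ-of c * β-of v ≡⟨ cong₂ (λ x y → x - σ-of c * y) (proj₂ av) β≡ ⟩
            γ-of c + σ-of v * β-of c - σ-of c * β-of w ≡⟨ cong (λ z → γ-of c + z * β-of c - σ-of c * β-of w) σ≡ ⟩
            γ-of c + σ-of w * β-of c - σ-of c * β-of w ≡⟨ cong (_- σ-of c * β-of w) (sym (proj₂ aw)) ⟩
            γ-of w + σ-of c * β-of w - σ-of c * β-of w ≡⟨ solve 2 (λ g x → g :+ x :- x := g) refl (γ-of w) (σ-of c * β-of w) ⟩
            γ-of w ∎

      d : ℕ
      d = ∑ vs a

      dist : K → List Triple → ℕ
      dist μ ws = ∑ ws (λ v → ∑ ws (λ w → a v ℕ.* (a w ℕ.* [ collide? μ v w ])))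

      dist-mono : ∀ μ {ws} → Sub ws vs → dist μ ws ≤ dist μ vs
      dist-mono μ {ws} sub = ℕₚ.≤-trans (∑-mono ws (λ v → sub _)) (sub _)

      collisions-bound : ∀ μ {ws} → Sub ws vs → Star.collisions a (pos μ) ws ≤ 2 ℕ.* ∑ ws a ℕ.+ dist μ vs
      collisions-bound μ {ws} sub = begin
        ∑ ws (λ v → ∑ ws (λ w → a v ℕ.* (a w ℕ.* [ pos μ w ≟ pos μ v ])))
          ≤⟨ ∑-mono ws (λ v → ∑-mono ws (λ w → pointwise v w)) ⟩
        ∑ ws (λ v → ∑ ws (λ w → a v ℕ.* [ v ≟ₜ w ] ℕ.+ a v ℕ.* (a w ℕ.* [ collide? μ v w ])))
          ≡⟨ trans (∑-cong ws (λ v → ∑-+ ws _ _)) (∑-+ ws _ _) ⟩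
        ∑ ws (λ v → ∑ ws (λ w → a v ℕ.* [ v ≟ₜ w ])) ℕ.+ dist μ ws
          ≤⟨ ℕₚ.+-mono-≤ (∑-mono ws (λ v → ℕₚ.≤-trans (ℕₚ.≤-reflexive (∑-*ˡ ws (a v) _)) (ℕₚ.*-monoʳ-≤ (a v) (ℕₚ.≤-trans (sub _) (multiplicity v))))) (dist-mono μ {ws} sub) ⟩
        ∑ ws (λ v → a v ℕ.* 2) ℕ.+ dist μ vs ≡⟨ cong (ℕ._+ dist μ vs) (trans (∑-*ʳ ws 2 a) (ℕₚ.*-comm (∑ ws a) 2)) ⟩
        2 ℕ.* ∑ ws a ℕ.+ dist μ vs ∎
        where
        open ℕₚ.≤-Reasoning
        pointwise : ∀ v w → a v ℕ.* (a w ℕ.* [ pos μ w ≟ pos μ v ]) ≤ a v ℕ.* [ v ≟ₜ w ] ℕ.+ a v ℕ.* (a w ℕ.* [ collide? μ v w ])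
        pointwise v w = ℕₚ.≤-trans (ℕₚ.*-monoʳ-≤ (a v) (split (v ≟ₜ w) (pos μ w ≟ pos μ v))) (ℕₚ.≤-reflexive (ℕₚ.*-distribˡ-+ (a v) _ _))
          where
          split : (e : Dec (v ≡ w)) (f : Dec (pos μ w ≡ pos μ v)) → a w ℕ.* [ f ] ≤ [ e ] ℕ.+ a w ℕ.* [ ¬? e ×-dec f ]
          split (yes _) f = ℕₚ.≤-trans (ℕₚ.*-mono-≤ ([]≤1 (adj? c w)) ([]≤1 f)) (ℕₚ.m≤m+n 1 _)
          split (no _) (yes _) = ℕₚ.≤-refl
          split (no _) (no _) = ℕₚ.≤-refl

      ∑-dist : ∑ elements (λ μ → dist μ vs) ≤ d ℕ.* d
      ∑-dist = begin
        ∑ elements (λ μ → dist μ vs) ≡⟨ trans (∑-swap elements vs _) (∑-cong vs (λ v → ∑-swap elements vs _)) ⟩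
        ∑ vs (λ v → ∑ vs (λ w → ∑ elements (λ μ → a v ℕ.* (a w ℕ.* [ collide? μ v w ]))))
          ≤⟨ ∑-mono vs (λ v → ∑-mono vs (λ w → ℕₚ.≤-trans (ℕₚ.≤-reflexive (trans (∑-*ˡ elements (a v) _) (cong (a v ℕ.*_) (∑-*ˡ elements (a w) _)))) (once v w (adj? c v) (adj? c w)))) ⟩
        ∑ vs (λ v → ∑ vs (λ w → a v ℕ.* a w)) ≡⟨ sym (∑-product vs vs a a) ⟩
        d ℕ.* d ∎
        where
        open ℕₚ.≤-Reasoning
        once : ∀ v w (x : Dec (Adj c v)) (y : Dec (Adj c w)) → [ x ] ℕ.* ([ y ] ℕ.* ∑ elements (λ μ → [ collide? μ v w ])) ≤ [ x ] ℕ.* [ y ]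
        once v w (no _) y = z≤n
        once v w (yes _) (no _) = z≤n
        once v w (yes av) (yes aw) = ℕₚ.≤-trans (ℕₚ.≤-reflexive (trans (ℕₚ.+-identityʳ _) (ℕₚ.+-identityʳ _))) (∑-unique-≤1 (λ μ → collide? μ v w) elements-distinct (collide-unique av aw))

      good? : ∀ μ → Dec (128 ℕ.* Δ ℕ.* dist μ vs ≤ d ℕ.* d)
      good? μ = 128 ℕ.* Δ ℕ.* dist μ vs ℕ.≤? d ℕ.* d

      -- Eight times an upper bound for the edges charged to a vertex when it is removed; for a bad
      -- shift the trivial 8d is added. The average over shifts is at most 32Δ + 2d, so summing over
      -- both sides counts each edge four times, strictly less than eight.
      weight8 : K → ℕ
      weight8 μ = 32 ℕ.* Δ ℕ.+ d ℕ.+ [ ¬? (good? μ) ] ℕ.* (8 ℕ.* d)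

      -- With `e` the remaining degree and `b` the number of collisions, e² ≤ Δ (2e + b). Were 8e
      -- greater than 32Δ + d, then 128 e² ≤ 8e · 32Δ + 128 Δ b ≤ 64 e² + d², which is below 128 e².
      poor⇒light : ∀ μ {ws} → Sub ws vs → Star.positions a (pos μ) ws ≤ Δ → 8 ℕ.* ∑ ws a ≤ weight8 μ
      poor⇒light μ {ws} sub poor with good? μ
      ... | no _ = ℕₚ.≤-trans (ℕₚ.*-monoʳ-≤ 8 (sub a)) (ℕₚ.≤-trans (ℕₚ.≤-reflexive (sym (ℕₚ.*-identityˡ (8 ℕ.* d)))) (ℕₚ.m≤n+m _ (32 ℕ.* Δ ℕ.+ d)))
      ... | yes good = ℕₚ.≤-trans (ℕₚ.≮⇒≥ impossible) (ℕₚ.m≤m+n _ _)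
        where
        e = ∑ ws a
        b = dist μ vs
        bound : e ℕ.* e ≤ Δ ℕ.* (2 ℕ.* e ℕ.+ b)
        bound = ℕₚ.≤-trans (Star.degree² a (pos μ) ws) (ℕₚ.*-mono-≤ poor (collisions-bound μ {ws} sub))
        impossible : ¬ (32 ℕ.* Δ ℕ.+ d < 8 ℕ.* e)
        impossible lt = ℕₚ.<-irrefl refl (begin-strict
          64 ℕ.* (e ℕ.* e) ℕ.+ 64 ℕ.* (e ℕ.* e) ≡⟨ l₁ e ⟩
          128 ℕ.* (e ℕ.* e) ≤⟨ ℕₚ.*-monoʳ-≤ 128 bound ⟩
          128 ℕ.* (Δ ℕ.* (2 ℕ.* e ℕ.+ b)) ≡⟨ l₂ Δ e b ⟩
          8 ℕ.* e ℕ.* (32 ℕ.* Δ) ℕ.+ 128 ℕ.* Δ ℕ.* b ≤⟨ ℕₚ.+-mono-≤ (ℕₚ.*-monoʳ-≤ (8 ℕ.* e) (ℕₚ.≤-trans (ℕₚ.m≤m+n _ d) (ℕₚ.<⇒≤ lt))) good ⟩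
          8 ℕ.* e ℕ.* (8 ℕ.* e) ℕ.+ d ℕ.* d <⟨ ℕₚ.+-monoʳ-< (8 ℕ.* e ℕ.* (8 ℕ.* e)) (ℕₚ.*-mono-< d<8e d<8e) ⟩
          8 ℕ.* e ℕ.* (8 ℕ.* e) ℕ.+ 8 ℕ.* e ℕ.* (8 ℕ.* e) ≡⟨ l₃ e ⟩
          64 ℕ.* (e ℕ.* e) ℕ.+ 64 ℕ.* (e ℕ.* e) ∎)
          where
          open ℕₚ.≤-Reasoning
          d<8e : d < 8 ℕ.* e
          d<8e = ℕₚ.≤-<-trans (ℕₚ.m≤n+m d (32 ℕ.* Δ)) lt
          l₁ : ∀ e → 64 ℕ.* (e ℕ.* e) ℕ.+ 64 ℕ.* (e ℕ.* e) ≡ 128 ℕ.* (e ℕ.* e)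
          l₁ = solve-∀
          l₂ : ∀ Δ e b → 128 ℕ.* (Δ ℕ.* (2 ℕ.* e ℕ.+ b)) ≡ 8 ℕ.* e ℕ.* (32 ℕ.* Δ) ℕ.+ 128 ℕ.* Δ ℕ.* b
          l₂ = solve-∀
          l₃ : ∀ e → 8 ℕ.* e ℕ.* (8 ℕ.* e) ℕ.+ 8 ℕ.* e ℕ.* (8 ℕ.* e) ≡ 64 ℕ.* (e ℕ.* e) ℕ.+ 64 ℕ.* (e ℕ.* e)
          l₃ = solve-∀

      -- Summed over all shifts the collisions number at most d². By Markov at most 128Δ shifts are
      -- bad, an eighth of all of them, and their surcharge 8d averages to at most d.
      ∑-weight8 : 1024 ℕ.* Δ ≤ size → ∑ elements weight8 ≤ size ℕ.* (32 ℕ.* Δ ℕ.+ 2 ℕ.* d)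
      ∑-weight8 small = begin
        ∑ elements weight8 ≡⟨ ∑-+ elements _ _ ⟩
        ∑ elements (λ _ → 32 ℕ.* Δ ℕ.+ d) ℕ.+ ∑ elements (λ μ → [ ¬? (good? μ) ] ℕ.* (8 ℕ.* d))
          ≡⟨ cong₂ ℕ._+_ (trans (∑-const elements _) (cong (ℕ._* (32 ℕ.* Δ ℕ.+ d)) elements-length)) (∑-*ʳ elements (8 ℕ.* d) _) ⟩
        size ℕ.* (32 ℕ.* Δ ℕ.+ d) ℕ.+ bad ℕ.* (8 ℕ.* d) ≤⟨ ℕₚ.+-monoʳ-≤ _ (few d refl) ⟩
        size ℕ.* (32 ℕ.* Δ ℕ.+ d) ℕ.+ size ℕ.* d ≡⟨ l₁ size Δ d ⟩
        size ℕ.* (32 ℕ.* Δ ℕ.+ 2 ℕ.* d) ∎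
        where
        open ℕₚ.≤-Reasoning
        bad = ∑ elements (λ μ → [ ¬? (good? μ) ])
        l₁ : ∀ s Δ d → s ℕ.* (32 ℕ.* Δ ℕ.+ d) ℕ.+ s ℕ.* d ≡ s ℕ.* (32 ℕ.* Δ ℕ.+ 2 ℕ.* d)
        l₁ = solve-∀
        l₂ : ∀ Δ d → 128 ℕ.* Δ ℕ.* (8 ℕ.* d) ≡ 1024 ℕ.* Δ ℕ.* d
        l₂ = solve-∀
        pointwise : ∀ μ → [ ¬? (good? μ) ] ℕ.* (d ℕ.* d) ≤ 128 ℕ.* Δ ℕ.* dist μ vs
        pointwise μ with good? μ
        ... | yes _ = z≤n
        ... | no ng = ℕₚ.≤-trans (ℕₚ.≤-reflexive (ℕₚ.*-identityˡ (d ℕ.* d))) (ℕₚ.<⇒≤ (ℕₚ.≰⇒> ng))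
        total : bad ℕ.* (d ℕ.* d) ≤ 128 ℕ.* Δ ℕ.* (d ℕ.* d)
        total = begin
          bad ℕ.* (d ℕ.* d) ≡⟨ sym (∑-*ʳ elements (d ℕ.* d) _) ⟩
          ∑ elements (λ μ → [ ¬? (good? μ) ] ℕ.* (d ℕ.* d)) ≤⟨ ∑-mono elements pointwise ⟩
          ∑ elements (λ μ → 128 ℕ.* Δ ℕ.* dist μ vs) ≡⟨ ∑-*ˡ elements (128 ℕ.* Δ) _ ⟩
          128 ℕ.* Δ ℕ.* ∑ elements (λ μ → dist μ vs) ≤⟨ ℕₚ.*-monoʳ-≤ (128 ℕ.* Δ) ∑-dist ⟩
          128 ℕ.* Δ ℕ.* (d ℕ.* d) ∎
        few : ∀ n → d ≡ n → bad ℕ.* (8 ℕ.* d) ≤ size ℕ.* d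
        few zero e = ℕₚ.≤-reflexive (trans (cong (λ z → bad ℕ.* (8 ℕ.* z)) e) (trans (ℕₚ.*-zeroʳ bad) (sym (trans (cong (size ℕ.*_) e) (ℕₚ.*-zeroʳ size)))))
        few (suc n) e = begin
          bad ℕ.* (8 ℕ.* d) ≤⟨ ℕₚ.*-monoˡ-≤ (8 ℕ.* d) (ℕₚ.*-cancelʳ-≤ bad (128 ℕ.* Δ) (suc n ℕ.* suc n) (subst (λ z → bad ℕ.* (z ℕ.* z) ≤ 128 ℕ.* Δ ℕ.* (z ℕ.* z)) e total)) ⟩
          128 ℕ.* Δ ℕ.* (8 ℕ.* d) ≡⟨ l₂ Δ d ⟩
          1024 ℕ.* Δ ℕ.* d ≤⟨ ℕₚ.*-monoˡ-≤ d small ⟩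
          size ℕ.* d ∎

    distinct-≤-count : ∀ {vs : List Triple} {ts} {P : Triple → Set} (P? : ∀ v → Dec (P v)) (g : Triple → K) → AllPairs _≢_ ts →
      All (λ t → ∃[ v ] (v ∈ vs × P v × g v ≡ t)) ts → length ts ≤ ∑ vs (λ v → [ P? v ])
    distinct-≤-count {vs} {ts} P? g distinct hits = begin
      length ts ≡⟨ sym (trans (∑-const ts 1) (ℕₚ.*-identityʳ _)) ⟩
      ∑ ts (λ _ → 1) ≤⟨ ∑-mono-∈ ts (λ {t} t∈ → let v , v∈ , pv , e = All.lookup hits t∈ in
        ℕₚ.≤-trans (ℕₚ.≤-reflexive (sym (cong₂ ℕ._*_ ([]-yes (g v ≟ t) e) ([]-yes (P? v) pv)))) (∑-∈ (λ v → [ g v ≟ t ] ℕ.* [ P? v ]) v∈)) ⟩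
      ∑ ts (λ t → ∑ vs (λ v → [ g v ≟ t ] ℕ.* [ P? v ])) ≡⟨ ∑-swap ts vs _ ⟩
      ∑ vs (λ v → ∑ ts (λ t → [ g v ≟ t ] ℕ.* [ P? v ])) ≤⟨ ∑-mono vs (λ v → ∑-distinct-≤ _≟_ distinct (g v) (λ _ → [ P? v ])) ⟩
      ∑ vs (λ v → [ P? v ]) ∎
      where open ℕₚ.≤-Reasoning

    OnPencil : Triple → K → K → K → Triple → Set
    OnPencil p μ ν κ q = Adj p q × μ * σ-of q + ν * β-of q ≡ κ

    onPencil? : ∀ p μ ν κ q → Dec (OnPencil p μ ν κ q)
    onPencil? p μ ν κ q = adj? p q ×-dec (μ * σ-of q + ν * β-of q ≟ κ)

    -- The contact argument ends in a relation μ σ + ν β = κ between the neighbours of one vertex.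
    -- This is the property of the family that contradicts it once more than `k` neighbours are
    -- involved.
    PencilBound : ℕ → List Triple → List Triple → Set
    PencilBound k ps qs = ∀ {p} → p ∈ ps → ∀ μ ν κ → ¬ (μ ≡ 0# × ν ≡ 0#) → ∑ qs (λ q → [ onPencil? p μ ν κ q ]) ≤ k

    incidences : List Triple → List Triple → ℕ
    incidences ps qs = ∑ ps (λ p → ∑ qs (λ q → [ adj? p q ]))

    module Bound (D k : ℕ) (xs ys : List Triple)
                 (multX : ∀ v → ∑ xs (λ w → [ v ≟ₜ w ]) ≤ 2) (multY : ∀ v → ∑ ys (λ w → [ v ≟ₜ w ]) ≤ 2)
                 (pencilX : PencilBound k xs ys) (pencilY : PencilBound k ys xs)
                 (room : (length xs ℕ.+ length ys) ℕ.* 3 ≤ suc D ℕ.* suc D) where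
      B h Δ : ℕ
      B = D ℕ.+ (D ℕ.+ (D ℕ.+ 0))
      -- More than 5B crossings make a line rich. After the loss of at most `B` of them more than
      -- `k` must remain to contradict the pencil bound.
      h = 5 ℕ.* B ℕ.+ k
      Δ = suc h

      neg-injective : ∀ {x y} → - x ≡ - y → x ≡ y
      neg-injective {x} {y} e = trans (sym (neg-neg x)) (trans (cong -_ e) (neg-neg y))
        where
        neg-neg : ∀ x → - (- x) ≡ x
        neg-neg = solve 1 (λ x → :- (:- x) := x) refl

      module X (p : Triple) = Centre id id p ys Δ multY
      -- Seen from the other side the numerator is β-of q - β-of p + μ, so the shift enters with the
      -- opposite sign.
      module Y (q : Triple) = Centre (-_) neg-injective q xs Δ multX

      -- Both sides of the relation `Adj` between `p` and `q` gain the same term σ-of p · μ, so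
      -- adjacency is unchanged, whereas the crossing parameter moves by -μ / (σ-of p - σ-of q).
      shiftX shiftY : K → Triple → Triple
      shiftX μ (σ , β , γ) = σ , β , γ + σ * μ
      shiftY μ (σ , β , γ) = σ , β + μ , γ

      side : K → Triple ⊎ Triple → Triple
      side μ (inj₁ p) = shiftX μ p
      side μ (inj₂ q) = shiftY μ q

      Linked : Triple ⊎ Triple → Triple ⊎ Triple → Set
      Linked (inj₁ p) (inj₂ q) = Adj p q
      Linked (inj₂ q) (inj₁ p) = Adj q p
      Linked _ _ = ⊥

      meets : ∀ μ p q t → Adj p q → t * (σ-of p - σ-of q) ≡ β-of p - β-of q - μ → Cores.Meets (shiftX μ p) (shiftY μ q) t
      meets μ (σ , β , γ) (σ′ , β′ , γ′) t (ne , adj) e = record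
        { transversal = ne ∘ sym
        ; eqx = x-y≡0⇒x≡y (trans
            (solve 8 (λ σ β γ σ′ β′ γ′ t μ →
               (γ :+ σ :* μ :- σ :* β :+ t :* (σ :* σ)) :- (γ′ :- σ′ :* (β′ :+ μ) :+ t :* (σ′ :* σ′))
               := (t :* (σ :- σ′) :- (β :- β′ :- μ)) :* (σ :+ σ′) :- ((γ′ :+ σ :* β′) :- (γ :+ σ′ :* β))) refl σ β γ σ′ β′ γ′ t μ)
            (trans (cong₂ (λ x y → x * (σ + σ′) - y) (x≡y⇒x-y≡0 e) (x≡y⇒x-y≡0 adj)) (solve 1 (λ x → :0 :* x :- :0 := :0) refl _)))
        ; eqy = x-y≡0⇒x≡y (trans
            (solve 6 (λ σ β σ′ β′ t μ → (β :+ t :* :- σ) :- (β′ :+ μ :+ t :* :- σ′) := (β :- β′ :- μ) :- t :* (σ :- σ′)) refl σ β σ′ β′ t μ)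
            (x≡y⇒x-y≡0 (sym e)))
        }

      meets-sym : ∀ {P Q t} → Cores.Meets P Q t → Cores.Meets Q P t
      meets-sym m = record { transversal = transversal ∘ sym ; eqx = sym eqx ; eqy = sym eqy }
        where open Cores.Meets m

      meets-position : ∀ μ p q t → Cores.Meets (shiftX μ p) (shiftY μ q) t → t * (σ-of p - σ-of q) ≡ β-of p - β-of q - μ
      meets-position μ (σ , β , γ) (σ′ , β′ , γ′) t m = x-y≡0⇒x≡y (trans
        (solve 6 (λ σ β σ′ β′ t μ → t :* (σ :- σ′) :- (β :- β′ :- μ) := (β′ :+ μ :+ t :* :- σ′) :- (β :+ t :* :- σ)) refl σ β σ′ β′ t μ)
        (x≡y⇒x-y≡0 (sym (Cores.Meets.eqy m))))

      flip : ∀ t σ σ′ β β′ μ → t * (σ - σ′) ≡ β - β′ - - μ → t * (σ′ - σ) ≡ β′ - β - μ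
      flip t σ σ′ β β′ μ e = trans (solve 3 (λ t σ σ′ → t :* (σ′ :- σ) := :- (t :* (σ :- σ′))) refl t σ σ′)
        (trans (cong -_ e) (solve 3 (λ β β′ μ → :- (β :- β′ :- :- μ) := β′ :- β :- μ) refl β β′ μ))

      flip′ : ∀ t σ σ′ β β′ μ → t * (σ′ - σ) ≡ β′ - β - μ → t * (σ - σ′) ≡ β - β′ - - μ
      flip′ t σ σ′ β β′ μ e = trans (solve 3 (λ t σ σ′ → t :* (σ :- σ′) := :- (t :* (σ′ :- σ))) refl t σ σ′)
        (trans (cong -_ e) (solve 3 (λ β β′ μ → :- (β′ :- β :- μ) := β :- β′ :- :- μ) refl β β′ μ))

      module AtShift (μ : K) where
        positionsX positionsY : Triple → List Triple → ℕ
        positionsX p qs = Star.positions (X.a p) (X.pos p μ) qs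
        positionsY q ps = Star.positions (Y.a q) (Y.pos q μ) ps

        record Cluster : Set where
          field
            p₀ : Triple
            ps qs : List Triple
            subX : Sub (p₀ ∷ ps) xs
            subY : Sub qs ys
            memX : ∀ {p} → p ∈ p₀ ∷ ps → p ∈ xs
            memY : ∀ {q} → q ∈ qs → q ∈ ys
            richX : All (λ p → h < positionsX p qs) (p₀ ∷ ps)
            richY : All (λ q → h < positionsY q (p₀ ∷ ps)) qs

        -- `core` supplies one vertex with a linear relation at more than h - B of its crossings.
        -- Undoing the shear turns it into a relation between the original triples, which the pencil
        -- bound allows for at most `k` of them.
        no-cluster : 1024 ℕ.* Δ ≤ size → Cluster → ⊥
        no-cluster small cluster = absurd (proj₁ found) (proj₁ (proj₂ found)) (proj₂ (proj₂ found))
          where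
          open Cluster cluster
          rest : List (Triple ⊎ Triple)
          rest = map inj₁ ps ++ map inj₂ qs
          open CoreContradiction (Triple ⊎ Triple) (side μ) D h (inj₁ p₀) rest Linked
            using (T; HitList; Collinear; core)
          ∈-left : ∀ {p} → p ∈ p₀ ∷ ps → inj₁ p ∈ T
          ∈-left (here refl) = here refl
          ∈-left (there i) = there (∈ₚ.∈-++⁺ˡ (∈ₚ.∈-map⁺ inj₁ i))
          ∈-right : ∀ {q} → q ∈ qs → inj₂ q ∈ T
          ∈-right i = there (∈ₚ.∈-++⁺ʳ (map inj₁ ps) (∈ₚ.∈-map⁺ inj₂ i))
          left-∈ : ∀ {p} → inj₁ p ∈ T → p ∈ p₀ ∷ ps
          left-∈ (here refl) = here refl
          left-∈ (there i) = there (∈-inj₁⁻ {ps = ps} {qs} i)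
          right-∈ : ∀ {q} → inj₂ q ∈ T → q ∈ qs
          right-∈ (there i) = ∈-inj₂⁻ {ps = ps} {qs} i

          hitX : ∀ {p} → h < positionsX p qs → HitList (inj₁ p)
          hitX {p} rich = ts , AllPairsₚ.filter⁺ (λ t → 0 ℕ.<? o t) elements-distinct , subst (h <_) (sym (length-filter-sgn o elements)) rich
            , All.map hit (Allₚ.all-filter (λ t → 0 ℕ.<? o t) elements)
            where
            o = Star.occ (X.a p) (X.pos p μ) qs
            ts = filter (λ t → 0 ℕ.<? o t) elements
            hit : ∀ {t} → 0 < o t → ∃[ q ] (q ∈ T × Linked (inj₁ p) q × Cores.Meets (shiftX μ p) (side μ q) t)
            hit {t} lt = let q , q∈ , pos = positive-term qs lt
                             a+ , b+ = *-positive _ _ pos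
                             adj = []-positive (adj? p q) a+
                         in inj₂ q , ∈-right q∈ , adj , meets μ p q t adj
                              (trans (cong (_* (σ-of p - σ-of q)) (sym ([]-positive (X.pos p μ q ≟ t) b+))) (X.pos-eq p μ adj))

          hitY : ∀ {q} → h < positionsY q (p₀ ∷ ps) → HitList (inj₂ q)
          hitY {q} rich = ts , AllPairsₚ.filter⁺ (λ t → 0 ℕ.<? o t) elements-distinct , subst (h <_) (sym (length-filter-sgn o elements)) rich
            , All.map hit (Allₚ.all-filter (λ t → 0 ℕ.<? o t) elements)
            where
            o = Star.occ (Y.a q) (Y.pos q μ) (p₀ ∷ ps)
            ts = filter (λ t → 0 ℕ.<? o t) elements
            hit : ∀ {t} → 0 < o t → ∃[ p ] (p ∈ T × Linked (inj₂ q) p × Cores.Meets (shiftY μ q) (side μ p) t)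
            hit {t} lt = let p , p∈ , pos = positive-term (p₀ ∷ ps) lt
                             a+ , b+ = *-positive _ _ pos
                             adj = []-positive (adj? q p) a+
                         in inj₁ p , ∈-left p∈ , adj , meets-sym (meets μ p q t (adj-sym adj)
                              (flip t (σ-of q) (σ-of p) (β-of q) (β-of p) μ
                                (trans (cong (_* (σ-of q - σ-of p)) (sym ([]-positive (Y.pos q μ p ≟ t) b+))) (Y.pos-eq q μ adj))))

          rich : All HitList T
          rich = hitX (All.head richX) ∷ Allₚ.++⁺ (Allₚ.map⁺ (All.map hitX (All.tail richX))) (Allₚ.map⁺ (All.map hitY richY))

          Δ<size : Δ < size
          Δ<size = ℕₚ.<-≤-trans (ℕₚ.m<m*n Δ 1024 (s≤s (s≤s z≤n))) (ℕₚ.≤-trans (ℕₚ.≤-reflexive (ℕₚ.*-comm Δ 1024)) small)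
          1<size : 1 < size
          1<size = ℕₚ.≤-<-trans (s≤s z≤n) Δ<size
          2B<size : suc (2 ℕ.* B) < size
          2B<size = ℕₚ.≤-<-trans (s≤s (ℕₚ.≤-trans (ℕₚ.*-monoˡ-≤ B {2} {5} (s≤s (s≤s z≤n))) (ℕₚ.m≤m+n _ k))) Δ<size
          T-length : length T ≤ length xs ℕ.+ length ys
          T-length = begin
            suc (length rest) ≡⟨ cong suc (trans (Listₚ.length-++ (map inj₁ ps)) (cong₂ ℕ._+_ (Listₚ.length-map inj₁ ps) (Listₚ.length-map inj₂ qs))) ⟩
            suc (length ps) ℕ.+ length qs ≤⟨ ℕₚ.+-mono-≤ (sub-length {p₀ ∷ ps} {xs} subX) (sub-length {qs} {ys} subY) ⟩
            length xs ℕ.+ length ys ∎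
            where
            open ℕₚ.≤-Reasoning
            sub-length : ∀ {as bs : List Triple} → Sub as bs → length as ≤ length bs
            sub-length {as} {bs} s = subst₂ _≤_ (trans (∑-const as 1) (ℕₚ.*-identityʳ _)) (trans (∑-const bs 1) (ℕₚ.*-identityʳ _)) (s (λ _ → 1))
          unknowns : length T ℕ.* suc B < suc D ℕ.* (suc D ℕ.* suc D)
          unknowns = begin-strict
            length T ℕ.* suc B <⟨ ℕₚ.*-monoʳ-< (length T) (ℕₚ.≤-trans (ℕₚ.n≤1+n _) (ℕₚ.≤-reflexive (l₁ D))) ⟩
            length T ℕ.* (3 ℕ.* suc D) ≡⟨ sym (ℕₚ.*-assoc (length T) 3 (suc D)) ⟩
            length T ℕ.* 3 ℕ.* suc D ≤⟨ ℕₚ.*-monoˡ-≤ (suc D) (ℕₚ.≤-trans (ℕₚ.*-monoˡ-≤ 3 T-length) room) ⟩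
            suc D ℕ.* suc D ℕ.* suc D ≡⟨ ℕₚ.*-comm (suc D ℕ.* suc D) (suc D) ⟩
            suc D ℕ.* (suc D ℕ.* suc D) ∎
            where
            open ℕₚ.≤-Reasoning
            l₁ : ∀ D → suc (suc (suc (D ℕ.+ (D ℕ.+ (D ℕ.+ 0))))) ≡ 3 ℕ.* suc D
            l₁ = solve-∀

          found : ∃[ p ] (p ∈ T × Collinear 1<size 2B<size unknowns (ℕₚ.m≤m+n (5 ℕ.* B) k) rich p)
          found = core 1<size 2B<size unknowns (ℕₚ.m≤m+n (5 ℕ.* B) k) rich

          too-many : ∀ {m} → h < m ℕ.+ B → ¬ (m ≤ k)
          too-many {m} lt le = ℕₚ.<⇒≱ lt (begin
            m ℕ.+ B ≤⟨ ℕₚ.+-mono-≤ le (ℕₚ.m≤m+n B _) ⟩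
            k ℕ.+ 5 ℕ.* B ≡⟨ ℕₚ.+-comm k _ ⟩
            h ∎)
            where open ℕₚ.≤-Reasoning

          absurd : ∀ r → r ∈ T → Collinear 1<size 2B<size unknowns (ℕₚ.m≤m+n (5 ℕ.* B) k) rich r → ⊥
          absurd (inj₁ p) r∈ col = too-many covers (ℕₚ.≤-trans
              (distinct-≤-count (onPencil? p μ₁ ν (κ - ν * μ)) (X.pos p μ) distinct (All.map (λ {t} → conv t) on))
              (ℕₚ.≤-trans (subY _) (pencilX (memX (left-∈ r∈)) μ₁ ν (κ - ν * μ) nontrivial)))
            where
            open Collinear col renaming (μ to μ₁)
            conv : ∀ t → ∃[ q ] (q ∈ T × Linked (inj₁ p) q × Cores.Meets (shiftX μ p) (side μ q) t × μ₁ * σ-of (side μ q) + ν * β-of (side μ q) ≡ κ) →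
              ∃[ q ] (q ∈ qs × OnPencil p μ₁ ν (κ - ν * μ) q × X.pos p μ q ≡ t)
            conv t (inj₂ q , q∈ , adj , m , e) = q , right-∈ q∈ , (adj , trans
                (solve 5 (λ m s n b u → m :* s :+ n :* b := m :* s :+ n :* (b :+ u) :- n :* u) refl μ₁ (σ-of q) ν (β-of q) μ) (cong (_- ν * μ) e))
              , X.pos-unique p μ adj (meets-position μ p q t m)
          absurd (inj₂ q) r∈ col = too-many covers (ℕₚ.≤-trans
              (distinct-≤-count (onPencil? q μ₁ ν κ) (Y.pos q μ) distinct (All.map (λ {t} → conv t) on))
              (ℕₚ.≤-trans (subX _) (pencilY (memY (right-∈ r∈)) μ₁ ν κ nontrivial)))
            where
            open Collinear col renaming (μ to μ₁)
            conv : ∀ t → ∃[ p ] (p ∈ T × Linked (inj₂ q) p × Cores.Meets (shiftY μ q) (side μ p) t × μ₁ * σ-of (side μ p) + ν * β-of (side μ p) ≡ κ) →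
              ∃[ p ] (p ∈ p₀ ∷ ps × OnPencil q μ₁ ν κ p × Y.pos q μ p ≡ t)
            conv t (inj₁ p , p∈ , adj , m , e) = p , left-∈ p∈ , (adj , e)
              , Y.pos-unique q μ adj (flip′ t (σ-of q) (σ-of p) (β-of q) (β-of p) μ (meets-position μ p q t (meets-sym m)))

        -- Vertices with at most `h` crossing positions are removed one at a time, each charging its
        -- remaining edges to its weight; `n` bounds the number of rounds. Getting stuck before the
        -- left side is exhausted exhibits a cluster.
        prune : ∀ n ps qs → ∑ ps (λ _ → 1) ℕ.+ ∑ qs (λ _ → 1) ≤ n → Sub ps xs → Sub qs ys → (∀ {p} → p ∈ ps → p ∈ xs) → (∀ {q} → q ∈ qs → q ∈ ys) →
          8 ℕ.* incidences ps qs ≤ ∑ ps (λ p → X.weight8 p μ) ℕ.+ ∑ qs (λ q → Y.weight8 q μ) ⊎ Cluster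
        prune n [] qs le sx sy mx my = inj₁ z≤n
        prune n (p₀ ∷ ps₀) qs le sx sy mx my = decide (All.all? (λ p → h ℕ.<? positionsX p qs) ps) (All.all? (λ q → h ℕ.<? positionsY q ps) qs)
          where
          ps = p₀ ∷ ps₀
          open ℕₚ.≤-Reasoning
          l₁ : ∀ a b c d → 8 ℕ.* a ℕ.+ 8 ℕ.* b ≡ 8 ℕ.* (a ℕ.+ b)
          l₁ = solve-∀
          decide : Dec (All (λ p → h < positionsX p qs) ps) → Dec (All (λ q → h < positionsY q ps) qs) →
            8 ℕ.* incidences ps qs ≤ ∑ ps (λ p → X.weight8 p μ) ℕ.+ ∑ qs (λ q → Y.weight8 q μ) ⊎ Cluster
          decide (yes rx) (yes ry) = inj₂ (record { p₀ = p₀ ; ps = ps₀ ; qs = qs ; subX = sx ; subY = sy ; memX = mx ; memY = my ; richX = rx ; richY = ry })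
          decide (no ¬rx) _ = dropX (find (Allₚ.¬All⇒Any¬ (λ p → h ℕ.<? positionsX p qs) ps ¬rx)) n le
            where
            dropX : ∃[ p ] (p ∈ ps × ¬ (h < positionsX p qs)) → ∀ n → ∑ ps (λ _ → 1) ℕ.+ ∑ qs (λ _ → 1) ≤ n →
              8 ℕ.* incidences ps qs ≤ ∑ ps (λ p → X.weight8 p μ) ℕ.+ ∑ qs (λ q → Y.weight8 q μ) ⊎ Cluster
            dropX (p , p∈ , poor) (suc n) (s≤s le) = Data.Sum.map₁ add
              (prune n (ps ─ p∈) qs (subst (_≤ n) (cong (ℕ._+ ∑ qs (λ _ → 1)) (ℕₚ.suc-injective (∑-remove p∈ (λ _ → 1)))) le)
                (remove-Sub {xs = ps} {xs} p∈ sx) sy (λ i → mx (remove-∈ p∈ i)) my)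
              where
              add : 8 ℕ.* incidences (ps ─ p∈) qs ≤ ∑ (ps ─ p∈) (λ p → X.weight8 p μ) ℕ.+ ∑ qs (λ q → Y.weight8 q μ) →
                    8 ℕ.* incidences ps qs ≤ ∑ ps (λ p → X.weight8 p μ) ℕ.+ ∑ qs (λ q → Y.weight8 q μ)
              add ih = begin
                8 ℕ.* incidences ps qs ≡⟨ cong (8 ℕ.*_) (∑-remove p∈ (λ p → ∑ qs (λ q → [ adj? p q ]))) ⟩
                8 ℕ.* (∑ qs (X.a p) ℕ.+ incidences (ps ─ p∈) qs) ≡⟨ ℕₚ.*-distribˡ-+ 8 (∑ qs (X.a p)) (incidences (ps ─ p∈) qs) ⟩
                8 ℕ.* ∑ qs (X.a p) ℕ.+ 8 ℕ.* incidences (ps ─ p∈) qs ≤⟨ ℕₚ.+-mono-≤ (X.poor⇒light p μ {qs} sy (ℕₚ.≤-trans (ℕₚ.≮⇒≥ poor) (ℕₚ.n≤1+n h))) ih ⟩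
                X.weight8 p μ ℕ.+ (∑ (ps ─ p∈) (λ p → X.weight8 p μ) ℕ.+ ∑ qs (λ q → Y.weight8 q μ)) ≡⟨ sym (ℕₚ.+-assoc (X.weight8 p μ) (∑ (ps ─ p∈) (λ p → X.weight8 p μ)) (∑ qs (λ q → Y.weight8 q μ))) ⟩
                X.weight8 p μ ℕ.+ ∑ (ps ─ p∈) (λ p → X.weight8 p μ) ℕ.+ ∑ qs (λ q → Y.weight8 q μ) ≡⟨ cong (ℕ._+ ∑ qs (λ q → Y.weight8 q μ)) (sym (∑-remove p∈ (λ p → X.weight8 p μ))) ⟩
                ∑ ps (λ p → X.weight8 p μ) ℕ.+ ∑ qs (λ q → Y.weight8 q μ) ∎
          decide (yes _) (no ¬ry) = dropY (find (Allₚ.¬All⇒Any¬ (λ q → h ℕ.<? positionsY q ps) qs ¬ry)) n le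
            where
            dropY : ∃[ q ] (q ∈ qs × ¬ (h < positionsY q ps)) → ∀ n → ∑ ps (λ _ → 1) ℕ.+ ∑ qs (λ _ → 1) ≤ n →
              8 ℕ.* incidences ps qs ≤ ∑ ps (λ p → X.weight8 p μ) ℕ.+ ∑ qs (λ q → Y.weight8 q μ) ⊎ Cluster
            dropY (q , q∈ , poor) (suc n) le = Data.Sum.map₁ add
              (prune n ps (qs ─ q∈) (ℕₚ.≤-pred (subst (_≤ suc n) (trans (cong (∑ ps (λ _ → 1) ℕ.+_) (∑-remove q∈ (λ _ → 1))) (ℕₚ.+-suc (∑ ps (λ _ → 1)) (∑ (qs ─ q∈) (λ _ → 1)))) le))
                sx (remove-Sub {xs = qs} {ys} q∈ sy) mx (λ i → my (remove-∈ q∈ i)))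
              where
              add : 8 ℕ.* incidences ps (qs ─ q∈) ≤ ∑ ps (λ p → X.weight8 p μ) ℕ.+ ∑ (qs ─ q∈) (λ q → Y.weight8 q μ) →
                    8 ℕ.* incidences ps qs ≤ ∑ ps (λ p → X.weight8 p μ) ℕ.+ ∑ qs (λ q → Y.weight8 q μ)
              add ih = begin
                8 ℕ.* incidences ps qs ≡⟨ cong (8 ℕ.*_) (trans (∑-cong ps (λ p → ∑-remove q∈ (λ v → [ adj? p v ]))) (∑-+ ps (λ p → [ adj? p q ]) (λ p → ∑ (qs ─ q∈) (λ v → [ adj? p v ])))) ⟩
                8 ℕ.* (∑ ps (λ p → [ adj? p q ]) ℕ.+ incidences ps (qs ─ q∈)) ≡⟨ cong (λ z → 8 ℕ.* (z ℕ.+ incidences ps (qs ─ q∈))) (∑-cong ps (λ p → []-cong (adj? p q) (adj? q p) adj-sym adj-sym)) ⟩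
                8 ℕ.* (∑ ps (Y.a q) ℕ.+ incidences ps (qs ─ q∈)) ≡⟨ ℕₚ.*-distribˡ-+ 8 (∑ ps (Y.a q)) (incidences ps (qs ─ q∈)) ⟩
                8 ℕ.* ∑ ps (Y.a q) ℕ.+ 8 ℕ.* incidences ps (qs ─ q∈) ≤⟨ ℕₚ.+-mono-≤ (Y.poor⇒light q μ {ps} sx (ℕₚ.≤-trans (ℕₚ.≮⇒≥ poor) (ℕₚ.n≤1+n h))) ih ⟩
                Y.weight8 q μ ℕ.+ (∑ ps (λ p → X.weight8 p μ) ℕ.+ ∑ (qs ─ q∈) (λ q → Y.weight8 q μ)) ≡⟨ l₂ (Y.weight8 q μ) (∑ ps (λ p → X.weight8 p μ)) (∑ (qs ─ q∈) (λ q → Y.weight8 q μ)) ⟩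
                ∑ ps (λ p → X.weight8 p μ) ℕ.+ (Y.weight8 q μ ℕ.+ ∑ (qs ─ q∈) (λ q → Y.weight8 q μ)) ≡⟨ cong (∑ ps (λ p → X.weight8 p μ) ℕ.+_) (sym (∑-remove q∈ (λ q → Y.weight8 q μ))) ⟩
                ∑ ps (λ p → X.weight8 p μ) ℕ.+ ∑ qs (λ q → Y.weight8 q μ) ∎
                where
                l₂ : ∀ a b c → a ℕ.+ (b ℕ.+ c) ≡ b ℕ.+ (a ℕ.+ c)
                l₂ = solve-∀

      -- With more incidences than this the total weight would average to less than eight times
      -- their number. For some shift pruning could then neither account for all edges nor stop at a
      -- cluster.
      incidence-bound : 1024 ℕ.* Δ ≤ size → incidences xs ys ≤ 8 ℕ.* Δ ℕ.* (length xs ℕ.+ length ys)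
      incidence-bound small = ℕₚ.≮⇒≥ λ big → contra (∑-< elements (total big))
        where
        open ℕₚ.≤-Reasoning
        I = incidences xs ys
        n = length xs ℕ.+ length ys
        W : K → ℕ
        W μ = ∑ xs (λ p → X.weight8 p μ) ℕ.+ ∑ ys (λ q → Y.weight8 q μ)
        l₁ : ∀ s D a b I → a ℕ.* (s ℕ.* (32 ℕ.* D)) ℕ.+ s ℕ.* 2 ℕ.* I ℕ.+ (b ℕ.* (s ℕ.* (32 ℕ.* D)) ℕ.+ s ℕ.* 2 ℕ.* I) ≡ s ℕ.* (4 ℕ.* (8 ℕ.* D ℕ.* (a ℕ.+ b)) ℕ.+ 4 ℕ.* I)
        l₁ = solve-∀
        l₂ : ∀ I → 4 ℕ.* I ℕ.+ 4 ℕ.* I ≡ 8 ℕ.* I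
        l₂ = solve-∀
        l₃ : ∀ s D d → s ℕ.* (32 ℕ.* D ℕ.+ 2 ℕ.* d) ≡ s ℕ.* (32 ℕ.* D) ℕ.+ s ℕ.* 2 ℕ.* d
        l₃ = solve-∀
        sumX : ∑ xs (λ p → ∑ elements (X.weight8 p)) ≤ length xs ℕ.* (size ℕ.* (32 ℕ.* Δ)) ℕ.+ size ℕ.* 2 ℕ.* I
        sumX = begin
          ∑ xs (λ p → ∑ elements (X.weight8 p)) ≤⟨ ∑-mono xs (λ p → ℕₚ.≤-trans (X.∑-weight8 p small) (ℕₚ.≤-reflexive (l₃ size Δ _))) ⟩
          ∑ xs (λ p → size ℕ.* (32 ℕ.* Δ) ℕ.+ size ℕ.* 2 ℕ.* X.d p) ≡⟨ ∑-+ xs _ _ ⟩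
          ∑ xs (λ p → size ℕ.* (32 ℕ.* Δ)) ℕ.+ ∑ xs (λ p → size ℕ.* 2 ℕ.* X.d p) ≡⟨ cong₂ ℕ._+_ (∑-const xs _) (∑-*ˡ xs (size ℕ.* 2) X.d) ⟩
          length xs ℕ.* (size ℕ.* (32 ℕ.* Δ)) ℕ.+ size ℕ.* 2 ℕ.* I ∎
        sumY : ∑ ys (λ q → ∑ elements (Y.weight8 q)) ≤ length ys ℕ.* (size ℕ.* (32 ℕ.* Δ)) ℕ.+ size ℕ.* 2 ℕ.* I
        sumY = begin
          ∑ ys (λ q → ∑ elements (Y.weight8 q)) ≤⟨ ∑-mono ys (λ q → ℕₚ.≤-trans (Y.∑-weight8 q small) (ℕₚ.≤-reflexive (l₃ size Δ _))) ⟩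
          ∑ ys (λ q → size ℕ.* (32 ℕ.* Δ) ℕ.+ size ℕ.* 2 ℕ.* Y.d q) ≡⟨ ∑-+ ys _ _ ⟩
          ∑ ys (λ q → size ℕ.* (32 ℕ.* Δ)) ℕ.+ ∑ ys (λ q → size ℕ.* 2 ℕ.* Y.d q) ≡⟨ cong₂ ℕ._+_ (∑-const ys _) (∑-*ˡ ys (size ℕ.* 2) Y.d) ⟩
          length ys ℕ.* (size ℕ.* (32 ℕ.* Δ)) ℕ.+ size ℕ.* 2 ℕ.* ∑ ys (λ q → ∑ xs (λ p → [ adj? q p ]))
            ≡⟨ cong (λ z → length ys ℕ.* (size ℕ.* (32 ℕ.* Δ)) ℕ.+ size ℕ.* 2 ℕ.* z) (trans (∑-swap ys xs _) (∑-cong xs (λ p → ∑-cong ys (λ q → []-cong (adj? q p) (adj? p q) adj-sym adj-sym)))) ⟩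
          length ys ℕ.* (size ℕ.* (32 ℕ.* Δ)) ℕ.+ size ℕ.* 2 ℕ.* I ∎
        instance
          size-nonzero : ℕ.NonZero size
          size-nonzero = ℕ.>-nonZero (ℕₚ.≤-trans (s≤s z≤n) (ℕₚ.≤-trans (ℕₚ.m≤m*n 1 (1024 ℕ.* Δ)) (ℕₚ.≤-trans (ℕₚ.≤-reflexive (ℕₚ.*-identityˡ (1024 ℕ.* Δ))) small)))
        total : 8 ℕ.* Δ ℕ.* n < I → ∑ elements W < ∑ elements (λ _ → 8 ℕ.* I)
        total big = begin-strict
          ∑ elements W ≡⟨ ∑-+ elements _ _ ⟩
          ∑ elements (λ μ → ∑ xs (λ p → X.weight8 p μ)) ℕ.+ ∑ elements (λ μ → ∑ ys (λ q → Y.weight8 q μ)) ≡⟨ cong₂ ℕ._+_ (∑-swap elements xs _) (∑-swap elements ys _) ⟩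
          ∑ xs (λ p → ∑ elements (X.weight8 p)) ℕ.+ ∑ ys (λ q → ∑ elements (Y.weight8 q)) ≤⟨ ℕₚ.+-mono-≤ sumX sumY ⟩
          length xs ℕ.* (size ℕ.* (32 ℕ.* Δ)) ℕ.+ size ℕ.* 2 ℕ.* I ℕ.+ (length ys ℕ.* (size ℕ.* (32 ℕ.* Δ)) ℕ.+ size ℕ.* 2 ℕ.* I) ≡⟨ l₁ size Δ (length xs) (length ys) I ⟩
          size ℕ.* (4 ℕ.* (8 ℕ.* Δ ℕ.* n) ℕ.+ 4 ℕ.* I) <⟨ ℕₚ.*-monoʳ-< size (ℕₚ.+-monoˡ-< (4 ℕ.* I) (ℕₚ.*-monoʳ-< 4 big)) ⟩
          size ℕ.* (4 ℕ.* I ℕ.+ 4 ℕ.* I) ≡⟨ cong (size ℕ.*_) (l₂ I) ⟩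
          size ℕ.* (8 ℕ.* I) ≡⟨ sym (trans (∑-const elements (8 ℕ.* I)) (cong (ℕ._* (8 ℕ.* I)) elements-length)) ⟩
          ∑ elements (λ _ → 8 ℕ.* I) ∎
        contra : ∃[ μ ] (μ ∈ elements × W μ < 8 ℕ.* I) → ⊥
        contra (μ , _ , lt) = Data.Sum.[ ℕₚ.<⇒≱ lt , AtShift.no-cluster μ small ]′
          (AtShift.prune μ (∑ xs (λ _ → 1) ℕ.+ ∑ ys (λ _ → 1)) xs ys ℕₚ.≤-refl (λ f → ℕₚ.≤-refl) (λ f → ℕₚ.≤-refl) id id)

  -- Coincidences of a quadratic form

  module Quadratics where
    open PrimeField 𝕂
    open Univariate
    open Trivariate
    open Existence
    open Cores using (Triple; σ-of; β-of; γ-of)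
    open Incidence
    open Solver using (solve; _:+_; _:*_; _:-_; :-_; _:=_; :0; :1)
    open DecMembership _≟_ using (_∈?_)

    quadratic-roots : ∀ {α β γ xs} {P : K → Set} (P? : ∀ x → Dec (P x)) → AllPairs _≢_ xs → ¬ (α ≡ 0# × β ≡ 0#) →
      (∀ {x} → P x → γ + x * (β + x * α) ≡ 0#) → ∑ xs (λ x → [ P? x ]) ≤ 2
    quadratic-roots {α} {β} {γ} {xs} P? distinct ne eq = ℕₚ.≮⇒≥ λ lt →
      let z = roots⇒zero 2 g (filter P? xs) vg (subst (2 <_) (length-filter-count P? xs) lt) (AllPairsₚ.filter⁺ P? distinct) (All.map eq (Allₚ.all-filter P? xs))
      in ne (z 2 , z 1)
      where
      g : Series
      g 0 = γ
      g 1 = β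
      g 2 = α
      g (suc (suc (suc _))) = 0#
      vg : VanishAbove 2 g
      vg (suc (suc (suc n))) _ = refl
      vg (suc (suc zero)) (s≤s (s≤s ()))
      vg (suc zero) (s≤s ())

    linear-root : ∀ {β γ xs} {P : K → Set} (P? : ∀ x → Dec (P x)) → AllPairs _≢_ xs → β ≢ 0# → (∀ {x} → P x → β * x ≡ γ) → ∑ xs (λ x → [ P? x ]) ≤ 1
    linear-root P? distinct ne eq = ∑-unique-≤1 P? distinct (λ p q → *-cancelˡ ne (trans (eq p) (sym (eq q))))

    ×-split : ∀ {P Q : Set} (p : Dec P) (q : Dec Q) → [ p ×-dec q ] ≡ [ p ] ℕ.* [ q ]
    ×-split (yes _) (yes _) = refl
    ×-split (yes _) (no _) = refl
    ×-split (no _) (yes _) = refl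
    ×-split (no _) (no _) = refl

    module Form (c₂₀ c₁₁ c₀₂ c₁₀ c₀₁ c₀₀ : K) where
      f : K → K → K
      f u a = c₂₀ * (u * u) + c₁₁ * (u * a) + c₀₂ * (a * a) + c₁₀ * u + c₀₁ * a + c₀₀

      -- The expansion of f(x + b, a) in b: `m` multiplies b in the mixed term, `κ` collects what is
      -- free of b, and `φ` below what depends on b alone.
      m κ : K → K → K
      m x a = (c₂₀ + c₂₀) * x + c₁₁ * a
      κ x a = c₂₀ * (x * x) + c₁₁ * (x * a) + c₁₀ * x + c₀₂ * (a * a) + c₀₁ * a

      φ : K → K
      φ b = c₂₀ * (b * b) + c₁₀ * b

      -- In a coincidence (x, a) is paired with the b of the other side. With this exchange m b + κ
      -- + φ(b) = m′ b′ + κ′ + φ(b′) becomes the equation in `Adj`.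
      τ : K → K → K → Triple
      τ x a b = m x a , b , φ b - κ x a

      f-split : ∀ x b a → f (x + b) a ≡ m x a * b + κ x a + φ b + c₀₀
      f-split x b a = solve 9 (λ c20 c11 c02 c10 c01 c00 x b a →
        c20 :* ((x :+ b) :* (x :+ b)) :+ c11 :* ((x :+ b) :* a) :+ c02 :* (a :* a) :+ c10 :* (x :+ b) :+ c01 :* a :+ c00
        := ((c20 :+ c20) :* x :+ c11 :* a) :* b :+ (c20 :* (x :* x) :+ c11 :* (x :* a) :+ c10 :* x :+ c02 :* (a :* a) :+ c01 :* a) :+ (c20 :* (b :* b) :+ c10 :* b) :+ c00)
        refl c₂₀ c₁₁ c₀₂ c₁₀ c₀₁ c₀₀ x b a

      -- Eliminating x from `m` and `κ` leaves a quadratic in a whose two upper coefficients are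
      -- these expressions, the second one up to a factor 2. If both vanish, completing the square
      -- exhibits the polynomial as a function of one linear form.
      SquareForm : Set
      SquareForm = c₂₀ + c₂₀ ≢ 0# × ¬ ((c₂₀ + c₂₀) * (c₀₂ + c₀₂) - c₁₁ * c₁₁ ≡ 0# × (c₂₀ + c₂₀) * c₀₁ - c₁₀ * c₁₁ ≡ 0#)

      -- For fixed a the polynomial is affine in its first argument with coefficient c₁₁ a + c₁₀.
      -- The one value of a where this vanishes has to be kept out of `A₀`, which is why `A₀` may
      -- differ from `A`.
      ProductForm : List K → Set
      ProductForm A₀ = c₂₀ ≡ 0# × c₁₁ ≢ 0# × All (λ a → c₁₁ * a + c₁₀ ≢ 0#) A₀

      Admissible : List K → Set
      Admissible A₀ = (1# + 1# ≢ 0# × SquareForm) ⊎ ProductForm A₀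

      module Count (X A₀ B : List K) (dX : AllPairs _≢_ X) (dA : AllPairs _≢_ A₀) (dB : AllPairs _≢_ B) (adm : Admissible A₀) where

        Fibre : K → K → K → K → Set
        Fibre σ k x a = m x a ≡ σ × κ x a ≡ k

        fibre? : ∀ σ k x a → Dec (Fibre σ k x a)
        fibre? σ k x a = (m x a ≟ σ) ×-dec (κ x a ≟ k)

        -- In the square case a is a root of a fixed nontrivial quadratic and `m` then determines x.
        -- In the product case `m` determines a, and `κ` then determines x.
        fibre-bound : ∀ σ k → ∑ X (λ x → ∑ A₀ (λ a → [ fibre? σ k x a ])) ≤ 2
        fibre-bound σ k = bound adm
          where
          open ℕₚ.≤-Reasoning
          bound : Admissible A₀ → ∑ X (λ x → ∑ A₀ (λ a → [ fibre? σ k x a ])) ≤ 2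
          bound (inj₁ (two≢0 , s≢0 , nd)) = begin
            ∑ X (λ x → ∑ A₀ (λ a → [ fibre? σ k x a ])) ≡⟨ ∑-swap X A₀ _ ⟩
            ∑ A₀ (λ a → ∑ X (λ x → [ fibre? σ k x a ])) ≤⟨ ∑-mono A₀ (λ a → ∑-mono X (λ x → []-mono (fibre? σ k x a) (solvable? a ×-dec (m x a ≟ σ)) (λ p → solvable p , proj₁ p))) ⟩
            ∑ A₀ (λ a → ∑ X (λ x → [ solvable? a ×-dec (m x a ≟ σ) ])) ≡⟨ ∑-cong A₀ (λ a → trans (∑-cong X (λ x → ×-split (solvable? a) (m x a ≟ σ))) (∑-*ˡ X [ solvable? a ] _)) ⟩
            ∑ A₀ (λ a → [ solvable? a ] ℕ.* ∑ X (λ x → [ m x a ≟ σ ]))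
              ≤⟨ ∑-mono A₀ (λ a → ℕₚ.≤-trans (ℕₚ.*-monoʳ-≤ [ solvable? a ] (linear-root {c₂₀ + c₂₀} {σ - c₁₁ * a} (λ x → m x a ≟ σ) dX s≢0 (λ {x} e → trans (solve 2 (λ u v → u := u :+ v :- v) refl ((c₂₀ + c₂₀) * x) (c₁₁ * a)) (cong (_- c₁₁ * a) e)))) (ℕₚ.≤-reflexive (ℕₚ.*-identityʳ _))) ⟩
            ∑ A₀ (λ a → [ solvable? a ]) ≤⟨ quadratic-roots {α} {β} {γ} solvable? dA nd′ id ⟩
            2 ∎
            where
            α β γ : K
            α = (c₂₀ + c₂₀) * (c₀₂ + c₀₂) - c₁₁ * c₁₁
            β = ((c₂₀ + c₂₀) * c₀₁ - c₁₀ * c₁₁) * (1# + 1#)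
            γ = σ * σ + c₁₀ * (σ + σ) - (c₂₀ + c₂₀) * (k + k)
            solvable? : ∀ a → Dec (γ + a * (β + a * α) ≡ 0#)
            solvable? a = γ + a * (β + a * α) ≟ 0#
            nd′ : ¬ (α ≡ 0# × β ≡ 0#)
            nd′ (e , e′) = nd (e , *-zero-product (trans (*-comm _ _) e′) two≢0)
            solvable : ∀ {x a} → Fibre σ k x a → γ + a * (β + a * α) ≡ 0#
            solvable {x} {a} (refl , refl) = solve 7 (λ c20 c11 c02 c10 c01 x a →
              let m = (c20 :+ c20) :* x :+ c11 :* a
                  k = c20 :* (x :* x) :+ c11 :* (x :* a) :+ c10 :* x :+ c02 :* (a :* a) :+ c01 :* a
              in m :* m :+ c10 :* (m :+ m) :- (c20 :+ c20) :* (k :+ k) :+ a :* (((c20 :+ c20) :* c01 :- c10 :* c11) :* (:1 :+ :1) :+ a :* ((c20 :+ c20) :* (c02 :+ c02) :- c11 :* c11)) := :0)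
              refl c₂₀ c₁₁ c₀₂ c₁₀ c₀₁ x a
          bound (inj₂ (refl , c≢0 , lin)) = begin
            ∑ X (λ x → ∑ A₀ (λ a → [ fibre? σ k x a ])) ≡⟨ ∑-swap X A₀ _ ⟩
            ∑ A₀ (λ a → ∑ X (λ x → [ fibre? σ k x a ])) ≤⟨ ∑-mono-∈ A₀ (λ {a} a∈ → ℕₚ.≤-trans (∑-mono X (λ x → []-mono (fibre? σ k x a) ((c₁₁ * a ≟ σ) ×-dec ((c₁₁ * a + c₁₀) * x ≟ k - (c₀₂ * (a * a) + c₀₁ * a))) (conv x a)))
                 (ℕₚ.≤-trans (ℕₚ.≤-reflexive (trans (∑-cong X (λ x → ×-split (c₁₁ * a ≟ σ) _)) (∑-*ˡ X [ c₁₁ * a ≟ σ ] _)))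
                   (ℕₚ.≤-trans (ℕₚ.*-monoʳ-≤ [ c₁₁ * a ≟ σ ] (linear-root (λ x → (c₁₁ * a + c₁₀) * x ≟ _) dX (All.lookup lin a∈) id)) (ℕₚ.≤-reflexive (ℕₚ.*-identityʳ _))))) ⟩
            ∑ A₀ (λ a → [ c₁₁ * a ≟ σ ]) ≤⟨ linear-root (λ a → c₁₁ * a ≟ σ) dA c≢0 id ⟩
            1 ≤⟨ s≤s z≤n ⟩
            2 ∎
            where
            conv : ∀ x a → Fibre σ k x a → c₁₁ * a ≡ σ × (c₁₁ * a + c₁₀) * x ≡ k - (c₀₂ * (a * a) + c₀₁ * a)
            conv x a (refl , refl) = solve 3 (λ c x a → c :* a := (:0 :+ :0) :* x :+ c :* a) refl c₁₁ x a ,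
              solve 6 (λ c11 c02 c10 c01 x a → (c11 :* a :+ c10) :* x := (:0 :* (x :* x) :+ c11 :* (x :* a) :+ c10 :* x :+ c02 :* (a :* a) :+ c01 :* a) :- (c02 :* (a :* a) :+ c01 :* a)) refl c₁₁ c₀₂ c₁₀ c₀₁ x a

        column? : ∀ t k x a → Dec (κ x a + m x a * t ≡ k)
        column? t k x a = κ x a + m x a * t ≟ k

        -- For fixed a this is a polynomial equation of degree at most two in x, and admissibility
        -- keeps its coefficients of x² and x from vanishing together.
        column-bound : ∀ t k {a} → a ∈ A₀ → ∑ X (λ x → [ column? t k x a ]) ≤ 2
        column-bound t k {a} a∈ = quadratic-roots {c₂₀} {c₁₁ * a + c₁₀ + (c₂₀ + c₂₀) * t} {c₀₂ * (a * a) + c₀₁ * a + c₁₁ * a * t - k} (λ x → column? t k x a) dX (nd adm)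
            (λ {x} e → trans (solve 9 (λ c20 c11 c02 c10 c01 x a t k →
               (c02 :* (a :* a) :+ c01 :* a :+ c11 :* a :* t :- k) :+ x :* ((c11 :* a :+ c10 :+ (c20 :+ c20) :* t) :+ x :* c20)
               := ((c20 :* (x :* x) :+ c11 :* (x :* a) :+ c10 :* x :+ c02 :* (a :* a) :+ c01 :* a) :+ ((c20 :+ c20) :* x :+ c11 :* a) :* t) :- k) refl c₂₀ c₁₁ c₀₂ c₁₀ c₀₁ x a t k) (x≡y⇒x-y≡0 e))
          where
          nd : Admissible A₀ → ¬ (c₂₀ ≡ 0# × c₁₁ * a + c₁₀ + (c₂₀ + c₂₀) * t ≡ 0#)
          nd (inj₁ (_ , s≢0 , _)) (e , _) = s≢0 (trans (cong₂ _+_ e e) (+-identityʳ 0#))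
          nd (inj₂ (refl , _ , lin)) (_ , e) = All.lookup lin a∈ (trans (solve 2 (λ u t → u := u :+ (:0 :+ :0) :* t) refl (c₁₁ * a + c₁₀) t) e)

        V : List Triple
        V = concatMap (λ x → concatMap (λ a → map (τ x a) B) A₀) X

        ∑-V : ∀ g → ∑ V g ≡ ∑ X (λ x → ∑ A₀ (λ a → ∑ B (λ b → g (τ x a b))))
        ∑-V g = trans (∑-concatMap _ X g) (∑-cong X (λ x → trans (∑-concatMap _ A₀ g) (∑-cong A₀ (λ a → ∑-map (τ x a) B g))))

        ∑-V′ : ∀ g → ∑ V g ≡ ∑ B (λ b → ∑ X (λ x → ∑ A₀ (λ a → g (τ x a b))))
        ∑-V′ g = trans (∑-V g) (trans (∑-cong X (λ x → ∑-swap A₀ B _)) (∑-swap X B _))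

        N : ℕ
        N = length X ℕ.* length A₀ ℕ.* length B

        length-V : length V ≡ N
        length-V = trans (sym (length-∑ V)) (trans (∑-V _) (trans (∑-cong X (λ x → trans (∑-cong A₀ (λ a → length-∑ B)) (∑-const A₀ _)))
          (trans (∑-const X _) (sym (ℕₚ.*-assoc (length X) (length A₀) (length B))))))

        multiplicity : ∀ v → ∑ V (λ w → [ v ≟ₜ w ]) ≤ 2
        multiplicity v@(σ , β , γ) = begin
          ∑ V (λ w → [ v ≟ₜ w ]) ≡⟨ ∑-V′ _ ⟩
          ∑ B (λ b → ∑ X (λ x → ∑ A₀ (λ a → [ v ≟ₜ τ x a b ])))
            ≤⟨ ∑-mono B (λ b → ∑-mono X (λ x → ∑-mono A₀ (λ a → ℕₚ.≤-trans ([]-mono (v ≟ₜ τ x a b) ((β ≟ b) ×-dec fibre? σ (φ β - γ) x a) (conv x a b)) (ℕₚ.≤-reflexive (×-split (β ≟ b) _))))) ⟩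
          ∑ B (λ b → ∑ X (λ x → ∑ A₀ (λ a → [ β ≟ b ] ℕ.* [ fibre? σ (φ β - γ) x a ])))
            ≡⟨ ∑-cong B (λ b → trans (∑-cong X (λ x → ∑-*ˡ A₀ [ β ≟ b ] _)) (∑-*ˡ X [ β ≟ b ] _)) ⟩
          ∑ B (λ b → [ β ≟ b ] ℕ.* ∑ X (λ x → ∑ A₀ (λ a → [ fibre? σ (φ β - γ) x a ]))) ≤⟨ ∑-distinct-≤ _≟_ dB β (λ _ → ∑ X (λ x → ∑ A₀ (λ a → [ fibre? σ (φ β - γ) x a ]))) ⟩
          ∑ X (λ x → ∑ A₀ (λ a → [ fibre? σ (φ β - γ) x a ])) ≤⟨ fibre-bound σ (φ β - γ) ⟩
          2 ∎
          where
          open ℕₚ.≤-Reasoning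
          conv : ∀ x a b → v ≡ τ x a b → β ≡ b × Fibre σ (φ β - γ) x a
          conv x a b refl = refl , refl , solve 2 (λ k p → k := p :- (p :- k)) refl (κ x a) (φ b)

        k : ℕ
        k = 2 ℕ.* (length A₀ ℕ.+ length B)

        -- For `μ` nonzero, each b fixes the value of `m` through the relation and the value of `κ`
        -- through adjacency, which leaves one fibre. For `μ` zero the relation fixes b itself, and
        -- adjacency becomes one equation for x in each column a.
        pencil : PencilBound k V V
        pencil {p} p∈ μ ν ρ nontrivial = bound (μ ≟ 0#)
          where
          open ℕₚ.≤-Reasoning
          σp = σ-of p
          βp = β-of p
          γp = γ-of p
          bound : Dec (μ ≡ 0#) → ∑ V (λ q → [ onPencil? p μ ν ρ q ]) ≤ k
          bound (no μ≢0) = begin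
            ∑ V (λ q → [ onPencil? p μ ν ρ q ]) ≡⟨ ∑-V′ _ ⟩
            ∑ B (λ b → ∑ X (λ x → ∑ A₀ (λ a → [ onPencil? p μ ν ρ (τ x a b) ])))
              ≤⟨ ∑-mono B (λ b → ℕₚ.≤-trans (∑-mono X (λ x → ∑-mono A₀ (λ a → []-mono (onPencil? p μ ν ρ (τ x a b)) (fibre? (s b) (g b) x a) (conv x a b)))) (fibre-bound (s b) (g b))) ⟩
            ∑ B (λ _ → 2) ≡⟨ trans (∑-const B 2) (ℕₚ.*-comm (length B) 2) ⟩
            2 ℕ.* length B ≤⟨ ℕₚ.*-monoʳ-≤ 2 (ℕₚ.m≤n+m (length B) (length A₀)) ⟩
            k ∎
            where
            s g : K → K
            s b = inv μ * (ρ - ν * b)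
            g b = φ b + σp * b - (γp + s b * βp)
            conv : ∀ x a b → OnPencil p μ ν ρ (τ x a b) → Fibre (s b) (g b) x a
            conv x a b ((_ , adj) , e) = ms , trans (solve 4 (λ k p s r → k := p :+ s :- (p :- k :+ s)) refl (κ x a) (φ b) (σp * b) (γp))
                (cong (λ z → φ b + σp * b - z) (trans adj (cong (λ z → γp + z * βp) ms)))
              where
              ms : m x a ≡ s b
              ms = *-cancelˡ μ≢0 (trans (solve 2 (λ u v → u := u :+ v :- v) refl (μ * m x a) (ν * b)) (trans (cong (_- ν * b) e)
                (trans (sym (*-identityˡ _)) (trans (cong (_* (ρ - ν * b)) (sym (inverseʳ μ μ≢0))) (*-assoc μ (inv μ) _)))))
          bound (yes refl) = begin
            ∑ V (λ q → [ onPencil? p 0# ν ρ q ]) ≡⟨ ∑-V′ _ ⟩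
            ∑ B (λ b → ∑ X (λ x → ∑ A₀ (λ a → [ onPencil? p 0# ν ρ (τ x a b) ])))
              ≤⟨ ∑-mono B (λ b → ∑-mono X (λ x → ∑-mono A₀ (λ a → ℕₚ.≤-trans ([]-mono (onPencil? p 0# ν ρ (τ x a b)) ((b₀ ≟ b) ×-dec column? βp r x a) (conv x a b)) (ℕₚ.≤-reflexive (×-split (b₀ ≟ b) _))))) ⟩
            ∑ B (λ b → ∑ X (λ x → ∑ A₀ (λ a → [ b₀ ≟ b ] ℕ.* [ column? βp r x a ])))
              ≡⟨ ∑-cong B (λ b → trans (∑-cong X (λ x → ∑-*ˡ A₀ [ b₀ ≟ b ] _)) (∑-*ˡ X [ b₀ ≟ b ] _)) ⟩
            ∑ B (λ b → [ b₀ ≟ b ] ℕ.* ∑ X (λ x → ∑ A₀ (λ a → [ column? βp r x a ]))) ≤⟨ ∑-distinct-≤ _≟_ dB b₀ (λ _ → ∑ X (λ x → ∑ A₀ (λ a → [ column? βp r x a ]))) ⟩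
            ∑ X (λ x → ∑ A₀ (λ a → [ column? βp r x a ])) ≡⟨ ∑-swap X A₀ _ ⟩
            ∑ A₀ (λ a → ∑ X (λ x → [ column? βp r x a ])) ≤⟨ ∑-mono-∈ A₀ (column-bound βp r) ⟩
            ∑ A₀ (λ _ → 2) ≡⟨ trans (∑-const A₀ 2) (ℕₚ.*-comm (length A₀) 2) ⟩
            2 ℕ.* length A₀ ≤⟨ ℕₚ.*-monoʳ-≤ 2 (ℕₚ.m≤m+n (length A₀) (length B)) ⟩
            k ∎
            where
            ν≢0 : ν ≢ 0#
            ν≢0 e = nontrivial (refl , e)
            b₀ r : K
            b₀ = inv ν * ρ
            r = φ b₀ + σp * b₀ - γp
            conv : ∀ x a b → OnPencil p 0# ν ρ (τ x a b) → b₀ ≡ b × κ x a + m x a * βp ≡ r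
            conv x a b ((_ , adj) , e) = sym b≡ , trans (solve 5 (λ k p s g t → k :+ t := p :+ s :- (p :- k :+ s) :+ t) refl (κ x a) (φ b) (σp * b) γp (m x a * βp))
                (trans (cong (λ z → φ b + σp * b - z + m x a * βp) adj) (trans (solve 3 (λ p g t → p :- (g :+ t) :+ t := p :- g) refl (φ b + σp * b) γp (m x a * βp))
                  (cong (λ z → φ z + σp * z - γp) b≡)))
              where
              b≡ : b ≡ b₀
              b≡ = *-cancelˡ ν≢0 (trans (solve 2 (λ u v → v := :0 :* u :+ v) refl (m x a) (ν * b)) (trans e (trans (sym (*-identityˡ ρ)) (trans (cong (_* ρ) (sym (inverseʳ ν ν≢0))) (*-assoc ν (inv ν) ρ)))))

        ∑₃ : (K → K → K → ℕ) → ℕ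
        ∑₃ g = ∑ X (λ x → ∑ A₀ (λ a → ∑ B (λ b → g x a b)))

        energy : ℕ
        energy = ∑₃ (λ x a b → ∑₃ (λ x′ a′ b′ → [ f (x + b) a ≟ f (x′ + b′) a′ ]))

        Parallel : K → K → K → K → K → K → Set
        Parallel x a b x′ a′ b′ = Fibre (m x a) (κ x a + φ b + m x a * b - φ b′ - m x a * b′) x′ a′

        parallel? : ∀ x a b x′ a′ b′ → Dec (Parallel x a b x′ a′ b′)
        parallel? x a b x′ a′ b′ = fibre? (m x a) (κ x a + φ b + m x a * b - φ b′ - m x a * b′) x′ a′

        -- With different `m` the coincidence is an adjacency of triples with exchanged b. With
        -- equal `m` the lines are parallel, but then (x′, a′) lies in a single fibre once b′ is
        -- given.
        split-energy : ∀ x a b x′ a′ b′ → [ f (x + b) a ≟ f (x′ + b′) a′ ] ≤ [ adj? (τ x a b′) (τ x′ a′ b) ] ℕ.+ [ parallel? x a b x′ a′ b′ ]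
        split-energy x a b x′ a′ b′ = cases (f (x + b) a ≟ f (x′ + b′) a′) (m x a ≟ m x′ a′)
          where
          cases : (e : Dec (f (x + b) a ≡ f (x′ + b′) a′)) → Dec (m x a ≡ m x′ a′) → [ e ] ≤ [ adj? (τ x a b′) (τ x′ a′ b) ] ℕ.+ [ parallel? x a b x′ a′ b′ ]
          cases (no _) _ = z≤n
          cases (yes e) d = lem d
            where
            core-eq : m x a * b + κ x a + φ b ≡ m x′ a′ * b′ + κ x′ a′ + φ b′
            core-eq = trans (solve 2 (λ u c → u := u :+ c :- c) refl _ c₀₀) (trans (cong (_- c₀₀) (trans (sym (f-split x b a)) (trans e (f-split x′ b′ a′)))) (solve 2 (λ u c → u :+ c :- c := u) refl _ c₀₀))
            lem : Dec (m x a ≡ m x′ a′) → 1 ≤ [ adj? (τ x a b′) (τ x′ a′ b) ] ℕ.+ [ parallel? x a b x′ a′ b′ ]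
            lem (no ne) = ℕₚ.≤-trans (ℕₚ.≤-reflexive (sym ([]-yes (adj? (τ x a b′) (τ x′ a′ b)) (ne , (begin
                φ b - κ x′ a′ + m x a * b ≡⟨ solve 4 (λ p k k′ t → p :- k′ :+ t := t :+ k :+ p :- k :- k′) refl (φ b) (κ x a) (κ x′ a′) (m x a * b) ⟩
                m x a * b + κ x a + φ b - κ x a - κ x′ a′ ≡⟨ cong (λ z → z - κ x a - κ x′ a′) core-eq ⟩
                m x′ a′ * b′ + κ x′ a′ + φ b′ - κ x a - κ x′ a′ ≡⟨ solve 4 (λ p k k′ t → t :+ k′ :+ p :- k :- k′ := p :- k :+ t) refl (φ b′) (κ x a) (κ x′ a′) (m x′ a′ * b′) ⟩
                φ b′ - κ x a + m x′ a′ * b′ ∎))))) (ℕₚ.m≤m+n _ _)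
              where open ≡-Reasoning
            lem (yes eq) = ℕₚ.≤-trans (ℕₚ.≤-reflexive (sym ([]-yes (parallel? x a b x′ a′ b′) (sym eq , (begin
                κ x′ a′ ≡⟨ solve 3 (λ k p t → k := t :+ k :+ p :- p :- t) refl (κ x′ a′) (φ b′) (m x′ a′ * b′) ⟩
                m x′ a′ * b′ + κ x′ a′ + φ b′ - φ b′ - m x′ a′ * b′ ≡⟨ cong₂ (λ z w → z - φ b′ - w * b′) (sym core-eq) (sym eq) ⟩
                m x a * b + κ x a + φ b - φ b′ - m x a * b′ ≡⟨ solve 5 (λ t k p p′ t′ → t :+ k :+ p :- p′ :- t′ := k :+ p :+ t :- p′ :- t′) refl (m x a * b) (κ x a) (φ b) (φ b′) (m x a * b′) ⟩
                κ x a + φ b + m x a * b - φ b′ - m x a * b′ ∎))))) (ℕₚ.m≤n+m _ _)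
              where open ≡-Reasoning

        ∑₃-mono : ∀ {g h : K → K → K → ℕ} → (∀ x a b → g x a b ≤ h x a b) → ∑₃ g ≤ ∑₃ h
        ∑₃-mono le = ∑-mono X (λ x → ∑-mono A₀ (λ a → ∑-mono B (λ b → le x a b)))

        ∑₃-+ : ∀ (g h : K → K → K → ℕ) → ∑₃ (λ x a b → g x a b ℕ.+ h x a b) ≡ ∑₃ g ℕ.+ ∑₃ h
        ∑₃-+ g h = trans (∑-cong X (λ x → trans (∑-cong A₀ (λ a → ∑-+ B (g x a) (h x a))) (∑-+ A₀ _ _))) (∑-+ X _ _)

        ∑₃-const : ∀ c → ∑₃ (λ _ _ _ → c) ≡ N ℕ.* c
        ∑₃-const c = trans (∑-cong X (λ x → trans (∑-cong A₀ (λ a → ∑-const B c)) (∑-const A₀ _))) (trans (∑-const X _) (lem (length X) (length A₀) (length B) c))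
          where lem : ∀ x a b c → x ℕ.* (a ℕ.* (b ℕ.* c)) ≡ x ℕ.* a ℕ.* b ℕ.* c
                lem = solve-∀

        adjacent-sum : ∑₃ (λ x a b → ∑₃ (λ x′ a′ b′ → [ adj? (τ x a b′) (τ x′ a′ b) ])) ≡ incidences V V
        adjacent-sum = trans (∑-cong X (λ x → ∑-cong A₀ (λ a → trans (∑-cong B (λ b → trans (∑-cong X (λ x′ → ∑-swap A₀ B _)) (∑-swap X B _)))
            (trans (∑-swap B B _) (∑-cong B (λ b′ → trans (∑-swap B X _) (∑-cong X (λ x′ → ∑-swap B A₀ _))))))))
          (sym (trans (∑-V _) (∑-cong X (λ x → ∑-cong A₀ (λ a → ∑-cong B (λ b′ → ∑-V _))))))

        energy-bound : ∀ D → N ℕ.* 6 ≤ suc D ℕ.* suc D → 1024 ℕ.* suc (5 ℕ.* (D ℕ.+ (D ℕ.+ (D ℕ.+ 0))) ℕ.+ k) ≤ size →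
          energy ≤ 8 ℕ.* suc (5 ℕ.* (D ℕ.+ (D ℕ.+ (D ℕ.+ 0))) ℕ.+ k) ℕ.* (N ℕ.+ N) ℕ.+ N ℕ.* (length B ℕ.* 2)
        energy-bound D room small = begin
          energy ≤⟨ ∑₃-mono (λ x a b → ∑₃-mono (λ x′ a′ b′ → split-energy x a b x′ a′ b′)) ⟩
          ∑₃ (λ x a b → ∑₃ (λ x′ a′ b′ → [ adj? (τ x a b′) (τ x′ a′ b) ] ℕ.+ [ parallel? x a b x′ a′ b′ ]))
            ≡⟨ trans (∑-cong X (λ x → ∑-cong A₀ (λ a → ∑-cong B (λ b → ∑₃-+ _ _)))) (∑₃-+ _ _) ⟩
          ∑₃ (λ x a b → ∑₃ (λ x′ a′ b′ → [ adj? (τ x a b′) (τ x′ a′ b) ])) ℕ.+ ∑₃ (λ x a b → ∑₃ (λ x′ a′ b′ → [ parallel? x a b x′ a′ b′ ]))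
            ≤⟨ ℕₚ.+-mono-≤ (ℕₚ.≤-trans (ℕₚ.≤-reflexive adjacent-sum) inc)
                 (∑₃-mono (λ x a b → ℕₚ.≤-trans (ℕₚ.≤-reflexive (trans (∑-cong X (λ x′ → ∑-swap A₀ B _)) (∑-swap X B _)))
                    (ℕₚ.≤-trans (∑-mono B (λ b′ → fibre-bound (m x a) (κ x a + φ b + m x a * b - φ b′ - m x a * b′))) (ℕₚ.≤-reflexive (∑-const B 2))))) ⟩
          8 ℕ.* suc (5 ℕ.* (D ℕ.+ (D ℕ.+ (D ℕ.+ 0))) ℕ.+ k) ℕ.* (N ℕ.+ N) ℕ.+ ∑₃ (λ _ _ _ → length B ℕ.* 2) ≡⟨ cong (8 ℕ.* suc (5 ℕ.* (D ℕ.+ (D ℕ.+ (D ℕ.+ 0))) ℕ.+ k) ℕ.* (N ℕ.+ N) ℕ.+_) (∑₃-const _) ⟩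
          8 ℕ.* suc (5 ℕ.* (D ℕ.+ (D ℕ.+ (D ℕ.+ 0))) ℕ.+ k) ℕ.* (N ℕ.+ N) ℕ.+ N ℕ.* (length B ℕ.* 2) ∎
          where
          open ℕₚ.≤-Reasoning
          room′ : (length V ℕ.+ length V) ℕ.* 3 ≤ suc D ℕ.* suc D
          room′ = subst (λ z → (z ℕ.+ z) ℕ.* 3 ≤ suc D ℕ.* suc D) (sym length-V) (ℕₚ.≤-trans (ℕₚ.≤-reflexive (lem N)) room)
            where lem : ∀ n → (n ℕ.+ n) ℕ.* 3 ≡ n ℕ.* 6
                  lem = solve-∀
          inc : incidences V V ≤ 8 ℕ.* suc (5 ℕ.* (D ℕ.+ (D ℕ.+ (D ℕ.+ 0))) ℕ.+ k) ℕ.* (N ℕ.+ N)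
          inc = subst (λ z → incidences V V ≤ 8 ℕ.* suc (5 ℕ.* (D ℕ.+ (D ℕ.+ (D ℕ.+ 0))) ℕ.+ k) ℕ.* (z ℕ.+ z)) length-V
            (Bound.incidence-bound D k V V multiplicity multiplicity pencil pencil room′ small)

        J : List K → ℕ
        J A = ∑ X (λ x → ∑ B (λ b → [ x + b ∈? A ]))

        -- A pair counted by `J` combines with any a in `A₀` to a value of `f` lying in `F`.
        -- Grouping these triples by value, Cauchy-Schwarz bounds their number by `F` and the
        -- coincidences.
        J²-bound : ∀ {A F} → (∀ {a} → a ∈ A₀ → a ∈ A) → AllPairs _≢_ F → (∀ {u a} → u ∈ A → a ∈ A → f u a ∈ F) →
          (J A ℕ.* length A₀) ℕ.* (J A ℕ.* length A₀) ≤ length F ℕ.* energy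
        J²-bound {A} {F} A₀⊆A dF closed = begin
          (J A ℕ.* length A₀) ℕ.* (J A ℕ.* length A₀) ≤⟨ ℕₚ.*-mono-≤ total total ⟩
          ∑ F w ℕ.* ∑ F w ≡⟨ cong (λ z → z ℕ.* z) (∑-cong F (λ c → sym (ℕₚ.*-identityˡ (w c)))) ⟩
          ∑ F (λ c → 1 ℕ.* w c) ℕ.* ∑ F (λ c → 1 ℕ.* w c) ≤⟨ cauchy-schwarz F (λ _ → 1) w ⟩
          ∑ F (λ _ → 1 ℕ.* 1) ℕ.* ∑ F (λ c → w c ℕ.* w c) ≤⟨ ℕₚ.*-mono-≤ (ℕₚ.≤-reflexive (length-∑ F)) w²-bound ⟩
          length F ℕ.* energy ∎
          where
          open ℕₚ.≤-Reasoning
          w : K → ℕ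
          w c = ∑₃ (λ x a b → [ f (x + b) a ≟ c ])
          ∑₃-swap : ∀ {C : Set} (cs : List C) (g : K → K → K → C → ℕ) → ∑ cs (λ c → ∑₃ (λ x a b → g x a b c)) ≡ ∑₃ (λ x a b → ∑ cs (g x a b))
          ∑₃-swap cs g = trans (∑-swap cs X _) (∑-cong X (λ x → trans (∑-swap cs A₀ _) (∑-cong A₀ (λ a → ∑-swap cs B _))))
          total : J A ℕ.* length A₀ ≤ ∑ F w
          total = begin
            J A ℕ.* length A₀ ≡⟨ ℕₚ.*-comm (J A) (length A₀) ⟩
            length A₀ ℕ.* J A ≡⟨ sym (∑-const A₀ (J A)) ⟩
            ∑ A₀ (λ a → J A) ≡⟨ ∑-swap A₀ X _ ⟩
            ∑ X (λ x → ∑ A₀ (λ a → ∑ B (λ b → [ x + b ∈? A ])))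
              ≤⟨ ∑-mono X (λ x → ∑-mono-∈ A₀ (λ {a} a∈ → ∑-mono B (λ b → one x a b a∈ (x + b ∈? A)))) ⟩
            ∑₃ (λ x a b → ∑ F (λ c → [ f (x + b) a ≟ c ])) ≡⟨ sym (∑₃-swap F (λ x a b c → [ f (x + b) a ≟ c ])) ⟩
            ∑ F w ∎
            where
            one : ∀ x a b → a ∈ A₀ → (d : Dec (x + b ∈ A)) → [ d ] ≤ ∑ F (λ c → [ f (x + b) a ≟ c ])
            one x a b a∈ (no _) = z≤n
            one x a b a∈ (yes d) = ℕₚ.≤-trans (ℕₚ.≤-reflexive (sym ([]-yes (f (x + b) a ≟ f (x + b) a) refl))) (∑-∈ (λ c → [ f (x + b) a ≟ c ]) (closed d (A₀⊆A a∈)))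
          w-pair : ∀ c → w c ℕ.* w c ≡ ∑₃ (λ x a b → ∑₃ (λ x′ a′ b′ → [ f (x + b) a ≟ c ] ℕ.* [ f (x′ + b′) a′ ≟ c ]))
          w-pair c = trans (sym (∑-*ʳ X (w c) _)) (∑-cong X (λ x → trans (sym (∑-*ʳ A₀ (w c) _)) (∑-cong A₀ (λ a → trans (sym (∑-*ʳ B (w c) _)) (∑-cong B (λ b →
            trans (sym (∑-*ˡ X [ f (x + b) a ≟ c ] _)) (∑-cong X (λ x′ → trans (sym (∑-*ˡ A₀ [ f (x + b) a ≟ c ] _)) (∑-cong A₀ (λ a′ → sym (∑-*ˡ B [ f (x + b) a ≟ c ] _)))))))))))
          w²-bound : ∑ F (λ c → w c ℕ.* w c) ≤ energy
          w²-bound = begin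
            ∑ F (λ c → w c ℕ.* w c) ≡⟨ ∑-cong F w-pair ⟩
            ∑ F (λ c → ∑₃ (λ x a b → ∑₃ (λ x′ a′ b′ → [ f (x + b) a ≟ c ] ℕ.* [ f (x′ + b′) a′ ≟ c ])))
              ≡⟨ trans (∑₃-swap F (λ x a b c → ∑₃ (λ x′ a′ b′ → [ f (x + b) a ≟ c ] ℕ.* [ f (x′ + b′) a′ ≟ c ])))
                   (∑-cong X (λ x → ∑-cong A₀ (λ a → ∑-cong B (λ b → ∑₃-swap F (λ x′ a′ b′ c → [ f (x + b) a ≟ c ] ℕ.* [ f (x′ + b′) a′ ≟ c ]))))) ⟩
            ∑₃ (λ x a b → ∑₃ (λ x′ a′ b′ → ∑ F (λ c → [ f (x + b) a ≟ c ] ℕ.* [ f (x′ + b′) a′ ≟ c ])))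
              ≤⟨ ∑₃-mono (λ x a b → ∑₃-mono (λ x′ a′ b′ → ℕₚ.≤-trans (∑-distinct-≤ _≟_ dF (f (x + b) a) (λ c → [ f (x′ + b′) a′ ≟ c ]))
                   ([]-mono (f (x′ + b′) a′ ≟ f (x + b) a) (f (x + b) a ≟ f (x′ + b′) a′) sym))) ⟩
            energy ∎

  -- The bound for sums falling into the set

  module StarBound where
    open import Data.Nat
    open import Data.Nat.Properties
    open PrimeField 𝕂 using (K; size) renaming (_+_ to _+ₖ_; _≟_ to _≟ₖ_)
    open Univariate using () renaming (+-comm to +ₖ-comm)
    open Quadratics
    open DecMembership _≟ₖ_ using (_∈?_)

    J : List K → List K → List K → ℕ
    J A X B = ∑ X (λ x → ∑ B (λ b → [ x +ₖ b ∈? A ]))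

    J-comm : ∀ A X B → J A X B ≡ J A B X
    J-comm A X B = trans (∑-swap X B _) (∑-cong B (λ b → ∑-cong X (λ x → cong (λ z → [ z ∈? A ]) (+ₖ-comm x b))))

    J-trivial : ∀ A X B → J A X B ≤ length B * length X
    J-trivial A X B = ≤-trans (∑-mono X (λ x → ≤-trans (∑-mono B (λ b → []≤1 (x +ₖ b ∈? A))) (≤-reflexive (length-∑ B)))) (≤-reflexive (trans (∑-const X (length B)) (*-comm (length X) (length B))))

    module Closed (c₂₀ c₁₁ c₀₂ c₁₀ c₀₁ c₀₀ : K) (A A₀ F : List K) (dA₀ : AllPairs _≢_ A₀) (dF : AllPairs _≢_ F)
                  (A₀⊆A : ∀ {a} → a ∈ A₀ → a ∈ A) (closed : ∀ {u a} → u ∈ A → a ∈ A → Form.f c₂₀ c₁₁ c₀₂ c₁₀ c₀₁ c₀₀ u a ∈ F)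
                  (adm : Form.Admissible c₂₀ c₁₁ c₀₂ c₁₀ c₀₁ c₀₀ A₀)
                  (M : ℕ) (F≤M : length F ≤ M) (A≤M : length A ≤ M) (A₀≤A : length A₀ ≤ length A) (A≤2A₀ : length A ≤ 2 * length A₀) where
      open Form c₂₀ c₁₁ c₀₂ c₁₀ c₀₁ c₀₀

      private
        n = length A
        n₀ = length A₀

      small-product : ∀ X B → length B * length X ≤ n₀ → n * fourth (J A X B) ≤ M * M * cube (length B * length X) * 2
      small-product X B le = begin
        n * fourth (J A X B) ≤⟨ *-mono-≤ A≤2A₀ (fourth-mono (J-trivial A X B)) ⟩
        2 * n₀ * fourth s ≡⟨ l₁ n₀ s ⟩
        n₀ * s * cube s * 2 ≤⟨ *-monoˡ-≤ 2 (*-monoˡ-≤ (cube s) (*-mono-≤ (≤-trans A₀≤A A≤M) (≤-trans le (≤-trans A₀≤A A≤M)))) ⟩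
        M * M * cube s * 2 ∎
        where
        open ≤-Reasoning
        s = length B * length X
        l₁ : ∀ a s → 2 * a * (s * s * (s * s)) ≡ a * s * (s * s * s) * 2
        l₁ = solve-∀

      -- `D` is the integer root of 6N: then the (D+1)³ coefficients outnumber the 3D+1 conditions
      -- on each of 2N lines. Since n₀ ≤ |X||B| and |B| ≤ |X|, the pencil bound is at most of the
      -- same order √N, hence so is Δ.
      large-product : ∀ X B → AllPairs _≢_ X → AllPairs _≢_ B → length B ≤ length X → n₀ ≤ length B * length X → 1 ≤ n₀ →
        n * (length B * length X) * 5436 * 1024 * 1024 ≤ size * size →
        n * fourth (J A X B) ≤ M * M * cube (length B * length X) * 3142008
      large-product X B dX dB B≤X n₀≤s 1≤n₀ fits with integer-sqrt (Count.N X A₀ B dX dA₀ dB adm * 6)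
      ... | D , lo , hi = final
        where
        open Count X A₀ B dX dA₀ dB adm using (N; k; energy; energy-bound; J²-bound)
        open ≤-Reasoning
        b = length B
        s = b * length X
        Δ = suc (5 * (D + (D + (D + 0))) + k)
        j = J A X B
        N≡ : N ≡ n₀ * s
        N≡ = lem (length X) n₀ b
          where lem : ∀ x a b → x * a * b ≡ a * (b * x)
                lem = solve-∀
        1≤N : 1 ≤ N
        1≤N = subst (1 ≤_) (sym N≡) (*-mono-≤ 1≤n₀ (≤-trans 1≤n₀ n₀≤s))
        n₀²≤N : n₀ * n₀ ≤ N
        n₀²≤N = subst (n₀ * n₀ ≤_) (sym N≡) (*-monoʳ-≤ n₀ n₀≤s)
        b²≤N : b * b ≤ N
        b²≤N = ≤-trans (*-monoʳ-≤ b B≤X) (subst (s ≤_) (sym N≡) (≤-trans (≤-reflexive (sym (*-identityˡ s))) (*-monoˡ-≤ s 1≤n₀)))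
        -- 5436 = 4 · (225 · 6 + 4 + 4 + 1); the leading 4 is the cost of squaring a sum of four
        -- terms.
        Δ² : Δ * Δ ≤ N * 5436
        Δ² = begin
          Δ * Δ ≡⟨ cong (λ z → z * z) (l₁ D n₀ b) ⟩
          (15 * D + (2 * n₀ + (2 * b + 1))) * (15 * D + (2 * n₀ + (2 * b + 1))) ≤⟨ square-of-sum (15 * D) (2 * n₀) (2 * b) 1 ⟩
          4 * (15 * D * (15 * D) + (2 * n₀ * (2 * n₀) + (2 * b * (2 * b) + 1))) ≡⟨ l₂ D n₀ b ⟩
          D * D * 900 + (n₀ * n₀ * 16 + (b * b * 16 + 4)) ≤⟨ +-mono-≤ (*-monoˡ-≤ 900 lo) (+-mono-≤ (*-monoˡ-≤ 16 n₀²≤N) (+-mono-≤ (*-monoˡ-≤ 16 b²≤N) (*-monoˡ-≤ 4 1≤N))) ⟩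
          N * 6 * 900 + (N * 16 + (N * 16 + N * 4)) ≡⟨ l₃ N 6 900 16 16 4 ⟩
          N * 5436 ∎
          where
          l₁ : ∀ D a b → suc (5 * (D + (D + (D + 0))) + 2 * (a + b)) ≡ 15 * D + (2 * a + (2 * b + 1))
          l₁ = solve-∀
          l₂ : ∀ D a b → 4 * (15 * D * (15 * D) + (2 * a * (2 * a) + (2 * b * (2 * b) + 1))) ≡ D * D * 900 + (a * a * 16 + (b * b * 16 + 4))
          l₂ = solve-∀
          l₃ : ∀ N a b c d e → N * a * b + (N * c + (N * d + N * e)) ≡ N * (a * b + (c + (d + e)))
          l₃ = solve-∀
        N≤ns : N ≤ n * s
        N≤ns = ≤-trans (≤-reflexive N≡) (*-monoˡ-≤ s A₀≤A)
        1024Δ≤size : 1024 * Δ ≤ size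
        1024Δ≤size = scaled-root 1024 Δ (n * s * 5436) size (≤-trans Δ² (*-monoˡ-≤ 5436 N≤ns)) fits
        energy≤ : energy ≤ 17 * Δ * N
        energy≤ = begin
          energy ≤⟨ energy-bound D (<⇒≤ hi) 1024Δ≤size ⟩
          8 * Δ * (N + N) + N * (b * 2) ≤⟨ +-monoʳ-≤ (8 * Δ * (N + N)) (*-monoʳ-≤ N 2b≤Δ) ⟩
          8 * Δ * (N + N) + N * Δ ≡⟨ l₁ Δ N ⟩
          17 * Δ * N ∎
          where
          2b≤Δ : b * 2 ≤ Δ
          2b≤Δ = ≤-trans (≤-reflexive (*-comm b 2)) (≤-trans (*-monoʳ-≤ 2 (m≤n+m b n₀)) (≤-trans (m≤n+m k (5 * (D + (D + (D + 0))))) (n≤1+n _)))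
          l₁ : ∀ Δ N → 8 * Δ * (N + N) + N * Δ ≡ 17 * Δ * N
          l₁ = solve-∀
        square : j * n₀ * (j * n₀) ≤ M * (17 * Δ * N)
        square = ≤-trans (J²-bound A₀⊆A dF closed) (*-mono-≤ F≤M energy≤)
        fourth-power : fourth j * n₀ * (n₀ * n₀ * n₀) ≤ M * M * cube s * (5436 * 289) * (n₀ * n₀ * n₀)
        fourth-power = begin
          fourth j * n₀ * (n₀ * n₀ * n₀) ≡⟨ l₁ j n₀ ⟩
          j * n₀ * (j * n₀) * (j * n₀ * (j * n₀)) ≤⟨ *-mono-≤ square square ⟩
          M * (17 * Δ * N) * (M * (17 * Δ * N)) ≡⟨ l₂ M Δ N 17 ⟩
          Δ * Δ * (17 * 17) * (M * M * (N * N)) ≤⟨ *-monoˡ-≤ (M * M * (N * N)) (*-monoˡ-≤ (17 * 17) Δ²) ⟩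
          N * 5436 * (17 * 17) * (M * M * (N * N)) ≡⟨ cong (λ z → z * 5436 * (17 * 17) * (M * M * (z * z))) N≡ ⟩
          n₀ * s * 5436 * (17 * 17) * (M * M * (n₀ * s * (n₀ * s))) ≡⟨ l₃ (17 * 17) 5436 n₀ s M ⟩
          M * M * cube s * (5436 * (17 * 17)) * (n₀ * n₀ * n₀) ∎
          where
          l₁ : ∀ j a → j * j * (j * j) * a * (a * a * a) ≡ j * a * (j * a) * (j * a * (j * a))
          l₁ = solve-∀
          l₂ : ∀ M d N c → M * (c * d * N) * (M * (c * d * N)) ≡ d * d * (c * c) * (M * M * (N * N))
          l₂ = solve-∀
          l₃ : ∀ c e a s M → a * s * e * c * (M * M * (a * s * (a * s))) ≡ M * M * (s * s * s) * (e * c) * (a * a * a)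
          l₃ = solve-∀
        instance
          n₀³-nonzero : NonZero (n₀ * n₀ * n₀)
          n₀³-nonzero = >-nonZero (*-mono-≤ (*-mono-≤ 1≤n₀ 1≤n₀) 1≤n₀)
        final : n * fourth j ≤ M * M * cube s * 3142008
        final = begin
          n * fourth j ≤⟨ *-monoˡ-≤ (fourth j) A≤2A₀ ⟩
          2 * n₀ * fourth j ≡⟨ l₁ n₀ (fourth j) ⟩
          fourth j * n₀ * 2 ≤⟨ *-monoˡ-≤ 2 {fourth j * n₀} {M * M * cube s * (5436 * 289)} (*-cancelʳ-≤ (fourth j * n₀) (M * M * cube s * (5436 * 289)) (n₀ * n₀ * n₀) fourth-power) ⟩
          M * M * cube s * (5436 * 289) * 2 ≡⟨ *-assoc (M * M * cube s) (5436 * 289) 2 ⟩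
          M * M * cube s * 3142008 ∎
          where
          l₁ : ∀ a j → 2 * a * j ≡ j * a * 2
          l₁ = solve-∀

      -- The count is symmetric in the two lists, so the shorter one can always take the place of
      -- `B`.
      star : ∀ X B → AllPairs _≢_ X → AllPairs _≢_ B →
        n * (length B * length X) * 5436 * 1024 * 1024 ≤ size * size →
        n * fourth (J A X B) ≤ M * M * cube (length B * length X) * 3142008
      star X B dX dB fits = cases (s ≤? n₀) (1 ≤? n₀)
        where
        s = length B * length X
        bound : ℕ → ℕ → Set
        bound j s = n * fourth j ≤ M * M * cube s * 3142008
        cases : Dec (s ≤ n₀) → Dec (1 ≤ n₀) → bound (J A X B) s
        cases (yes le) _ = ≤-trans (small-product X B le) (*-monoʳ-≤ (M * M * cube s) (s≤s (s≤s z≤n)))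
        cases (no gt) (no n₀<1) = ≤-trans (≤-reflexive (cong (_* fourth (J A X B)) (n≤0⇒n≡0 (≤-trans A≤2A₀ (*-monoʳ-≤ 2 (≤-pred (≰⇒> n₀<1))))))) z≤n
        cases (no gt) (yes 1≤n₀) with ≤-total (length B) (length X)
        ... | inj₁ le = large-product X B dX dB le (<⇒≤ (≰⇒> gt)) 1≤n₀ fits
        ... | inj₂ ge = subst₂ bound (J-comm A B X) (*-comm (length X) (length B))
                (large-product B X dB dX ge (subst (n₀ ≤_) (*-comm (length B) (length X)) (<⇒≤ (≰⇒> gt))) 1≤n₀
                  (subst (λ s → n * s * 5436 * 1024 * 1024 ≤ size * size) (*-comm (length B) (length X)) fits))

  -- Popular sums and differences

  module AdditiveBound where
    open import Data.Nat
    open import Data.Nat.Properties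
    open PrimeField 𝕂 using (K; size) renaming (_+_ to _⊹_; -_ to neg; _≟_ to _≟ₖ_)
    open Univariate using () renaming (_-_ to _−_)
    open Trivariate using (elements; elements-distinct)
    open Existence using (elements-complete)
    open StarBound using (J)
    open Solver using (solve; _:+_; _:-_; :-_; _:=_)
    open DecMembership _≟ₖ_ using (_∈?_)

    membership-count : ∀ {xs} → AllPairs _≢_ xs → ∀ x → [ x ∈? xs ] ≡ ∑ xs (λ a → [ x ≟ₖ a ])
    membership-count {xs} d x with x ∈? xs
    ... | yes x∈ = sym (trans (∑-cong xs (λ a → sym (*-identityʳ _))) (∑-point _≟ₖ_ d x∈ (λ _ → 1)))
    ... | no x∉ = sym (trans (∑-cong-∈ xs (λ {a} a∈ → []-no (x ≟ₖ a) (λ e → x∉ (subst (_∈ xs) (sym e) a∈)))) (∑-zero xs))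

    ∑-substitute : ∀ {xs} → AllPairs _≢_ xs → (φ ψ : K → K) → (∀ a → φ (ψ a) ≡ a) → (∀ z → ψ (φ z) ≡ z) → ∀ g →
      ∑ elements (λ z → [ φ z ∈? xs ] * g z) ≡ ∑ xs (λ a → g (ψ a))
    ∑-substitute {xs} d φ ψ φψ ψφ g = begin
      ∑ elements (λ z → [ φ z ∈? xs ] * g z) ≡⟨ ∑-cong elements (λ z → trans (cong (_* g z) (membership-count d (φ z))) (sym (∑-*ʳ xs (g z) _))) ⟩
      ∑ elements (λ z → ∑ xs (λ a → [ φ z ≟ₖ a ] * g z)) ≡⟨ ∑-swap elements xs _ ⟩
      ∑ xs (λ a → ∑ elements (λ z → [ φ z ≟ₖ a ] * g z))
        ≡⟨ ∑-cong xs (λ a → trans (∑-cong elements (λ z → cong (_* g z) ([]-cong (φ z ≟ₖ a) (ψ a ≟ₖ z) (λ e → trans (cong ψ (sym e)) (ψφ z)) (λ e → trans (cong φ (sym e)) (φψ a)))))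
             (∑-point _≟ₖ_ elements-distinct (elements-complete (ψ a)) g)) ⟩
      ∑ xs (λ a → g (ψ a)) ∎
      where open ≡-Reasoning

    ∑-restrict : ∀ {xs} → AllPairs _≢_ xs → ∀ g → ∑ xs g ≡ ∑ elements (λ z → [ z ∈? xs ] * g z)
    ∑-restrict d g = sym (∑-substitute d id id (λ _ → refl) (λ _ → refl) g)

    ∑-≤-elements : ∀ {xs} → AllPairs _≢_ xs → ∀ g → ∑ xs g ≤ ∑ elements g
    ∑-≤-elements {xs} d g = ≤-trans (≤-reflexive (∑-restrict d g)) (∑-mono elements (λ z → ≤-trans (*-monoˡ-≤ (g z) ([]≤1 (z ∈? xs))) (≤-reflexive (*-identityˡ (g z)))))

    module Sets {A : List K} (dA : AllPairs _≢_ A) where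
      shift+ : ∀ b g → ∑ elements (λ d → [ d ⊹ b ∈? A ] * g d) ≡ ∑ A (λ a → g (a − b))
      shift+ b = ∑-substitute dA (_⊹ b) (_− b) (λ a → solve 2 (λ a b → a :- b :+ b := a) refl a b) (λ a → solve 2 (λ a b → a :+ b :- b := a) refl a b)

      shift- : ∀ b g → ∑ elements (λ d → [ d − b ∈? A ] * g d) ≡ ∑ A (λ a → g (a ⊹ b))
      shift- b = ∑-substitute dA (_− b) (_⊹ b) (λ a → solve 2 (λ a b → a :+ b :- b := a) refl a b) (λ a → solve 2 (λ a b → a :- b :+ b := a) refl a b)

      reflect : ∀ b g → ∑ elements (λ z → [ neg z ⊹ b ∈? A ] * g z) ≡ ∑ A (λ a → g (b − a))
      reflect b = ∑-substitute dA (λ z → neg z ⊹ b) (b −_) (λ a → solve 2 (λ a b → :- (b :- a) :+ b := a) refl a b) (λ a → solve 2 (λ a b → b :- (:- a :+ b) := a) refl a b)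

      R : List K → K → ℕ
      R B z = ∑ B (λ b → [ z ⊹ b ∈? A ])

      r : K → ℕ
      r = R A

      ∑-weighted-r : ∀ B g → ∑ elements (λ z → R B z * g z) ≡ ∑ B (λ b → ∑ A (λ a → g (a − b)))
      ∑-weighted-r B g = trans (∑-cong elements (λ z → sym (∑-*ʳ B (g z) _))) (trans (∑-swap elements B _) (∑-cong B (λ b → shift+ b g)))

      ∑-R : ∀ B → ∑ elements (R B) ≡ length B * length A
      ∑-R B = trans (∑-cong elements (λ z → sym (*-identityʳ (R B z)))) (trans (∑-weighted-r B (λ _ → 1)) (trans (∑-cong B (λ b → length-∑ A)) (∑-const B (length A))))

      R-flip : ∀ {B} → AllPairs _≢_ B → ∀ z → R B z ≡ ∑ A (λ a → [ a − z ∈? B ])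
      R-flip {B} dB z = trans (∑-restrict dB _) (trans (∑-cong elements (λ d → trans (*-comm [ d ∈? B ] _) (cong (λ x → [ x ∈? A ] * [ d ∈? B ]) (solve 2 (λ z d → z :+ d := d :+ z) refl z d)))) (shift+ z (λ d → [ d ∈? B ])))

      R≤ : ∀ B z → AllPairs _≢_ B → R B z ≤ length A
      R≤ B z dB = ≤-trans (≤-reflexive (R-flip dB z)) (≤-trans (∑-mono A (λ a → []≤1 (a − z ∈? B))) (≤-reflexive (length-∑ A)))

      s : K → ℕ
      s x = ∑ A (λ a → [ x − a ∈? A ])

      ∑-weighted-s : ∀ g → ∑ elements (λ x → s x * g x) ≡ ∑ A (λ a → ∑ A (λ a′ → g (a′ ⊹ a)))
      ∑-weighted-s g = trans (∑-cong elements (λ z → sym (∑-*ʳ A (g z) _))) (trans (∑-swap elements A _) (∑-cong A (λ b → shift- b g)))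

      -- The equation a + b = c + d is the same as a - c = d - b, so sums and differences have equal
      -- second moments.
      energies-agree : ∑ elements (λ x → s x * s x) ≡ ∑ elements (λ d → r d * r d)
      energies-agree = begin
        ∑ elements (λ x → s x * s x) ≡⟨ ∑-weighted-s s ⟩
        ∑ A (λ a → ∑ A (λ b → ∑ A (λ c → [ b ⊹ a − c ∈? A ]))) ≡⟨ ∑-cong A (λ a → ∑-swap A A _) ⟩
        ∑ A (λ a → ∑ A (λ c → ∑ A (λ b → [ b ⊹ a − c ∈? A ]))) ≡⟨ ∑-swap A A _ ⟩
        ∑ A (λ c → ∑ A (λ a → ∑ A (λ b → [ b ⊹ a − c ∈? A ])))
          ≡⟨ ∑-cong A (λ c → ∑-cong A (λ a → ∑-cong A (λ b → cong (λ x → [ x ∈? A ]) (solve 3 (λ a b c → b :+ a :- c := a :- c :+ b) refl a b c)))) ⟩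
        ∑ A (λ c → ∑ A (λ a → r (a − c))) ≡⟨ sym (∑-weighted-r A r) ⟩
        ∑ elements (λ d → r d * r d) ∎
        where open ≡-Reasoning

      energy-lower : ∀ {S} → AllPairs _≢_ S → (∀ {a b} → a ∈ A → b ∈ A → a ⊹ b ∈ S) →
        length A * length A * (length A * length A) ≤ length S * ∑ elements (λ d → r d * r d)
      energy-lower {S} dS sums = begin
        length A * length A * (length A * length A) ≡⟨ cong (λ z → z * z) (sym total) ⟩
        ∑ S (λ x → 1 * s x) * ∑ S (λ x → 1 * s x) ≤⟨ cauchy-schwarz S (λ _ → 1) s ⟩
        ∑ S (λ _ → 1 * 1) * ∑ S (λ x → s x * s x) ≤⟨ *-mono-≤ (≤-reflexive (length-∑ S)) (∑-≤-elements dS _) ⟩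
        length S * ∑ elements (λ x → s x * s x) ≡⟨ cong (length S *_) energies-agree ⟩
        length S * ∑ elements (λ d → r d * r d) ∎
        where
        open ≤-Reasoning
        total : ∑ S (λ x → 1 * s x) ≡ length A * length A
        total = trans (∑-restrict dS _) (trans (∑-cong elements (λ x → trans (cong ([ x ∈? S ] *_) (*-identityˡ (s x))) (*-comm [ x ∈? S ] _)))
          (trans (∑-weighted-s (λ x → [ x ∈? S ])) (trans (∑-cong-∈ A (λ {a} a∈ → trans (∑-cong-∈ A (λ {b} b∈ → []-yes (b ⊹ a ∈? S) (sums b∈ a∈))) (length-∑ A))) (∑-const A (length A)))))

    module SumsetBound {A S : List K} (dA : AllPairs _≢_ A) (dS : AllPairs _≢_ S) (sums : ∀ {a b} → a ∈ A → b ∈ A → a ⊹ b ∈ S)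
                       (M c C : ℕ) (1≤n : 1 ≤ length A) (n≤M : length A ≤ M) (S≤M : length S ≤ M) (M≤n² : M ≤ length A * length A) (1≤C : 1 ≤ C)
                       (star : ∀ X B → AllPairs _≢_ X → AllPairs _≢_ B → length A * (length B * length X) * c ≤ size * size →
                               length A * fourth (J A X B) ≤ M * M * cube (length B * length X) * C)
                       (fits : length A * length A * (length A * length A) * 4 * c ≤ size * size) where
      open Sets dA
      open ≤-Reasoning

      n L : ℕ
      n = length A
      L = suc ⌊log₂ n ⌋

      1≤M : 1 ≤ M
      1≤M = ≤-trans 1≤n n≤M

      -- The condition relative to p is settled once: under the standing assumption on `A` it holds
      -- whenever n |X| |B| is at most 4 n⁴.
      star′ : ∀ X B → AllPairs _≢_ X → AllPairs _≢_ B → n * (length B * length X) ≤ n * n * (n * n) * 4 →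
              n * J A X B ^ 4 ≤ C * M ^ 2 * (length B * length X) ^ 3
      star′ X B dX dB le = subst₂ _≤_ (l₁ n (J A X B)) (l₂ M (length B * length X) C) (star X B dX dB (≤-trans (*-monoˡ-≤ c le) fits))
        where
        l₁ : ∀ n j → n * (j * j * (j * j)) ≡ n * (j * (j * (j * (j * 1))))
        l₁ = solve-∀
        l₂ : ∀ M s C → M * M * (s * s * s) * C ≡ C * (M * (M * 1)) * (s * (s * (s * 1)))
        l₂ = solve-∀

      -- A sum has on average at least n²/M representations. Sums below an eighth of that account
      -- for at most n²/8 pairs altogether.
      Popular : K → Set
      Popular x = n * n ≤ 8 * M * s x

      popular? : ∀ x → Dec (Popular x)
      popular? x = n * n ≤? 8 * M * s x

      P : List K
      P = filter popular? S

      dP : AllPairs _≢_ P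
      dP = AllPairsₚ.filter⁺ popular? dS

      P≤M : length P ≤ M
      P≤M = ≤-trans (Listₚ.length-filter popular? S) S≤M

      u : K → ℕ
      u a = ∑ A (λ c → [ ¬? (popular? (a ⊹ c)) ])

      u-total : 8 * ∑ A u ≤ n * n
      u-total = *-cancelˡ-≤ M {{positive 1≤M}} (begin
        M * (8 * ∑ A u) ≡⟨ l₁ M (∑ A u) ⟩
        8 * M * ∑ A u ≡⟨ cong (8 * M *_) rewritten ⟩
        8 * M * ∑ S (λ x → s x * [ ¬? (popular? x) ]) ≡⟨ sym (∑-*ˡ S (8 * M) _) ⟩
        ∑ S (λ x → 8 * M * (s x * [ ¬? (popular? x) ])) ≤⟨ ∑-≤ S _ (n * n) (λ {x} _ → rare x (popular? x)) ⟩
        n * n * length S ≤⟨ *-monoʳ-≤ (n * n) S≤M ⟩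
        n * n * M ≡⟨ *-comm (n * n) M ⟩
        M * (n * n) ∎)
        where
        l₁ : ∀ m v → m * (8 * v) ≡ 8 * m * v
        l₁ = solve-∀
        rare : ∀ x → (p : Dec (Popular x)) → 8 * M * (s x * [ ¬? p ]) ≤ n * n
        rare x (yes _) = ≤-trans (≤-reflexive (trans (cong (8 * M *_) (*-zeroʳ (s x))) (*-zeroʳ (8 * M)))) z≤n
        rare x (no ¬p) = ≤-trans (≤-reflexive (cong (8 * M *_) (*-identityʳ (s x)))) (<⇒≤ (≰⇒> ¬p))
        rewritten : ∑ A u ≡ ∑ S (λ x → s x * [ ¬? (popular? x) ])
        rewritten = trans (∑-cong-∈ A (λ {a} a∈ → ∑-cong-∈ A (λ {b} b∈ → trans (cong (λ z → [ ¬? (popular? z) ]) (solve 2 (λ a b → a :+ b := b :+ a) refl a b))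
              (sym (trans (cong (_* [ ¬? (popular? (b ⊹ a)) ]) ([]-yes (b ⊹ a ∈? S) (sums b∈ a∈))) (*-identityˡ _))))))
          (trans (sym (∑-weighted-s (λ x → [ x ∈? S ] * [ ¬? (popular? x) ])))
            (trans (∑-cong elements (λ x → l₂ (s x) [ x ∈? S ] _)) (sym (∑-restrict dS _))))
          where
          l₂ : ∀ a b c → a * (b * c) ≡ b * (a * c)
          l₂ = solve-∀

      -- Few pairs have an unpopular sum, so by Markov at least half of `A` is regular. For two
      -- regular elements at least half of all c make both sums popular, which is `W-large`.
      regular? : ∀ a → Dec (4 * u a ≤ n)
      regular? a = 4 * u a ≤? n

      A′ : List K
      A′ = filter regular? A

      dA′ : AllPairs _≢_ A′
      dA′ = AllPairsₚ.filter⁺ regular? dA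

      A′⊆A : ∀ {a} → a ∈ A′ → a ∈ A
      A′⊆A a∈ = proj₁ (∈ₚ.∈-filter⁻ regular? a∈)

      A′-regular : ∀ {a} → a ∈ A′ → 4 * u a ≤ n
      A′-regular a∈ = proj₂ (∈ₚ.∈-filter⁻ regular? {xs = A} a∈)

      n′ : ℕ
      n′ = length A′

      A′-large : n ≤ 2 * n′
      A′-large = +-cancelʳ-≤ n n (2 * n′) (begin
        n + n ≡⟨ cong₂ _+_ split split ⟩
        n′ + bad + (n′ + bad) ≡⟨ l₁ n′ bad ⟩
        2 * n′ + 2 * bad ≤⟨ +-monoʳ-≤ (2 * n′) few ⟩
        2 * n′ + n ∎)
        where
        bad : ℕ
        bad = ∑ A (λ a → [ ¬? (regular? a) ])
        l₁ : ∀ a b → a + b + (a + b) ≡ 2 * a + 2 * b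
        l₁ = solve-∀
        l₂ : ∀ n b → n * (2 * b) ≡ 2 * (b * n)
        l₂ = solve-∀
        split : n ≡ n′ + bad
        split = trans (sym (length-∑ A)) (trans (∑-cong A (λ a → sym ([]-complement (regular? a)))) (trans (∑-+ A _ _) (cong (_+ bad) (length-filter-count regular? A))))
        few : 2 * bad ≤ n
        few = *-cancelˡ-≤ n {{positive 1≤n}} (begin
          n * (2 * bad) ≡⟨ l₂ n bad ⟩
          2 * (bad * n) ≡⟨ cong (2 *_) (sym (∑-*ʳ A n _)) ⟩
          2 * ∑ A (λ a → [ ¬? (regular? a) ] * n) ≤⟨ *-monoʳ-≤ 2 (∑-mono A (λ a → heavy a (regular? a))) ⟩
          2 * ∑ A (λ a → 4 * u a) ≡⟨ cong (2 *_) (∑-*ˡ A 4 u) ⟩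
          2 * (4 * ∑ A u) ≡⟨ sym (*-assoc 2 4 (∑ A u)) ⟩
          8 * ∑ A u ≤⟨ u-total ⟩
          n * n ∎)
          where
          heavy : ∀ a (d : Dec (4 * u a ≤ n)) → [ ¬? d ] * n ≤ 4 * u a
          heavy a (yes _) = z≤n
          heavy a (no ¬p) = ≤-trans (≤-reflexive (*-identityˡ n)) (<⇒≤ (≰⇒> ¬p))

      1≤n′ : 1 ≤ n′
      1≤n′ = ≰⇒> λ le → <⇒≱ 1≤n (≤-trans A′-large (≤-reflexive (cong (2 *_) (n≤0⇒n≡0 le))))

      W : K → K → ℕ
      W a b = ∑ A (λ c → [ popular? (a ⊹ c) ] * [ popular? (b ⊹ c) ])

      W-large : ∀ {a b} → a ∈ A′ → b ∈ A′ → n ≤ 2 * W a b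
      W-large {a} {b} a∈ b∈ = *-cancelˡ-≤ 2 (+-cancelʳ-≤ (2 * n) (2 * n) (2 * (2 * W a b)) (begin
        2 * n + 2 * n ≡⟨ l₁ n ⟩
        4 * n ≤⟨ *-monoʳ-≤ 4 covered ⟩
        4 * (W a b + (u a + u b)) ≡⟨ l₂ (W a b) (u a) (u b) ⟩
        2 * (2 * W a b) + (4 * u a + 4 * u b) ≤⟨ +-monoʳ-≤ (2 * (2 * W a b)) (+-mono-≤ (A′-regular a∈) (≤-trans (A′-regular b∈) (≤-reflexive (sym (+-identityʳ n))))) ⟩
        2 * (2 * W a b) + 2 * n ∎))
        where
        l₁ : ∀ n → 2 * n + 2 * n ≡ 4 * n
        l₁ = solve-∀
        l₂ : ∀ w x y → 4 * (w + (x + y)) ≡ 2 * (2 * w) + (4 * x + 4 * y)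
        l₂ = solve-∀
        union : ∀ {X Y : Set} (p : Dec X) (q : Dec Y) → 1 ≤ [ p ] * [ q ] + ([ ¬? p ] + [ ¬? q ])
        union (yes _) (yes _) = s≤s z≤n
        union (yes _) (no _) = s≤s z≤n
        union (no _) q = s≤s z≤n
        covered : n ≤ W a b + (u a + u b)
        covered = begin
          n ≡⟨ sym (length-∑ A) ⟩
          ∑ A (λ _ → 1) ≤⟨ ∑-mono A (λ c → union (popular? (a ⊹ c)) (popular? (b ⊹ c))) ⟩
          ∑ A (λ c → [ popular? (a ⊹ c) ] * [ popular? (b ⊹ c) ] + ([ ¬? (popular? (a ⊹ c)) ] + [ ¬? (popular? (b ⊹ c)) ])) ≡⟨ trans (∑-+ A _ _) (cong (W a b +_) (∑-+ A _ _)) ⟩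
          W a b + (u a + u b) ∎

      module S′ = Sets dA′
      r′ : K → ℕ
      r′ = S′.r

      r′≤r : ∀ z → r′ z ≤ r z
      r′≤r z = ≤-trans (∑-filter-≤ regular? A _) (∑-mono A (λ b → []-mono (z ⊹ b ∈? A′) (z ⊹ b ∈? A) A′⊆A))

      -- Differences under this threshold carry at most half of the energy `E′`. Those above it
      -- number at most 2M, and this keeps Δ within reach of the incidence bound.
      Heavy : K → Set
      Heavy d = n′ * n′ ≤ 2 * M * r′ d

      heavy? : ∀ d → Dec (Heavy d)
      heavy? d = n′ * n′ ≤? 2 * M * r′ d

      E′ : ℕ
      E′ = ∑ elements (λ d → r′ d * r′ d)

      n′⁴≤ : n′ * n′ * (n′ * n′) ≤ M * E′
      n′⁴≤ = ≤-trans (S′.energy-lower dS (λ a∈ b∈ → sums (A′⊆A a∈) (A′⊆A b∈))) (*-monoˡ-≤ E′ S≤M)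

      heavy-energy : E′ ≤ 2 * ∑ (filter heavy? elements) (λ d → r′ d * r′ d)
      heavy-energy = +-cancelʳ-≤ E′ E′ (2 * H) (begin
        E′ + E′ ≡⟨ cong₂ _+_ split split ⟩
        H + U + (H + U) ≡⟨ l₁ H U ⟩
        2 * H + 2 * U ≤⟨ +-monoʳ-≤ (2 * H) light ⟩
        2 * H + E′ ∎)
        where
        H U : ℕ
        H = ∑ (filter heavy? elements) (λ d → r′ d * r′ d)
        U = ∑ elements (λ d → [ ¬? (heavy? d) ] * (r′ d * r′ d))
        l₁ : ∀ a b → a + b + (a + b) ≡ 2 * a + 2 * b
        l₁ = solve-∀
        l₂ : ∀ M U → M * (2 * U) ≡ 2 * M * U
        l₂ = solve-∀
        split : E′ ≡ H + U
        split = trans (∑-cong elements (λ d → trans (sym (*-identityˡ (r′ d * r′ d))) (trans (cong (_* (r′ d * r′ d)) (sym ([]-complement (heavy? d)))) (*-distribʳ-+ (r′ d * r′ d) [ heavy? d ] _))))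
          (trans (∑-+ elements _ _) (cong (_+ U) (sym (∑-filter heavy? elements _))))
        low : ∀ d (p : Dec (Heavy d)) → 2 * M * ([ ¬? p ] * (r′ d * r′ d)) ≤ n′ * n′ * r′ d
        low d (yes _) = ≤-trans (≤-reflexive (*-zeroʳ (2 * M))) z≤n
        low d (no ¬p) = ≤-trans (≤-reflexive (l₃ (2 * M) (r′ d))) (*-monoˡ-≤ (r′ d) (<⇒≤ (≰⇒> ¬p)))
          where l₃ : ∀ m x → m * (1 * (x * x)) ≡ m * x * x
                l₃ = solve-∀
        light : 2 * U ≤ E′
        light = *-cancelˡ-≤ M {{positive 1≤M}} (begin
          M * (2 * U) ≡⟨ l₂ M U ⟩
          2 * M * U ≡⟨ sym (∑-*ˡ elements (2 * M) _) ⟩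
          ∑ elements (λ d → 2 * M * ([ ¬? (heavy? d) ] * (r′ d * r′ d))) ≤⟨ ∑-mono elements (λ d → low d (heavy? d)) ⟩
          ∑ elements (λ d → n′ * n′ * r′ d) ≡⟨ ∑-*ˡ elements (n′ * n′) r′ ⟩
          n′ * n′ * ∑ elements r′ ≡⟨ cong (n′ * n′ *_) (S′.∑-R A′) ⟩
          n′ * n′ * (n′ * n′) ≤⟨ n′⁴≤ ⟩
          M * E′ ∎)

      pigeonhole-j : ∃[ j ] ∑ (filter heavy? elements) (λ d → r′ d * r′ d) ≤ L * ∑ (filter (level? r′ j) (filter heavy? elements)) (λ d → r′ d * r′ d)
      pigeonhole-j = dyadic L (filter heavy? elements) r′ _ (λ {d} _ → ≤-<-trans (≤-trans (r′≤r d) (R≤ A d dA)) (n<2^log n)) (λ d e → cong (λ z → z * z) e)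

      j₀ τ : ℕ
      j₀ = proj₁ pigeonhole-j
      τ = 2 ^ j₀

      Δ : List K
      Δ = filter (level? r′ j₀) (filter heavy? elements)

      dΔ : AllPairs _≢_ Δ
      dΔ = AllPairsₚ.filter⁺ (level? r′ j₀) (AllPairsₚ.filter⁺ heavy? elements-distinct)

      δ : ℕ
      δ = length Δ

      in-Δ : ∀ {d} → d ∈ Δ → Heavy d × Level r′ j₀ d
      in-Δ {d} d∈ = let d∈′ , lv = ∈ₚ.∈-filter⁻ (level? r′ j₀) {xs = filter heavy? elements} d∈ in proj₂ (∈ₚ.∈-filter⁻ heavy? {xs = elements} d∈′) , lv

      -- 128 = 2⁴ · 2 · 2²: the passage from `n` to `n′`, the restriction to heavy differences, and
      -- the width of the dyadic level.
      energy-on-Δ : n ^ 4 ≤ 128 * M * L * τ ^ 2 * δ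
      energy-on-Δ = begin
        n ^ 4 ≤⟨ ^-monoˡ-≤ 4 A′-large ⟩
        (2 * n′) ^ 4 ≡⟨ l₁ n′ ⟩
        16 * (n′ * n′ * (n′ * n′)) ≤⟨ *-monoʳ-≤ 16 n′⁴≤ ⟩
        16 * (M * E′) ≤⟨ *-monoʳ-≤ 16 (*-monoʳ-≤ M (≤-trans heavy-energy (*-monoʳ-≤ 2 (≤-trans (proj₂ pigeonhole-j) (*-monoʳ-≤ L top))))) ⟩
        16 * (M * (2 * (L * (2 * τ * (2 * τ) * δ)))) ≡⟨ l₂ M L τ δ ⟩
        128 * M * L * τ ^ 2 * δ ∎
        where
        l₁ : ∀ x → 2 * x * (2 * x * (2 * x * (2 * x * 1))) ≡ 16 * (x * x * (x * x))
        l₁ = solve-∀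
        l₂ : ∀ M L t d → 16 * (M * (2 * (L * (2 * t * (2 * t) * d)))) ≡ 128 * M * L * (t * (t * 1)) * d
        l₂ = solve-∀
        top : ∑ Δ (λ d → r′ d * r′ d) ≤ 2 * τ * (2 * τ) * δ
        top = ∑-≤ Δ _ (2 * τ * (2 * τ)) (λ d∈ → let _ , _ , lt = in-Δ d∈ in *-mono-≤ (<⇒≤ lt) (<⇒≤ lt))

      1≤δ : 1 ≤ δ
      1≤δ = ≰⇒> λ le → <⇒≱ (m^n>0 n {{positive 1≤n}} 4) (≤-trans energy-on-Δ (≤-reflexive (trans (cong (128 * M * L * τ ^ 2 *_) (n≤0⇒n≡0 le)) (*-zeroʳ (128 * M * L * τ ^ 2)))))

      δ≤2M : δ ≤ 2 * M
      δ≤2M = *-cancelˡ-≤ (n′ * n′) {{positive (*-mono-≤ 1≤n′ 1≤n′)}} (begin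
        n′ * n′ * δ ≤⟨ ∑-≥ Δ (λ d → 2 * M * r′ d) (n′ * n′) (λ d∈ → proj₁ (in-Δ d∈)) ⟩
        ∑ Δ (λ d → 2 * M * r′ d) ≤⟨ ∑-≤-elements dΔ _ ⟩
        ∑ elements (λ d → 2 * M * r′ d) ≡⟨ ∑-*ˡ elements (2 * M) r′ ⟩
        2 * M * ∑ elements r′ ≡⟨ cong (2 * M *_) (S′.∑-R A′) ⟩
        2 * M * (n′ * n′) ≡⟨ *-comm (2 * M) (n′ * n′) ⟩
        n′ * n′ * (2 * M) ∎)

      level-mass : ∀ X → (∀ {d} → d ∈ X → τ ≤ r′ d) → τ * length X ≤ ∑ X r
      level-mass X le = ≤-trans (∑-≥ X r′ τ le) (∑-mono X r′≤r)

      τδ≤J : τ * δ ≤ J A Δ A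
      τδ≤J = level-mass Δ (λ d∈ → proj₁ (proj₂ (in-Δ d∈)))

      J≤n² : ∀ {X} → AllPairs _≢_ X → J A X A ≤ n * n
      J≤n² dX = ≤-trans (∑-≤-elements dX r) (≤-reflexive (∑-R A))

      star-A : ∀ {X t} → AllPairs _≢_ X → 1 ≤ t → t * length X ≤ J A X A → n * (t * length X) ^ 4 ≤ C * M ^ 2 * (n * length X) ^ 3
      star-A {X} {t} dX 1≤t le = ≤-trans (*-monoʳ-≤ n (^-monoˡ-≤ 4 le)) (star′ X A dX dA (begin
        n * (n * length X) ≤⟨ *-monoʳ-≤ n (*-monoʳ-≤ n (≤-trans (m≤n*m (length X) t {{positive 1≤t}}) (≤-trans le (J≤n² dX)))) ⟩
        n * (n * (n * n)) ≡⟨ sym (*-assoc n n (n * n)) ⟩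
        n * n * (n * n) ≤⟨ m≤m*n (n * n * (n * n)) 4 ⟩
        n * n * (n * n) * 4 ∎))

      difference-levels : n * (τ * δ) ^ 4 ≤ C * M ^ 2 * (n * δ) ^ 3
      difference-levels = star-A dΔ (m^n>0 2 j₀) τδ≤J

      pairs : List (K × K)
      pairs = concatMap (λ x → map (x ,_) P) P

      ∑-pairs : ∀ g → ∑ pairs g ≡ ∑ P (λ x → ∑ P (λ y → g (x , y)))
      ∑-pairs g = trans (∑-concatMap _ P g) (∑-cong P (λ x → ∑-map (x ,_) P g))

      g : K → K → ℕ
      g x y = ∑ A (λ c → [ x − c ∈? A ] * [ y − c ∈? A ])

      -- `T` counts (a, b, c) with a - b in `Δ` and both a + c and b + c popular, indexed by x = a +
      -- c and y = b + c. `Q` forgets c, `G` is the third moment of the representation function, and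
      -- `Q′` is `Q` with x replaced by a pair of summands.
      T Q G Q′ : ℕ
      T = ∑ P (λ x → ∑ P (λ y → [ x − y ∈? Δ ] * g x y))
      Q = ∑ P (λ x → ∑ P (λ y → [ x − y ∈? Δ ]))
      G = ∑ elements (λ d → r d * (r d * r d))
      Q′ = ∑ P (λ y → ∑ A (λ a₁ → ∑ A (λ a₂ → [ a₂ ⊹ a₁ − y ∈? Δ ])))

      ω : ∀ c c′ → ∑ elements (λ x → [ x − c ∈? A ] * [ x − c′ ∈? A ]) ≡ r (c − c′)
      ω c c′ = trans (shift- c (λ x → [ x − c′ ∈? A ])) (∑-cong A (λ a → cong (λ z → [ z ∈? A ]) (solve 3 (λ a c c′ → a :+ c :- c′ := c :- c′ :+ a) refl a c c′)))

      -- Squaring brings in c and c′; for fixed c and c′ the sums over x and over y separate, each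
      -- giving r(c - c′). Counting the pairs c, c′ by their difference contributes the third
      -- factor.
      g-energy : ∑ P (λ x → ∑ P (λ y → g x y * g x y)) ≤ G
      g-energy = begin
        ∑ P (λ x → ∑ P (λ y → g x y * g x y)) ≤⟨ ≤-trans (∑-mono P (λ x → ∑-≤-elements dP _)) (∑-≤-elements dP _) ⟩
        ∑ elements (λ x → ∑ elements (λ y → g x y * g x y)) ≡⟨ ∑-cong elements (λ x → ∑-cong elements (λ y → ∑-product A A _ _)) ⟩
        ∑ elements (λ x → ∑ elements (λ y → ∑ A (λ c → ∑ A (λ c′ → ι x c * ι y c * (ι x c′ * ι y c′)))))
          ≡⟨ ∑-cong elements (λ x → trans (∑-swap elements A _) (∑-cong A (λ c → ∑-swap elements A _))) ⟩
        ∑ elements (λ x → ∑ A (λ c → ∑ A (λ c′ → ∑ elements (λ y → ι x c * ι y c * (ι x c′ * ι y c′)))))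
          ≡⟨ trans (∑-swap elements A _) (∑-cong A (λ c → ∑-swap elements A _)) ⟩
        ∑ A (λ c → ∑ A (λ c′ → ∑ elements (λ x → ∑ elements (λ y → ι x c * ι y c * (ι x c′ * ι y c′)))))
          ≡⟨ ∑-cong A (λ c → ∑-cong A (λ c′ → trans (∑-cong elements (λ x → ∑-cong elements (λ y → l₁ (ι x c) (ι y c) (ι x c′) (ι y c′)))) (sym (∑-product elements elements _ _)))) ⟩
        ∑ A (λ c → ∑ A (λ c′ → ∑ elements (λ x → ι x c * ι x c′) * ∑ elements (λ y → ι y c * ι y c′))) ≡⟨ ∑-cong A (λ c → ∑-cong A (λ c′ → cong₂ _*_ (ω c c′) (ω c c′))) ⟩
        ∑ A (λ c → ∑ A (λ c′ → r (c − c′) * r (c − c′))) ≡⟨ ∑-swap A A _ ⟩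
        ∑ A (λ c′ → ∑ A (λ c → r (c − c′) * r (c − c′))) ≡⟨ sym (∑-weighted-r A (λ d → r d * r d)) ⟩
        G ∎
        where
        ι : K → K → ℕ
        ι x c = [ x − c ∈? A ]
        l₁ : ∀ a b c d → a * b * (c * d) ≡ a * c * (b * d)
        l₁ = solve-∀

      T²≤QG : T ^ 2 ≤ Q * G
      T²≤QG = begin
        T ^ 2 ≡⟨ cong (T *_) (*-identityʳ T) ⟩
        T * T ≡⟨ cong (λ z → z * z) (sym (∑-pairs (λ (x , y) → [ x − y ∈? Δ ] * g x y))) ⟩
        ∑ pairs (λ (x , y) → [ x − y ∈? Δ ] * g x y) * ∑ pairs (λ (x , y) → [ x − y ∈? Δ ] * g x y) ≤⟨ cauchy-schwarz pairs (λ (x , y) → [ x − y ∈? Δ ]) (λ (x , y) → g x y) ⟩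
        ∑ pairs (λ (x , y) → [ x − y ∈? Δ ] * [ x − y ∈? Δ ]) * ∑ pairs (λ (x , y) → g x y * g x y)
          ≤⟨ *-mono-≤ (≤-reflexive (trans (∑-pairs _) (∑-cong P (λ x → ∑-cong P (λ y → []-idem (x − y ∈? Δ)))))) (≤-trans (≤-reflexive (∑-pairs _)) g-energy) ⟩
        Q * G ∎

      popular-in-P : ∀ {a b} → a ∈ A → b ∈ A → [ a ⊹ b ∈? P ] ≡ [ popular? (a ⊹ b) ]
      popular-in-P a∈ b∈ = []-cong (_ ∈? P) (popular? _) (λ i → proj₂ (∈ₚ.∈-filter⁻ popular? {xs = S} i)) (λ p → ∈ₚ.∈-filter⁺ popular? (sums a∈ b∈) p)

      T-expand : T ≡ ∑ A (λ b → ∑ A (λ c → ∑ A (λ a → [ a − b ∈? Δ ] * ([ popular? (a ⊹ c) ] * [ popular? (b ⊹ c) ]))))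
      T-expand = trans₂ (begin-equality
        T ≡⟨ ∑-cong P (λ x → ∑-cong P (λ y → sym (∑-*ˡ A [ x − y ∈? Δ ] _))) ⟩
        ∑ P (λ x → ∑ P (λ y → ∑ A (λ c → [ x − y ∈? Δ ] * ([ x − c ∈? A ] * [ y − c ∈? A ]))))
          ≡⟨ trans (∑-cong P (λ x → ∑-swap P A _)) (∑-swap P A _) ⟩
        ∑ A (λ c → ∑ P (λ x → ∑ P (λ y → [ x − y ∈? Δ ] * ([ x − c ∈? A ] * [ y − c ∈? A ]))))
          ≡⟨ ∑-cong A (λ c → trans (∑-cong P (λ x → trans (∑-cong P (λ y → l₁ [ x − y ∈? Δ ] [ x − c ∈? A ] [ y − c ∈? A ])) (∑-*ˡ P [ x − c ∈? A ] (λ y → [ y − c ∈? A ] * [ x − y ∈? Δ ])))) (through c (λ x → ∑ P (λ y → [ y − c ∈? A ] * [ x − y ∈? Δ ])))) ⟩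
        ∑ A (λ c → ∑ A (λ a → [ a ⊹ c ∈? P ] * ∑ P (λ y → [ y − c ∈? A ] * [ a ⊹ c − y ∈? Δ ])))
          ≡⟨ ∑-cong A (λ c → ∑-cong A (λ a → cong ([ a ⊹ c ∈? P ] *_) (through c (λ y → [ a ⊹ c − y ∈? Δ ])))) ⟩
        ∑ A (λ c → ∑ A (λ a → [ a ⊹ c ∈? P ] * ∑ A (λ b → [ b ⊹ c ∈? P ] * [ a ⊹ c − (b ⊹ c) ∈? Δ ])))
          ≡⟨ ∑-cong-∈ A (λ {c} c∈ → ∑-cong-∈ A (λ {a} a∈ → trans (sym (∑-*ˡ A [ a ⊹ c ∈? P ] _)) (∑-cong-∈ A (λ {b} b∈ → trans
               (cong₂ _*_ (popular-in-P a∈ c∈) (cong₂ _*_ (popular-in-P b∈ c∈) (cong (λ z → [ z ∈? Δ ]) (solve 3 (λ a b c → a :+ c :- (b :+ c) := a :- b) refl a b c))))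
               (l₂ [ popular? (a ⊹ c) ] [ popular? (b ⊹ c) ] [ a − b ∈? Δ ]))))) ⟩
        ∑ A (λ c → ∑ A (λ a → ∑ A (λ b → [ a − b ∈? Δ ] * ([ popular? (a ⊹ c) ] * [ popular? (b ⊹ c) ])))) ∎)
        (trans (∑-cong A (λ c → ∑-swap A A _)) (∑-swap A A _))
        where
        trans₂ : ∀ {x y z : ℕ} → x ≡ y → y ≡ z → x ≡ z
        trans₂ = trans
        l₁ : ∀ a b c → a * (b * c) ≡ b * (c * a)
        l₁ = solve-∀
        l₂ : ∀ a b c → a * (b * c) ≡ c * (a * b)
        l₂ = solve-∀
        l₃ : ∀ a b c → a * (b * c) ≡ b * (a * c)
        l₃ = solve-∀
        through : ∀ c k → ∑ P (λ x → [ x − c ∈? A ] * k x) ≡ ∑ A (λ a → [ a ⊹ c ∈? P ] * k (a ⊹ c))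
        through c k = trans (∑-restrict dP _) (trans (∑-cong elements (λ x → l₃ [ x ∈? P ] [ x − c ∈? A ] (k x))) (shift- c (λ x → [ x ∈? P ] * k x)))

      -- Each difference in `Δ` has at least τ representations a - b within the regular elements,
      -- and by `W-large` each of these admits at least n/2 values of c.
      T-large : n * (τ * δ) ≤ 2 * T
      T-large = begin
        n * (τ * δ) ≤⟨ *-monoʳ-≤ n (∑-≥ Δ r′ τ (λ d∈ → proj₁ (proj₂ (in-Δ d∈)))) ⟩
        n * ∑ Δ r′ ≡⟨ trans (sym (∑-*ˡ Δ n r′)) (∑-cong Δ (λ d → sym (∑-*ˡ A′ n _))) ⟩
        ∑ Δ (λ d → ∑ A′ (λ b → n * [ d ⊹ b ∈? A′ ])) ≤⟨ ∑-mono Δ (λ d → ≤-trans (∑-mono-∈ A′ (λ {b} b∈ → count d b∈ (d ⊹ b ∈? A′))) (∑-filter-≤ regular? A _)) ⟩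
        ∑ Δ (λ d → ∑ A (λ b → 2 * ([ d ⊹ b ∈? A ] * W (d ⊹ b) b))) ≡⟨ trans (∑-cong Δ (λ d → ∑-*ˡ A 2 _)) (∑-*ˡ Δ 2 _) ⟩
        2 * ∑ Δ (λ d → ∑ A (λ b → [ d ⊹ b ∈? A ] * W (d ⊹ b) b)) ≡⟨ cong (2 *_) expand ⟩
        2 * T ∎
        where
        count : ∀ d {b} → b ∈ A′ → (i : Dec (d ⊹ b ∈ A′)) → n * [ i ] ≤ 2 * ([ d ⊹ b ∈? A ] * W (d ⊹ b) b)
        count d b∈ (no _) = ≤-trans (≤-reflexive (*-zeroʳ n)) z≤n
        count d {b} b∈ (yes i) = ≤-trans (≤-reflexive (*-identityʳ n)) (≤-trans (W-large i b∈) (*-monoʳ-≤ 2 (≤-reflexive (sym (trans (cong (_* W (d ⊹ b) b) ([]-yes (d ⊹ b ∈? A) (A′⊆A i))) (*-identityˡ _))))))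
        l₁ : ∀ a b c → a * (b * c) ≡ b * (a * c)
        l₁ = solve-∀
        expand : ∑ Δ (λ d → ∑ A (λ b → [ d ⊹ b ∈? A ] * W (d ⊹ b) b)) ≡ T
        expand = begin-equality
          ∑ Δ (λ d → ∑ A (λ b → [ d ⊹ b ∈? A ] * W (d ⊹ b) b)) ≡⟨ ∑-swap Δ A _ ⟩
          ∑ A (λ b → ∑ Δ (λ d → [ d ⊹ b ∈? A ] * W (d ⊹ b) b))
            ≡⟨ ∑-cong A (λ b → trans (∑-restrict dΔ _) (trans (∑-cong elements (λ d → l₁ [ d ∈? Δ ] [ d ⊹ b ∈? A ] _)) (shift+ b (λ d → [ d ∈? Δ ] * W (d ⊹ b) b)))) ⟩
          ∑ A (λ b → ∑ A (λ a → [ a − b ∈? Δ ] * W (a − b ⊹ b) b))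
            ≡⟨ ∑-cong A (λ b → ∑-cong A (λ a → trans (cong (λ z → [ a − b ∈? Δ ] * W z b) (solve 2 (λ a b → a :- b :+ b := a) refl a b)) (sym (∑-*ˡ A [ a − b ∈? Δ ] _)))) ⟩
          ∑ A (λ b → ∑ A (λ a → ∑ A (λ c → [ a − b ∈? Δ ] * ([ popular? (a ⊹ c) ] * [ popular? (b ⊹ c) ])))) ≡⟨ ∑-cong A (λ b → ∑-swap A A _) ⟩
          ∑ A (λ b → ∑ A (λ c → ∑ A (λ a → [ a − b ∈? Δ ] * ([ popular? (a ⊹ c) ] * [ popular? (b ⊹ c) ])))) ≡⟨ sym T-expand ⟩
          T ∎

      -- Popularity pays for replacing x by its representations a₁ + a₂: there are at least n²/(8M)
      -- of them.
      Q-bound : n ^ 2 * Q ≤ 8 * M * Q′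
      Q-bound = begin
        n ^ 2 * Q ≡⟨ cong (λ z → n * z * Q) (*-identityʳ n) ⟩
        n * n * Q ≡⟨ sym (∑-*ˡ P (n * n) _) ⟩
        ∑ P (λ x → n * n * ∑ P (λ y → [ x − y ∈? Δ ])) ≤⟨ ∑-mono-∈ P (λ {x} x∈ → *-monoˡ-≤ (∑ P (λ y → [ x − y ∈? Δ ])) (proj₂ (∈ₚ.∈-filter⁻ popular? {xs = S} x∈))) ⟩
        ∑ P (λ x → 8 * M * s x * ∑ P (λ y → [ x − y ∈? Δ ])) ≡⟨ trans (∑-cong P (λ x → *-assoc (8 * M) (s x) _)) (∑-*ˡ P (8 * M) _) ⟩
        8 * M * ∑ P (λ x → s x * ∑ P (λ y → [ x − y ∈? Δ ])) ≤⟨ *-monoʳ-≤ (8 * M) (∑-≤-elements dP _) ⟩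
        8 * M * ∑ elements (λ x → s x * ∑ P (λ y → [ x − y ∈? Δ ])) ≡⟨ cong (8 * M *_) (∑-weighted-s _) ⟩
        8 * M * ∑ A (λ a₁ → ∑ A (λ a₂ → ∑ P (λ y → [ a₂ ⊹ a₁ − y ∈? Δ ]))) ≡⟨ cong (8 * M *_) (trans (∑-cong A (λ a₁ → ∑-swap A P _)) (∑-swap A P _)) ⟩
        8 * M * Q′ ∎

      -- Representations of z as y - a with y in `P` and a in `A`. Since a₂ + a₁ - y = a₂ - z for z
      -- = y - a₁, the count `Q′` becomes a correlation of `ρ` with the representation function of
      -- `Δ`.
      ρ : K → ℕ
      ρ z = R P (neg z)

      Q′-convolution : Q′ ≡ ∑ elements (λ z → ρ z * R Δ z)
      Q′-convolution = begin-equality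
        Q′ ≡⟨ ∑-cong P (λ y → ∑-cong A (λ a₁ → trans (∑-cong A (λ a₂ → cong (λ z → [ z ∈? Δ ]) (solve 3 (λ a b y → a :+ b :- y := a :- (y :- b)) refl a₂ a₁ y))) (sym (R-flip dΔ (y − a₁))))) ⟩
        ∑ P (λ y → ∑ A (λ a₁ → R Δ (y − a₁))) ≡⟨ ∑-cong P (λ y → sym (reflect y (R Δ))) ⟩
        ∑ P (λ y → ∑ elements (λ z → [ neg z ⊹ y ∈? A ] * R Δ z)) ≡⟨ ∑-swap P elements _ ⟩
        ∑ elements (λ z → ∑ P (λ y → [ neg z ⊹ y ∈? A ] * R Δ z)) ≡⟨ ∑-cong elements (λ z → ∑-*ʳ P (R Δ z) _) ⟩
        ∑ elements (λ z → ρ z * R Δ z) ∎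

      ∑-ρ : ∑ elements ρ ≡ length P * n
      ∑-ρ = trans (∑-swap elements P _) (trans (∑-cong P (λ y → trans (∑-cong elements (λ z → sym (*-identityʳ _))) (trans (reflect y (λ _ → 1)) (length-∑ A)))) (∑-const P n))

      pigeonhole-t : ∃[ j ] ∑ elements (λ z → ρ z * R Δ z) ≤ L * ∑ (filter (level? ρ j) elements) (λ z → ρ z * R Δ z)
      pigeonhole-t = dyadic L elements ρ _ (λ {z} _ → ≤-<-trans (R≤ P (neg z) dP) (n<2^log n)) (λ z e → cong (_* R Δ z) e)

      t : ℕ
      t = 2 ^ proj₁ pigeonhole-t

      1≤t : 1 ≤ t
      1≤t = m^n>0 2 (proj₁ pigeonhole-t)

      Z : List K
      Z = filter (level? ρ (proj₁ pigeonhole-t)) elements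

      dZ : AllPairs _≢_ Z
      dZ = AllPairsₚ.filter⁺ (level? ρ (proj₁ pigeonhole-t)) elements-distinct

      in-Z : ∀ {z} → z ∈ Z → Level ρ (proj₁ pigeonhole-t) z
      in-Z z∈ = proj₂ (∈ₚ.∈-filter⁻ (level? ρ (proj₁ pigeonhole-t)) {xs = elements} z∈)

      tZ≤∑ρ : t * length Z ≤ ∑ Z ρ
      tZ≤∑ρ = ∑-≥ Z ρ t (λ z∈ → proj₁ (in-Z z∈))

      tZ≤Mn : t * length Z ≤ M * n
      tZ≤Mn = ≤-trans tZ≤∑ρ (≤-trans (∑-≤-elements dZ ρ) (≤-trans (≤-reflexive ∑-ρ) (*-monoˡ-≤ n P≤M)))

      Q′-level : Q′ ≤ 2 * L * (t * J A Z Δ)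
      Q′-level = begin
        Q′ ≡⟨ Q′-convolution ⟩
        ∑ elements (λ z → ρ z * R Δ z) ≤⟨ proj₂ pigeonhole-t ⟩
        L * ∑ Z (λ z → ρ z * R Δ z) ≤⟨ *-monoʳ-≤ L (∑-mono-∈ Z (λ {z} z∈ → *-monoˡ-≤ (R Δ z) (<⇒≤ (proj₂ (in-Z z∈))))) ⟩
        L * ∑ Z (λ z → 2 * t * R Δ z) ≡⟨ cong (L *_) (∑-*ˡ Z (2 * t) (R Δ)) ⟩
        L * (2 * t * J A Z Δ) ≡⟨ l₁ L t (J A Z Δ) ⟩
        2 * L * (t * J A Z Δ) ∎
        where
        l₁ : ∀ L t j → L * (2 * t * j) ≡ 2 * L * (t * j)
        l₁ = solve-∀

      -- A representation of z by `ρ` says that -z + y lies in `A`, so the mass of `ρ` on `Z` is a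
      -- count `J` for the negated set and `P`.
      -Z : List K
      -Z = map neg Z

      d-Z : AllPairs _≢_ -Z
      d-Z = AllPairsₚ.map⁺ (AllPairs.map (λ {x} {y} ne e → ne (trans (solve 1 (λ x → x := :- (:- x)) refl x) (trans (cong neg e) (solve 1 (λ x → :- (:- x) := x) refl y)))) dZ)

      -- With δ ≤ 2M the hypothesis bounds M¹⁶, and M ≤ n² bounds M⁸. Their product is the twelfth
      -- power of the claim.
      M²-small : M ^ 17 < t ^ 12 * n ^ 8 * δ → M * M ≤ 2 * t * (n * n)
      M²-small big = ≮⇒≥ λ lt → <⇒≱ (^-monoˡ-< 12 lt) (begin
        (M * M) ^ 12 ≡⟨ same-monomial ν ((M′ ⊙ M′) ↑ 12) (M′ ↑ 16 ⊙ M′ ↑ 8) refl ⟩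
        M ^ 16 * M ^ 8 ≤⟨ *-mono-≤ M¹⁶ (^-monoˡ-≤ 8 M≤n²) ⟩
        t ^ 12 * n ^ 8 * 2 * (n * n) ^ 8 ≤⟨ *-monoˡ-≤ ((n * n) ^ 8) (*-monoʳ-≤ (t ^ 12 * n ^ 8) (^-monoʳ-≤ 2 {1} {12} (s≤s z≤n))) ⟩
        t ^ 12 * n ^ 8 * 2 ^ 12 * (n * n) ^ 8 ≡⟨ same-monomial ν (t′ ↑ 12 ⊙ n″ ↑ 8 ⊙ two ↑ 12 ⊙ (n″ ⊙ n″) ↑ 8) ((two ⊙ t′ ⊙ (n″ ⊙ n″)) ↑ 12) refl ⟩
        (2 * t * (n * n)) ^ 12 ∎)
        where
        ν = M ∷ t ∷ n ∷ 2 ∷ []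
        M′ = var {4} 0F
        t′ = var {4} 1F
        n″ = var {4} 2F
        two = var {4} 3F
        M¹⁶ : M ^ 16 ≤ t ^ 12 * n ^ 8 * 2
        M¹⁶ = *-cancelˡ-≤ M {{positive 1≤M}} (≤-trans (<⇒≤ big) (≤-trans (*-monoʳ-≤ (t ^ 12 * n ^ 8) δ≤2M) (≤-reflexive (l₁ (t ^ 12 * n ^ 8) M))))
          where l₁ : ∀ x m → x * (2 * m) ≡ m * (x * 2)
                l₁ = solve-∀

      -- The set `Z` has at most M n / t elements, and t is large compared with M in the only case
      -- where `level-product` asks for incidence bounds. In the other case `Z` may be too large for
      -- p, but trivial counting is enough.
      fits-Z : ∀ {b} → b ≤ 2 * M → M ^ 17 < t ^ 12 * n ^ 8 * δ → n * (b * length Z) ≤ n * n * (n * n) * 4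
      fits-Z {b} b≤ big = *-cancelˡ-≤ t {{positive 1≤t}} (begin
        t * (n * (b * length Z)) ≡⟨ l₁ t n b (length Z) ⟩
        n * b * (t * length Z) ≤⟨ *-mono-≤ (*-monoʳ-≤ n b≤) tZ≤Mn ⟩
        n * (2 * M) * (M * n) ≡⟨ l₂ n M ⟩
        2 * (M * M) * (n * n) ≤⟨ *-monoˡ-≤ (n * n) (*-monoʳ-≤ 2 (M²-small big)) ⟩
        2 * (2 * t * (n * n)) * (n * n) ≡⟨ l₃ t (n * n) ⟩
        t * (n * n * (n * n) * 4) ∎)
        where
        l₁ : ∀ t n b z → t * (n * (b * z)) ≡ n * b * (t * z)
        l₁ = solve-∀
        l₂ : ∀ n M → n * (2 * M) * (M * n) ≡ 2 * (M * M) * (n * n)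
        l₂ = solve-∀
        l₃ : ∀ t x → 2 * (2 * t * x) * x ≡ t * (x * x * 4)
        l₃ = solve-∀

      Q′-bound : Q′ ^ 12 ≤ (2 * L) ^ 12 * (C ^ 12 * (M ^ 17 * n ^ 4 * δ ^ 11))
      Q′-bound = begin
        Q′ ^ 12 ≤⟨ ^-monoˡ-≤ 12 Q′-level ⟩
        (2 * L * (t * J A Z Δ)) ^ 12 ≡⟨ ^-distrib-* (2 * L) (t * J A Z Δ) 12 ⟩
        (2 * L) ^ 12 * (t * J A Z Δ) ^ 12 ≤⟨ *-monoʳ-≤ ((2 * L) ^ 12) (level-product {n} {M} {δ} {t} {J A Z Δ} {length Z} {C} 1≤M 1≤n 1≤t 1≤C
            (≤-trans (∑-≤-elements dZ (R Δ)) (≤-reflexive (∑-R Δ)))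
            (λ big → ≤-trans (*-monoʳ-≤ n (^-monoˡ-≤ 4 tZ≤J)) (≤-trans (star′ -Z P d-Z dP (subst (λ z → n * (length P * z) ≤ n * n * (n * n) * 4) (sym (Listₚ.length-map neg Z)) (fits-Z (≤-trans P≤M (m≤n*m M 2)) big)))
               (*-monoʳ-≤ (C * M ^ 2) (^-monoˡ-≤ 3 (*-mono-≤ P≤M (≤-reflexive (Listₚ.length-map neg Z)))))))
            (λ big → star′ Z Δ dZ dΔ (fits-Z δ≤2M big))
            empty) ⟩
        (2 * L) ^ 12 * (C ^ 12 * (M ^ 17 * n ^ 4 * δ ^ 11)) ∎
        where
        tZ≤J : t * length Z ≤ J A -Z P
        tZ≤J = ≤-trans tZ≤∑ρ (≤-reflexive (sym (∑-map neg Z (R P))))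
        empty : length Z ≡ 0 → J A Z Δ ≡ 0
        empty e = n≤0⇒n≡0 (≤-trans (∑-≤ Z (R Δ) (length Δ) (λ {z} _ → ≤-trans (∑-mono Δ (λ b → []≤1 (z ⊹ b ∈? A))) (≤-reflexive (length-∑ Δ)))) (≤-reflexive (trans (cong (length Δ *_) e) (*-zeroʳ (length Δ)))))

      pigeonhole-s : ∃[ j ] G ≤ L * ∑ (filter (level? r j) elements) (λ d → r d * (r d * r d))
      pigeonhole-s = dyadic L elements r _ (λ {d} _ → ≤-<-trans (R≤ A d dA) (n<2^log n)) (λ d e → cong (λ z → z * (z * z)) e)

      G-bound : G ^ 3 ≤ (8 * L) ^ 3 * (C ^ 3 * (M ^ 4 * n ^ 6))
      G-bound = begin
        G ^ 3 ≤⟨ ^-monoˡ-≤ 3 (≤-trans (proj₂ pigeonhole-s) (*-monoʳ-≤ L (∑-≤ X _ (2 * σ * (2 * σ * (2 * σ))) (λ d∈ → let lt = <⇒≤ (proj₂ (in-X d∈)) in *-mono-≤ lt (*-mono-≤ lt lt))))) ⟩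
        (L * (2 * σ * (2 * σ * (2 * σ)) * length X)) ^ 3 ≡⟨ cong (_^ 3) (l₁ L σ (length X)) ⟩
        (8 * L * (σ ^ 3 * length X)) ^ 3 ≡⟨ ^-distrib-* (8 * L) (σ ^ 3 * length X) 3 ⟩
        (8 * L) ^ 3 * (σ ^ 3 * length X) ^ 3 ≤⟨ *-monoʳ-≤ ((8 * L) ^ 3) (level-cube {n} {M} {σ} {length X} {C} 1≤M 1≤n 1≤C
            (≤-trans σX≤J (≤-trans (J≤n² dX) (≤-reflexive (cong (n *_) (sym (*-identityʳ n)))))) (star-A dX (m^n>0 2 (proj₁ pigeonhole-s)) σX≤J)) ⟩
        (8 * L) ^ 3 * (C ^ 3 * (M ^ 4 * n ^ 6)) ∎
        where
        σ = 2 ^ proj₁ pigeonhole-s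
        X = filter (level? r (proj₁ pigeonhole-s)) elements
        dX : AllPairs _≢_ X
        dX = AllPairsₚ.filter⁺ (level? r (proj₁ pigeonhole-s)) elements-distinct
        in-X : ∀ {d} → d ∈ X → Level r (proj₁ pigeonhole-s) d
        in-X d∈ = proj₂ (∈ₚ.∈-filter⁻ (level? r (proj₁ pigeonhole-s)) {xs = elements} d∈)
        σX≤J : σ * length X ≤ J A X A
        σX≤J = ∑-≥ X r σ (λ d∈ → proj₁ (in-X d∈))
        l₁ : ∀ L s x → L * (2 * s * (2 * s * (2 * s)) * x) ≡ 8 * L * (s * (s * (s * 1)) * x)
        l₁ = solve-∀

      -- The quantities are passed through equations, so that the opaque `multiplier` can be matched
      -- with the constant of `combine` without computing either.
      sumset-bound : ∀ m l k → m ≡ n → l ≡ L → k ≡ 128 ^ 14 * (2 ^ 2 * 8 * 2 * 8 * C ^ 2) ^ 12 * C → m ^ 74 ≤ l ^ 38 * M ^ 61 * k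
      sumset-bound m l k m≡ l≡ k≡ = subst₂ _≤_ (cong (_^ 74) (sym m≡)) (cong₂ (λ l k → l ^ 38 * M ^ 61 * k) (sym l≡) (sym k≡))
        (combine {n} {M} {L} {δ} {τ} {T} {Q} {Q′} {G} {C} {128} {2} {8} {2} {8} 1≤n 1≤δ energy-on-Δ difference-levels T-large T²≤QG Q-bound Q′-bound G-bound)

  -- Non-degenerate quadratic polynomials

  module Plane where
    open PrimeField 𝕂
    open Univariate
    open Quadratics
    open Solver using (solve; _:+_; _:*_; _:-_; :-_; _:=_; :0; :1)

    -- For the field of residues these unfold to the rings in which the theorem is stated, so its
    -- hypotheses on the polynomial apply unchanged.
    base K[y] K[x,y] : RawSemiring 0ℓ 0ℓ
    base = record { Carrier = K ; _≈_ = _≡_ ; _+_ = _+_ ; _*_ = _*_ ; 0# = 0# ; 1# = 1# }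
    K[y] = Poly.poly base
    K[x,y] = Poly.poly K[y]

    Plane : Set
    Plane = List (List K)

    coeff : Plane → ℕ → ℕ → K
    coeff f i j = Poly.coeff base (Poly.coeff K[y] f i) j

    value : Plane → K → K → K
    value f a b = Poly.eval K[y] base (Poly.eval base base id b) a f

    composed : List K → K → K → Plane
    composed Q α β = Poly.eval base K[x,y] (λ a → (a ∷ []) ∷ []) ((0# ∷ β ∷ []) ∷ (α ∷ []) ∷ []) Q

    Degree≤2 : Plane → Set
    Degree≤2 f = ∀ i j → 2 < i ℕ.+ j → coeff f i j ≡ 0#

    -- The map `φ` sends a coefficient to the field, so one statement covers evaluation in y, where
    -- it is the identity, and evaluation in x, where it evaluates a whole row.
    eval≡ev : ∀ (R : RawSemiring 0ℓ 0ℓ) (φ : RawSemiring.Carrier R → K) → φ (RawSemiring.0# R) ≡ 0# → ∀ as m s →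
      (∀ n → m < n → φ (Poly.coeff R as n) ≡ 0#) → Poly.eval R base φ s as ≡ ev m (φ ∘ Poly.coeff R as) s
    eval≡ev R φ φ0 [] m s v = sym (ev-zero m s (λ _ → φ0))
    eval≡ev R φ φ0 (a ∷ as) zero s v = trans (cong (λ z → φ a + s * z) (zero-eval as (λ n → v (suc n) (s≤s z≤n)))) (trans (cong (φ a +_) (zeroʳ s)) (+-identityʳ _))
      where
      zero-eval : ∀ as → (∀ n → φ (Poly.coeff R as n) ≡ 0#) → Poly.eval R base φ s as ≡ 0#
      zero-eval [] _ = refl
      zero-eval (a ∷ as) v = trans (cong₂ (λ x y → x + s * y) (v 0) (zero-eval as (v ∘ suc))) (trans (cong (0# +_) (zeroʳ s)) (+-identityʳ 0#))
    eval≡ev R φ φ0 (a ∷ as) (suc m) s v = cong (λ z → φ a + s * z) (eval≡ev R φ φ0 as m s (λ n lt → v (suc n) (s≤s lt)))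

    value-form : ∀ f → Degree≤2 f → ∀ a b →
      value f a b ≡ Form.f (coeff f 2 0) (coeff f 1 1) (coeff f 0 2) (coeff f 1 0) (coeff f 0 1) (coeff f 0 0) a b
    value-form f small a b = begin
      value f a b ≡⟨ eval≡ev K[y] (Poly.eval base base id b) refl f 2 a (λ i lt → trans (row i) (ev-zero 2 b (λ j → small i j (ℕₚ.<-≤-trans lt (ℕₚ.m≤m+n i j))))) ⟩
      ev 2 (λ i → Poly.eval base base id b (Poly.coeff K[y] f i)) a ≡⟨ ev-cong 2 a row ⟩
      ev 2 (λ i → ev 2 (coeff f i) b) a
        ≡⟨ cong₂ (λ u v → (c 0 0 + b * (c 0 1 + b * c 0 2)) + a * (u + a * v)) (cong (λ z → c 1 0 + b * (c 1 1 + b * z)) (small 1 2 (s≤s (s≤s (s≤s z≤n)))))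
             (cong₂ (λ y z → c 2 0 + b * (y + b * z)) (small 2 1 (s≤s (s≤s (s≤s z≤n)))) (small 2 2 (s≤s (s≤s (s≤s z≤n))))) ⟩
      (c 0 0 + b * (c 0 1 + b * c 0 2)) + a * ((c 1 0 + b * (c 1 1 + b * 0#)) + a * (c 2 0 + b * (0# + b * 0#)))
        ≡⟨ solve 8 (λ c00 c01 c02 c10 c11 c20 a b → (c00 :+ b :* (c01 :+ b :* c02)) :+ a :* ((c10 :+ b :* (c11 :+ b :* :0)) :+ a :* (c20 :+ b :* (:0 :+ b :* :0)))
             := c20 :* (a :* a) :+ c11 :* (a :* b) :+ c02 :* (b :* b) :+ c10 :* a :+ c01 :* b :+ c00) refl (c 0 0) (c 0 1) (c 0 2) (c 1 0) (c 1 1) (c 2 0) a b ⟩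
      Form.f (c 2 0) (c 1 1) (c 0 2) (c 1 0) (c 0 1) (c 0 0) a b ∎
      where
      open ≡-Reasoning
      c : ℕ → ℕ → K
      c = coeff f
      row : ∀ i → Poly.eval base base id b (Poly.coeff K[y] f i) ≡ ev 2 (coeff f i) b
      row i = eval≡ev base id refl (Poly.coeff K[y] f i) 2 b (λ j lt → small i j (ℕₚ.<-≤-trans lt (ℕₚ.m≤n+m j i)))

    degenerate : ∀ f → Degree≤2 f → ∀ α β q₁ q₂ → coeff f 1 0 ≡ q₁ * α → coeff f 0 1 ≡ q₁ * β →
      coeff f 2 0 ≡ q₂ * (α * α) → coeff f 1 1 ≡ q₂ * (α * β) + q₂ * (α * β) → coeff f 0 2 ≡ q₂ * (β * β) →
      ∀ i j → coeff f i j ≡ coeff (composed (coeff f 0 0 ∷ q₁ ∷ q₂ ∷ []) α β) i j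
    degenerate f small α β q₁ q₂ e₁₀ e₀₁ e₂₀ e₁₁ e₀₂ = go
      where
      big : ∀ i j → 2 < i ℕ.+ j → ∀ {x} → x ≡ 0# → coeff f i j ≡ x
      big i j lt e = trans (small i j lt) (sym e)
      3≤ : ∀ {n} → 2 < suc (suc (suc n))
      3≤ = s≤s (s≤s (s≤s z≤n))
      go : ∀ i j → coeff f i j ≡ coeff (composed (coeff f 0 0 ∷ q₁ ∷ q₂ ∷ []) α β) i j
      go 0 0 = solve 3 (λ q₀ q₁ q₂ → q₀ := q₀ :+ (:0 :* (q₁ :+ (:0 :* q₂ :+ :0)) :+ :0)) refl (coeff f 0 0) q₁ q₂
      go 0 1 = trans e₀₁ (solve 3 (λ b q₁ q₂ → q₁ :* b := :0 :* (b :* q₂ :+ :0) :+ (b :* (q₁ :+ (:0 :* q₂ :+ :0)) :+ :0)) refl β q₁ q₂)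
      go 0 2 = trans e₀₂ (solve 2 (λ b q₂ → q₂ :* (b :* b) := b :* (b :* q₂ :+ :0)) refl β q₂)
      go 0 (suc (suc (suc j))) = big 0 (suc (suc (suc j))) 3≤ refl
      go 1 0 = trans e₁₀ (solve 3 (λ a q₁ q₂ → q₁ :* a := :0 :* (:0 :+ (a :* q₂ :+ :0)) :+ :0 :+ (a :* (q₁ :+ (:0 :* q₂ :+ :0)) :+ :0)) refl α q₁ q₂)
      go 1 1 = trans e₁₁ (solve 3 (λ a b q₂ → q₂ :* (a :* b) :+ q₂ :* (a :* b) := :0 :* :0 :+ (b :* (:0 :+ (a :* q₂ :+ :0)) :+ :0) :+ a :* (b :* q₂ :+ :0)) refl α β q₂)
      go 1 2 = big 1 2 3≤ (zeroʳ β)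
      go 1 (suc (suc (suc j))) = big 1 (suc (suc (suc j))) 3≤ refl
      go 2 0 = trans e₂₀ (solve 2 (λ a q₂ → q₂ :* (a :* a) := :0 :* :0 :+ :0 :+ (a :* (:0 :+ (a :* q₂ :+ :0)) :+ :0)) refl α q₂)
      go 2 1 = big 2 1 3≤ (solve 2 (λ a b → b :* :0 :+ :0 :+ a :* :0 := :0) refl α β)
      go 2 (suc (suc j)) = big 2 (suc (suc j)) 3≤ refl
      go 3 0 = big 3 0 3≤ (solve 1 (λ a → a :* :0 :+ :0 := :0) refl α)
      go 3 (suc j) = big 3 (suc j) 3≤ refl
      go (suc (suc (suc (suc i)))) j = big (suc (suc (suc (suc i)))) j 3≤ refl

    Degenerate′ : Plane → Set
    Degenerate′ f = ∃[ Q ] ∃[ α ] ∃[ β ] (∀ i j → coeff f i j ≡ coeff (composed Q α β) i j)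

    -- Completing the square; i is the inverse of t = 2 c.
    complete-square : ∀ {c t i e₁₁ c′ l l′} → t ≡ c + c → t * i ≡ 1# → t * (c′ + c′) ≡ e₁₁ * e₁₁ → t * l ≡ l′ * e₁₁ →
      (l ≡ l′ * (e₁₁ * i)) × (e₁₁ ≡ c * (e₁₁ * i) + c * (e₁₁ * i)) × (c′ ≡ c * ((e₁₁ * i) * (e₁₁ * i)))
    complete-square {c} {t} {i} {e} {c′} {l} {l′} refl ti disc lin =
        trans (unit l) (trans (solve 3 (λ t i l → t :* i :* l := i :* (t :* l)) refl t i l) (trans (cong (i *_) lin) (solve 3 (λ i l e → i :* (l :* e) := l :* (e :* i)) refl i l′ e)))
      , trans (unit e) (solve 3 (λ c i e → (c :+ c) :* i :* e := c :* (e :* i) :+ c :* (e :* i)) refl c i e)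
      , trans (unit c′) (trans (cong (_* c′) (trans (sym (*-identityˡ (t * i))) (cong (_* (t * i)) (sym ti))))
          (trans (solve 4 (λ c i e c′ → (c :+ c) :* i :* ((c :+ c) :* i) :* c′ := c :* (((c :+ c) :* (c′ :+ c′)) :* (i :* i))) refl c i e c′)
            (trans (cong (λ z → c * (z * (i * i))) disc) (solve 3 (λ c i e → c :* (e :* e :* (i :* i)) := c :* ((e :* i) :* (e :* i))) refl c i e))))
      where
      unit : ∀ x → x ≡ t * i * x
      unit x = trans (sym (*-identityˡ x)) (cong (_* x) (sym ti))

    -- If a square coefficient is nonzero but its `SquareForm` fails, `complete-square` displays the
    -- polynomial as Q(L), with L normalised in that variable. If both square coefficients vanish,
    -- degree two leaves only the mixed one.
    classification : 1# + 1# ≢ 0# → ∀ f → Degree≤2 f → ¬ Degenerate′ f → (∃[ i ] ∃[ j ] (i ℕ.+ j ≡ 2 × coeff f i j ≢ 0#)) →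
      let c = coeff f in
      Form.SquareForm (c 2 0) (c 1 1) (c 0 2) (c 1 0) (c 0 1) (c 0 0) ⊎
      Form.SquareForm (c 0 2) (c 1 1) (c 2 0) (c 0 1) (c 1 0) (c 0 0) ⊎ (c 2 0 ≡ 0# × c 1 1 ≢ 0#)
    classification two≢0 f small nd nonzero = cases (c 2 0 ≟ 0#) (c 0 2 ≟ 0#)
      where
      c : ℕ → ℕ → K
      c = coeff f
      double : ∀ {x} → x ≢ 0# → x + x ≢ 0#
      double {x} ne e = ne (*-zero-product (trans (solve 1 (λ x → (:1 :+ :1) :* x := x :+ x) refl x) e) two≢0)
      cases : Dec (c 2 0 ≡ 0#) → Dec (c 0 2 ≡ 0#) →
        Form.SquareForm (c 2 0) (c 1 1) (c 0 2) (c 1 0) (c 0 1) (c 0 0) ⊎ Form.SquareForm (c 0 2) (c 1 1) (c 2 0) (c 0 1) (c 1 0) (c 0 0) ⊎ (c 2 0 ≡ 0# × c 1 1 ≢ 0#)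
      cases (no ne) _ = inj₁ (double ne , λ (disc , lin) →
        let t = c 2 0 + c 2 0
            l , e , s = complete-square {c 2 0} {t} {inv t} {c 1 1} {c 0 2} {c 0 1} {c 1 0} refl (inverseʳ t (double ne)) (x-y≡0⇒x≡y disc) (x-y≡0⇒x≡y lin)
            β = c 1 1 * inv t
        in nd (c 0 0 ∷ c 1 0 ∷ c 2 0 ∷ [] , 1# , β , degenerate f small 1# β (c 1 0) (c 2 0) (sym (*-identityʳ _)) l
             (solve 1 (λ q → q := q :* (:1 :* :1)) refl (c 2 0))
             (trans e (solve 2 (λ q b → q :* b :+ q :* b := q :* (:1 :* b) :+ q :* (:1 :* b)) refl (c 2 0) β)) s))
      cases (yes _) (no ne) = inj₂ (inj₁ (double ne , λ (disc , lin) →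
        let t = c 0 2 + c 0 2
            l , e , s = complete-square {c 0 2} {t} {inv t} {c 1 1} {c 2 0} {c 1 0} {c 0 1} refl (inverseʳ t (double ne)) (x-y≡0⇒x≡y disc) (x-y≡0⇒x≡y lin)
            α = c 1 1 * inv t
        in nd (c 0 0 ∷ c 0 1 ∷ c 0 2 ∷ [] , α , 1# , degenerate f small α 1# (c 0 1) (c 0 2) l (sym (*-identityʳ _)) s
             (trans e (solve 2 (λ q a → q :* a :+ q :* a := q :* (a :* :1) :+ q :* (a :* :1)) refl (c 0 2) α))
             (solve 1 (λ q → q := q :* (:1 :* :1)) refl (c 0 2)))))
      cases (yes e₂₀) (yes e₀₂) = inj₂ (inj₂ (e₂₀ , λ e₁₁ → impossible e₁₁ nonzero))
        where
        impossible : c 1 1 ≡ 0# → (∃[ i ] ∃[ j ] (i ℕ.+ j ≡ 2 × c i j ≢ 0#)) → ⊥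
        impossible e₁₁ (0 , 2 , refl , ne) = ne e₀₂
        impossible e₁₁ (1 , 1 , refl , ne) = ne e₁₁
        impossible e₁₁ (2 , 0 , refl , ne) = ne e₂₀

  -- The bound for lists in a prime field

  module SumProduct where
    open import Data.Nat
    open import Data.Nat.Properties

    open PrimeField 𝕂 using (K; size; 0#; 1#; nat≢0) renaming (_+_ to _⊹_; _≟_ to _≟ₖ_; _*_ to _✶_)
    open Quadratics using (module Form; linear-root)
    open Plane using (coeff; value; value-form; classification)
    open Solver using (solve; _:+_; _:*_; _:-_; _:=_; :1)
    open Univariate using () renaming (+-identityʳ to +ₖ-identityʳ; _-_ to _−_)

    sum-product-bound : ∀ (c₂₀ c₁₁ c₀₂ c₁₀ c₀₁ c₀₀ : K) {A A₀ S F : List K} (dA : AllPairs _≢_ A) (dA₀ : AllPairs _≢_ A₀) (dS : AllPairs _≢_ S) (dF : AllPairs _≢_ F) →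
      (∀ {a} → a ∈ A₀ → a ∈ A) → (∀ {a b} → a ∈ A → b ∈ A → a ⊹ b ∈ S) → (∀ {u a} → u ∈ A → a ∈ A → Form.f c₂₀ c₁₁ c₀₂ c₁₀ c₀₁ c₀₀ u a ∈ F) →
      Form.Admissible c₂₀ c₁₁ c₀₂ c₁₀ c₀₁ c₀₀ A₀ → ∀ M → 1 ≤ length A → length A ≤ M → length S ≤ M → length F ≤ M →
      length A ≤ 2 * length A₀ → length A * length A * (length A * length A) * 4 * scale ≤ size * size →
      Bounded (length A) M
    sum-product-bound c₂₀ c₁₁ c₀₂ c₁₀ c₀₁ c₀₀ {A} {A₀} {S} {F} dA dA₀ dS dF A₀⊆A sums closed adm M 1≤n n≤M S≤M F≤M A≤2A₀ fits = bounded {length A} {M} (cases (M ≤? length A * length A))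
      where
      cases : Dec (M ≤ length A * length A) → length A ^ 74 ≤ suc ⌊log₂ length A ⌋ ^ 38 * M ^ 61 * multiplier
      cases (no M>n²) = ≤-trans (large-M (length A) M 1≤n (<⇒≤ (≰⇒> M>n²))) (widen (suc ⌊log₂ length A ⌋) (M ^ 61) multiplier (s≤s z≤n) 1≤multiplier)
      cases (yes M≤n²) = (AdditiveBound.SumsetBound.sumset-bound dA dS sums M scale 3142008 1≤n n≤M S≤M M≤n² (s≤s z≤n)
            (λ X B dX dB le → StarBound.Closed.star c₂₀ c₁₁ c₀₂ c₁₀ c₀₁ c₀₀ A A₀ F dA₀ dF A₀⊆A closed adm M F≤M n≤M (distinct-⊆-length _≟ₖ_ dA₀ A₀⊆A) A≤2A₀
               X B dX dB (≤-trans (≤-reflexive (scale-expand (length A * (length B * length X)))) le)) fits (length A) (suc ⌊log₂ length A ⌋) multiplier refl refl (sym multiplier-expand))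

    sumset-≥ : ∀ {A S : List K} → AllPairs _≢_ A → (∀ {a b} → a ∈ A → b ∈ A → a ⊹ b ∈ S) → length A ≤ length S
    sumset-≥ {[]} d sums = z≤n
    sumset-≥ {b ∷ B} {S} d sums = subst (_≤ length S) (Listₚ.length-map (b ⊹_) (b ∷ B)) (distinct-⊆-length _≟ₖ_ (AllPairsₚ.map⁺ (AllPairs.map (λ {x} {y} ne e → ne (cancel x y e)) d)) shifted)
      where
      cancel : ∀ x y → b ⊹ x ≡ b ⊹ y → x ≡ y
      cancel x y e = trans (solve 2 (λ b x → x := b :+ x :- b) refl b x) (trans (cong (λ z → z − b) e) (solve 2 (λ b y → b :+ y :- b := y) refl b y))
      shifted : ∀ {x} → x ∈ map (b ⊹_) (b ∷ B) → x ∈ S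
      shifted i with y , y∈ , refl ← ∈ₚ.∈-map⁻ (b ⊹_) i = sums (here refl) y∈

    module Main (f : Plane.Plane) (small : Plane.Degree≤2 f) (nd : ¬ Plane.Degenerate′ f)
                (quadratic : ∃[ i ] ∃[ j ] (i ℕ.+ j ≡ 2 × coeff f i j ≢ 0#))
                {A S F : List K} (dA : AllPairs _≢_ A) (dS : AllPairs _≢_ S) (dF : AllPairs _≢_ F)
                (sums : ∀ {a b} → a ∈ A → b ∈ A → a ⊹ b ∈ S) (images : ∀ {u a} → u ∈ A → a ∈ A → value f u a ∈ F)
                (X : ℕ) (S≤X : length S ≤ X) (F≤X : length F ≤ X)
                (2≤n : 2 ≤ length A) (n²-small : length A * length A * 160000 ≤ size) where
      c : ℕ → ℕ → K
      c = coeff f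

      values : ∀ {u a} → u ∈ A → a ∈ A → Form.f (c 2 0) (c 1 1) (c 0 2) (c 1 0) (c 0 1) (c 0 0) u a ∈ F
      values {u} {a} u∈ a∈ = subst (_∈ F) (value-form f small u a) (images u∈ a∈)

      swap-form : ∀ u a → Form.f (c 2 0) (c 1 1) (c 0 2) (c 1 0) (c 0 1) (c 0 0) a u ≡ Form.f (c 0 2) (c 1 1) (c 2 0) (c 0 1) (c 1 0) (c 0 0) u a
      swap-form u a = solve 8 (λ c20 c11 c02 c10 c01 c00 u a →
        c20 :* (a :* a) :+ c11 :* (a :* u) :+ c02 :* (u :* u) :+ c10 :* a :+ c01 :* u :+ c00
        := c02 :* (u :* u) :+ c11 :* (u :* a) :+ c20 :* (a :* a) :+ c01 :* u :+ c10 :* a :+ c00) refl (c 2 0) (c 1 1) (c 0 2) (c 1 0) (c 0 1) (c 0 0) u a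

      fits : length A * length A * (length A * length A) * 4 * scale ≤ size * size
      fits = ≤-trans (scale-fits (length A * length A)) (*-mono-≤ n²-small n²-small)

      -- The size condition together with n ≥ 2 excludes characteristic 2, where completing the
      -- square breaks down.
      two≢0 : 1# ⊹ 1# ≢ 0#
      two≢0 e = nat≢0 1 (≤-trans (≤-trans (≤-trans (s≤s (s≤s (s≤s z≤n))) (*-mono-≤ 2≤n 2≤n)) (m≤m*n (length A * length A) 160000)) n²-small) (trans (cong (1# ⊹_) (+ₖ-identityʳ 1#)) e)

      n≤X : length A ≤ X
      n≤X = ≤-trans (sumset-≥ dA sums) S≤X

      conclusion : Bounded (length A) X
      conclusion = cases (classification two≢0 f small nd quadratic)
        where
        1≤A : 1 ≤ length A
        1≤A = ≤-trans (s≤s z≤n) 2≤n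
        A≤2A : length A ≤ 2 * length A
        A≤2A = m≤n*m (length A) 2
        cases : Form.SquareForm (c 2 0) (c 1 1) (c 0 2) (c 1 0) (c 0 1) (c 0 0) ⊎ Form.SquareForm (c 0 2) (c 1 1) (c 2 0) (c 0 1) (c 1 0) (c 0 0) ⊎ (c 2 0 ≡ 0# × c 1 1 ≢ 0#) → Bounded (length A) X
        cases (inj₁ square) = sum-product-bound (c 2 0) (c 1 1) (c 0 2) (c 1 0) (c 0 1) (c 0 0) {A} {A} {S} {F} dA dA dS dF id sums values
          (inj₁ (two≢0 , square)) X 1≤A n≤X S≤X F≤X A≤2A fits
        cases (inj₂ (inj₁ square)) = sum-product-bound (c 0 2) (c 1 1) (c 2 0) (c 0 1) (c 1 0) (c 0 0) {A} {A} {S} {F} dA dA dS dF id sums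
          (λ {u} {a} u∈ a∈ → subst (_∈ F) (swap-form u a) (values a∈ u∈))
          (inj₁ (two≢0 , square)) X 1≤A n≤X S≤X F≤X A≤2A fits
        cases (inj₂ (inj₂ (e , ne))) = sum-product-bound (c 2 0) (c 1 1) (c 0 2) (c 1 0) (c 0 1) (c 0 0) {A} {filter nonzero? A} {S} {F} dA (AllPairsₚ.filter⁺ nonzero? dA) dS dF
          (λ i → proj₁ (∈ₚ.∈-filter⁻ nonzero? i)) sums values
          (inj₂ (e , ne , Allₚ.all-filter nonzero? A)) X 1≤A n≤X S≤X F≤X enough fits
          where
          zero? : ∀ a → Dec (c 1 1 ✶ a ⊹ c 1 0 ≡ 0#)
          zero? a = c 1 1 ✶ a ⊹ c 1 0 ≟ₖ 0#
          nonzero? : ∀ a → Dec (c 1 1 ✶ a ⊹ c 1 0 ≢ 0#)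
          nonzero? a = ¬? (zero? a)
          one-zero : length (filter zero? A) ≤ 1
          one-zero = subst (_≤ 1) (length-filter-count zero? A) (linear-root {c 1 1} {0# − c 1 0} zero? dA ne
            (λ {a} e → trans (solve 2 (λ x y → x := x :+ y :- y) refl (c 1 1 ✶ a) (c 1 0)) (cong (_− c 1 0) e)))
          -- Only the root of c₁₁ a + c₁₀ is left out, and n ≤ 2 (n - 1) as soon as n ≥ 2.
          enough : length A ≤ 2 * length (filter nonzero? A)
          enough = +-cancelˡ-≤ 2 _ _ (begin
            2 + length A ≤⟨ +-monoˡ-≤ (length A) 2≤n ⟩
            length A + length A ≡⟨ cong₂ _+_ (length-filter-complement zero? A) (length-filter-complement zero? A) ⟩
            length (filter zero? A) + k + (length (filter zero? A) + k) ≤⟨ +-mono-≤ (+-monoˡ-≤ k one-zero) (+-monoˡ-≤ k one-zero) ⟩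
            1 + k + (1 + k) ≡⟨ l₁ k ⟩
            2 + 2 * k ∎)
            where
            open ≤-Reasoning
            k = length (filter nonzero? A)
            l₁ : ∀ k → 1 + k + (1 + k) ≡ 2 + 2 * k
            l₁ = solve-∀

  open SumProduct

-- From subsets of the residues to lists

module Subsets where
  open import Data.Fin using (zero; suc)
  open import Data.Nat
  open import Data.Nat.Properties

  toList : ∀ {n} → Subset n → List (Fin n)
  toList [] = []
  toList (true ∷ A) = zero ∷ map suc (toList A)
  toList (false ∷ A) = map suc (toList A)

  length-toList : ∀ {n} (A : Subset n) → length (toList A) ≡ ∣ A ∣
  length-toList [] = refl
  length-toList (true ∷ A) = cong suc (trans (Listₚ.length-map suc (toList A)) (length-toList A))
  length-toList (false ∷ A) = trans (Listₚ.length-map suc (toList A)) (length-toList A)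

  toList-distinct : ∀ {n} (A : Subset n) → AllPairs _≢_ (toList A)
  toList-distinct [] = []
  toList-distinct (true ∷ A) = Allₚ.map⁺ (All.tabulate (λ _ ())) ∷ AllPairsₚ.map⁺ (AllPairs.map (λ ne e → ne (Finₚ.suc-injective e)) (toList-distinct A))
  toList-distinct (false ∷ A) = AllPairsₚ.map⁺ (AllPairs.map (λ ne e → ne (Finₚ.suc-injective e)) (toList-distinct A))

  toList⁻ : ∀ {n} (A : Subset n) {x} → x ∈ toList A → Vec.lookup A x ≡ true
  toList⁻ (true ∷ A) (here refl) = refl
  toList⁻ (true ∷ A) (there i) with y , y∈ , refl ← ∈ₚ.∈-map⁻ suc i = toList⁻ A y∈
  toList⁻ (false ∷ A) i with y , y∈ , refl ← ∈ₚ.∈-map⁻ suc i = toList⁻ A y∈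

  toList⁺ : ∀ {n} (A : Subset n) {x} → Vec.lookup A x ≡ true → x ∈ toList A
  toList⁺ (true ∷ A) {zero} e = here refl
  toList⁺ (true ∷ A) {suc x} e = there (∈ₚ.∈-map⁺ suc (toList⁺ A e))
  toList⁺ (false ∷ A) {suc x} e = ∈ₚ.∈-map⁺ suc (toList⁺ A e)

  ∈-image₂ : ∀ p .{{_ : NonZero p}} g A {a b} → a ∈ toList A → b ∈ toList A → g a b ∈ toList (image₂ p g A)
  ∈-image₂ p g A {a} {b} a∈ b∈ = toList⁺ (image₂ p g A) (trans (Vecₚ.lookup∘tabulate _ (g a b))
    (dec-true (Finₚ.any? _) (a , dec-witness)))
    where
    dec-witness = b , Vecₚ.lookup⇒[]= a A (toList⁻ A a∈) , Vecₚ.lookup⇒[]= b A (toList⁻ A b∈) , refl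

  -- The bound is applied to `n` elements taken from `A`. Their sums and values of `f` lie in the
  -- corresponding sets of the whole of `A`, whose sizes therefore may stand on the right.
  subset-bound : ∀ p .{{_ : NonZero p}} → Prime p → ∀ f → Quadratic p f → NonDegenerate p f → ∀ A → let X = ∣ sumset p A ∣ ⊔ ∣ image₂ p (⟦_⟧ p f) A ∣ in
    ∀ n → 2 ≤ n → n ≤ ∣ A ∣ → n * n * 160000 ≤ p → Bounded n X
  subset-bound p isPrime f (nonzero , small) nd A n 2≤n n≤A n²-small =
    subst (λ m → Bounded m X) A₁-length
      (bound A₁ (AllPairsₚ.take⁺ n (toList-distinct A)) ⊆A (≤-trans 2≤n (≤-reflexive (sym A₁-length)))
        (subst (λ m → m * m * 160000 ≤ p) (sym A₁-length) n²-small))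
    where
    𝕂 = Residues.field′ p isPrime
    X = ∣ sumset p A ∣ ⊔ ∣ image₂ p (⟦_⟧ p f) A ∣
    A₁ = take n (toList A)
    A₁-length : length A₁ ≡ n
    A₁-length = trans (Listₚ.length-take n (toList A)) (m≤n⇒m⊓n≡m (subst (n ≤_) (sym (length-toList A)) n≤A))
    ⊆A : ∀ {a} → a ∈ A₁ → a ∈ toList A
    ⊆A {a} i = subst (a ∈_) (Listₚ.take++drop≡id n (toList A)) (∈ₚ.∈-++⁺ˡ i)
    bound : ∀ B → AllPairs _≢_ B → (∀ {a} → a ∈ B → a ∈ toList A) → 2 ≤ length B → length B * length B * 160000 ≤ p → Bounded (length B) X
    bound B dB B⊆A = SumProduct.Main.conclusion 𝕂 f small nd nonzero {B} {toList (sumset p A)} {toList (image₂ p (⟦_⟧ p f) A)} dB (toList-distinct (sumset p A)) (toList-distinct (image₂ p (⟦_⟧ p f) A))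
      (λ a∈ b∈ → ∈-image₂ p _ A (B⊆A a∈) (B⊆A b∈)) (λ a∈ b∈ → ∈-image₂ p (⟦_⟧ p f) A (B⊆A a∈) (B⊆A b∈)) X
      (≤-trans (≤-reflexive (length-toList (sumset p A))) (m≤m⊔n _ _))
      (≤-trans (≤-reflexive (length-toList (image₂ p (⟦_⟧ p f) A))) (m≤n⊔m ∣ sumset p A ∣ _))

  subset-nonempty : ∀ p .{{_ : NonZero p}} f A → 1 ≤ ∣ A ∣ → 1 ≤ ∣ sumset p A ∣ ⊔ ∣ image₂ p (⟦_⟧ p f) A ∣
  subset-nonempty p f A 1≤A = ≤-trans (subst (1 ≤_) (length-toList (sumset p A)) (occupied (toList A) (λ x∈ → x∈) (subst (1 ≤_) (sym (length-toList A)) 1≤A))) (m≤m⊔n _ _)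
    where
    occupied : ∀ B → (∀ {b} → b ∈ B → b ∈ toList A) → 1 ≤ length B → 1 ≤ length (toList (sumset p A))
    occupied (b ∷ _) sub _ = ∈ₚ.∈-length (∈-image₂ p _ A (sub (here refl)) (sub (here refl)))

open Subsets

theorem1p6 :
    ∀ (K : ℕ) → 0 < K →
    ∃[ C₁ ] ∃[ C₂ ] (0 < C₁ × 0 < C₂ ×
      (∀ (p : ℕ) .{{_ : NonZero p}} → Prime p →
       ∀ (f : Poly₂ p) → Quadratic p f → NonDegenerate p f →
       ∀ (A : Subset p) → ∣ A ∣ ≤ K ·√ p →
       Gtrsim C₁ C₂ (∣ sumset p A ∣ ⊔ ∣ image₂ p (⟦_⟧ p f) A ∣) ∣ A ∣ 74 61))
-- The factor 400 is the square root of the 160000 required by `subset-bound`; `C₂` = 1 is enough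
-- because the logarithm occurs only to the power 38 against 61.
theorem1p6 K 0<K = implied-constant (K ℕ.* 400) , 1 , implied-constant-positive (ℕₚ.*-mono-≤ 0<K (s≤s {n = 399} z≤n)) , s≤s z≤n ,
  λ p isPrime f quadratic nd A A≤√p →
    shrink K 400 {p} {∣ A ∣} {∣ sumset p A ∣ ⊔ ∣ image₂ p (⟦_⟧ p f) A ∣} 0<K (s≤s z≤n) A≤√p (subset-nonempty p f A)
      (subset-bound p isPrime f quadratic nd A)
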